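{- There is an absolute constant $C>0$ such that for every modulus $q \geq 1$, every integer $L$ with $1 \leq L \leq q$ and every integer $c$ with $(c,q)=1$, $$S := \sum_{a = 1}^{q} \sum_{b = 1}^{q} \Bigl( \mathop{\sum_{q_1 \in (a, a+L]} \mathop{{\sum\nolimits}'}_{q_2 \in (b, b+L]}}_{q_1 q_2 \equiv c \pmod q} 1 - \frac{1}{q} \sum_{q_1 \in (a, a+L]} \mathop{{\sum\nolimits}'}_{q_2 \in (b, b+L]} 1 \Bigr)^2 \leq C\, L^2 q\, d(q)^3 .$$
   Context: The sums are over integers $q_1, q_2$ in the indicated half-open intervals. The notation $\sum'$ means that the summation is restricted to integers $q_2$ relatively prime to $q$ (the variable $q_1$ is unrestricted apart from the congruence condition). $d(q)$ denotes the number of positive divisors of $q$. -}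

module Defs where

open import Data.Nat as ℕ using (ℕ; zero; suc)
open import Data.Nat.Coprimality using (Coprime; coprime?)
open import Data.Nat.Divisibility using () renaming (_∣?_ to _∣ℕ?_)
open import Data.Integer as ℤ using (ℤ; +_)
open import Data.Integer.Divisibility.Signed using (_∣?_)
open import Data.Rational as ℚ using (ℚ)
open import Data.Bool using (if_then_else_)
open import Data.List using (List; []; _∷_; map; length; filter; sum; upTo; applyUpTo; foldr; concatMap)
open import Relation.Nullary.Decidable using (Dec; does; ¬?; _×-dec_)

Ioc : ℕ → ℕ → List ℕ
Ioc a L = applyUpTo (λ i → a ℕ.+ suc i) L

Σℚ : {A : Set} → List A → (A → ℚ) → ℚ
Σℚ xs f = foldr (λ x acc → f x ℚ.+ acc) ℚ.0ℚ xs

𝟙 : {P : Set} → Dec P → ℚ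
𝟙 d = if does d then ℚ.1ℚ else ℚ.0ℚ

CongMod : ℕ → ℕ → ℕ → ℤ → Set
CongMod q q1 q2 c = (+ q) Data.Integer.Divisibility.Signed.∣ ((+ (q1 ℕ.* q2)) ℤ.- c)

congMod? : ∀ q q1 q2 c → Dec (CongMod q q1 q2 c)
congMod? q q1 q2 c = (+ q) ∣? ((+ (q1 ℕ.* q2)) ℤ.- c)

N : (q L : ℕ) (c : ℤ) (a b : ℕ) → ℚ
N q L c a b =
  Σℚ (Ioc a L) λ q1 → Σℚ (Ioc b L) λ q2 →
    𝟙 (coprime? q2 q ×-dec congMod? q q1 q2 c)

M : (q L : ℕ) (a b : ℕ) → ℚ
M q L a b =
  Σℚ (Ioc a L) λ q1 → Σℚ (Ioc b L) λ q2 → 𝟙 (coprime? q2 q)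

d : ℕ → ℕ
d q = length (filter (λ k → k ∣ℕ? q) (applyUpTo suc q))

S : (q L : ℕ) (c : ℤ) .{{_ : ℕ.NonZero q}} → ℚ
S q L c =
  Σℚ (applyUpTo suc q) λ a → Σℚ (applyUpTo suc q) λ b →
    let x = N q L c a b ℚ.- (M q L a b ℚ.* ((+ 1) ℚ./ q)) in x ℚ.* x

{-# OPTIONS --safe #-}
module Submission where

-- Everything is done with integer-valued functions on (ℤ/q)², without characters. With I the indicator of [1, L] mod q and
-- F(x, y) = (q I(x) - L) I(y), the sum q² S is the squared norm of κF, where κ adds up the translates by the solutions of
-- u w ≡ c (mod q). The heart is an operator form of Weil's bound for Kloosterman sums: |κv|² ≤ A ∑ s ⟨Pr g s v, v⟩, over
-- factorisations q = g s, with Pr g s the sum over the subgroup s (ℤ/q)²; here A ≤ 8 d(q)² and there are at most d(q) terms.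
-- These bounds multiply over coprime moduli by the Chinese remainder theorem. For a prime power one splits off the part
-- that comes from the next lower power and treats the rest by stationary phase: pieces attached to e and e' are orthogonal
-- unless e² ≡ e'² modulo half the exponent, and a quadratic Gauss sum handles odd exponents. For a prime, the Radon
-- transform on lines reduces to the one-variable sum over u + a / u; its bound follows from Newton's identities over the
-- monic polynomials of F_p[X], which give a two-term recurrence, together with Stepanov's method for the power sums.

open import Level using (0ℓ)
open import Algebra.Bundles using (CommutativeRing; CommutativeSemigroup)
open import Algebra.Solver.Ring.AlmostCommutativeRing using (fromCommutativeRing; _-Raw-AlmostCommutative⟶_)
import Algebra.Solver.Ring
import Algebra.Properties.Semiring.Mult
import Algebra.Properties.Semiring.Mult.TCOptimised
import Algebra.Properties.Ring
import Relation.Binary.Reasoning.Setoid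
open import Data.Nat as N using (ℕ; zero; suc)
import Data.Nat.Properties as NP
open import Data.Integer as ℤ using (ℤ; +_; -[1+_])
import Data.Integer.Properties as ZP
open import Data.Maybe using (Maybe; just; nothing)
open import Relation.Nullary using (yes; no)
open import Relation.Binary.PropositionalEquality as ≡ using (_≡_)
import Algebra.Properties.Semiring.Exp
open import Data.List using (List; []; _∷_; map; take; length)
open import Data.Nat.Primality using (Prime; euclidsLemma)
open import Data.Fin as Fin using (Fin; toℕ; fromℕ; inject₁)
open import Data.List.Relation.Unary.All using ([]; _∷_)
open import Data.List.Relation.Unary.AllPairs using ([]; _∷_)
open import Data.Vec using ([]; _∷_)
open import Data.Sum using (inj₁; inj₂)
open import Data.Empty using (⊥-elim)
import Algebra.Properties.Semiring.Sum
import Algebra.Properties.CommutativeSemiring.Exp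
import Algebra.Properties.CommutativeSemiring.Binomial
open import Data.Nat.Divisibility as ND using (divides)
open import Data.Nat.Combinatorics using (nCn≡1; nC1≡n; nCk≡nC[n∸k]; nCk+nC[k+1]≡[n+1]C[k+1]; k>n⇒nCk≡0) renaming (_C_ to _choose_)
open import Data.Nat.Tactic.RingSolver using () renaming (solve-∀ to solveℕ)
import Data.Fin.Properties as Finₚ
import Algebra.Properties.CommutativeSemigroup

-- Without characters no single Kloosterman sum can be named, so Weil's bound becomes an inequality
-- of quadratic forms. On a frequency x, `Pr g s` acts as g² or 0 as g divides x or not; since s g²
-- = q g, the right side is A q times the sum of those g. The constants A multiply over the primes
-- of q, so an odd prime power may cost no more than the square of its number of divisors: at a
-- prime the sharp 4 is forced. Stepanov's method gives only one-sided bounds with spare constants.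
-- That is enough because the power sums of degree 2 ν are -(α^(2ν) + β^(2ν)): an upper bound for
-- point counts bounds this form from above, and repeated doubling of ν lets any excess of α² + β²
-- over 2 p outgrow the bound. At odd prime powers two classes e' ≡ ± e interact, giving 2² = 4. At
-- p = 2 there are four, and the trivial bound replaces the Gauss sum, giving 32 = 8 · 2². The final
-- 16 is 8 times a factor 2 from L + s ≤ 2 q.

-- A ring solver with integer coefficients.

module RingSolver (R : CommutativeRing 0ℓ 0ℓ) where
 open CommutativeRing R
 open Algebra.Properties.Semiring.Mult semiring
 open Algebra.Properties.Ring ring
 open Relation.Binary.Reasoning.Setoid setoid

 fromℤ : ℤ → Carrier
 fromℤ (+ n) = n × 1#
 fromℤ -[1+ n ] = - (suc n × 1#)

 fromℤ-⊖ : ∀ m n → fromℤ (m ℤ.⊖ n) ≈ m × 1# + - (n × 1#)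
 fromℤ-⊖ m zero = sym (trans (+-congˡ -0#≈0#) (+-identityʳ _))
 fromℤ-⊖ zero (suc n) = sym (+-identityˡ _)
 fromℤ-⊖ (suc m) (suc n) = begin
  fromℤ (suc m ℤ.⊖ suc n)              ≡⟨ ≡.cong fromℤ (ZP.[1+m]⊖[1+n]≡m⊖n m n) ⟩
  fromℤ (m ℤ.⊖ n)                      ≈⟨ fromℤ-⊖ m n ⟩
  m × 1# + - (n × 1#)                  ≈⟨ +-congʳ (sym (+-identityʳ _)) ⟩
  m × 1# + 0# + - (n × 1#)             ≈⟨ +-congʳ (+-congˡ (sym (-‿inverseʳ 1#))) ⟩
  m × 1# + (1# + - 1#) + - (n × 1#)    ≈⟨ +-congʳ (sym (+-assoc _ _ _)) ⟩
  m × 1# + 1# + - 1# + - (n × 1#)      ≈⟨ +-assoc _ _ _ ⟩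
  m × 1# + 1# + (- 1# + - (n × 1#))    ≈⟨ +-cong (+-comm _ _) (-‿+-comm 1# _) ⟩
  1# + m × 1# + - (1# + n × 1#)        ∎

 fromℤ-+ : ∀ i j → fromℤ (i ℤ.+ j) ≈ fromℤ i + fromℤ j
 fromℤ-+ (+ m) (+ n) = ×-homo-+ 1# m n
 fromℤ-+ (+ m) -[1+ n ] = fromℤ-⊖ m (suc n)
 fromℤ-+ -[1+ m ] (+ n) = trans (fromℤ-⊖ n (suc m)) (+-comm _ _)
 fromℤ-+ -[1+ m ] -[1+ n ] = begin
  - (suc (suc (m N.+ n)) × 1#)         ≡⟨ ≡.cong (λ k → - (suc k × 1#)) (≡.sym (NP.+-suc m n)) ⟩
  - ((suc m N.+ suc n) × 1#)           ≈⟨ -‿cong (×-homo-+ 1# (suc m) (suc n)) ⟩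
  - (suc m × 1# + suc n × 1#)          ≈⟨ sym (-‿+-comm _ _) ⟩
  - (suc m × 1#) + - (suc n × 1#)      ∎

 fromℤ-neg : ∀ i → fromℤ (ℤ.- i) ≈ - fromℤ i
 fromℤ-neg (+ zero) = sym -0#≈0#
 fromℤ-neg (+ suc n) = refl
 fromℤ-neg -[1+ n ] = sym (-‿involutive _)

 fromℤ-pos* : ∀ m j → fromℤ (+ m ℤ.* j) ≈ m × 1# * fromℤ j
 fromℤ-pos* zero j = sym (zeroˡ _)
 fromℤ-pos* (suc m) j = begin
  fromℤ (+ suc m ℤ.* j)                ≡⟨ ≡.cong fromℤ (ZP.suc-* (+ m) j) ⟩
  fromℤ (j ℤ.+ + m ℤ.* j)              ≈⟨ fromℤ-+ j (+ m ℤ.* j) ⟩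
  fromℤ j + fromℤ (+ m ℤ.* j)          ≈⟨ +-cong (sym (*-identityˡ _)) (fromℤ-pos* m j) ⟩
  1# * fromℤ j + m × 1# * fromℤ j      ≈⟨ sym (distribʳ _ _ _) ⟩
  (1# + m × 1#) * fromℤ j              ∎

 fromℤ-* : ∀ i j → fromℤ (i ℤ.* j) ≈ fromℤ i * fromℤ j
 fromℤ-* (+ m) j = fromℤ-pos* m j
 fromℤ-* -[1+ m ] j = begin
  fromℤ (-[1+ m ] ℤ.* j)               ≡⟨ ≡.cong fromℤ (≡.sym (ZP.neg-distribˡ-* (+ suc m) j)) ⟩
  fromℤ (ℤ.- (+ suc m ℤ.* j))          ≈⟨ fromℤ-neg (+ suc m ℤ.* j) ⟩
  - fromℤ (+ suc m ℤ.* j)              ≈⟨ -‿cong (fromℤ-pos* (suc m) j) ⟩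
  - (suc m × 1# * fromℤ j)             ≈⟨ -‿distribˡ-* _ _ ⟩
  - (suc m × 1#) * fromℤ j             ∎

 private
  module Opt = Algebra.Properties.Semiring.Mult.TCOptimised semiring

  -- The type-checking optimised multiples make fromℤ' (+ 1) reduce to 1#.
  fromℤ' : ℤ → Carrier
  fromℤ' (+ n) = n Opt.× 1#
  fromℤ' -[1+ n ] = - (suc n Opt.× 1#)

  fromℤ'≈ : ∀ i → fromℤ' i ≈ fromℤ i
  fromℤ'≈ (+ n) = sym (Opt.×ᵤ≈× n 1#)
  fromℤ'≈ -[1+ n ] = -‿cong (sym (Opt.×ᵤ≈× (suc n) 1#))

  morphism : ℤ.+-*-rawRing -Raw-AlmostCommutative⟶ fromCommutativeRing R
  morphism = record
   { ⟦_⟧    = fromℤ'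
   ; +-homo = λ i j → trans (fromℤ'≈ (i ℤ.+ j)) (trans (fromℤ-+ i j) (sym (+-cong (fromℤ'≈ i) (fromℤ'≈ j))))
   ; *-homo = λ i j → trans (fromℤ'≈ (i ℤ.* j)) (trans (fromℤ-* i j) (sym (*-cong (fromℤ'≈ i) (fromℤ'≈ j))))
   ; -‿homo = λ i → trans (fromℤ'≈ (ℤ.- i)) (trans (fromℤ-neg i) (sym (-‿cong (fromℤ'≈ i))))
   ; 0-homo = refl
   ; 1-homo = refl
   }

  -- Coefficients are compared as integers, so that the solver works over rings without decidable
  -- equality, such as polynomial and quotient rings.
  eq? : ∀ i j → Maybe (fromℤ' i ≈ fromℤ' j)
  eq? i j with i ℤ.≟ j
  ... | yes ≡.refl = just refl
  ... | no  _      = nothing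

 open Algebra.Solver.Ring ℤ.+-*-rawRing (fromCommutativeRing R) morphism eq? public
  using (solve; _:=_; _:+_; _:*_; _:-_; :-_; con; _:^_; _:×_)

open import Data.Product using (_×_; _,_)

-- Finite sums over duplicate-free lists.

module ListSums where
 open import Level using (0ℓ)
 open import Algebra.Bundles using (CommutativeMonoid)
 import Relation.Binary.Reasoning.Setoid
 import Algebra.Properties.CommutativeSemigroup
 open import Data.Nat as ℕ using (ℕ; suc)
 import Data.Nat.Properties as NP
 open import Data.List using (List; []; _∷_; _++_; map; concatMap; length; cartesianProductWith)
 open import Data.List.Membership.Propositional using (_∈_)
 open import Data.List.Membership.Propositional.Properties using (∈-map⁺; ∈-map⁻; ∈-∃++)
 open import Data.List.Membership.Propositional.Properties.WithK using (unique∧set⇒bag)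
 open import Data.List.Relation.Unary.Any using (here; there)
 open import Data.List.Relation.Unary.All as All using (All; []; _∷_)
 open import Data.List.Relation.Unary.AllPairs using ([]; _∷_)
 open import Data.List.Relation.Unary.Unique.Propositional using (Unique)
 open import Data.List.Relation.Binary.BagAndSetEquality using (∼bag⇒↭)
 open import Data.List.Relation.Binary.Permutation.Propositional using (_↭_; refl; prep; swap; trans)
 open import Data.List.Relation.Binary.Permutation.Propositional.Properties using (shift; ↭-length; ∈-resp-↭)
 open import Data.Product using (Σ; _×_; _,_)
 open import Data.Empty using (⊥; ⊥-elim)
 open import Function using (_∘_; mk⇔)
 open import Relation.Binary.PropositionalEquality as ≡ using (_≡_; _≢_)

 unique-map : {A B : Set} (f : A → B) {xs : List A} → (∀ {x y} → x ∈ xs → y ∈ xs → f x ≡ f y → x ≡ y) →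
        Unique xs → Unique (map f xs)
 unique-map f inj [] = []
 unique-map f {x ∷ xs} inj (x∉ ∷ u) = All.tabulate new ∷ unique-map f (λ p q → inj (there p) (there q)) u where
  new : ∀ {y} → y ∈ map f xs → f x ≢ y
  new y∈ fx≡y with ∈-map⁻ f y∈
  ... | z , z∈ , ≡.refl = All.lookup x∉ z∈ (inj (here ≡.refl) (there z∈) fx≡y)

 -- In a duplicate-free list an element occurs at most once, so equality as sets is equality as
 -- bags, and equal bags are permutations of each other. Changes of variables in sums rest on this
 -- instead of an explicit permutation.
 unique-↭ : {A : Set} {xs ys : List A} → Unique xs → Unique ys →
       (∀ {x} → x ∈ xs → x ∈ ys) → (∀ {x} → x ∈ ys → x ∈ xs) → xs ↭ ys
 unique-↭ u v f g = ∼bag⇒↭ (unique∧set⇒bag u v (mk⇔ f g))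

 unique-⊆-length : {A : Set} (xs : List A) {ys : List A} → Unique xs → (∀ {x} → x ∈ xs → x ∈ ys) → length xs N.≤ length ys
 unique-⊆-length [] u f = N.z≤n
 unique-⊆-length (x ∷ xs) (x∉ ∷ u) f with ∈-∃++ (f (here ≡.refl))
 ... | as , bs , ≡.refl = ≡.subst (suc (length xs) N.≤_) (≡.sym (↭-length (shift x as bs)))
     (N.s≤s (unique-⊆-length xs u sub)) where
  sub : ∀ {y} → y ∈ xs → y ∈ as ++ bs
  sub y∈ with ∈-resp-↭ (shift x as bs) (f (there y∈))
  ... | here ≡.refl = ⊥-elim (All.lookup x∉ y∈ ≡.refl)
  ... | there q = q

 -- Pigeonhole: an element of `ys` missing from `xs` could be put in front of `xs`, giving a
 -- duplicate-free list inside `ys` that is longer than `ys`.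
 unique-⊆-full : {A : Set} (xs : List A) {ys : List A} → Unique xs → (∀ {x} → x ∈ xs → x ∈ ys) →
         length ys N.≤ length xs → ∀ {y} → y ∈ ys → (y ∈ xs → ⊥) → ⊥
 unique-⊆-full xs {ys} u f len {y} y∈ y∉ =
  NP.<-irrefl ≡.refl (NP.≤-trans (unique-⊆-length (y ∷ xs) (All.tabulate (λ z∈ e → y∉ (≡.subst (_∈ xs) (≡.sym e) z∈)) ∷ u) sub) len) where
  sub : ∀ {z} → z ∈ y ∷ xs → z ∈ ys
  sub (here ≡.refl) = y∈
  sub (there z∈) = f z∈

 module Sums (M : CommutativeMonoid 0ℓ 0ℓ) where
  open CommutativeMonoid M renaming (refl to ≈-refl; trans to ≈-trans; sym to ≈-sym)
  open Relation.Binary.Reasoning.Setoid setoid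
  open Algebra.Properties.CommutativeSemigroup commutativeSemigroup using (interchange; x∙yz≈y∙xz)

  ∑ : {A : Set} → List A → (A → Carrier) → Carrier
  ∑ [] f = ε
  ∑ (x ∷ xs) f = f x ∙ ∑ xs f

  module _ {A : Set} where
   ∑-cong∈ : (xs : List A) {f g : A → Carrier} → (∀ {x} → x ∈ xs → f x ≈ g x) → ∑ xs f ≈ ∑ xs g
   ∑-cong∈ [] e = ≈-refl
   ∑-cong∈ (x ∷ xs) e = ∙-cong (e (here ≡.refl)) (∑-cong∈ xs (e ∘ there))

   ∑-cong : (xs : List A) {f g : A → Carrier} → (∀ x → f x ≈ g x) → ∑ xs f ≈ ∑ xs g
   ∑-cong xs e = ∑-cong∈ xs (λ {x} _ → e x)

   ∑-ε∈ : (xs : List A) {f : A → Carrier} → (∀ {x} → x ∈ xs → f x ≈ ε) → ∑ xs f ≈ ε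
   ∑-ε∈ [] e = ≈-refl
   ∑-ε∈ (x ∷ xs) e = ≈-trans (∙-cong (e (here ≡.refl)) (∑-ε∈ xs (e ∘ there))) (identityˡ ε)

   ∑-ε : (xs : List A) {f : A → Carrier} → (∀ x → f x ≈ ε) → ∑ xs f ≈ ε
   ∑-ε xs e = ∑-ε∈ xs (λ {x} _ → e x)

   ∑-∙ : (xs : List A) (f g : A → Carrier) → ∑ xs (λ x → f x ∙ g x) ≈ ∑ xs f ∙ ∑ xs g
   ∑-∙ [] f g = ≈-sym (identityˡ ε)
   ∑-∙ (x ∷ xs) f g = ≈-trans (∙-congˡ (∑-∙ xs f g)) (interchange _ _ _ _)

   ∑-++ : (xs ys : List A) (f : A → Carrier) → ∑ (xs ++ ys) f ≈ ∑ xs f ∙ ∑ ys f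
   ∑-++ [] ys f = ≈-sym (identityˡ _)
   ∑-++ (x ∷ xs) ys f = ≈-trans (∙-congˡ (∑-++ xs ys f)) (≈-sym (assoc _ _ _))

   ∑-↭ : {xs ys : List A} (f : A → Carrier) → xs ↭ ys → ∑ xs f ≈ ∑ ys f
   ∑-↭ f refl = ≈-refl
   ∑-↭ f (prep x p) = ∙-congˡ (∑-↭ f p)
   ∑-↭ f (swap x y p) = ≈-trans (∙-congˡ (∙-congˡ (∑-↭ f p))) (x∙yz≈y∙xz _ _ _)
   ∑-↭ f (trans p q) = ≈-trans (∑-↭ f p) (∑-↭ f q)

   ∑-single : {xs : List A} {f : A → Carrier} {x : A} → Unique xs → x ∈ xs →
         (∀ {y} → y ∈ xs → y ≢ x → f y ≈ ε) → ∑ xs f ≈ f x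
   ∑-single {_ ∷ xs} (x∉ ∷ u) (here ≡.refl) z =
    ≈-trans (∙-congˡ (∑-ε∈ xs (λ y∈ → z (there y∈) (λ e → All.lookup x∉ y∈ (≡.sym e))))) (identityʳ _)
   ∑-single {_ ∷ xs} (x∉ ∷ u) (there x∈) z =
    ≈-trans (∙-cong (z (here ≡.refl) (All.lookup x∉ x∈)) (∑-single u x∈ (z ∘ there))) (identityˡ _)

  module _ {A B : Set} where
   ∑-swap : (xs : List A) (ys : List B) (f : A → B → Carrier) →
        ∑ xs (λ x → ∑ ys (f x)) ≈ ∑ ys (λ y → ∑ xs (λ x → f x y))
   ∑-swap [] ys f = ≈-sym (∑-ε ys (λ _ → ≈-refl))
   ∑-swap (x ∷ xs) ys f = ≈-trans (∙-congˡ (∑-swap xs ys f)) (≈-sym (∑-∙ ys _ _))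

   ∑-map : (g : A → B) (xs : List A) (f : B → Carrier) → ∑ (map g xs) f ≈ ∑ xs (f ∘ g)
   ∑-map g [] f = ≈-refl
   ∑-map g (x ∷ xs) f = ∙-congˡ (∑-map g xs f)

   -- The image of `xs` need not come in the order of `ys`; both are duplicate-free with the same
   -- members, so `unique-↭` supplies the permutation.
   ∑-reindex : {xs : List A} {ys : List B} (g : A → B) (f : B → Carrier) → Unique xs → Unique ys →
         (∀ {x} → x ∈ xs → g x ∈ ys) → (∀ {x y} → x ∈ xs → y ∈ xs → g x ≡ g y → x ≡ y) →
         (∀ {y} → y ∈ ys → Σ A λ x → x ∈ xs × g x ≡ y) → ∑ ys f ≈ ∑ xs (f ∘ g)
   ∑-reindex {xs} {ys} g f u v into inj sur =
    ≈-trans (≈-sym (∑-↭ f (unique-↭ (unique-map g inj u) v fwd bwd))) (∑-map g xs f) where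
    fwd : ∀ {y} → y ∈ map g xs → y ∈ ys
    fwd y∈ with ∈-map⁻ g y∈
    ... | x , x∈ , ≡.refl = into x∈
    bwd : ∀ {y} → y ∈ ys → y ∈ map g xs
    bwd y∈ with sur y∈
    ... | x , x∈ , ≡.refl = ∈-map⁺ g x∈

  ∑-cartesianProductWith : {A B C : Set} (g : A → B → C) (xs : List A) (ys : List B) (f : C → Carrier) →
               ∑ (cartesianProductWith g xs ys) f ≈ ∑ xs (λ x → ∑ ys (λ y → f (g x y)))
  ∑-cartesianProductWith g [] ys f = ≈-refl
  ∑-cartesianProductWith g (x ∷ xs) ys f =
   ≈-trans (∑-++ (map (g x) ys) (cartesianProductWith g xs ys) f)
    (∙-cong (∑-map (g x) ys f) (∑-cartesianProductWith g xs ys f))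

open ListSums

-- Congruences, residue rings and prime fields.

module ModularArithmetic where
 open import Level using (0ℓ)
 open import Algebra.Bundles using (CommutativeRing)
 open import Data.Nat as ℕ using (ℕ; zero; suc; NonZero)
 import Data.Nat.Properties as NP
 import Data.Nat.Divisibility as ND
 open import Data.Nat.Coprimality as Coprimality using (Coprime; coprime-Bézout; prime⇒coprime)
 open import Data.Nat.GCD using (module Bézout)
 open import Data.Nat.Primality using (Prime; prime⇒nonZero; prime⇒nonTrivial; euclidsLemma)
 open import Data.Fin as Fin using (Fin; toℕ; fromℕ<)
 import Data.Fin.Properties as Finₚ
 open import Data.Integer using (ℤ; +_; -[1+_]; _+_; _*_; -_; _-_; ∣_∣)
 import Data.Integer.Properties as ZP
 open import Data.Integer.DivMod using (_%ℕ_; _/ℕ_; n%ℕd<d; a≡a%ℕn+[a/ℕn]*n)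
 open import Data.Integer.Divisibility.Signed using (_∣_; divides; ∣⇒∣ᵤ; ∣ᵤ⇒∣)
 open import Data.Integer.Tactic.RingSolver using (solve-∀)
 open import Data.Product using (∃; _,_) renaming (proj₁ to fst)
 open import Data.Sum using (_⊎_; inj₁; inj₂)
 open import Data.Empty using (⊥-elim)
 open import Relation.Nullary using (¬_; yes; no)
 open import Relation.Binary.PropositionalEquality using (_≡_; _≢_; refl; sym; trans; cong; cong₂; subst)
 import Relation.Binary.PropositionalEquality.Properties as ≡ₚ

 infix 4 _≡_[_]
 -- A record rather than a synonym for divisibility of a difference, so that both sides and the
 -- modulus can be inferred from a proof.
 record _≡_[_] (i j : ℤ) (n : ℕ) : Set where
  constructor mk
  field divs : + n ∣ i - j
 open _≡_[_] public

 module _ {n : ℕ} where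
  mod-refl : ∀ {i} → i ≡ i [ n ]
  mod-refl {i} = mk (divides (+ 0) (ZP.+-inverseʳ i))

  mod-reflexive : ∀ {i j} → i ≡ j → i ≡ j [ n ]
  mod-reflexive refl = mod-refl

  mod-by : ∀ {i j} k → i - j ≡ k * + n → i ≡ j [ n ]
  mod-by k e = mk (divides k e)

  mod-sym : ∀ {i j} → i ≡ j [ n ] → j ≡ i [ n ]
  mod-sym {i} {j} (mk (divides k e)) = mod-by (- k) (trans (lem i j) (trans (cong -_ e) (ZP.neg-distribˡ-* k (+ n)))) where
   lem : ∀ i j → j - i ≡ - (i - j)
   lem = solve-∀

  mod-trans : ∀ {i j k} → i ≡ j [ n ] → j ≡ k [ n ] → i ≡ k [ n ]
  mod-trans {i} {j} {k} (mk (divides a d)) (mk (divides b e)) =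
   mod-by (a + b) (trans (lem i j k) (trans (cong₂ _+_ d e) (sym (ZP.*-distribʳ-+ (+ n) a b)))) where
   lem : ∀ i j k → i - k ≡ (i - j) + (j - k)
   lem = solve-∀

  mod-+ : ∀ {i i' j j'} → i ≡ i' [ n ] → j ≡ j' [ n ] → i + j ≡ i' + j' [ n ]
  mod-+ {i} {i'} {j} {j'} (mk (divides a d)) (mk (divides b e)) =
   mod-by (a + b) (trans (lem i i' j j') (trans (cong₂ _+_ d e) (sym (ZP.*-distribʳ-+ (+ n) a b)))) where
   lem : ∀ i i' j j' → (i + j) - (i' + j') ≡ (i - i') + (j - j')
   lem = solve-∀

  mod-* : ∀ {i i' j j'} → i ≡ i' [ n ] → j ≡ j' [ n ] → i * j ≡ i' * j' [ n ]
  mod-* {i} {i'} {j} {j'} (mk (divides a d)) (mk (divides b e)) =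
   mod-by (a * j + i' * b) (trans (lem1 i i' j j') (trans (cong₂ (λ u v → u * j + i' * v) d e) (lem2 a (+ n) j i' b))) where
   lem1 : ∀ i i' j j' → i * j - i' * j' ≡ (i - i') * j + i' * (j - j')
   lem1 = solve-∀
   lem2 : ∀ a n j i b → a * n * j + i * (b * n) ≡ (a * j + i * b) * n
   lem2 = solve-∀

  mod-neg : ∀ {i j} → i ≡ j [ n ] → - i ≡ - j [ n ]
  mod-neg {i} {j} (mk (divides a d)) = mod-by (- a) (trans (lem i j) (trans (cong -_ d) (ZP.neg-distribˡ-* a (+ n)))) where
   lem : ∀ i j → - i - - j ≡ - (i - j)
   lem = solve-∀

  mod-0⇒∣ : ∀ {i} → i ≡ + 0 [ n ] → + n ∣ i
  mod-0⇒∣ {i} (mk d) = subst (+ n ∣_) (ZP.+-identityʳ i) d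

  ∣⇒mod-0 : ∀ {i} → + n ∣ i → i ≡ + 0 [ n ]
  ∣⇒mod-0 {i} d = mk (subst (+ n ∣_) (sym (ZP.+-identityʳ i)) d)

 mod-coarsen : ∀ m {n i j} → i ≡ j [ m N.* n ] → i ≡ j [ n ]
 mod-coarsen m {n} (mk (divides k e)) = mod-by (k * + m) (trans e (trans (cong (k *_) (ZP.pos-* m n)) (sym (ZP.*-assoc k (+ m) (+ n)))))

 mod-%ℕ : ∀ i n .{{_ : NonZero n}} → + (i %ℕ n) ≡ i [ n ]
 mod-%ℕ i n = mod-by (- (i /ℕ n)) (trans (cong (λ k → + (i %ℕ n) - k) (a≡a%ℕn+[a/ℕn]*n i n)) (lem (+ (i %ℕ n)) (i /ℕ n) (+ n))) where
  lem : ∀ r k n → r - (r + k * n) ≡ - k * n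
  lem = solve-∀

 small-mod-≡ : ∀ {a b n} → a N.< n → b N.< n → + a ≡ + b [ n ] → a ≡ b
 small-mod-≡ {a} {b} {n} a<n b<n (mk d) = ZP.+-injective (ZP.i-j≡0⇒i≡j (+ a) (+ b) (ZP.∣i∣≡0⇒i≡0 zero-abs)) where
  bound : ∣ + a - + b ∣ N.< n
  bound = NP.≤-<-trans (subst (λ z → ∣ z ∣ N.≤ a N.⊔ b) (sym (ZP.[+m]-[+n]≡m⊖n a b)) (ZP.∣m⊝n∣≤m⊔n a b)) (NP.⊔-lub a<n b<n)
  zero-abs : ∣ + a - + b ∣ ≡ 0
  zero-abs with ∣ + a - + b ∣ in eq
  ... | zero = refl
  ... | suc k = ⊥-elim (ND.>⇒∤ (subst (N._< n) eq bound) (subst (n ND.∣_) eq (∣⇒∣ᵤ d)))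

 module _ {n : ℕ} where
  private
   unit-modℕ : ∀ {m} → Bézout.Identity 1 m n → ∃ λ e → + m * e ≡ + 1 [ n ]
   unit-modℕ {m} (Bézout.+- x y eq) = + x , mod-by (+ y)
    (trans (cong (_- + 1) (trans (ZP.*-comm (+ m) (+ x)) (trans (sym (ZP.pos-* x m)) (trans (cong +_ (sym eq)) (trans (ZP.pos-+ 1 (y N.* n)) (cong (λ z → + 1 + z) (ZP.pos-* y n)))))))
        (lem (+ y * + n))) where
    lem : ∀ z → + 1 + z - + 1 ≡ z
    lem = solve-∀
   unit-modℕ {m} (Bézout.-+ x y eq) = - + x , mod-by (- + y)
    (trans (lem1 (+ m) (+ x)) (trans (cong -_ (trans (cong (λ z → + 1 + z) (sym (ZP.pos-* x m))) (trans (sym (ZP.pos-+ 1 (x N.* m))) (trans (cong +_ eq) (ZP.pos-* y n)))))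
     (ZP.neg-distribˡ-* (+ y) (+ n)))) where
    lem1 : ∀ m x → m * - x - + 1 ≡ - (+ 1 + x * m)
    lem1 = solve-∀

  unit-mod : ∀ {c} → Coprime ∣ c ∣ n → ∃ λ e → c * e ≡ + 1 [ n ]
  unit-mod {+ a} cop = unit-modℕ (coprime-Bézout cop)
  unit-mod { -[1+ a ]} cop with unit-modℕ (coprime-Bézout cop)
  ... | e , h = - e , subst (λ z → z ≡ + 1 [ n ]) (lem (+ suc a) e) h where
   lem : ∀ a e → a * e ≡ - a * - e
   lem = solve-∀

  mod-cancel : ∀ {c i j} → Coprime ∣ c ∣ n → c * i ≡ c * j [ n ] → i ≡ j [ n ]
  mod-cancel {c} {i} {j} cop h with unit-mod {c} cop
  ... | e , ce = mod-trans (mod-sym (step i)) (mod-trans (mod-* (mod-refl {i = e}) h) (step j)) where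
   lem : ∀ e c i → e * (c * i) ≡ c * e * i
   lem = solve-∀
   step : ∀ i → e * (c * i) ≡ i [ n ]
   step i = subst (_≡ i [ n ]) (sym (lem e c i)) (subst (c * e * i ≡_[ n ]) (ZP.*-identityˡ i) (mod-* ce (mod-refl {i = i})))

 prime-∣-* : ∀ {p} → Prime p → ∀ i j → + p ∣ i * j → (+ p ∣ i) ⊎ (+ p ∣ j)
 prime-∣-* pr i j d with euclidsLemma ∣ i ∣ ∣ j ∣ pr (subst (_ ND.∣_) (ZP.abs-* i j) (∣⇒∣ᵤ d))
 ... | inj₁ h = inj₁ (∣ᵤ⇒∣ h)
 ... | inj₂ h = inj₂ (∣ᵤ⇒∣ h)

 module Residues (n : ℕ) {{nz : NonZero n}} where
  infixl 6 _⊕_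
  infixl 7 _⊗_

  toℤ : Fin n → ℤ
  toℤ x = + toℕ x

  opaque
   ⟦_⟧ : ℤ → Fin n
   ⟦ i ⟧ = fromℕ< (n%ℕd<d i n)

   toℤ-⟦⟧ : ∀ i → toℤ ⟦ i ⟧ ≡ i [ n ]
   toℤ-⟦⟧ i = subst (λ k → + k ≡ i [ n ]) (sym (Finₚ.toℕ-fromℕ< (n%ℕd<d i n))) (mod-%ℕ i n)

  toℤ-injective-mod : ∀ {x y} → toℤ x ≡ toℤ y [ n ] → x ≡ y
  toℤ-injective-mod {x} {y} h = Finₚ.toℕ-injective (small-mod-≡ (Finₚ.toℕ<n x) (Finₚ.toℕ<n y) h)

  ⟦⟧-cong : ∀ {i j} → i ≡ j [ n ] → ⟦ i ⟧ ≡ ⟦ j ⟧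
  ⟦⟧-cong {i} {j} h = toℤ-injective-mod (mod-trans (toℤ-⟦⟧ i) (mod-trans h (mod-sym (toℤ-⟦⟧ j))))

  ⟦⟧-injective : ∀ {i j} → ⟦ i ⟧ ≡ ⟦ j ⟧ → i ≡ j [ n ]
  ⟦⟧-injective {i} {j} h = mod-trans (mod-sym (toℤ-⟦⟧ i)) (subst (λ k → toℤ k ≡ j [ n ]) (sym h) (toℤ-⟦⟧ j))

  ⟦toℤ⟧ : ∀ x → ⟦ toℤ x ⟧ ≡ x
  ⟦toℤ⟧ x = toℤ-injective-mod (toℤ-⟦⟧ (toℤ x))

  𝟘 𝟙ᶠ : Fin n
  𝟘 = ⟦ + 0 ⟧
  𝟙ᶠ = ⟦ + 1 ⟧

  opaque
   _⊕_ _⊗_ : Fin n → Fin n → Fin n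
   x ⊕ y = ⟦ toℤ x + toℤ y ⟧
   x ⊗ y = ⟦ toℤ x * toℤ y ⟧

   ⊝_ : Fin n → Fin n
   ⊝ x = ⟦ - toℤ x ⟧

   ⟦⟧-⊕ : ∀ i j → ⟦ i ⟧ ⊕ ⟦ j ⟧ ≡ ⟦ i + j ⟧
   ⟦⟧-⊕ i j = ⟦⟧-cong (mod-+ (toℤ-⟦⟧ i) (toℤ-⟦⟧ j))

   ⟦⟧-⊗ : ∀ i j → ⟦ i ⟧ ⊗ ⟦ j ⟧ ≡ ⟦ i * j ⟧
   ⟦⟧-⊗ i j = ⟦⟧-cong (mod-* (toℤ-⟦⟧ i) (toℤ-⟦⟧ j))

   ⟦⟧-⊝ : ∀ i → ⊝ ⟦ i ⟧ ≡ ⟦ - i ⟧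
   ⟦⟧-⊝ i = ⟦⟧-cong (mod-neg (toℤ-⟦⟧ i))

  private
   -- Every residue is `⟦ i ⟧` for some integer i, so a ring law holds once it holds on such
   -- classes, where it is the law of the integers under `⟦_⟧`.
   onReps₁ : {P : Fin n → Set} → (∀ i → P ⟦ i ⟧) → ∀ x → P x
   onReps₁ {P} h x = subst P (⟦toℤ⟧ x) (h (toℤ x))

   onReps₂ : {P : Fin n → Fin n → Set} → (∀ i j → P ⟦ i ⟧ ⟦ j ⟧) → ∀ x y → P x y
   onReps₂ {P} h x y = onReps₁ {P x} (λ j → onReps₁ {λ x → P x ⟦ j ⟧} (λ i → h i j) x) y

   onReps₃ : {P : Fin n → Fin n → Fin n → Set} → (∀ i j k → P ⟦ i ⟧ ⟦ j ⟧ ⟦ k ⟧) → ∀ x y z → P x y z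
   onReps₃ {P} h x y z = onReps₁ {P x y} (λ k → onReps₂ {λ x y → P x y ⟦ k ⟧} (λ i j → h i j k) x y) z

  opaque
   unfolding _⊕_
   ⊕-assoc : ∀ x y z → (x ⊕ y) ⊕ z ≡ x ⊕ (y ⊕ z)
   ⊕-assoc = onReps₃ {λ x y z → (x ⊕ y) ⊕ z ≡ x ⊕ (y ⊕ z)} λ i j k →
    trans (trans (cong (_⊕ ⟦ k ⟧) (⟦⟧-⊕ i j)) (⟦⟧-⊕ (i + j) k))
     (trans (cong ⟦_⟧ (ZP.+-assoc i j k)) (sym (trans (cong (⟦ i ⟧ ⊕_) (⟦⟧-⊕ j k)) (⟦⟧-⊕ i (j + k)))))

   ⊕-comm : ∀ x y → x ⊕ y ≡ y ⊕ x
   ⊕-comm x y = cong ⟦_⟧ (ZP.+-comm (toℤ x) (toℤ y))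

   ⊗-assoc : ∀ x y z → (x ⊗ y) ⊗ z ≡ x ⊗ (y ⊗ z)
   ⊗-assoc = onReps₃ {λ x y z → (x ⊗ y) ⊗ z ≡ x ⊗ (y ⊗ z)} λ i j k →
    trans (trans (cong (_⊗ ⟦ k ⟧) (⟦⟧-⊗ i j)) (⟦⟧-⊗ (i * j) k))
     (trans (cong ⟦_⟧ (ZP.*-assoc i j k)) (sym (trans (cong (⟦ i ⟧ ⊗_) (⟦⟧-⊗ j k)) (⟦⟧-⊗ i (j * k)))))

   ⊗-comm : ∀ x y → x ⊗ y ≡ y ⊗ x
   ⊗-comm x y = cong ⟦_⟧ (ZP.*-comm (toℤ x) (toℤ y))

   ⊕-identityˡ : ∀ x → 𝟘 ⊕ x ≡ x
   ⊕-identityˡ = onReps₁ {λ x → 𝟘 ⊕ x ≡ x} λ i → trans (⟦⟧-⊕ (+ 0) i) (cong ⟦_⟧ (ZP.+-identityˡ i))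

   ⊗-identityˡ : ∀ x → 𝟙ᶠ ⊗ x ≡ x
   ⊗-identityˡ = onReps₁ {λ x → 𝟙ᶠ ⊗ x ≡ x} λ i → trans (⟦⟧-⊗ (+ 1) i) (cong ⟦_⟧ (ZP.*-identityˡ i))

   ⊕-inverseˡ : ∀ x → ⊝ x ⊕ x ≡ 𝟘
   ⊕-inverseˡ = onReps₁ {λ x → ⊝ x ⊕ x ≡ 𝟘} λ i →
    trans (cong (_⊕ ⟦ i ⟧) (⟦⟧-⊝ i)) (trans (⟦⟧-⊕ (- i) i) (cong ⟦_⟧ (ZP.+-inverseˡ i)))

   ⊗-distribˡ : ∀ x y z → x ⊗ (y ⊕ z) ≡ x ⊗ y ⊕ x ⊗ z
   ⊗-distribˡ = onReps₃ {λ x y z → x ⊗ (y ⊕ z) ≡ x ⊗ y ⊕ x ⊗ z} λ i j k →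
    trans (trans (cong (⟦ i ⟧ ⊗_) (⟦⟧-⊕ j k)) (⟦⟧-⊗ i (j + k)))
     (trans (cong ⟦_⟧ (ZP.*-distribˡ-+ i j k))
      (sym (trans (cong₂ _⊕_ (⟦⟧-⊗ i j) (⟦⟧-⊗ i k)) (⟦⟧-⊕ (i * j) (i * k)))))

  residueRing : CommutativeRing 0ℓ 0ℓ
  residueRing = record
   { Carrier = Fin n ; _≈_ = _≡_ ; _+_ = _⊕_ ; _*_ = _⊗_ ; -_ = ⊝_ ; 0# = 𝟘 ; 1# = 𝟙ᶠ
   ; isCommutativeRing = record
    { isRing = record
     { +-isAbelianGroup = record
      { isGroup = record
       { isMonoid = record
        { isSemigroup = record
         { isMagma = record { isEquivalence = ≡ₚ.isEquivalence ; ∙-cong = cong₂ _⊕_ }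
         ; assoc = ⊕-assoc }
        ; identity = ⊕-identityˡ , λ x → trans (⊕-comm x 𝟘) (⊕-identityˡ x) }
       ; inverse = ⊕-inverseˡ , λ x → trans (⊕-comm x (⊝ x)) (⊕-inverseˡ x)
       ; ⁻¹-cong = cong ⊝_ }
      ; comm = ⊕-comm }
     ; *-cong = cong₂ _⊗_
     ; *-assoc = ⊗-assoc
     ; *-identity = ⊗-identityˡ , λ x → trans (⊗-comm x 𝟙ᶠ) (⊗-identityˡ x)
     ; distrib = ⊗-distribˡ , λ x y z → trans (⊗-comm (y ⊕ z) x) (trans (⊗-distribˡ x y z) (cong₂ _⊕_ (⊗-comm x y) (⊗-comm x z))) }
    ; *-comm = ⊗-comm } }

 module PrimeField (p : ℕ) (pr : Prime p) where
  instance
   p≢0 : NonZero p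
   p≢0 = prime⇒nonZero pr

  open Residues p public

  F : Set
  F = Fin p

  0≢1 : 𝟘 ≢ 𝟙ᶠ
  0≢1 e = contra (∣⇒∣ᵤ (divs (⟦⟧-injective {+ 1} {+ 0} (sym e)))) where
   contra : ¬ (p ND.∣ 1)
   contra d with ND.∣1⇒≡1 d
   ... | refl = N.nonTrivial⇒≢1 {{prime⇒nonTrivial pr}} refl

  nonzero-coprime : ∀ {x} → x ≢ 𝟘 → Coprime ∣ toℤ x ∣ p
  nonzero-coprime {x} x≢0 = Coprimality.sym (prime⇒coprime pr {{N.≢-nonZero λ e → x≢0 (trans (sym (⟦toℤ⟧ x)) (cong (λ k → ⟦ + k ⟧) e))}} (Finₚ.toℕ<n x))

  infix 8 _⁻¹
  opaque
   -- The default value at zero keeps expressions such as `c ⊕ a ⊗ c ⁻¹` total; sums over c mask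
   -- that term by an indicator.
   _⁻¹ : F → F
   x ⁻¹ with x Fin.≟ 𝟘
   ... | yes _ = 𝟘
   ... | no x≢0 = ⟦ fst (unit-mod {c = toℤ x} (nonzero-coprime x≢0)) ⟧

   ⁻¹-inverse : ∀ {x} → x ≢ 𝟘 → x ⊗ x ⁻¹ ≡ 𝟙ᶠ
   ⁻¹-inverse {x} x≢0 with x Fin.≟ 𝟘
   ... | yes e = ⊥-elim (x≢0 e)
   ... | no x≢0' with unit-mod {c = toℤ x} (nonzero-coprime x≢0')
   ... | e , h = trans (cong (_⊗ ⟦ e ⟧) (sym (⟦toℤ⟧ x))) (trans (⟦⟧-⊗ (toℤ x) e) (⟦⟧-cong h))

open ModularArithmetic

-- Polynomials over a commutative ring.

module Poly (R : CommutativeRing 0ℓ 0ℓ) where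
 open CommutativeRing R
 open Algebra.Properties.Ring ring
 open RingSolver R
 open Relation.Binary.Reasoning.Setoid setoid

 -- Coefficients from degree 0 upwards. Trailing zeros are allowed, because without decidable
 -- equality they cannot be trimmed; hence equality is coefficientwise, and degrees enter only
 -- through `Below` and `Monic`.
 Pol : Set
 Pol = List Carrier

 coef : Pol → ℕ → Carrier
 coef [] _ = 0#
 coef (a ∷ f) zero = a
 coef (a ∷ f) (suc i) = coef f i

 infix 4 _≋_
 record _≋_ (f g : Pol) : Set where
  constructor mk
  field at : ∀ i → coef f i ≈ coef g i
 open _≋_ public

 ≋-refl : ∀ {f} → f ≋ f
 ≋-refl .at i = refl

 ≋-sym : ∀ {f g} → f ≋ g → g ≋ f
 ≋-sym e .at i = sym (at e i)

 ≋-trans : ∀ {f g h} → f ≋ g → g ≋ h → f ≋ h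
 ≋-trans d e .at i = trans (at d i) (at e i)

 infixl 6 _⊞_
 infixl 7 _⊠_ _⋆_

 one : Pol
 one = 1# ∷ []

 opaque
  _⊞_ : Pol → Pol → Pol
  [] ⊞ g = g
  (a ∷ f) ⊞ [] = a ∷ f
  (a ∷ f) ⊞ (b ∷ g) = (a + b) ∷ (f ⊞ g)

  ⊟_ : Pol → Pol
  ⊟_ = map (-_)

  _⋆_ : Carrier → Pol → Pol
  a ⋆ f = map (a *_) f

  _⊠_ : Pol → Pol → Pol
  [] ⊠ g = []
  (a ∷ f) ⊠ g = a ⋆ g ⊞ (0# ∷ f ⊠ g)

  coef-⊞ : ∀ f g i → coef (f ⊞ g) i ≈ coef f i + coef g i
  coef-⊞ [] g i = sym (+-identityˡ _)
  coef-⊞ (a ∷ f) [] i = sym (+-identityʳ _)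
  coef-⊞ (a ∷ f) (b ∷ g) zero = refl
  coef-⊞ (a ∷ f) (b ∷ g) (suc i) = coef-⊞ f g i

  coef-⊟ : ∀ f i → coef (⊟ f) i ≈ - coef f i
  coef-⊟ [] i = sym -0#≈0#
  coef-⊟ (a ∷ f) zero = refl
  coef-⊟ (a ∷ f) (suc i) = coef-⊟ f i

  coef-⋆ : ∀ a f i → coef (a ⋆ f) i ≈ a * coef f i
  coef-⋆ a [] i = sym (zeroʳ a)
  coef-⋆ a (b ∷ f) zero = refl
  coef-⋆ a (b ∷ f) (suc i) = coef-⋆ a f i

  coef-⊠-zero : ∀ a f g → coef ((a ∷ f) ⊠ g) 0 ≈ a * coef g 0
  coef-⊠-zero a f g = trans (coef-⊞ (a ⋆ g) _ 0) (trans (+-identityʳ _) (coef-⋆ a g 0))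

  coef-⊠-suc : ∀ a f g i → coef ((a ∷ f) ⊠ g) (suc i) ≈ a * coef g (suc i) + coef (f ⊠ g) i
  coef-⊠-suc a f g i = trans (coef-⊞ (a ⋆ g) _ (suc i)) (+-congʳ (coef-⋆ a g (suc i)))

  ∷-cong : ∀ {a b f g} → a ≈ b → f ≋ g → (a ∷ f) ≋ (b ∷ g)
  ∷-cong d e .at zero = d
  ∷-cong d e .at (suc i) = at e i

  ⊞-cong : ∀ {f f' g g'} → f ≋ f' → g ≋ g' → f ⊞ g ≋ f' ⊞ g'
  ⊞-cong {f} {f'} {g} {g'} d e .at i =
   trans (coef-⊞ f g i) (trans (+-cong (at d i) (at e i)) (sym (coef-⊞ f' g' i)))

  ⊟-cong : ∀ {f g} → f ≋ g → ⊟ f ≋ ⊟ g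
  ⊟-cong {f} {g} e .at i = trans (coef-⊟ f i) (trans (-‿cong (at e i)) (sym (coef-⊟ g i)))

  ⋆-cong : ∀ {a b f g} → a ≈ b → f ≋ g → a ⋆ f ≋ b ⋆ g
  ⋆-cong {a} {b} {f} {g} d e .at i = trans (coef-⋆ a f i) (trans (*-cong d (at e i)) (sym (coef-⋆ b g i)))

  ⊞-assoc : ∀ f g h → (f ⊞ g) ⊞ h ≋ f ⊞ (g ⊞ h)
  ⊞-assoc f g h .at i = begin
   coef ((f ⊞ g) ⊞ h) i               ≈⟨ trans (coef-⊞ (f ⊞ g) h i) (+-congʳ (coef-⊞ f g i)) ⟩
   coef f i + coef g i + coef h i     ≈⟨ +-assoc _ _ _ ⟩
   coef f i + (coef g i + coef h i)   ≈⟨ sym (trans (coef-⊞ f (g ⊞ h) i) (+-congˡ (coef-⊞ g h i))) ⟩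
   coef (f ⊞ (g ⊞ h)) i               ∎

  ⊞-comm : ∀ f g → f ⊞ g ≋ g ⊞ f
  ⊞-comm f g .at i = trans (coef-⊞ f g i) (trans (+-comm _ _) (sym (coef-⊞ g f i)))

  ∷-⊞-∷ : ∀ a f b g → (a ∷ f) ⊞ (b ∷ g) ≋ (a + b) ∷ (f ⊞ g)
  ∷-⊞-∷ a f b g = ≋-refl

  ⊞-identityˡ : ∀ f → [] ⊞ f ≋ f
  ⊞-identityˡ f = ≋-refl

  ⊞-identityʳ : ∀ f → f ⊞ [] ≋ f
  ⊞-identityʳ [] = ≋-refl
  ⊞-identityʳ (a ∷ f) = ≋-refl

  ⊞-inverseʳ : ∀ f → f ⊞ ⊟ f ≋ []
  ⊞-inverseʳ f .at i = trans (coef-⊞ f (⊟ f) i) (trans (+-congˡ (coef-⊟ f i)) (-‿inverseʳ _))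

  ⊠-congʳ : ∀ f {g g'} → g ≋ g' → f ⊠ g ≋ f ⊠ g'
  ⊠-congʳ [] e = ≋-refl
  ⊠-congʳ (a ∷ f) e = ⊞-cong (⋆-cong refl e) (∷-cong refl (⊠-congʳ f e))

  ⊠-zeroʳ : ∀ f → f ⊠ [] ≋ []
  ⊠-zeroʳ [] = ≋-refl
  ⊠-zeroʳ (a ∷ f) .at zero = refl
  ⊠-zeroʳ (a ∷ f) .at (suc i) = at (⊠-zeroʳ f) i

  -- Multiplication recurses on its left factor. This is the mirror recursion on the right factor,
  -- from which commutativity follows by induction.
  ⊠-∷ : ∀ f b g → f ⊠ (b ∷ g) ≋ b ⋆ f ⊞ (0# ∷ f ⊠ g)
  ⊠-∷ [] b g .at zero = refl
  ⊠-∷ [] b g .at (suc i) = refl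
  ⊠-∷ (a ∷ f) b g .at zero = +-congʳ (*-comm a b)
  ⊠-∷ (a ∷ f) b g .at (suc i) = begin
   coef (a ⋆ g ⊞ f ⊠ (b ∷ g)) i                             ≈⟨ coef-⊞ (a ⋆ g) _ i ⟩
   coef (a ⋆ g) i + coef (f ⊠ (b ∷ g)) i                    ≈⟨ +-congˡ (trans (at (⊠-∷ f b g) i) (coef-⊞ (b ⋆ f) _ i)) ⟩
   coef (a ⋆ g) i + (coef (b ⋆ f) i + coef (0# ∷ f ⊠ g) i)  ≈⟨ solve 3 (λ x y z → x :+ (y :+ z) := y :+ (x :+ z)) refl _ _ _ ⟩
   coef (b ⋆ f) i + (coef (a ⋆ g) i + coef (0# ∷ f ⊠ g) i)  ≈⟨ +-congˡ (sym (coef-⊞ (a ⋆ g) _ i)) ⟩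
   coef (b ⋆ f) i + coef ((a ∷ f) ⊠ g) i                    ≈⟨ sym (coef-⊞ (b ⋆ f) _ i) ⟩
   coef (b ⋆ f ⊞ (a ∷ f) ⊠ g) i                             ∎

  ⊠-comm : ∀ f g → f ⊠ g ≋ g ⊠ f
  ⊠-comm [] g = ≋-sym (⊠-zeroʳ g)
  ⊠-comm (a ∷ f) g = ≋-trans (⊞-cong ≋-refl (∷-cong refl (⊠-comm f g))) (≋-sym (⊠-∷ g a f))

  ⊠-cong : ∀ {f f' g g'} → f ≋ f' → g ≋ g' → f ⊠ g ≋ f' ⊠ g'
  ⊠-cong {f} {f'} {g} {g'} d e =
   ≋-trans (⊠-congʳ f e) (≋-trans (⊠-comm f g') (≋-trans (⊠-congʳ g' d) (⊠-comm g' f')))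

  ⋆-⊞ : ∀ a f g → a ⋆ (f ⊞ g) ≋ a ⋆ f ⊞ a ⋆ g
  ⋆-⊞ a f g .at i = begin
   coef (a ⋆ (f ⊞ g)) i             ≈⟨ trans (coef-⋆ a (f ⊞ g) i) (*-congˡ (coef-⊞ f g i)) ⟩
   a * (coef f i + coef g i)        ≈⟨ distribˡ _ _ _ ⟩
   a * coef f i + a * coef g i      ≈⟨ +-cong (sym (coef-⋆ a f i)) (sym (coef-⋆ a g i)) ⟩
   coef (a ⋆ f) i + coef (a ⋆ g) i  ≈⟨ sym (coef-⊞ (a ⋆ f) (a ⋆ g) i) ⟩
   coef (a ⋆ f ⊞ a ⋆ g) i           ∎

  interchange : ∀ f g h k → (f ⊞ g) ⊞ (h ⊞ k) ≋ (f ⊞ h) ⊞ (g ⊞ k)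
  interchange f g h k .at i = begin
   coef ((f ⊞ g) ⊞ (h ⊞ k)) i ≈⟨ trans (coef-⊞ (f ⊞ g) (h ⊞ k) i) (+-cong (coef-⊞ f g i) (coef-⊞ h k i)) ⟩
   (coef f i + coef g i) + (coef h i + coef k i)
    ≈⟨ solve 4 (λ x y z w → (x :+ y) :+ (z :+ w) := (x :+ z) :+ (y :+ w)) refl _ _ _ _ ⟩
   (coef f i + coef h i) + (coef g i + coef k i)
    ≈⟨ sym (trans (coef-⊞ (f ⊞ h) (g ⊞ k) i) (+-cong (coef-⊞ f h i) (coef-⊞ g k i))) ⟩
   coef ((f ⊞ h) ⊞ (g ⊞ k)) i ∎

  ⊠-distribˡ : ∀ f g h → f ⊠ (g ⊞ h) ≋ f ⊠ g ⊞ f ⊠ h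
  ⊠-distribˡ [] g h = ≋-refl
  ⊠-distribˡ (a ∷ f) g h =
   ≋-trans (⊞-cong (⋆-⊞ a g h) (∷-cong (sym (+-identityˡ 0#)) (⊠-distribˡ f g h)))
       (interchange (a ⋆ g) (a ⋆ h) (0# ∷ f ⊠ g) (0# ∷ f ⊠ h))

  ⊠-distribʳ : ∀ f g h → (g ⊞ h) ⊠ f ≋ g ⊠ f ⊞ h ⊠ f
  ⊠-distribʳ f g h =
   ≋-trans (⊠-comm (g ⊞ h) f) (≋-trans (⊠-distribˡ f g h) (⊞-cong (⊠-comm f g) (⊠-comm f h)))

  ⋆-⊠ : ∀ a f g → (a ⋆ f) ⊠ g ≋ a ⋆ (f ⊠ g)
  ⋆-⊠ a [] g = ≋-refl
  ⋆-⊠ a (b ∷ f) g = ≋-trans (⊞-cong assoc⋆ (∷-cong (sym (zeroʳ a)) (⋆-⊠ a f g))) (≋-sym (⋆-⊞ a (b ⋆ g) (0# ∷ f ⊠ g))) where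
   assoc⋆ : (a * b) ⋆ g ≋ a ⋆ (b ⋆ g)
   assoc⋆ .at i = begin
    coef ((a * b) ⋆ g) i   ≈⟨ coef-⋆ (a * b) g i ⟩
    a * b * coef g i       ≈⟨ *-assoc _ _ _ ⟩
    a * (b * coef g i)     ≈⟨ *-congˡ (sym (coef-⋆ b g i)) ⟩
    a * coef (b ⋆ g) i     ≈⟨ sym (coef-⋆ a (b ⋆ g) i) ⟩
    coef (a ⋆ (b ⋆ g)) i   ∎

  0∷-⊠ : ∀ f g → (0# ∷ f) ⊠ g ≋ 0# ∷ f ⊠ g
  0∷-⊠ f g .at zero = trans (coef-⊠-zero 0# f g) (zeroˡ _)
  0∷-⊠ f g .at (suc i) = trans (coef-⊠-suc 0# f g i) (trans (+-congʳ (zeroˡ _)) (+-identityˡ _))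

  ⊠-assoc : ∀ f g h → (f ⊠ g) ⊠ h ≋ f ⊠ (g ⊠ h)
  ⊠-assoc [] g h = ≋-refl
  ⊠-assoc (a ∷ f) g h =
   ≋-trans (⊠-distribʳ h (a ⋆ g) (0# ∷ f ⊠ g))
    (⊞-cong (⋆-⊠ a g h) (≋-trans (0∷-⊠ (f ⊠ g) h) (∷-cong refl (⊠-assoc f g h))))

  [_]⊠ : ∀ a g → (a ∷ []) ⊠ g ≋ a ⋆ g
  [ a ]⊠ g .at i = trans (coef-⊞ (a ⋆ g) (0# ∷ []) i) (trans (+-congˡ (z i)) (+-identityʳ _)) where
   z : ∀ i → coef (0# ∷ []) i ≈ 0#
   z zero = refl
   z (suc i) = refl

  ⊠-identityˡ : ∀ f → one ⊠ f ≋ f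
  ⊠-identityˡ f = ≋-trans ([ 1# ]⊠ f) (mk λ i → trans (coef-⋆ 1# f i) (*-identityˡ _))

 polyRing : CommutativeRing 0ℓ 0ℓ
 polyRing = record
  { Carrier = Pol ; _≈_ = _≋_ ; _+_ = _⊞_ ; _*_ = _⊠_ ; -_ = ⊟_ ; 0# = [] ; 1# = one
  ; isCommutativeRing = record
   { isRing = record
    { +-isAbelianGroup = record
     { isGroup = record
      { isMonoid = record
       { isSemigroup = record
        { isMagma = record
         { isEquivalence = record { refl = ≋-refl ; sym = ≋-sym ; trans = ≋-trans }
         ; ∙-cong = ⊞-cong }
        ; assoc = ⊞-assoc }
       ; identity = ⊞-identityˡ , ⊞-identityʳ }
      ; inverse = (λ f → ≋-trans (⊞-comm (⊟ f) f) (⊞-inverseʳ f)) , ⊞-inverseʳ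
      ; ⁻¹-cong = ⊟-cong }
     ; comm = ⊞-comm }
    ; *-cong = ⊠-cong
    ; *-assoc = ⊠-assoc
    ; *-identity = ⊠-identityˡ , (λ f → ≋-trans (⊠-comm f one) (⊠-identityˡ f))
    ; distrib = ⊠-distribˡ , ⊠-distribʳ }
   ; *-comm = ⊠-comm } }

 open Algebra.Properties.Semiring.Exp (CommutativeRing.semiring polyRing) public
  using () renaming (_^_ to _^ₚ_)

 X : Pol
 X = 0# ∷ 1# ∷ []

 opaque
  X⊠ : ∀ f → X ⊠ f ≋ 0# ∷ f
  X⊠ f = ≋-trans (0∷-⊠ one f) (∷-cong refl (⊠-identityˡ f))

 record Below (n : ℕ) (f : Pol) : Set where
  constructor mk
  field vanish : ∀ i → n N.≤ i → coef f i ≈ 0#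
 open Below public

 record Monic (n : ℕ) (f : Pol) : Set where
  constructor mk
  field
   lead  : coef f n ≈ 1#
   below : Below (suc n) f
 open Monic public

 opaque
  unfolding _⊞_
  below-resp : ∀ {n f g} → f ≋ g → Below n f → Below n g
  below-resp e b .vanish i p = trans (sym (at e i)) (vanish b i p)

  monic-resp : ∀ {n f g} → f ≋ g → Monic n f → Monic n g
  monic-resp {n} e m = mk (trans (sym (at e n)) (lead m)) (below-resp e (below m))

  below-mono : ∀ {m n f} → m N.≤ n → Below m f → Below n f
  below-mono p b .vanish i q = vanish b i (NP.≤-trans p q)

  below-length : ∀ f → Below (length f) f
  below-length [] .vanish i p = refl
  below-length (a ∷ f) .vanish (suc i) (N.s≤s p) = vanish (below-length f) i p

  below-0 : ∀ {f} → Below 0 f → f ≋ []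
  below-0 b .at i = vanish b i N.z≤n

  below-tail : ∀ {n a f} → Below (suc n) (a ∷ f) → Below n f
  below-tail b .vanish i p = vanish b (suc i) (N.s≤s p)

  below-∷ : ∀ {n a f} → Below n f → Below (suc n) (a ∷ f)
  below-∷ b .vanish (suc i) (N.s≤s p) = vanish b i p

  below-⊞ : ∀ {n f g} → Below n f → Below n g → Below n (f ⊞ g)
  below-⊞ {n} {f} {g} b c .vanish i p =
   trans (coef-⊞ f g i) (trans (+-cong (vanish b i p) (vanish c i p)) (+-identityʳ 0#))

  below-⊟ : ∀ {n f} → Below n f → Below n (⊟ f)
  below-⊟ {n} {f} b .vanish i p = trans (coef-⊟ f i) (trans (-‿cong (vanish b i p)) -0#≈0#)

  below-⋆ : ∀ {n} a {f} → Below n f → Below n (a ⋆ f)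
  below-⋆ a {f} b .vanish i p = trans (coef-⋆ a f i) (trans (*-congˡ (vanish b i p)) (zeroʳ a))

  below-⊠ : ∀ {m n f g} → Below (suc m) f → Below (suc n) g → Below (suc (m N.+ n)) (f ⊠ g)
  below-⊠ {f = []} b c .vanish i p = refl
  below-⊠ {m} {n} {a ∷ f} {g} b c .vanish (suc i) (N.s≤s p) =
   trans (coef-⊠-suc a f g i)
    (trans (+-cong (trans (*-congˡ (vanish c (suc i) (N.s≤s (NP.≤-trans (NP.m≤n+m n m) p)))) (zeroʳ a)) (rest m b p))
        (+-identityʳ 0#)) where
   rest : ∀ m → Below (suc m) (a ∷ f) → m N.+ n N.≤ i → coef (f ⊠ g) i ≈ 0#
   rest zero b p = at (⊠-cong (below-0 (below-tail b)) (≋-refl {g})) i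
   rest (suc m) b p = vanish (below-⊠ (below-tail b) c) i p

  coef-⊠-top : ∀ {m n f g} → Below (suc m) f → Below (suc n) g → coef (f ⊠ g) (m N.+ n) ≈ coef f m * coef g n
  coef-⊠-top {f = []} b c = sym (zeroˡ _)
  coef-⊠-top {zero} {zero} {a ∷ f} {g} b c = coef-⊠-zero a f g
  coef-⊠-top {zero} {suc n} {a ∷ f} {g} b c =
   trans (coef-⊠-suc a f g n) (trans (+-congˡ (at (⊠-cong (below-0 (below-tail b)) (≋-refl {g})) n)) (+-identityʳ _))
  coef-⊠-top {suc m} {n} {a ∷ f} {g} b c =
   trans (coef-⊠-suc a f g (m N.+ n))
    (trans (+-cong (trans (*-congˡ (vanish c (suc (m N.+ n)) (N.s≤s (NP.m≤n+m n m)))) (zeroʳ a)) (coef-⊠-top (below-tail b) c))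
        (+-identityˡ _))

  -- For monic factors this says that the coefficient below the top, which is minus the sum of the
  -- roots, is additive. It is one half of the additivity of `τ`.
  coef-⊠-subtop : ∀ {m n f g} → Below (suc (suc m)) f → Below (suc (suc n)) g →
          coef (f ⊠ g) (suc (m N.+ n)) ≈ coef f m * coef g (suc n) + coef f (suc m) * coef g n
  coef-⊠-subtop {f = []} b c = sym (trans (+-cong (zeroˡ _) (zeroˡ _)) (+-identityʳ 0#))
  coef-⊠-subtop {zero} {n} {a ∷ f} {g} b c =
   trans (coef-⊠-suc a f g n) (+-congˡ (lower n f (below-tail b))) where
   lower : ∀ n f → Below 1 f → coef (f ⊠ g) n ≈ coef f 0 * coef g n
   lower n [] b = sym (zeroˡ _)
   lower zero (a ∷ f) b = coef-⊠-zero a f g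
   lower (suc n) (a ∷ f) b =
    trans (coef-⊠-suc a f g n) (trans (+-congˡ (at (⊠-cong (below-0 (below-tail b)) (≋-refl {g})) n)) (+-identityʳ _))
  coef-⊠-subtop {suc m} {n} {a ∷ f} {g} b c =
   trans (coef-⊠-suc a f g (suc (m N.+ n)))
    (trans (+-cong (trans (*-congˡ (vanish c _ (N.s≤s (N.s≤s (NP.m≤n+m n m))))) (zeroʳ a)) (coef-⊠-subtop (below-tail b) c))
        (+-identityˡ _))

  monic-⊠ : ∀ {m n f g} → Monic m f → Monic n g → Monic (m N.+ n) (f ⊠ g)
  monic-⊠ a b .lead = trans (coef-⊠-top (below a) (below b)) (trans (*-cong (lead a) (lead b)) (*-identityˡ 1#))
  monic-⊠ a b .below = below-⊠ (below a) (below b)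

  monic-one : Monic 0 one
  monic-one = mk refl (below-length one)

  monic-X : Monic 1 X
  monic-X = mk refl (below-length X)

  monic-⊞ : ∀ {n f g} → Monic n f → Below n g → Monic n (f ⊞ g)
  monic-⊞ {n} {f} {g} m b .lead =
   trans (coef-⊞ f g n) (trans (+-cong (lead m) (vanish b n NP.≤-refl)) (+-identityʳ 1#))
  monic-⊞ {n} m b .below = below-⊞ (below m) (below-mono (NP.n≤1+n n) b)

  monic-^ : ∀ {m f} k → Monic m f → Monic (k N.* m) (f ^ₚ k)
  monic-^ zero a = monic-one
  monic-^ (suc k) a = monic-⊠ a (monic-^ k a)

  below-^ : ∀ {m f} k → Below (suc m) f → Below (suc (k N.* m)) (f ^ₚ k)
  below-^ zero a = below-length one
  below-^ (suc k) a = below-⊠ a (below-^ k a)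

  monic-X^ : ∀ n → Monic n (X ^ₚ n)
  monic-X^ n = ≡.subst (λ k → Monic k (X ^ₚ n)) (NP.*-identityʳ n) (monic-^ n monic-X)

  coef-⊠-0 : ∀ f g → coef (f ⊠ g) 0 ≈ coef f 0 * coef g 0
  coef-⊠-0 [] g = sym (zeroˡ _)
  coef-⊠-0 (a ∷ f) g = coef-⊠-zero a f g

  coef-⊠-1 : ∀ f g → coef (f ⊠ g) 1 ≈ coef f 0 * coef g 1 + coef f 1 * coef g 0
  coef-⊠-1 [] g = sym (trans (+-cong (zeroˡ _) (zeroˡ _)) (+-identityʳ 0#))
  coef-⊠-1 (a ∷ f) g = trans (coef-⊠-suc a f g 0) (+-congˡ (coef-⊠-0 f g))

 eval : Pol → Carrier → Carrier
 eval [] z = 0#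
 eval (a ∷ f) z = a + z * eval f z

 opaque
  unfolding _⊞_
  eval-zero : ∀ f z → f ≋ [] → eval f z ≈ 0#
  eval-zero [] z e = refl
  eval-zero (a ∷ f) z e =
   trans (+-cong (at e 0) (trans (*-congˡ (eval-zero f z (mk λ i → at e (suc i)))) (zeroʳ z))) (+-identityʳ 0#)

  eval-cong : ∀ f g z → f ≋ g → eval f z ≈ eval g z
  eval-cong [] g z e = sym (eval-zero g z (≋-sym e))
  eval-cong (a ∷ f) [] z e = eval-zero (a ∷ f) z e
  eval-cong (a ∷ f) (b ∷ g) z e = +-cong (at e 0) (*-congˡ (eval-cong f g z (mk λ i → at e (suc i))))

  eval-⊞ : ∀ f g z → eval (f ⊞ g) z ≈ eval f z + eval g z
  eval-⊞ [] g z = sym (+-identityˡ _)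
  eval-⊞ (a ∷ f) [] z = sym (+-identityʳ _)
  eval-⊞ (a ∷ f) (b ∷ g) z =
   trans (+-congˡ (*-congˡ (eval-⊞ f g z)))
    (solve 5 (λ a b z u v → (a :+ b) :+ z :* (u :+ v) := (a :+ z :* u) :+ (b :+ z :* v)) refl a b z _ _)

  eval-⋆ : ∀ a f z → eval (a ⋆ f) z ≈ a * eval f z
  eval-⋆ a [] z = sym (zeroʳ a)
  eval-⋆ a (b ∷ f) z =
   trans (+-congˡ (*-congˡ (eval-⋆ a f z)))
    (solve 4 (λ a b z u → a :* b :+ z :* (a :* u) := a :* (b :+ z :* u)) refl a b z _)

  eval-⊠ : ∀ f g z → eval (f ⊠ g) z ≈ eval f z * eval g z
  eval-⊠ [] g z = sym (zeroˡ _)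
  eval-⊠ (a ∷ f) g z =
   trans (eval-⊞ (a ⋆ g) (0# ∷ f ⊠ g) z)
    (trans (+-cong (eval-⋆ a g z) (+-congˡ (*-congˡ (eval-⊠ f g z))))
     (solve 4 (λ a z u v → a :* v :+ (con (+ 0) :+ z :* (u :* v)) := (a :+ z :* u) :* v) refl a z _ _))

-- Ring identities behind Euclid's algorithm.

module RingIdentities (R : CommutativeRing 0ℓ 0ℓ) where
 open CommutativeRing R
 open RingSolver R
 open Relation.Binary.Reasoning.Setoid setoid

 id1 : ∀ g u v w → g * u + v ≈ g * (u + w) + (v - w * g)
 id1 = solve 4 (λ g u v w → g :* u :+ v := g :* (u :+ w) :+ (v :- w :* g)) refl

 id2 : ∀ a b → a ≈ (a - b) + b
 id2 = solve 2 (λ a b → a := (a :- b) :+ b) refl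

 id3 : ∀ g a b → g * (a - b) ≈ g * a - g * b
 id3 = solve 3 (λ g a b → g :* (a :- b) := g :* a :- g :* b) refl

 remainder : ∀ g m q r f → f ≈ g * q + r → f ≈ g * m → r ≈ g * (m - q)
 remainder g m q r f e h = begin
  r                    ≈⟨ solve 2 (λ r s → r := (s :+ r) :- s) refl r (g * q) ⟩
  (g * q + r) - g * q  ≈⟨ +-congʳ (trans (sym e) h) ⟩
  g * m - g * q        ≈⟨ solve 3 (λ g m q → g :* m :- g :* q := g :* (m :- q)) refl g m q ⟩
  g * (m - q)          ∎

 -- Modulo `P` the remainder is -(f₁ q), so an inverse `u` of `r` makes -(q u) an inverse of f₁ = c
 -- f, and c times this an inverse of `f`.
 inverse-step : ∀ P f f₁ c q r u m → f₁ ≈ c * f → P ≈ f₁ * q + r → r * u ≈ 1# + P * m →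
         f * (c * - (q * u)) ≈ 1# + P * (m - u)
 inverse-step P f f₁ c q r u m e₁ e h = begin
  f * (c * - (q * u))            ≈⟨ solve 4 (λ f c q u → f :* (c :* :- (q :* u)) := :- ((c :* f) :* q :* u)) refl f c q u ⟩
  - (c * f * q * u)              ≈⟨ -‿cong (*-congʳ (*-congʳ (sym e₁))) ⟩
  - (f₁ * q * u)                 ≈⟨ solve 3 (λ a r u → :- (a :* u) := r :* u :- (a :+ r) :* u) refl (f₁ * q) r u ⟩
  r * u - (f₁ * q + r) * u       ≈⟨ +-cong h (-‿cong (*-congʳ (sym e))) ⟩
  (1# + P * m) - P * u           ≈⟨ solve 3 (λ P m u → (con (+ 1) :+ P :* m) :- P :* u := con (+ 1) :+ P :* (m :- u)) refl P m u ⟩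
  1# + P * (m - u)               ∎

 inverse-lift : ∀ P f q r u m → f ≈ P * q + r → r * u ≈ 1# + P * m → f * u ≈ 1# + P * (m + q * u)
 inverse-lift P f q r u m e h = begin
  f * u                      ≈⟨ *-congʳ e ⟩
  (P * q + r) * u            ≈⟨ solve 4 (λ p q r u → (p :* q :+ r) :* u := r :* u :+ p :* (q :* u)) refl P q r u ⟩
  r * u + P * (q * u)        ≈⟨ +-congʳ h ⟩
  (1# + P * m) + P * (q * u) ≈⟨ solve 3 (λ p m v → (con (+ 1) :+ p :* m) :+ p :* v := con (+ 1) :+ p :* (m :+ v)) refl P m (q * u) ⟩
  1# + P * (m + q * u)       ∎

 prime-step : ∀ P f g k u m → f * g ≈ P * k → f * u ≈ 1# + P * m → g ≈ P * (k * u - m * g)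
 prime-step P f g k u m e h = begin
  g                                  ≈⟨ solve 3 (λ g P m → g := (con (+ 1) :+ P :* m) :* g :- P :* (m :* g)) refl g P m ⟩
  (1# + P * m) * g - P * (m * g)     ≈⟨ +-congʳ (*-congʳ (sym h)) ⟩
  f * u * g - P * (m * g)            ≈⟨ +-congʳ (solve 3 (λ f u g → f :* u :* g := f :* g :* u) refl f u g) ⟩
  f * g * u - P * (m * g)            ≈⟨ +-congʳ (*-congʳ e) ⟩
  P * k * u - P * (m * g)            ≈⟨ solve 4 (λ P k u v → P :* k :* u :- P :* v := P :* (k :* u :- v)) refl P k u (m * g) ⟩
  P * (k * u - m * g)                ∎

 id14 : ∀ p q → q ≈ (q - p) + p
 id14 = solve 2 (λ p q → q := (q :- p) :+ p) refl

 id15 : ∀ p m o → p * m - p * o ≈ p * (m - o)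
 id15 = solve 3 (λ p m o → p :* m :- p :* o := p :* (m :- o)) refl

-- Binomial coefficients and the Frobenius map.

nC0≡1 : ∀ n → n choose 0 ≡ 1
nC0≡1 n = ≡.trans (nCk≡nC[n∸k] {0} {n} N.z≤n) (nCn≡1 n)

absorption : ∀ n k → suc k N.* (suc n choose suc k) ≡ suc n N.* (n choose k)
absorption zero zero = ≡.refl
absorption zero (suc k) = ≡.trans (≡.cong (suc (suc k) N.*_) (k>n⇒nCk≡0 {1} {suc (suc k)} (N.s≤s (N.s≤s N.z≤n))))
 (≡.trans (NP.*-zeroʳ (suc (suc k))) (≡.sym (≡.trans (NP.*-identityˡ _) (k>n⇒nCk≡0 {0} {suc k} (N.s≤s N.z≤n)))))
absorption (suc n) zero = ≡.trans (NP.*-identityˡ _) (≡.trans (nC1≡n (suc (suc n)))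
 (≡.sym (≡.trans (≡.cong (suc (suc n) N.*_) (nC0≡1 (suc n))) (NP.*-identityʳ _))))
absorption (suc n) (suc k) = begin
 suc (suc k) N.* (suc (suc n) choose suc (suc k))  ≡⟨ ≡.cong (suc (suc k) N.*_) (≡.sym (nCk+nC[k+1]≡[n+1]C[k+1] (suc n) (suc k))) ⟩
 suc (suc k) N.* (A N.+ B)                    ≡⟨ lem k A B ⟩
 suc k N.* A N.+ suc (suc k) N.* B N.+ A      ≡⟨ ≡.cong₂ (λ u v → u N.+ v N.+ A) (absorption n k) (absorption n (suc k)) ⟩
 suc n N.* (n choose k) N.+ suc n N.* (n choose suc k) N.+ A
  ≡⟨ ≡.cong (N._+ A) (≡.trans (≡.sym (NP.*-distribˡ-+ (suc n) (n choose k) (n choose suc k))) (≡.cong (suc n N.*_) (nCk+nC[k+1]≡[n+1]C[k+1] n k))) ⟩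
 suc n N.* A N.+ A                            ≡⟨ NP.+-comm (suc n N.* A) A ⟩
 suc (suc n) N.* A                            ∎ where
 open ≡.≡-Reasoning
 A = suc n choose suc k
 B = suc n choose suc (suc k)
 lem : ∀ k A B → suc (suc k) N.* (A N.+ B) ≡ suc k N.* A N.+ suc (suc k) N.* B N.+ A
 lem = solveℕ

-- By `absorption` p divides the product of k and the binomial coefficient, and it does not divide
-- k, which lies strictly between 0 and p.
prime∣binomial : ∀ {p} → Prime p → ∀ k → 0 N.< k → k N.< p → p ND.∣ p choose k
prime∣binomial {suc n} pr (suc k) _ k<p
 with euclidsLemma (suc k) (suc n choose suc k) pr (divides (n choose k) (≡.trans (absorption n k) (NP.*-comm (suc n) (n choose k))))
... | inj₁ p∣k = ⊥-elim (ND.>⇒∤ k<p p∣k)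
... | inj₂ h = h

module CharP (S : CommutativeRing 0ℓ 0ℓ) (p : ℕ) (pr : Prime p) where
 open CommutativeRing S
 open Algebra.Properties.Semiring.Mult semiring using () renaming (_×_ to _×ₛ_; ×-congʳ to ×ₛ-congʳ; ×-assoc-* to ×ₛ-assoc-*; ×-assocˡ to ×ₛ-assocˡ; ×-homo-1 to ×ₛ-homo-1) public
 open Algebra.Properties.CommutativeSemiring.Exp commutativeSemiring public using (_^_; ^-congˡ; ^-congʳ; ^-homo-*; ^-assocʳ; ^-distrib-*)
 open Algebra.Properties.CommutativeSemiring.Binomial commutativeSemiring using (theorem; binomialTerm; binomial)
 open Algebra.Properties.Semiring.Sum semiring using (sum; sum-cong-≋; sum-init-last; sum-replicate-zero)
 open Relation.Binary.Reasoning.Setoid setoid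

 ×ₛ-≈0 : p ×ₛ 1# ≈ 0# → ∀ n x → p ND.∣ n → n ×ₛ x ≈ 0#
 ×ₛ-≈0 char n x (divides k ≡.refl) = begin
  (k N.* p) ×ₛ x        ≡⟨ ≡.cong (_×ₛ x) (NP.*-comm k p) ⟩
  (p N.* k) ×ₛ x        ≈⟨ sym (×ₛ-assocˡ x p k) ⟩
  p ×ₛ (k ×ₛ x)         ≈⟨ ×ₛ-congʳ p (sym (*-identityˡ _)) ⟩
  p ×ₛ (1# * (k ×ₛ x))  ≈⟨ sym (×ₛ-assoc-* p 1# _) ⟩
  (p ×ₛ 1#) * (k ×ₛ x)  ≈⟨ trans (*-congʳ char) (zeroˡ _) ⟩
  0#                    ∎

 frobenius-+ : p ×ₛ 1# ≈ 0# → ∀ x y → (x + y) ^ p ≈ x ^ p + y ^ p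
 frobenius-+ char x y = trans (theorem p x y) (go p pr ≡.refl) where
  term = binomialTerm x y
  go : ∀ n → Prime n → n ≡ p → sum (term n) ≈ x ^ n + y ^ n
  go (suc n) prn ≡.refl = begin
   term p₀ Fin.zero + sum (λ k → term p₀ (Fin.suc k))  ≈⟨ +-congˡ (sum-init-last (λ k → term p₀ (Fin.suc k))) ⟩
   term p₀ Fin.zero + (sum (λ k → term p₀ (Fin.suc (inject₁ k))) + term p₀ (Fin.suc (fromℕ n)))
    ≈⟨ +-cong first (+-cong (trans (sum-cong-≋ middle) (sum-replicate-zero n)) last) ⟩
   y ^ p₀ + (0# + x ^ p₀)                              ≈⟨ trans (+-congˡ (+-identityˡ _)) (+-comm _ _) ⟩
   x ^ p₀ + y ^ p₀                                     ∎ where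
   p₀ = suc n
   first : term p₀ Fin.zero ≈ y ^ p₀
   first = trans (reflexive (≡.cong (_×ₛ (1# * y ^ p₀)) (nC0≡1 p₀))) (trans (×ₛ-homo-1 _) (*-identityˡ _))
   last : term p₀ (Fin.suc (fromℕ n)) ≈ x ^ p₀
   last = begin
    (p₀ choose suc (toℕ (fromℕ n))) ×ₛ (x ^ suc (toℕ (fromℕ n)) * y ^ (n N.∸ toℕ (fromℕ n)))
     ≡⟨ ≡.cong (λ k → (p₀ choose suc k) ×ₛ (x ^ suc k * y ^ (n N.∸ k))) (Finₚ.toℕ-fromℕ n) ⟩
    (p₀ choose p₀) ×ₛ (x ^ p₀ * y ^ (n N.∸ n))
     ≡⟨ ≡.cong₂ (λ c k → c ×ₛ (x ^ p₀ * y ^ k)) (nCn≡1 p₀) (NP.n∸n≡0 n) ⟩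
    1 ×ₛ (x ^ p₀ * 1#)                                ≈⟨ trans (×ₛ-homo-1 _) (*-identityʳ _) ⟩
    x ^ p₀                                            ∎
   middle : ∀ k → term p₀ (Fin.suc (inject₁ k)) ≈ 0#
   middle k = ×ₛ-≈0 char _ _ (prime∣binomial prn (suc (toℕ (inject₁ k))) (N.s≤s N.z≤n)
    (N.s≤s (≡.subst (N._< n) (≡.sym (Finₚ.toℕ-inject₁ k)) (Finₚ.toℕ<n k))))

 module Frobenius (char : p ×ₛ 1# ≈ 0#) where
  frobenius-0 : 0# ^ p ≈ 0#
  frobenius-0 = go p pr where
   go : ∀ n → Prime n → 0# ^ n ≈ 0#
   go (suc n) _ = zeroˡ _

  1^ : ∀ n → 1# ^ n ≈ 1#
  1^ zero = refl
  1^ (suc n) = trans (*-identityˡ _) (1^ n)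

  ^p-cong : ∀ {x y} → x ≈ y → x ^ p ≈ y ^ p
  ^p-cong = ^-congˡ p

  ^-p^suc : ∀ x j → x ^ (p N.^ suc j) ≈ (x ^ (p N.^ j)) ^ p
  ^-p^suc x j = trans (^-congʳ x (NP.*-comm p (p N.^ j))) (sym (^-assocʳ x (p N.^ j) p))

  frobenius^-+ : ∀ j x y → (x + y) ^ (p N.^ j) ≈ x ^ (p N.^ j) + y ^ (p N.^ j)
  frobenius^-+ zero x y = trans (*-identityʳ _) (+-cong (sym (*-identityʳ x)) (sym (*-identityʳ y)))
  frobenius^-+ (suc j) x y = begin
   (x + y) ^ (p N.^ suc j)                        ≈⟨ ^-p^suc (x + y) j ⟩
   ((x + y) ^ (p N.^ j)) ^ p                      ≈⟨ ^p-cong (frobenius^-+ j x y) ⟩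
   (x ^ (p N.^ j) + y ^ (p N.^ j)) ^ p            ≈⟨ frobenius-+ char _ _ ⟩
   (x ^ (p N.^ j)) ^ p + (y ^ (p N.^ j)) ^ p      ≈⟨ +-cong (sym (^-p^suc x j)) (sym (^-p^suc y j)) ⟩
   x ^ (p N.^ suc j) + y ^ (p N.^ suc j)          ∎

  frobenius^-0 : ∀ j → 0# ^ (p N.^ j) ≈ 0#
  frobenius^-0 zero = *-identityʳ 0#
  frobenius^-0 (suc j) = trans (^-p^suc 0# j) (trans (^p-cong (frobenius^-0 j)) frobenius-0)

  fixed^ : ∀ x j → x ^ p ≈ x → x ^ (p N.^ j) ≈ x
  fixed^ x zero e = *-identityʳ x
  fixed^ x (suc j) e = trans (^-p^suc x j) (trans (^p-cong (fixed^ x j e)) e)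

  -- Induction by additivity of Frobenius. In the prime field every element is a multiple of 1, so
  -- this contains Fermat's little theorem.
  multiple-fixed : ∀ n → (n ×ₛ 1#) ^ p ≈ n ×ₛ 1#
  multiple-fixed zero = frobenius-0
  multiple-fixed (suc n) = trans (frobenius-+ char 1# (n ×ₛ 1#)) (+-cong (1^ p) (multiple-fixed n))

  open Sums +-commutativeMonoid using (∑)

-- Quotient rings and homomorphisms.

module Quotient (R : CommutativeRing 0ℓ 0ℓ) (P : CommutativeRing.Carrier R) where
 open CommutativeRing R
 open RingSolver R

 infix 4 _~_
 -- The quotient is carried as data, and carrier and operations stay those of `R`; elements of the
 -- residue fields are therefore plain polynomials.
 record _~_ (x y : Carrier) : Set where
  constructor mk
  field
   quot : Carrier
   eq   : x ≈ y + P * quot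

 ≈⇒~ : ∀ {x y} → x ≈ y → x ~ y
 ≈⇒~ {x} {y} e = mk 0# (trans e (solve 2 (λ y P → y := y :+ P :* con (+ 0)) refl y P))

 ~-sym : ∀ {x y} → x ~ y → y ~ x
 ~-sym {x} {y} (mk m e) = mk (- m) (trans (solve 3 (λ y P m → y := (y :+ P :* m) :+ P :* :- m) refl y P m) (+-congʳ (sym e)))

 ~-trans : ∀ {x y z} → x ~ y → y ~ z → x ~ z
 ~-trans {x} {y} {z} (mk m d) (mk n e) =
  mk (n + m) (trans d (trans (+-congʳ e) (solve 4 (λ z P m n → (z :+ P :* n) :+ P :* m := z :+ P :* (n :+ m)) refl z P m n)))

 ~-+ : ∀ {x x' y y'} → x ~ x' → y ~ y' → x + y ~ x' + y'
 ~-+ {x} {x'} {y} {y'} (mk m d) (mk n e) = mk (m + n) (trans (+-cong d e)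
  (solve 5 (λ x y P m n → (x :+ P :* m) :+ (y :+ P :* n) := (x :+ y) :+ P :* (m :+ n)) refl x' y' P m n))

 ~-* : ∀ {x x' y y'} → x ~ x' → y ~ y' → x * y ~ x' * y'
 ~-* {x} {x'} {y} {y'} (mk m d) (mk n e) = mk (x' * n + m * y' + P * (m * n)) (trans (*-cong d e)
  (solve 5 (λ x y P m n → (x :+ P :* m) :* (y :+ P :* n) := x :* y :+ P :* (x :* n :+ m :* y :+ P :* (m :* n))) refl x' y' P m n))

 ~-neg : ∀ {x y} → x ~ y → - x ~ - y
 ~-neg {x} {y} (mk m d) = mk (- m) (trans (-‿cong d) (solve 3 (λ y P m → :- (y :+ P :* m) := :- y :+ P :* :- m) refl y P m))

 quotientRing : CommutativeRing 0ℓ 0ℓ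
 quotientRing = record
  { Carrier = Carrier ; _≈_ = _~_ ; _+_ = _+_ ; _*_ = _*_ ; -_ = -_ ; 0# = 0# ; 1# = 1#
  ; isCommutativeRing = record
   { isRing = record
    { +-isAbelianGroup = record
     { isGroup = record
      { isMonoid = record
       { isSemigroup = record
        { isMagma = record
         { isEquivalence = record { refl = ≈⇒~ refl ; sym = ~-sym ; trans = ~-trans }
         ; ∙-cong = ~-+ }
        ; assoc = λ x y z → ≈⇒~ (+-assoc x y z) }
       ; identity = (λ x → ≈⇒~ (+-identityˡ x)) , (λ x → ≈⇒~ (+-identityʳ x)) }
      ; inverse = (λ x → ≈⇒~ (-‿inverseˡ x)) , (λ x → ≈⇒~ (-‿inverseʳ x))
      ; ⁻¹-cong = ~-neg }
     ; comm = λ x y → ≈⇒~ (+-comm x y) }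
    ; *-cong = ~-*
    ; *-assoc = λ x y z → ≈⇒~ (*-assoc x y z)
    ; *-identity = (λ x → ≈⇒~ (*-identityˡ x)) , (λ x → ≈⇒~ (*-identityʳ x))
    ; distrib = (λ x y z → ≈⇒~ (distribˡ x y z)) , (λ x y z → ≈⇒~ (distribʳ x y z)) }
   ; *-comm = λ x y → ≈⇒~ (*-comm x y) } }

record Hom (R S : CommutativeRing 0ℓ 0ℓ) : Set where
 private
  module R = CommutativeRing R
  module S = CommutativeRing S
 field
  fun    : R.Carrier → S.Carrier
  cong   : ∀ {x y} → x R.≈ y → fun x S.≈ fun y
  homo-+ : ∀ x y → fun (x R.+ y) S.≈ fun x S.+ fun y
  homo-* : ∀ x y → fun (x R.* y) S.≈ fun x S.* fun y
  homo-0 : fun R.0# S.≈ S.0#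
  homo-1 : fun R.1# S.≈ S.1#

 homo-neg : ∀ x → fun (R.- x) S.≈ S.- fun x
 homo-neg x = S.trans (S.sym (S.+-identityʳ _)) (S.trans (S.+-congˡ (S.sym (S.-‿inverseʳ (fun x))))
  (S.trans (S.sym (S.+-assoc _ _ _)) (S.trans (S.+-congʳ (S.trans (S.sym (homo-+ _ _)) (S.trans (cong (R.-‿inverseˡ x)) homo-0))) (S.+-identityˡ _))))

module PolyMap {R S : CommutativeRing 0ℓ 0ℓ} (φ : Hom R S) where
 private
  module R = CommutativeRing R
  module S = CommutativeRing S
  module A = Poly R
  module B = Poly S
 open Hom φ

 polyMap : A.Pol → B.Pol
 polyMap = map fun

 coef-polyMap : ∀ f i → B.coef (polyMap f) i S.≈ fun (A.coef f i)
 coef-polyMap [] i = S.sym homo-0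
 coef-polyMap (a ∷ f) zero = S.refl
 coef-polyMap (a ∷ f) (suc i) = coef-polyMap f i

 polyMap-cong : ∀ {f g} → f A.≋ g → polyMap f B.≋ polyMap g
 polyMap-cong {f} {g} e = B.mk λ i → S.trans (coef-polyMap f i) (S.trans (cong (A.at e i)) (S.sym (coef-polyMap g i)))

 polyMap-⊞ : ∀ f g → polyMap (f A.⊞ g) B.≋ polyMap f B.⊞ polyMap g
 polyMap-⊞ f g = B.mk λ i → S.trans (coef-polyMap (f A.⊞ g) i) (S.trans (cong (A.coef-⊞ f g i)) (S.trans (homo-+ _ _)
  (S.trans (S.+-cong (S.sym (coef-polyMap f i)) (S.sym (coef-polyMap g i))) (S.sym (B.coef-⊞ (polyMap f) (polyMap g) i)))))

 polyMap-⊠ : ∀ f g → polyMap (f A.⊠ g) B.≋ polyMap f B.⊠ polyMap g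
 polyMap-⊠ f g = B.mk λ i → S.trans (coef-polyMap (f A.⊠ g) i) (go f g i) where
  go : ∀ f g i → fun (A.coef (f A.⊠ g) i) S.≈ B.coef (polyMap f B.⊠ polyMap g) i
  go [] g i = S.trans (cong (A.at (zeroˡᴬ g) i)) (S.trans homo-0 (S.sym (B.at (zeroˡᴮ (polyMap g)) i))) where
   zeroˡᴬ = CommutativeRing.zeroˡ A.polyRing
   zeroˡᴮ = CommutativeRing.zeroˡ B.polyRing
  go (a ∷ f) g zero = S.trans (cong (A.coef-⊠-zero a f g)) (S.trans (homo-* _ _)
   (S.trans (S.*-congˡ (S.sym (coef-polyMap g 0))) (S.sym (B.coef-⊠-zero (fun a) (polyMap f) (polyMap g)))))
  go (a ∷ f) g (suc i) = S.trans (cong (A.coef-⊠-suc a f g i)) (S.trans (homo-+ _ _)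
   (S.trans (S.+-cong (S.trans (homo-* _ _) (S.*-congˡ (S.sym (coef-polyMap g (suc i))))) (go f g i))
    (S.sym (B.coef-⊠-suc (fun a) (polyMap f) (polyMap g) i))))

-- Products of linear factors and their coefficients.

module LinearFactors (S : CommutativeRing 0ℓ 0ℓ) where
 open CommutativeRing S
 open Poly S
 open RingSolver S
 private module P = CommutativeRing polyRing

 linear : Carrier → Pol
 linear z = - z ∷ 1# ∷ []

 ∏linear : ℕ → (ℕ → Carrier) → Pol
 ∏linear zero z = one
 ∏linear (suc n) z = linear (z 0) ⊠ ∏linear n (λ i → z (suc i))

 ∑ℕ : ℕ → (ℕ → Carrier) → Carrier
 ∑ℕ zero z = 0#
 ∑ℕ (suc n) z = z 0 + ∑ℕ n (λ i → z (suc i))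

 ∑ℕ-cong : ∀ n {y z} → (∀ i → y i ≈ z i) → ∑ℕ n y ≈ ∑ℕ n z
 ∑ℕ-cong zero e = refl
 ∑ℕ-cong (suc n) e = +-cong (e 0) (∑ℕ-cong n (λ i → e (suc i)))

 ∑ℕ-cong< : ∀ n {y z} → (∀ i → i N.< n → y i ≈ z i) → ∑ℕ n y ≈ ∑ℕ n z
 ∑ℕ-cong< zero e = refl
 ∑ℕ-cong< (suc n) e = +-cong (e 0 (N.s≤s N.z≤n)) (∑ℕ-cong< n (λ i i<n → e (suc i) (N.s≤s i<n)))

 ∑ℕ-+ : ∀ n y z → ∑ℕ n (λ i → y i + z i) ≈ ∑ℕ n y + ∑ℕ n z
 ∑ℕ-+ zero y z = sym (+-identityʳ 0#)
 ∑ℕ-+ (suc n) y z = trans (+-congˡ (∑ℕ-+ n _ _))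
  (solve 4 (λ a b c e → (a :+ b) :+ (c :+ e) := (a :+ c) :+ (b :+ e)) refl (y 0) (z 0) _ _)

 ∑ℕ-* : ∀ n a z → ∑ℕ n (λ i → a * z i) ≈ a * ∑ℕ n z
 ∑ℕ-* zero a z = sym (zeroʳ a)
 ∑ℕ-* (suc n) a z = trans (+-congˡ (∑ℕ-* n a _)) (sym (distribˡ a _ _))

 ∑ℕ-split : ∀ m n z → ∑ℕ (m N.+ n) z ≈ ∑ℕ m z + ∑ℕ n (λ i → z (m N.+ i))
 ∑ℕ-split zero n z = sym (+-identityˡ _)
 ∑ℕ-split (suc m) n z = trans (+-congˡ (∑ℕ-split m n _)) (sym (+-assoc _ _ _))

 linear-cong : ∀ {x y} → x ≈ y → linear x ≋ linear y
 linear-cong e = ∷-cong (-‿cong e) ≋-refl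

 ∏linear-cong : ∀ n {y z} → (∀ i → y i ≈ z i) → ∏linear n y ≋ ∏linear n z
 ∏linear-cong zero e = P.refl
 ∏linear-cong (suc n) e = P.*-cong (linear-cong (e 0)) (∏linear-cong n (λ i → e (suc i)))

 ∏linear-last : ∀ n z → ∏linear (suc n) z ≋ linear (z n) ⊠ ∏linear n z
 ∏linear-last zero z = P.refl
 ∏linear-last (suc n) z = P.trans (P.*-congˡ {linear (z 0)} (∏linear-last n (λ i → z (suc i))))
  (P.trans (P.sym (P.*-assoc (linear (z 0)) (linear (z (suc n))) _))
   (P.trans (P.*-congʳ {∏linear n (λ i → z (suc i))} (P.*-comm (linear (z 0)) (linear (z (suc n))))) (P.*-assoc (linear (z (suc n))) (linear (z 0)) _)))

 -- Meant for `z i` the i-th Frobenius conjugate: the conjugates close up to a cycle, so applying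
 -- Frobenius to all roots leaves their product polynomial unchanged.
 ∏linear-rotate : ∀ n z → z n ≈ z 0 → ∏linear n (λ i → z (suc i)) ≋ ∏linear n z
 ∏linear-rotate zero z e = P.refl
 ∏linear-rotate (suc n) z e = P.trans (∏linear-last n (λ i → z (suc i))) (P.*-congʳ {∏linear n (λ i → z (suc i))} (linear-cong e))

 linear-monic : ∀ z → Monic 1 (linear z)
 linear-monic z = mk refl (below-length (linear z))

 ∏linear-monic : ∀ n z → Monic n (∏linear n z)
 ∏linear-monic zero z = monic-one
 ∏linear-monic (suc n) z = monic-⊠ (linear-monic (z 0)) (∏linear-monic n (λ i → z (suc i)))

 ∏linear-subtop : ∀ n z → coef (∏linear (suc n) z) n ≈ - ∑ℕ (suc n) z
 ∏linear-subtop zero z = trans (at (P.*-identityʳ (linear (z 0))) 0) (-‿cong (sym (+-identityʳ _)))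
 ∏linear-subtop (suc n) z =
  trans (coef-⊠-subtop {0} {n} (below (linear-monic (z 0))) (below (∏linear-monic (suc n) (λ i → z (suc i)))))
   (trans (+-cong (*-congˡ (lead (∏linear-monic (suc n) (λ i → z (suc i))))) (*-congˡ (∏linear-subtop n (λ i → z (suc i)))))
    (solve 2 (λ z s → :- z :* con (+ 1) :+ con (+ 1) :* :- s := :- (z :+ s)) refl (z 0) _))

 -- The logarithmic derivative at 0 of the product of the factors T - z, multiplied out. The
 -- inverses are passed as data because `S` is only a ring.
 ∏linear-coef₁ : ∀ n z z' → (∀ i → z i * z' i ≈ 1#) → coef (∏linear n z) 1 ≈ - (coef (∏linear n z) 0 * ∑ℕ n z')
 ∏linear-coef₁ zero z z' inv = solve 0 (con (+ 0) := :- (con (+ 1) :* con (+ 0))) refl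
 ∏linear-coef₁ (suc n) z z' inv = begin
  coef (linear (z 0) ⊠ G) 1                                ≈⟨ coef-⊠-1 (linear (z 0)) G ⟩
  - z 0 * coef G 1 + 1# * coef G 0                         ≈⟨ +-cong (*-congˡ (∏linear-coef₁ n _ _ (λ i → inv (suc i)))) (*-congʳ (sym (inv 0))) ⟩
  - z 0 * - (coef G 0 * s) + z 0 * z' 0 * coef G 0
   ≈⟨ solve 4 (λ z g s z' → :- z :* :- (g :* s) :+ z :* z' :* g := :- (:- z :* g :* (z' :+ s))) refl (z 0) (coef G 0) s (z' 0) ⟩
  - (- z 0 * coef G 0 * (z' 0 + s))                        ≈⟨ -‿cong (*-congʳ (sym (coef-⊠-0 (linear (z 0)) G))) ⟩
  - (coef (linear (z 0) ⊠ G) 0 * (z' 0 + s))               ∎ where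
  open Relation.Binary.Reasoning.Setoid setoid
  G = ∏linear n (λ i → z (suc i))
  s = ∑ℕ n (λ i → z' (suc i))

 eval-linear : ∀ z → eval (linear z) z ≈ 0#
 eval-linear z = solve 1 (λ z → :- z :+ z :* (con (+ 1) :+ z :* con (+ 0)) := con (+ 0)) refl z

 eval-∏linear : ∀ n z → eval (∏linear (suc n) z) (z 0) ≈ 0#
 eval-∏linear n z = trans (eval-⊠ (linear (z 0)) _ (z 0)) (trans (*-congʳ (eval-linear (z 0))) (zeroˡ _))

module _ {R S : CommutativeRing 0ℓ 0ℓ} (φ : Hom R S) where
 private
  module R = CommutativeRing R
  module S = CommutativeRing S
  module B = Poly S
  module PB = CommutativeRing B.polyRing
  module LR = LinearFactors R
  module LS = LinearFactors S
 open Hom φ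
 open PolyMap φ

 polyMap-∏linear : ∀ n z → polyMap (LR.∏linear n z) B.≋ LS.∏linear n (λ i → fun (z i))
 polyMap-∏linear zero z = B.∷-cong homo-1 B.≋-refl
 polyMap-∏linear (suc n) z = PB.trans (polyMap-⊠ (LR.linear (z 0)) _)
  (PB.*-cong (B.∷-cong (homo-neg (z 0)) (B.∷-cong homo-1 B.≋-refl)) (polyMap-∏linear n (λ i → z (suc i))))

-- The power identity of Stepanov's method.

module StepanovTerm (S : CommutativeRing 0ℓ 0ℓ) where
 open CommutativeRing S
 open Algebra.Properties.CommutativeSemiring.Exp commutativeSemiring
 open Relation.Binary.Reasoning.Setoid setoid
 open Algebra.Properties.CommutativeSemigroup *-commutativeSemigroup using (interchange; x∙yz≈y∙xz)

 -- Since x^(r²) = x, the r-th power turns x^(k r) into x^k, while W^r = ξ^r V is traded for Y = ξ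
 -- V. What remains has a small degree, up to a power of ξ that depends only on b + i; in the
 -- application b + i is the same for all terms.
 stepanovTerm : ∀ r' x ξ V W Y → let r = suc r' in x ^ (r N.* r) ≈ x → W ^ r ≈ ξ ^ r * V → Y ≈ ξ * V →
  ∀ l k b i → (x ^ (l N.+ k N.* r) * (ξ ^ b * W ^ i)) ^ r ≈ ξ ^ (r' N.* (b N.+ i)) * (x ^ (l N.* r N.+ k) * (ξ ^ b * Y ^ i))
 stepanovTerm r' x ξ V W Y xq Wr Ye l k b i = begin
  (x ^ (l N.+ k N.* r) * (ξ ^ b * W ^ i)) ^ r             ≈⟨ ^-distrib-* _ _ r ⟩
  (x ^ (l N.+ k N.* r)) ^ r * (ξ ^ b * W ^ i) ^ r         ≈⟨ *-cong xpart ξpart ⟩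
  x ^ (l N.* r N.+ k) * (ξ ^ e * (ξ ^ (b N.+ i) * V ^ i)) ≈⟨ x∙yz≈y∙xz _ _ _ ⟩
  ξ ^ e * (x ^ (l N.* r N.+ k) * (ξ ^ (b N.+ i) * V ^ i)) ≈⟨ *-congˡ (*-congˡ Ypart) ⟩
  ξ ^ e * (x ^ (l N.* r N.+ k) * (ξ ^ b * Y ^ i))         ∎ where
  r = suc r'
  e = r' N.* (b N.+ i)
  xpart : (x ^ (l N.+ k N.* r)) ^ r ≈ x ^ (l N.* r N.+ k)
  xpart = begin
   (x ^ (l N.+ k N.* r)) ^ r              ≈⟨ ^-assocʳ x (l N.+ k N.* r) r ⟩
   x ^ ((l N.+ k N.* r) N.* r)            ≈⟨ ^-congʳ x (lem l k r) ⟩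
   x ^ (l N.* r N.+ r N.* r N.* k)        ≈⟨ ^-homo-* x (l N.* r) _ ⟩
   x ^ (l N.* r) * x ^ (r N.* r N.* k)    ≈⟨ *-congˡ (trans (sym (^-assocʳ x (r N.* r) k)) (^-congˡ k xq)) ⟩
   x ^ (l N.* r) * x ^ k                  ≈⟨ sym (^-homo-* x (l N.* r) k) ⟩
   x ^ (l N.* r N.+ k)                    ∎ where
   lem : ∀ l k r → (l N.+ k N.* r) N.* r ≡ l N.* r N.+ r N.* r N.* k
   lem = solveℕ
  ξpart : (ξ ^ b * W ^ i) ^ r ≈ ξ ^ e * (ξ ^ (b N.+ i) * V ^ i)
  ξpart = begin
   (ξ ^ b * W ^ i) ^ r                     ≈⟨ ^-distrib-* _ _ r ⟩
   (ξ ^ b) ^ r * (W ^ i) ^ r               ≈⟨ *-cong (^-assocʳ ξ b r) (trans (^-assocʳ W i r) (trans (^-congʳ W (NP.*-comm i r)) (sym (^-assocʳ W r i)))) ⟩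
   ξ ^ (b N.* r) * (W ^ r) ^ i             ≈⟨ *-congˡ (trans (^-congˡ i Wr) (^-distrib-* _ _ i)) ⟩
   ξ ^ (b N.* r) * ((ξ ^ r) ^ i * V ^ i)   ≈⟨ sym (*-assoc _ _ _) ⟩
   ξ ^ (b N.* r) * (ξ ^ r) ^ i * V ^ i     ≈⟨ *-congʳ (*-congˡ (^-assocʳ ξ r i)) ⟩
   ξ ^ (b N.* r) * ξ ^ (r N.* i) * V ^ i   ≈⟨ *-congʳ (sym (^-homo-* ξ (b N.* r) (r N.* i))) ⟩
   ξ ^ (b N.* r N.+ r N.* i) * V ^ i       ≈⟨ *-congʳ (^-congʳ ξ (lem b i r')) ⟩
   ξ ^ (e N.+ (b N.+ i)) * V ^ i           ≈⟨ *-congʳ (^-homo-* ξ e (b N.+ i)) ⟩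
   ξ ^ e * ξ ^ (b N.+ i) * V ^ i           ≈⟨ *-assoc _ _ _ ⟩
   ξ ^ e * (ξ ^ (b N.+ i) * V ^ i)         ∎ where
   lem : ∀ b i r' → b N.* suc r' N.+ suc r' N.* i ≡ r' N.* (b N.+ i) N.+ (b N.+ i)
   lem = solveℕ
  Ypart : ξ ^ (b N.+ i) * V ^ i ≈ ξ ^ b * Y ^ i
  Ypart = begin
   ξ ^ (b N.+ i) * V ^ i          ≈⟨ *-congʳ (^-homo-* ξ b i) ⟩
   ξ ^ b * ξ ^ i * V ^ i          ≈⟨ *-assoc _ _ _ ⟩
   ξ ^ b * (ξ ^ i * V ^ i)        ≈⟨ *-congˡ (sym (^-distrib-* ξ V i)) ⟩
   ξ ^ b * (ξ * V) ^ i            ≈⟨ *-congˡ (^-congˡ i (sym Ye)) ⟩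
   ξ ^ b * Y ^ i                  ∎

 combine : ∀ x y f u v → (x - y) * f + (u - v) ≈ (x * f + u) - (y * f + v)
 combine = solve 5 (λ x y f u v → (x :- y) :* f :+ (u :- v) := (x :* f :+ u) :- (y :* f :+ v)) refl where
  open RingSolver S

 minus : ∀ {w u t} → w + u ≈ t → u ≈ t - w
 minus {w} {u} {t} e = trans (solve 2 (λ w u → u := (w :+ u) :- w) refl w u) (+-congʳ e) where
  open RingSolver S

 scaled-minus : ∀ {ξ w W} → W ≈ ξ * w → ∀ t → t * ξ - W ≈ ξ * (t - w)
 scaled-minus {ξ} {w} e t = trans (+-congˡ (-‿cong e)) (solve 3 (λ t ξ w → t :* ξ :- ξ :* w := ξ :* (t :- w)) refl t ξ w) where
  open RingSolver S

open import Data.Nat using (NonZero)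
open import Data.Nat.Primality using (prime⇒nonTrivial; prime⇒nonZero; prime⇒irreducible)
open import Data.Integer using (_+_; _*_; -_; _-_; _≤_; 0ℤ; 1ℤ; _<_; ∣_∣)
open import Data.List using (allFin; cartesianProductWith; _++_; filter; upTo; cartesianProduct; applyUpTo)
open import Data.List.Membership.Propositional using (_∈_; find; lose)
open import Data.List.Membership.Propositional.Properties using (∈-allFin; ∈-cartesianProductWith⁺; ∈-map⁻; ∈-filter⁺; ∈-filter⁻; ∈-map⁺; ∈-upTo⁺; ∈-upTo⁻; ∈-cartesianProduct⁻; ∈-applyUpTo⁺; ∈-cartesianProductWith⁻)
open import Data.List.Relation.Unary.Any as Any using (Any; here; there; any?)
open import Data.List.Relation.Unary.All as All using (All)
open import Data.List.Relation.Unary.Unique.Propositional using (Unique)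
import Data.List.Relation.Unary.Unique.Propositional.Properties as Uniqueₚ
open import Data.Vec using (Vec)
open import Data.Product using (Σ; ∃) renaming (proj₁ to fst; proj₂ to snd)
open import Data.Sum as Sum using (_⊎_; [_,_]′)
open import Data.Empty using (⊥)
open import Relation.Nullary using (¬_; Dec; ¬?; does; _×-dec_)
open import Relation.Binary.PropositionalEquality using (_≢_; refl; sym; trans; cong; cong₂; subst)
open import Relation.Binary.Definitions using (tri<; tri≈; tri>)
import Data.List.Properties as Listₚ
open import Data.List.Relation.Binary.Permutation.Propositional.Properties using (↭-length) renaming (shift to ↭-shift)
import Data.Vec.Properties as Vecₚ
open import Data.Nat.DivMod using (_%_; _/_; m≡m%n+[m/n]*n; m%n<n; m/n*n≤m)
import Algebra.Properties.Group
open import Data.Bool using (true; false; if_then_else_)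
open import Data.Integer.Tactic.RingSolver using (solve-∀)
import Data.Product.Properties as Productₚ
open import Data.Nat.Coprimality as Coprimality using (Coprime; coprime?)
open import Data.Integer.DivMod using (_%ℕ_; n%ℕd<d)
open import Data.Integer.Divisibility.Signed as ZD using (divides; _∣?_)
import Data.List.Relation.Unary.All.Properties as Allₚ
open import Data.Nat.ListAction using (product)
open import Data.Nat.Primality.Factorisation using (factorise; PrimeFactorisation)
open import Data.Rational as ℚ using (ℚ; 0ℚ)
import Data.Rational.Properties as ℚₚ
open import Data.Rational.Unnormalised as ℚᵘ using (mkℚᵘ; *≡*; *≤*)
import Data.Rational.Unnormalised.Properties as ℚᵘₚ
open import Relation.Nullary.Decidable using (_×-dec_)
open import Data.List.Membership.DecPropositional N._≟_ using (_∈?_)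

-- Integer sums and indicators.

open Sums ZP.+-0-commutativeMonoid public

∑-*ˡ : {A : Set} (c : ℤ) (xs : List A) (f : A → ℤ) → ∑ xs (λ x → c * f x) ≡ c * ∑ xs f
∑-*ˡ c [] f = sym (ZP.*-zeroʳ c)
∑-*ˡ c (x ∷ xs) f = trans (cong (λ z → c * f x + z) (∑-*ˡ c xs f)) (sym (ZP.*-distribˡ-+ c (f x) (∑ xs f)))

∑-*ʳ : {A : Set} (c : ℤ) (xs : List A) (f : A → ℤ) → ∑ xs (λ x → f x * c) ≡ ∑ xs f * c
∑-*ʳ c xs f = trans (∑-cong xs (λ x → ZP.*-comm (f x) c)) (trans (∑-*ˡ c xs f) (ZP.*-comm c (∑ xs f)))

∑-neg : {A : Set} (xs : List A) (f : A → ℤ) → ∑ xs (λ x → - f x) ≡ - ∑ xs f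
∑-neg [] f = refl
∑-neg (x ∷ xs) f = trans (cong (λ z → - f x + z) (∑-neg xs f)) (sym (ZP.neg-distrib-+ (f x) (∑ xs f)))

∑-minus : {A : Set} (xs : List A) (f g : A → ℤ) → ∑ xs (λ x → f x - g x) ≡ ∑ xs f - ∑ xs g
∑-minus xs f g = trans (∑-∙ xs f (λ x → - g x)) (cong (λ z → ∑ xs f + z) (∑-neg xs g))

∑-const : {A : Set} (xs : List A) (c : ℤ) → ∑ xs (λ _ → c) ≡ + length xs * c
∑-const [] c = refl
∑-const (x ∷ xs) c = trans (cong (λ z → c + z) (∑-const xs c)) (sym (ZP.suc-* (+ length xs) c))

∑-mono : {A : Set} (xs : List A) {f g : A → ℤ} → (∀ {x} → x ∈ xs → f x ≤ g x) → ∑ xs f ≤ ∑ xs g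
∑-mono [] h = ZP.≤-refl
∑-mono (x ∷ xs) h = ZP.+-mono-≤ (h (here refl)) (∑-mono xs (λ p → h (there p)))

∑-nonneg : {A : Set} (xs : List A) {f : A → ℤ} → (∀ x → 0ℤ ≤ f x) → 0ℤ ≤ ∑ xs f
∑-nonneg [] h = ZP.≤-refl
∑-nonneg (x ∷ xs) h = ZP.+-mono-≤ (h x) (∑-nonneg xs h)

indicator : {A : Set} → Dec A → ℤ
indicator d = if does d then 1ℤ else 0ℤ

module _ {A : Set} where
 indicator-yes : (d : Dec A) → A → indicator d ≡ 1ℤ
 indicator-yes (yes _) a = refl
 indicator-yes (no ¬a) a = ⊥-elim (¬a a)

 indicator-no : (d : Dec A) → ¬ A → indicator d ≡ 0ℤ
 indicator-no (yes a) ¬a = ⊥-elim (¬a a)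
 indicator-no (no _) ¬a = refl

 indicator-nonneg : (d : Dec A) → 0ℤ ≤ indicator d
 indicator-nonneg (yes _) = ℤ.+≤+ N.z≤n
 indicator-nonneg (no _) = ZP.≤-refl

 indicator-≤1 : (d : Dec A) → indicator d ≤ 1ℤ
 indicator-≤1 (yes _) = ZP.≤-refl
 indicator-≤1 (no _) = ℤ.+≤+ N.z≤n

indicator-⇔ : {A B : Set} (d : Dec A) (e : Dec B) → (A → B) → (B → A) → indicator d ≡ indicator e
indicator-⇔ (yes a) e f g = sym (indicator-yes e (f a))
indicator-⇔ (no ¬a) e f g = sym (indicator-no e (λ b → ¬a (g b)))

∑-filter : {A : Set} {P : A → Set} (P? : ∀ x → Dec (P x)) (xs : List A) (f : A → ℤ) →
      ∑ xs (λ x → indicator (P? x) * f x) ≡ ∑ (filter P? xs) f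
∑-filter P? [] f = refl
∑-filter P? (x ∷ xs) f with P? x
... | yes _ = cong₂ _+_ (ZP.*-identityˡ (f x)) (∑-filter P? xs f)
... | no _ = trans (ZP.+-identityˡ _) (∑-filter P? xs f)

-- In decreasing order, so that the largest indices split off by reduction, as Newton's identities
-- require.
range : ℕ → List ℕ
range zero = []
range (suc n) = suc n ∷ range n

∈-range⁺ : ∀ {k n} → 1 N.≤ k → k N.≤ n → k ∈ range n
∈-range⁺ {k} {zero} 1≤k k≤0 = ⊥-elim (NP.<-irrefl refl (NP.≤-trans 1≤k k≤0))
∈-range⁺ {k} {suc n} 1≤k k≤n with NP.m≤n⇒m<n∨m≡n k≤n
... | inj₁ k<n = there (∈-range⁺ 1≤k (NP.≤-pred k<n))
... | inj₂ refl = here refl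

∈-range⁻ : ∀ {k} n → k ∈ range n → 1 N.≤ k × k N.≤ n
∈-range⁻ (suc n) (here refl) = N.s≤s N.z≤n , NP.≤-refl
∈-range⁻ (suc n) (there h) = let a , b = ∈-range⁻ n h in a , NP.m≤n⇒m≤1+n b

range-unique : ∀ n → Unique (range n)
range-unique zero = []
range-unique (suc n) = All.tabulate (λ {k} k∈ e → NP.<-irrefl (sym e) (N.s≤s (snd (∈-range⁻ n k∈)))) ∷ range-unique n

∑-range-shift : ∀ n f → ∑ (range (suc n)) f ≡ ∑ (range n) (λ k → f (suc k)) + f 1
∑-range-shift zero f = trans (ZP.+-identityʳ (f 1)) (sym (ZP.+-identityˡ (f 1)))
∑-range-shift (suc n) f = trans (cong (λ z → f (suc (suc n)) + z) (∑-range-shift n f)) (sym (ZP.+-assoc (f (suc (suc n))) _ (f 1)))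

∑-range-extend : ∀ {k n} f → k N.≤ n → (∀ i → k N.< i → f i ≡ 0ℤ) → ∑ (range n) f ≡ ∑ (range k) f
∑-range-extend {n = zero} f N.z≤n z = refl
∑-range-extend {k} {suc n} f k≤n z with NP.m≤n⇒m<n∨m≡n k≤n
... | inj₂ refl = refl
... | inj₁ k<n = trans (cong₂ _+_ (z (suc n) k<n) (∑-range-extend f (NP.≤-pred k<n) z)) (ZP.+-identityˡ _)

module FieldIdentities (R : CommutativeRing 0ℓ 0ℓ) where
 open CommutativeRing R renaming (_+_ to _⊕_; _*_ to _⊗_; -_ to ⊝_; refl to ≈refl; sym to ≈sym; trans to ≈trans)
 open RingSolver R

 -- The logarithmic derivative of a product at 0, where u₀ + u₁ X and v₀ + v₁ X are the low order
 -- parts of the factors.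
 quotient-sum : ∀ u₀ u₁ v₀ v₁ u' v' w → u₀ ⊗ u' ≈ 1# → v₀ ⊗ v' ≈ 1# → (u₀ ⊗ v₀) ⊗ w ≈ 1# →
         (u₀ ⊗ v₁ ⊕ u₁ ⊗ v₀) ⊗ w ≈ u₁ ⊗ u' ⊕ v₁ ⊗ v'
 quotient-sum u₀ u₁ v₀ v₁ u' v' w eu ev ew = begin
  (u₀ ⊗ v₁ ⊕ u₁ ⊗ v₀) ⊗ w
   ≈⟨ *-congʳ (+-cong (≈trans (≈sym (*-identityʳ _)) (*-congˡ (≈sym ev))) (≈trans (≈sym (*-identityʳ _)) (*-congˡ (≈sym eu)))) ⟩
  (u₀ ⊗ v₁ ⊗ (v₀ ⊗ v') ⊕ u₁ ⊗ v₀ ⊗ (u₀ ⊗ u')) ⊗ w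
   ≈⟨ solve 7 (λ u₀ u₁ v₀ v₁ u' v' w → (u₀ :* v₁ :* (v₀ :* v') :+ u₁ :* v₀ :* (u₀ :* u')) :* w := ((u₀ :* v₀) :* w) :* (u₁ :* u' :+ v₁ :* v')) ≈refl u₀ u₁ v₀ v₁ u' v' w ⟩
  ((u₀ ⊗ v₀) ⊗ w) ⊗ (u₁ ⊗ u' ⊕ v₁ ⊗ v')
   ≈⟨ ≈trans (*-congʳ ew) (*-identityˡ _) ⟩
  u₁ ⊗ u' ⊕ v₁ ⊗ v' ∎ where
  open import Relation.Binary.Reasoning.Setoid setoid

 trace-sum : ∀ s s' a l l' → ⊝ ((s ⊕ s') ⊕ a ⊗ (l ⊕ l')) ≈ ⊝ (s ⊕ a ⊗ l) ⊕ ⊝ (s' ⊕ a ⊗ l')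
 trace-sum = solve 5 (λ s s' a l l' → :- ((s :+ s') :+ a :* (l :+ l')) := :- (s :+ a :* l) :+ :- (s' :+ a :* l')) ≈refl

module AffineIdentities (R : CommutativeRing 0ℓ 0ℓ) where
 open CommutativeRing R renaming (_+_ to _⊕_; _*_ to _⊗_; -_ to ⊝_; refl to ≈refl; sym to ≈sym; trans to ≈trans)
 open RingSolver R
 open import Relation.Binary.Reasoning.Setoid setoid

 undo-shift' : ∀ x t → x ⊕ (t ⊕ ⊝ x) ≈ t
 undo-shift' = solve 2 (λ x t → x :+ (t :- x) := t) ≈refl

 shift-undo : ∀ x t → (x ⊕ t) ⊕ ⊝ x ≈ t
 shift-undo = solve 2 (λ x t → (x :+ t) :- x := t) ≈refl

 double-neg : ∀ x → ⊝ ⊝ x ≈ x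
 double-neg = solve 1 (λ x → :- :- x := x) ≈refl

 factor : ∀ c a c' → ⊝ (c ⊕ a ⊗ (c ⊗ c')) ≈ ⊝ (c ⊗ (1# ⊕ a ⊗ c'))
 factor = solve 3 (λ c a c' → :- (c :+ a :* (c :* c')) := :- (c :* (con (+ 1) :+ a :* c'))) ≈refl

 -- c ↦ x - (s + c u) is inverted by t ↦ (x - s - t) u⁻¹.
 affine-inverse : ∀ x s u u' → u ⊗ u' ≈ 1# → ∀ t → x ⊕ ⊝ (s ⊕ (((x ⊕ ⊝ s) ⊕ ⊝ t) ⊗ u') ⊗ u) ≈ t
 affine-inverse x s u u' e t = begin
  x ⊕ ⊝ (s ⊕ (((x ⊕ ⊝ s) ⊕ ⊝ t) ⊗ u') ⊗ u)
   ≈⟨ solve 5 (λ x s u u' t → x :- (s :+ (((x :- s) :- t) :* u') :* u) := x :- (s :+ ((x :- s) :- t) :* (u :* u'))) ≈refl x s u u' t ⟩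
  x ⊕ ⊝ (s ⊕ ((x ⊕ ⊝ s) ⊕ ⊝ t) ⊗ (u ⊗ u'))   ≈⟨ +-congˡ (-‿cong (+-congˡ (*-congˡ e))) ⟩
  x ⊕ ⊝ (s ⊕ ((x ⊕ ⊝ s) ⊕ ⊝ t) ⊗ 1#)         ≈⟨ solve 3 (λ x s t → x :- (s :+ ((x :- s) :- t) :* con (+ 1)) := t) ≈refl x s t ⟩
  t ∎

 affine-inverse' : ∀ x s u u' → u ⊗ u' ≈ 1# → ∀ c → ((x ⊕ ⊝ s) ⊕ ⊝ (x ⊕ ⊝ (s ⊕ c ⊗ u))) ⊗ u' ≈ c
 affine-inverse' x s u u' e c = begin
  ((x ⊕ ⊝ s) ⊕ ⊝ (x ⊕ ⊝ (s ⊕ c ⊗ u))) ⊗ u'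
   ≈⟨ solve 5 (λ x s u u' c → ((x :- s) :- (x :- (s :+ c :* u))) :* u' := c :* (u :* u')) ≈refl x s u u' c ⟩
  c ⊗ (u ⊗ u')  ≈⟨ ≈trans (*-congˡ e) (*-identityʳ c) ⟩
  c ∎

-- Inner products of integer-valued functions, and Dickson polynomials of an operator.

square-nonneg : ∀ x → 0ℤ ≤ x * x
square-nonneg (+ n) = subst (0ℤ ≤_) (ZP.pos-* n n) (ℤ.+≤+ N.z≤n)
square-nonneg ℤ.-[1+ n ] = ℤ.+≤+ N.z≤n

≤-by : ∀ {x y z} → 0ℤ ≤ z → y - x ≡ z → x ≤ y
≤-by {x} {y} h e = ZP.0≤i-j⇒j≤i (subst (0ℤ ≤_) (sym e) h)

*-nonneg : ∀ {x y} → 0ℤ ≤ x → 0ℤ ≤ y → 0ℤ ≤ x * y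
*-nonneg {x} {y} hx hy = subst (_≤ x * y) (ZP.*-zeroʳ x) (ZP.*-monoˡ-≤-nonNeg x {{ℤ.nonNegative hx}} hy)

*-monoˡ-nonneg : ∀ {c x y} → 0ℤ ≤ c → x ≤ y → c * x ≤ c * y
*-monoˡ-nonneg {c} hc h = ZP.*-monoˡ-≤-nonNeg c {{ℤ.nonNegative hc}} h

*-cancelˡ-pos : ∀ {c x y} → 0ℤ < c → c * x ≤ c * y → x ≤ y
*-cancelˡ-pos {c} {x} {y} hc h = ZP.*-cancelˡ-≤-pos x y c {{ℤ.positive hc}} h

module InnerProduct {A : Set} (xs : List A) where
 infix 8 ⟨_,_⟩
 ⟨_,_⟩ : (A → ℤ) → (A → ℤ) → ℤ
 ⟨ v , w ⟩ = ∑ xs (λ x → v x * w x)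

 normSq : (A → ℤ) → ℤ
 normSq v = ⟨ v , v ⟩

 inner-comm : ∀ v w → ⟨ v , w ⟩ ≡ ⟨ w , v ⟩
 inner-comm v w = ∑-cong xs (λ x → ZP.*-comm (v x) (w x))

 inner-cong : ∀ {v v' w w'} → (∀ x → v x ≡ v' x) → (∀ x → w x ≡ w' x) → ⟨ v , w ⟩ ≡ ⟨ v' , w' ⟩
 inner-cong e f = ∑-cong xs (λ x → cong₂ _*_ (e x) (f x))

 inner-linear : ∀ c d v w u → ⟨ (λ x → c * v x + d * w x) , u ⟩ ≡ c * ⟨ v , u ⟩ + d * ⟨ w , u ⟩
 inner-linear c d v w u = trans (∑-cong xs (λ x → lem c d (v x) (w x) (u x))) (trans (∑-∙ xs _ _) (cong₂ _+_ (∑-*ˡ c xs _) (∑-*ˡ d xs _))) where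
  lem : ∀ c d v w u → (c * v + d * w) * u ≡ c * (v * u) + d * (w * u)
  lem = solve-∀

 normSq-linear : ∀ c d v w → normSq (λ x → c * v x + d * w x) ≡ c * c * normSq v + + 2 * (c * d) * ⟨ v , w ⟩ + d * d * normSq w
 normSq-linear c d v w = trans (inner-linear c d v w u) (trans (cong₂ (λ s t → c * s + d * t) (trans (inner-comm v u) (inner-linear c d v w v)) (trans (inner-comm w u) (inner-linear c d v w w)))
  (trans (cong (λ z → c * (c * normSq v + d * z) + d * (c * ⟨ v , w ⟩ + d * normSq w)) (inner-comm w v)) (lem c d (normSq v) ⟨ v , w ⟩ (normSq w)))) where
  u = λ x → c * v x + d * w x
  lem : ∀ c d n i m → c * (c * n + d * i) + d * (c * i + d * m) ≡ c * c * n + + 2 * (c * d) * i + d * d * m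
  lem = solve-∀

 normSq-nonneg : ∀ v → 0ℤ ≤ normSq v
 normSq-nonneg v = ∑-nonneg xs (λ x → square-nonneg (v x))

 -- With X the squared norm of v and H the inner product, the squared norm of X w - H v is X times
 -- the claimed difference. No division occurs, but a factor X is cancelled, whence the positivity.
 cauchy-schwarz : ∀ v w → 0ℤ < normSq v → ⟨ w , v ⟩ * ⟨ w , v ⟩ ≤ normSq v * normSq w
 cauchy-schwarz v w pos = *-cancelˡ-pos pos (≤-by (normSq-nonneg (λ x → X * w x + - H * v x))
  (sym (trans (normSq-linear X (- H) w v) (lem X H (normSq w))))) where
  X = normSq v
  H = ⟨ w , v ⟩
  lem : ∀ X H n → X * X * n + + 2 * (X * - H) * H + - H * - H * X ≡ X * (X * n) - X * (H * H)
  lem = solve-∀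

 2inner≤ : ∀ v w → + 2 * ⟨ v , w ⟩ ≤ normSq v + normSq w
 2inner≤ v w = ≤-by (normSq-nonneg (λ x → 1ℤ * v x + - 1ℤ * w x)) (sym (trans (normSq-linear 1ℤ (- 1ℤ) v w) (lem (normSq v) ⟨ v , w ⟩ (normSq w)))) where
  lem : ∀ n i m → 1ℤ * 1ℤ * n + + 2 * (1ℤ * - 1ℤ) * i + - 1ℤ * - 1ℤ * m ≡ n + m - + 2 * i
  lem = solve-∀

-- E j = α^j + β^j for α + β = B and α β = Q.
module Dickson {A : Set} (xs : List A) (B : (A → ℤ) → (A → ℤ)) (Q : ℤ)
  (B-cong : ∀ {v w} → (∀ x → v x ≡ w x) → ∀ x → B v x ≡ B w x)
  (B-linear : ∀ c d v w x → B (λ y → c * v y + d * w y) x ≡ c * B v x + d * B w x) where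
 open InnerProduct xs

 E : ℕ → (A → ℤ) → A → ℤ
 E zero v x = + 2 * v x
 E (suc zero) v x = B v x
 -- `B` acts on the argument, and the right side keeps the literal shape c * _ + d * _, so that
 -- linearity lemmas apply to it as it stands.
 E (suc (suc j)) v x = 1ℤ * E (suc j) (B v) x + - Q * E j v x

 E-cong : ∀ j {v w} → (∀ x → v x ≡ w x) → ∀ x → E j v x ≡ E j w x
 E-cong zero e x = cong (+ 2 *_) (e x)
 E-cong (suc zero) e = B-cong e
 E-cong (suc (suc j)) e x = cong₂ (λ u w → 1ℤ * u + - Q * w) (E-cong (suc j) (B-cong e) x) (E-cong j e x)

 E-linear : ∀ j c d v w x → E j (λ y → c * v y + d * w y) x ≡ c * E j v x + d * E j w x
 E-linear zero c d v w x = lem c d (v x) (w x) where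
  lem : ∀ c d v w → + 2 * (c * v + d * w) ≡ c * (+ 2 * v) + d * (+ 2 * w)
  lem = solve-∀
 E-linear (suc zero) c d v w x = B-linear c d v w x
 E-linear (suc (suc j)) c d v w x = trans (cong₂ (λ s t → 1ℤ * s + - Q * t) (trans (E-cong (suc j) (B-linear c d v w) x) (E-linear (suc j) c d (B v) (B w) x)) (E-linear j c d v w x))
  (lem c d Q (E (suc j) (B v) x) (E (suc j) (B w) x) (E j v x) (E j w x)) where
  lem : ∀ c d q a b e f → 1ℤ * (c * a + d * b) + - q * (c * e + d * f) ≡ c * (1ℤ * a + - q * e) + d * (1ℤ * b + - q * f)
  lem = solve-∀

 B-E : ∀ j v x → B (E j v) x ≡ E j (B v) x
 B-E zero v x = trans (B-cong (λ y → lem (v y)) x) (trans (B-linear 1ℤ 1ℤ v v x) (sym (lem (B v x)))) where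
  lem : ∀ v → + 2 * v ≡ 1ℤ * v + 1ℤ * v
  lem = solve-∀
 B-E (suc zero) v x = refl
 B-E (suc (suc j)) v x = trans (B-linear 1ℤ (- Q) _ _ x) (cong₂ (λ s t → 1ℤ * s + - Q * t) (B-E (suc j) (B v) x) (B-E j v x))

 -- The identity (α^(n+k) + β^(n+k)) (α^n + β^n) = α^(2n+k) + β^(2n+k) + Q^n (α^k + β^k). The offset
 -- `k` is general because the induction on n, in steps of two, raises it.
 E-double : ∀ n k v x → E (n N.+ k) (E n v) x ≡ E (n N.+ (n N.+ k)) v x + Q ℤ.^ n * E k v x
 E-double zero k v x = trans (E-cong k (λ y → lem (v y)) x) (trans (E-linear k 1ℤ 1ℤ v v x) (lem' (E k v x))) where
  lem : ∀ v → + 2 * v ≡ 1ℤ * v + 1ℤ * v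
  lem = solve-∀
  lem' : ∀ e → 1ℤ * e + 1ℤ * e ≡ e + 1ℤ * e
  lem' = solve-∀
 E-double (suc zero) k v x = lem Q (E (suc k) (B v) x) (E k v x) where
  lem : ∀ q a b → a ≡ 1ℤ * a + - q * b + q ℤ.^ 1 * b
  lem q a b = trans (lem' q a b) (cong (λ z → 1ℤ * a + - q * b + z * b) (sym (ZP.*-identityʳ q))) where
   lem' : ∀ q a b → a ≡ 1ℤ * a + - q * b + q * b
   lem' = solve-∀
 E-double (suc (suc n)) k v x = begin
  E (2 N.+ n N.+ k) (E (2 N.+ n) v) x
   ≡⟨ E-linear (2 N.+ n N.+ k) 1ℤ (- Q) (E (suc n) (B v)) (E n v) x ⟩
  1ℤ * E (2 N.+ n N.+ k) (E (suc n) (B v)) x + - Q * E (2 N.+ n N.+ k) (E n v) x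
   ≡⟨ cong₂ (λ s t → 1ℤ * s + - Q * t) (first (E-double (suc n) (suc k) (B v) x)) (second (E-double n (2 N.+ k) v x)) ⟩
  1ℤ * (E (3 N.+ m) (B v) x + Q * Q ℤ.^ n * E (1 N.+ k) (B v) x) + - Q * (E (2 N.+ m) v x + Q ℤ.^ n * E (2 N.+ k) v x)
   ≡⟨ lem Q (Q ℤ.^ n) (E (3 N.+ m) (B v) x) (E (1 N.+ k) (B v) x) (E (2 N.+ m) v x) (E k v x) ⟩
  E (4 N.+ m) v x + Q * (Q * Q ℤ.^ n) * E k v x
   ≡⟨ cong (λ i → E i v x + Q * (Q * Q ℤ.^ n) * E k v x) (sym (idx 2)) ⟩
  E (2 N.+ n N.+ (2 N.+ n N.+ k)) v x + Q * (Q * Q ℤ.^ n) * E k v x ∎ where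
  open ≡.≡-Reasoning
  m = n N.+ (n N.+ k)
  move : ∀ a b → n N.+ (a N.+ b) ≡ a N.+ (n N.+ b)
  move a b = trans (sym (NP.+-assoc n a b)) (trans (cong (N._+ b) (NP.+-comm n a)) (NP.+-assoc a n b))
  idx : ∀ a → a N.+ n N.+ (2 N.+ n N.+ k) ≡ a N.+ (2 N.+ m)
  idx a = trans (NP.+-assoc a n _) (cong (a N.+_) (move 2 (n N.+ k)))
  first : E (suc n N.+ suc k) (E (suc n) (B v)) x ≡ E (suc n N.+ (suc n N.+ suc k)) (B v) x + Q * Q ℤ.^ n * E (1 N.+ k) (B v) x →
      E (2 N.+ n N.+ k) (E (suc n) (B v)) x ≡ E (3 N.+ m) (B v) x + Q * Q ℤ.^ n * E (1 N.+ k) (B v) x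
  first ih = trans (cong (λ i → E i (E (suc n) (B v)) x) (cong suc (sym (move 1 k)))) (trans ih
   (cong (λ i → E i (B v) x + Q * Q ℤ.^ n * E (1 N.+ k) (B v) x) (cong suc (trans (cong (λ z → n N.+ suc z) (move 1 k)) (move 2 (n N.+ k))))))
  second : E (n N.+ (2 N.+ k)) (E n v) x ≡ E (n N.+ (n N.+ (2 N.+ k))) v x + Q ℤ.^ n * E (2 N.+ k) v x →
       E (2 N.+ n N.+ k) (E n v) x ≡ E (2 N.+ m) v x + Q ℤ.^ n * E (2 N.+ k) v x
  second ih = trans (cong (λ i → E i (E n v) x) (sym (move 2 k))) (trans ih
   (cong (λ i → E i v x + Q ℤ.^ n * E (2 N.+ k) v x) (trans (cong (n N.+_) (move 2 k)) (move 2 (n N.+ k)))))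
  lem : ∀ q s a b c e → 1ℤ * (a + q * s * b) + - q * (c + s * (1ℤ * b + - q * e)) ≡ (1ℤ * a + - q * c) + q * (q * s) * e
  lem = solve-∀

 module _ (B-self : ∀ v w → ⟨ B v , w ⟩ ≡ ⟨ v , B w ⟩) where
  E-self : ∀ j v w → ⟨ E j v , w ⟩ ≡ ⟨ v , E j w ⟩
  E-self zero v w = ∑-cong xs (λ x → lem (v x) (w x)) where
   lem : ∀ v w → + 2 * v * w ≡ v * (+ 2 * w)
   lem = solve-∀
  E-self (suc zero) v w = B-self v w
  E-self (suc (suc j)) v w = trans (inner-linear 1ℤ (- Q) (E (suc j) (B v)) (E j v) w)
   (trans (cong₂ (λ s t → 1ℤ * s + - Q * t) (trans (E-self (suc j) (B v) w) (trans (B-self v (E (suc j) w)) (inner-cong {v} (λ _ → refl) (B-E (suc j) w)))) (E-self j v w))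
    (trans (cong₂ (λ s t → 1ℤ * s + - Q * t) (inner-comm v (E (suc j) (B w))) (inner-comm v (E j w)))
     (trans (sym (inner-linear 1ℤ (- Q) (E (suc j) (B w)) (E j w) v)) (inner-comm (E (suc (suc j)) w) v))))

  -- The case k = 0, with self-adjointness turning the square of `E j` into a squared norm. This
  -- norm is what Cauchy-Schwarz bounds from below in the amplification step.
  E-double-inner : ∀ j v → ⟨ E (j N.+ j) v , v ⟩ ≡ normSq (E j v) - + 2 * (Q ℤ.^ j * normSq v)
  E-double-inner j v = trans (lem ⟨ E (j N.+ j) v , v ⟩ (Q ℤ.^ j) (normSq v)) (cong (λ z → z - + 2 * (Q ℤ.^ j * normSq v)) (sym expand)) where
   lem : ∀ e q n → e ≡ (1ℤ * e + q * (+ 2 * n)) - + 2 * (q * n)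
   lem = solve-∀
   shape : ∀ x → E j (E j v) x ≡ 1ℤ * E (j N.+ j) v x + Q ℤ.^ j * (+ 2 * v x)
   shape x = trans (cong (λ i → E i (E j v) x) (sym (NP.+-identityʳ j))) (trans (E-double j 0 v x) (cong (λ z → z + Q ℤ.^ j * (+ 2 * v x)) (trans (cong (λ i → E (j N.+ i) v x) (NP.+-identityʳ j)) (sym (ZP.*-identityˡ _)))))
   expand : normSq (E j v) ≡ 1ℤ * ⟨ E (j N.+ j) v , v ⟩ + Q ℤ.^ j * (+ 2 * normSq v)
   expand = trans (sym (E-self j (E j v) v)) (trans (inner-cong shape (λ _ → refl))
    (trans (inner-linear 1ℤ (Q ℤ.^ j) (E (j N.+ j) v) (λ x → + 2 * v x) v) (cong (λ z → 1ℤ * ⟨ E (j N.+ j) v , v ⟩ + Q ℤ.^ j * z) (trans (∑-cong xs (λ x → ZP.*-assoc (+ 2) (v x) (v x))) (∑-*ˡ (+ 2) xs _)))))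

-- Periodic functions and complete residue systems.

Periodic : ℕ → (ℤ → ℤ) → Set
Periodic n f = ∀ {i j} → i ≡ j [ n ] → f i ≡ f j

res : ℕ → List ℤ
res n = map +_ (upTo n)

res-unique : ∀ n → Unique (res n)
res-unique n = unique-map +_ (λ _ _ → ZP.+-injective) (Uniqueₚ.upTo⁺ n)

res-length : ∀ n → length (res n) ≡ n
res-length n = trans (Listₚ.length-map +_ (upTo n)) (Listₚ.length-upTo n)

∈-res⁻ : ∀ {n i} → i ∈ res n → ∃ λ k → k N.< n × i ≡ + k
∈-res⁻ i∈ with ∈-map⁻ +_ i∈
... | k , k∈ , e = k , ∈-upTo⁻ k∈ , e

∈-res⁺ : ∀ {n k} → k N.< n → + k ∈ res n
∈-res⁺ k<n = ∈-map⁺ +_ (∈-upTo⁺ k<n)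

res-mod-injective : ∀ {n i j} → i ∈ res n → j ∈ res n → i ≡ j [ n ] → i ≡ j
res-mod-injective i∈ j∈ h with ∈-res⁻ i∈ | ∈-res⁻ j∈
... | k , k<n , refl | l , l<n , refl = cong +_ (small-mod-≡ k<n l<n h)

mod-+ˡ : ∀ {n i j} a → i ≡ j [ n ] → a + i ≡ a + j [ n ]
mod-+ˡ a h = mod-+ (mod-refl {i = a}) h

mod-*ˡ : ∀ {n i j} a → i ≡ j [ n ] → a * i ≡ a * j [ n ]
mod-*ˡ a h = mod-* (mod-refl {i = a}) h

mod-cancel-+ : ∀ {n i j} a → a + i ≡ a + j [ n ] → i ≡ j [ n ]
mod-cancel-+ {n} {i} {j} a (mk d) = mk (subst (+ n ZD.∣_) (lem a i j) d) where
 lem : ∀ a i j → (a + i) - (a + j) ≡ i - j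
 lem = solve-∀

mod-scale : ∀ {n i j} m → i ≡ j [ n ] → + m * i ≡ + m * j [ m N.* n ]
mod-scale {n} {i} {j} m (mk (divides k e)) = mod-by k (trans (lem (+ m) i j) (trans (cong (+ m *_) e) (trans (lem' (+ m) k (+ n)) (cong (k *_) (sym (ZP.pos-* m n)))))) where
 lem : ∀ m i j → m * i - m * j ≡ m * (i - j)
 lem = solve-∀
 lem' : ∀ m k n → m * (k * n) ≡ k * (m * n)
 lem' = solve-∀

mod-unscale : ∀ {n i j} m .{{_ : NonZero m}} → + m * i ≡ + m * j [ m N.* n ] → i ≡ j [ n ]
mod-unscale {n} {i} {j} m {{nz}} (mk (divides k e)) = mod-by k (ZP.*-cancelˡ-≡ (+ m) (i - j) (k * + n) {{nz}}
 (trans (lem (+ m) i j) (trans e (trans (cong (k *_) (ZP.pos-* m n)) (lem' (+ m) k (+ n)))))) where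
 lem : ∀ m i j → m * (i - j) ≡ m * i - m * j
 lem = solve-∀
 lem' : ∀ m k n → k * (m * n) ≡ m * (k * n)
 lem' = solve-∀

mod-coarsenˡ : ∀ {m i j} n → i ≡ j [ m N.* n ] → i ≡ j [ m ]
mod-coarsenˡ {m} {i} {j} n h = mod-coarsen n (subst (λ k → i ≡ j [ k ]) (NP.*-comm m n) h)

mod-drop : ∀ {m} i j → i + + m * j ≡ i [ m ]
mod-drop {m} i j = mod-by j (lem i j (+ m)) where
 lem : ∀ i j m → i + m * j - i ≡ j * m
 lem = solve-∀

-- As many incongruent integers as there are classes meet every class, by counting; so only
-- injectivity has to be checked in each application.
complete : {A : Set} (xs : List A) (g : A → ℤ) (n : ℕ) .{{_ : NonZero n}} → Unique xs → length xs ≡ n →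
      (∀ {a b} → a ∈ xs → b ∈ xs → g a ≡ g b [ n ] → a ≡ b) → ∀ f → Periodic n f → ∑ xs (λ a → f (g a)) ≡ ∑ (res n) f
complete {A} xs g n u len inj f per = sym (trans (∑-map +_ (upTo n) f) (trans (∑-reindex g' (λ k → f (+ k)) u (Uniqueₚ.upTo⁺ n) (λ {a} _ → into a) inj' sur) (∑-cong xs (λ a → per (mod-%ℕ (g a) n))))) where
 g' : A → ℕ
 g' a = g a %ℕ n
 into : ∀ a → g' a ∈ upTo n
 into a = ∈-upTo⁺ (n%ℕd<d (g a) n)
 inj' : ∀ {a b} → a ∈ xs → b ∈ xs → g' a ≡ g' b → a ≡ b
 inj' {a} {b} a∈ b∈ e = inj a∈ b∈ (mod-trans (mod-sym (mod-%ℕ (g a) n)) (subst (λ k → + k ≡ g b [ n ]) (sym e) (mod-%ℕ (g b) n)))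
 sur : ∀ {k} → k ∈ upTo n → Σ A λ a → a ∈ xs × g' a ≡ k
 sur {k} k∈ = go (k ∈? map g' xs) where
  go : Dec (k ∈ map g' xs) → Σ A λ a → a ∈ xs × g' a ≡ k
  go (yes h) with ∈-map⁻ g' h
  ... | a , a∈ , e = a , a∈ , sym e
  go (no h) = ⊥-elim (unique-⊆-full (map g' xs) (unique-map g' inj' u) sub (NP.≤-reflexive (trans (Listₚ.length-upTo n) (sym (trans (Listₚ.length-map g' xs) len)))) k∈ h) where
   sub : ∀ {j} → j ∈ map g' xs → j ∈ upTo n
   sub j∈ with ∈-map⁻ g' j∈
   ... | a , _ , refl = into a

module _ (n : ℕ) .{{_ : NonZero n}} (f : ℤ → ℤ) (per : Periodic n f) where
 res-shift : ∀ a → ∑ (res n) (λ x → f (a + x)) ≡ ∑ (res n) f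
 res-shift a = complete (res n) (a +ℤ_) n (res-unique n) (res-length n) (λ i∈ j∈ h → res-mod-injective i∈ j∈ (mod-cancel-+ a h)) f per
  where _+ℤ_ = ℤ._+_

 res-unit : ∀ u → Coprime ∣ u ∣ n → ∑ (res n) (λ x → f (u * x)) ≡ ∑ (res n) f
 res-unit u cop = complete (res n) (u *_) n (res-unique n) (res-length n) (λ i∈ j∈ h → res-mod-injective i∈ j∈ (mod-cancel {c = u} cop h)) f per

length-cartesian : {A B C : Set} (f : A → B → C) (xs : List A) (ys : List B) → length (cartesianProductWith f xs ys) ≡ length xs N.* length ys
length-cartesian f [] ys = refl
length-cartesian f (x ∷ xs) ys = trans (Listₚ.length-++ (map (f x) ys)) (cong₂ N._+_ (Listₚ.length-map (f x) ys) (length-cartesian f xs ys))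

private
 pairs : ∀ m n (N : ℕ) .{{_ : NonZero N}} → m N.* n ≡ N → (φ : ℤ → ℤ → ℤ) →
     (∀ {i i' j j'} → i ∈ res m → i' ∈ res m → j ∈ res n → j' ∈ res n → φ i j ≡ φ i' j' [ N ] → i ≡ i' × j ≡ j') →
     ∀ f → Periodic N f → ∑ (res N) f ≡ ∑ (res m) (λ i → ∑ (res n) (λ j → f (φ i j)))
 pairs m n N e φ inj f per = trans (sym (complete (cartesianProduct (res m) (res n)) (λ ij → φ (fst ij) (snd ij)) N
   (Uniqueₚ.cartesianProduct⁺ (res-unique m) (res-unique n)) (trans (length-cartesian _,_ (res m) (res n)) (trans (cong₂ N._*_ (res-length m) (res-length n)) e))
   (λ {a} {b} a∈ b∈ h → let i∈ , j∈ = ∈-cartesianProduct⁻ (res m) (res n) a∈ ; i'∈ , j'∈ = ∈-cartesianProduct⁻ (res m) (res n) b∈ ; p , q = inj i∈ i'∈ j∈ j'∈ h in cong₂ _,_ p q) f per))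
  (∑-cartesianProductWith _,_ (res m) (res n) _)

res-mixed : ∀ m n .{{_ : NonZero m}} .{{_ : NonZero (m N.* n)}} f → Periodic (m N.* n) f →
      ∑ (res (m N.* n)) f ≡ ∑ (res m) (λ i → ∑ (res n) (λ j → f (i + + m * j)))
res-mixed m n = pairs m n (m N.* n) refl (λ i j → i + + m * j) inj where
 inj : ∀ {i i' j j'} → i ∈ res m → i' ∈ res m → j ∈ res n → j' ∈ res n → i + + m * j ≡ i' + + m * j' [ m N.* n ] → i ≡ i' × j ≡ j'
 inj {i} {i'} {j} {j'} i∈ i'∈ j∈ j'∈ h with res-mod-injective i∈ i'∈ (mod-trans (mod-sym (mod-drop i j)) (mod-trans (mod-coarsenˡ n h) (mod-drop i' j')))
 ... | refl = refl , res-mod-injective j∈ j'∈ (mod-unscale m (mod-cancel-+ i h))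

-- The combination n i + m j avoids inverses in the parametrisation. The price is a factor n² modulo
-- m, and m² modulo n, in products of two such residues.
res-crt : ∀ m n .{{_ : NonZero (m N.* n)}} → Coprime m n → ∀ f → Periodic (m N.* n) f →
     ∑ (res (m N.* n)) f ≡ ∑ (res m) (λ i → ∑ (res n) (λ j → f (+ n * i + + m * j)))
res-crt m n cop = pairs m n (m N.* n) refl (λ i j → + n * i + + m * j) inj where
 inj : ∀ {i i' j j'} → i ∈ res m → i' ∈ res m → j ∈ res n → j' ∈ res n → + n * i + + m * j ≡ + n * i' + + m * j' [ m N.* n ] → i ≡ i' × j ≡ j'
 inj {i} {i'} {j} {j'} i∈ i'∈ j∈ j'∈ h =
  res-mod-injective i∈ i'∈ (mod-cancel {c = + n} (Coprimality.sym cop) (mod-trans (mod-sym (mod-drop (+ n * i) j)) (mod-trans (mod-coarsenˡ n h) (mod-drop (+ n * i') j')))) ,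
  res-mod-injective j∈ j'∈ (mod-cancel {c = + m} cop (mod-trans (mod-sym (drop' i j)) (mod-trans (mod-coarsen m h) (drop' i' j')))) where
  drop' : ∀ i j → + n * i + + m * j ≡ + m * j [ n ]
  drop' i j = subst (_≡ + m * j [ n ]) (ZP.+-comm (+ m * j) (+ n * i)) (mod-drop (+ m * j) i)

-- The plane (ℤ/q)² and its convolution operators.

infixl 6 _⊹_
infixl 7 _·_

-- Functions on (ℤ/q)² are functions on integer vectors with `Periodic² q`, so that one function can
-- be read modulo several moduli.
G : Set
G = ℤ × ℤ

_⊹_ : G → G → G
(x , y) ⊹ (x' , y') = x + x' , y + y'

_·_ : ℤ → G → G
c · (x , y) = c * x , c * y

infix 4 _≡²_[_]
record _≡²_[_] (x y : G) (n : ℕ) : Set where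
 constructor mk²
 field
  ≡fst : fst x ≡ fst y [ n ]
  ≡snd : snd x ≡ snd y [ n ]

Periodic² : ℕ → (G → ℤ) → Set
Periodic² n v = ∀ {x y} → x ≡² y [ n ] → v x ≡ v y

mod²-reflexive : ∀ {n x y} → x ≡ y → x ≡² y [ n ]
mod²-reflexive refl = mk² mod-refl mod-refl

mod²-⊹ : ∀ {n x x' y y'} → x ≡² x' [ n ] → y ≡² y' [ n ] → x ⊹ y ≡² x' ⊹ y' [ n ]
mod²-⊹ (mk² a b) (mk² c d) = mk² (mod-+ a c) (mod-+ b d)

mod²-scale : ∀ {n x y} m → x ≡² y [ n ] → + m · x ≡² + m · y [ m N.* n ]
mod²-scale m (mk² a b) = mk² (mod-scale m a) (mod-scale m b)

⊹-comm : ∀ x y → x ⊹ y ≡ y ⊹ x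
⊹-comm (a , b) (c , d) = cong₂ _,_ (ZP.+-comm a c) (ZP.+-comm b d)

⊹-assoc : ∀ x y z → (x ⊹ y) ⊹ z ≡ x ⊹ (y ⊹ z)
⊹-assoc (a , b) (c , d) (e , f) = cong₂ _,_ (ZP.+-assoc a c e) (ZP.+-assoc b d f)

⊹-swap : ∀ x y z → (x ⊹ y) ⊹ z ≡ (x ⊹ z) ⊹ y
⊹-swap x y z = trans (⊹-assoc x y z) (trans (cong (x ⊹_) (⊹-comm y z)) (sym (⊹-assoc x z y)))

box : ℕ → List G
box n = cartesianProduct (res n) (res n)

∑-box : ∀ n (v : G → ℤ) → ∑ (box n) v ≡ ∑ (res n) (λ x → ∑ (res n) (λ y → v (x , y)))
∑-box n v = ∑-cartesianProductWith _,_ (res n) (res n) v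

module _ (n : ℕ) {v : G → ℤ} (per : Periodic² n v) where
 periodicʳ : ∀ x → Periodic n (λ y → v (x , y))
 periodicʳ x h = per (mk² mod-refl h)

 periodic-∑ʳ : ∀ (ys : List ℤ) (g : ℤ → ℤ) → Periodic n (λ x → ∑ ys (λ y → v (x , g y)))
 periodic-∑ʳ ys g h = ∑-cong ys (λ y → per (mk² h mod-refl))

box-shift : ∀ n .{{_ : NonZero n}} (v : G → ℤ) → Periodic² n v → ∀ a → ∑ (box n) (λ x → v (x ⊹ a)) ≡ ∑ (box n) v
box-shift n v per (a , b) = trans (∑-box n (λ x → v (x ⊹ (a , b)))) (trans (∑-cong (res n) (λ x → trans (∑-cong (res n) (λ y → cong (λ z → v (x + a , z)) (ZP.+-comm y b))) (res-shift n (λ y → v (x + a , y)) (periodicʳ n {v} per (x + a)) b)))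
 (trans (∑-cong (res n) (λ x → cong (λ z → ∑ (res n) (λ y → v (z , y))) (ZP.+-comm x a))) (trans (res-shift n (λ x → ∑ (res n) (λ y → v (x , y))) (periodic-∑ʳ n {v} per (res n) (λ y → y)) a) (sym (∑-box n v)))))

-- Lifts a two-parameter description of the residues mod N to dimension two.
box-lift : ∀ {N m n} (φ : ℤ → ℤ → ℤ) → (∀ f → Periodic N f → ∑ (res N) f ≡ ∑ (res m) (λ i → ∑ (res n) (λ j → f (φ i j)))) →
      ∀ v → Periodic² N v → ∑ (box N) v ≡ ∑ (box m) (λ a → ∑ (box n) (λ b → v (φ (fst a) (fst b) , φ (snd a) (snd b))))
box-lift {N} {m} {n} φ split v per = begin
 ∑ (box N) v                                                             ≡⟨ ∑-box N v ⟩
 ∑ (res N) (λ x → ∑ (res N) (λ y → v (x , y)))                           ≡⟨ ∑-cong (res N) (λ x → split (λ y → v (x , y)) (periodicʳ N {v} per x)) ⟩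
 ∑ (res N) (λ x → ∑ (res m) (λ i → ∑ (res n) (λ j → v (x , φ i j))))     ≡⟨ split _ (λ h → ∑-cong (res m) (λ i → ∑-cong (res n) (λ j → per (mk² h mod-refl)))) ⟩
 ∑ (res m) (λ k → ∑ (res n) (λ l → ∑ (res m) (λ i → ∑ (res n) (λ j → v (φ k l , φ i j)))))
  ≡⟨ ∑-cong (res m) (λ k → ∑-swap (res n) (res m) _) ⟩
 ∑ (res m) (λ k → ∑ (res m) (λ i → ∑ (res n) (λ l → ∑ (res n) (λ j → v (φ k l , φ i j)))))
  ≡⟨ ∑-cong (res m) (λ k → ∑-cong (res m) (λ i → sym (∑-box n (λ b → v (φ k (fst b) , φ i (snd b)))))) ⟩
 ∑ (res m) (λ k → ∑ (res m) (λ i → ∑ (box n) (λ b → v (φ k (fst b) , φ i (snd b)))))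
  ≡⟨ sym (∑-box m (λ a → ∑ (box n) (λ b → v (φ (fst a) (fst b) , φ (snd a) (snd b))))) ⟩
 ∑ (box m) (λ a → ∑ (box n) (λ b → v (φ (fst a) (fst b) , φ (snd a) (snd b)))) ∎ where
 open ≡.≡-Reasoning

-- A weighted sum of translates. The operators on the plane are of this form, hence commute by
-- `conv-comm`; this takes the place of their simultaneous diagonalisation by characters.
conv : {A : Set} → List A → (A → ℤ) → (A → G) → (G → ℤ) → G → ℤ
conv xs ω σ v x = ∑ xs (λ a → ω a * v (x ⊹ σ a))

module _ {A : Set} (xs : List A) (ω : A → ℤ) (σ : A → G) where
 conv-periodic : ∀ {q v} → Periodic² q v → Periodic² q (conv xs ω σ v)
 conv-periodic per h = ∑-cong xs (λ a → cong (ω a *_) (per (mod²-⊹ h (mod²-reflexive refl))))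

 conv-linear : ∀ c d v w x → conv xs ω σ (λ y → c * v y + d * w y) x ≡ c * conv xs ω σ v x + d * conv xs ω σ w x
 conv-linear c d v w x = trans (∑-cong xs (λ a → lem c d (ω a) (v _) (w _))) (trans (∑-∙ xs _ _) (cong₂ _+_ (∑-*ˡ c xs _) (∑-*ˡ d xs _))) where
  lem : ∀ c d i v w → i * (c * v + d * w) ≡ c * (i * v) + d * (i * w)
  lem = solve-∀

 conv-zero : ∀ {v} → (∀ x → v x ≡ 0ℤ) → ∀ x → conv xs ω σ v x ≡ 0ℤ
 conv-zero z x = ∑-ε xs (λ a → trans (cong (ω a *_) (z _)) (ZP.*-zeroʳ (ω a)))

conv-conv : {A B : Set} (xs : List A) (ω : A → ℤ) (σ : A → G) (ys : List B) (θ : B → ℤ) (ρ : B → G) (v : G → ℤ) (x : G) →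
      conv xs ω σ (conv ys θ ρ v) x ≡ ∑ xs (λ a → ∑ ys (λ b → ω a * θ b * v (x ⊹ σ a ⊹ ρ b)))
conv-conv xs ω σ ys θ ρ v x = ∑-cong xs (λ a → trans (sym (∑-*ˡ (ω a) ys _)) (∑-cong ys (λ b → sym (ZP.*-assoc (ω a) (θ b) _))))

conv-comm : {A B : Set} (xs : List A) (ω : A → ℤ) (σ : A → G) (ys : List B) (θ : B → ℤ) (ρ : B → G) (v : G → ℤ) (x : G) →
      conv xs ω σ (conv ys θ ρ v) x ≡ conv ys θ ρ (conv xs ω σ v) x
conv-comm xs ω σ ys θ ρ v x = trans (conv-conv xs ω σ ys θ ρ v x) (trans (∑-swap xs ys _) (trans (∑-cong ys (λ b → ∑-cong xs (λ a →
 cong₂ _*_ (ZP.*-comm (ω a) (θ b)) (cong v (⊹-swap x (σ a) (ρ b)))))) (sym (conv-conv ys θ ρ xs ω σ v x))))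

neg : G → G
neg (x , y) = - x , - y

⊹-neg : ∀ x s → (x ⊹ s) ⊹ neg s ≡ x
⊹-neg (a , b) (c , d) = cong₂ _,_ (lem a c) (lem b d) where
 lem : ∀ a c → a + c + - c ≡ a
 lem = solve-∀

module Inner (q : ℕ) = InnerProduct (box q)

inner-shift : ∀ q .{{_ : NonZero q}} {v w} → Periodic² q v → Periodic² q w → ∀ s → Inner.⟨_,_⟩ q (λ x → v (x ⊹ s)) w ≡ Inner.⟨_,_⟩ q v (λ x → w (x ⊹ neg s))
inner-shift q {v} {w} pv pw s = trans (∑-cong (box q) (λ x → cong (λ y → v (x ⊹ s) * w y) (sym (⊹-neg x s))))
 (box-shift q (λ x → v x * w (x ⊹ neg s)) (λ h → cong₂ _*_ (pv h) (pw (mod²-⊹ h (mod²-reflexive refl)))) s)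

conv-adjoint : {A : Set} (xs : List A) (ω : A → ℤ) (σ : A → G) → ∀ q .{{_ : NonZero q}} {v w} → Periodic² q v → Periodic² q w →
        Inner.⟨_,_⟩ q (conv xs ω σ v) w ≡ Inner.⟨_,_⟩ q v (conv xs ω (λ a → neg (σ a)) w)
conv-adjoint xs ω σ q {v} {w} pv pw = begin
 ∑ (box q) (λ x → conv xs ω σ v x * w x)                            ≡⟨ ∑-cong (box q) (λ x → sym (∑-*ʳ (w x) xs _)) ⟩
 ∑ (box q) (λ x → ∑ xs (λ a → ω a * v (x ⊹ σ a) * w x))             ≡⟨ ∑-swap (box q) xs _ ⟩
 ∑ xs (λ a → ∑ (box q) (λ x → ω a * v (x ⊹ σ a) * w x))             ≡⟨ ∑-cong xs (λ a → trans (∑-cong (box q) (λ x → ZP.*-assoc (ω a) _ (w x))) (∑-*ˡ (ω a) (box q) _)) ⟩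
 ∑ xs (λ a → ω a * ∑ (box q) (λ x → v (x ⊹ σ a) * w x))             ≡⟨ ∑-cong xs (λ a → cong (ω a *_) (inner-shift q {v} {w} pv pw (σ a))) ⟩
 ∑ xs (λ a → ω a * ∑ (box q) (λ x → v x * w (x ⊹ neg (σ a))))       ≡⟨ ∑-cong xs (λ a → trans (sym (∑-*ˡ (ω a) (box q) _)) (∑-cong (box q) (λ x → lem (ω a) (v x) _))) ⟩
 ∑ xs (λ a → ∑ (box q) (λ x → v x * (ω a * w (x ⊹ neg (σ a)))))     ≡⟨ ∑-swap xs (box q) _ ⟩
 ∑ (box q) (λ x → ∑ xs (λ a → v x * (ω a * w (x ⊹ neg (σ a)))))     ≡⟨ ∑-cong (box q) (λ x → ∑-*ˡ (v x) xs _) ⟩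
 ∑ (box q) (λ x → v x * conv xs ω (λ a → neg (σ a)) w x)            ∎ where
 open ≡.≡-Reasoning
 lem : ∀ i v w → i * (v * w) ≡ v * (i * w)
 lem = solve-∀

-- Summation over the subgroup of (ℤ/gs)² generated by s.
Pr : ℕ → ℕ → (G → ℤ) → G → ℤ
Pr g s = conv (box g) (λ _ → 1ℤ) (+ s ·_)

·-⊹ : ∀ c x y → c · (x ⊹ y) ≡ c · x ⊹ c · y
·-⊹ c (a , b) (d , e) = cong₂ _,_ (ZP.*-distribˡ-+ c a d) (ZP.*-distribˡ-+ c b e)

·-· : ∀ c d x → c · (d · x) ≡ (c * d) · x
·-· c d (a , b) = cong₂ _,_ (sym (ZP.*-assoc c d a)) (sym (ZP.*-assoc c d b))

module _ {q : ℕ} {v : G → ℤ} (per : Periodic² q v) where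
 dilate-periodic : ∀ s r → s N.* r ≡ q → ∀ x → Periodic² r (λ a → v (x ⊹ + s · a))
 dilate-periodic s r refl x {a} {b} h = per (mod²-⊹ {x = x} {x} (mod²-reflexive refl) (mod²-scale {x = a} {b} s h))

module _ {q : ℕ} .{{_ : NonZero q}} (g s : ℕ) (gs : g N.* s ≡ q) {v : G → ℤ} (per : Periodic² q v) where
 private
  instance
   g≢0 : NonZero g
   g≢0 = N.≢-nonZero λ { refl → N.≢-nonZero⁻¹ q (sym gs) }

  dil : ∀ x → Periodic² g (λ a → v (x ⊹ + s · a))
  dil = dilate-periodic {v = v} per s g (trans (NP.*-comm s g) gs)

 Pr-neg : ∀ x → conv (box g) (λ _ → 1ℤ) (λ a → neg (+ s · a)) v x ≡ Pr g s v x
 Pr-neg x = trans (∑-cong (box g) (λ a → cong (λ z → 1ℤ * v (x ⊹ z)) (neg-· (+ s) a))) (flip (λ a → 1ℤ * v (x ⊹ + s · a)) (λ h → cong (1ℤ *_) (dil x h))) where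
  neg-· : ∀ c x → neg (c · x) ≡ c · (- 1ℤ * fst x , - 1ℤ * snd x)
  neg-· c (a , b) = cong₂ _,_ (lem c a) (lem c b) where
   lem : ∀ c a → - (c * a) ≡ c * (- 1ℤ * a)
   lem = solve-∀
  flip : ∀ f → Periodic² g f → ∑ (box g) (λ a → f (- 1ℤ * fst a , - 1ℤ * snd a)) ≡ ∑ (box g) f
  flip f pf = trans (∑-box g _) (trans (∑-cong (res g) (λ x → res-unit g (λ y → f (- 1ℤ * x , y)) (periodicʳ g {f} pf (- 1ℤ * x)) (- 1ℤ) (Coprimality.1-coprimeTo g)))
   (trans (res-unit g (λ x → ∑ (res g) (λ y → f (x , y))) (periodic-∑ʳ g {f} pf (res g) (λ y → y)) (- 1ℤ) (Coprimality.1-coprimeTo g)) (sym (∑-box g f))))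

 -- The subgroup has g² elements, and `Pr g s` is g² times the orthogonal projection to the
 -- functions invariant under it.
 Pr-Pr : ∀ x → Pr g s (Pr g s v) x ≡ + (g N.* g) * Pr g s v x
 Pr-Pr x = trans (∑-cong (box g) (λ a → trans (ZP.*-identityˡ _) (trans (∑-cong (box g) (λ b → cong (λ z → 1ℤ * v z) (trans (⊹-assoc x (+ s · a) (+ s · b)) (cong (x ⊹_) (trans (sym (·-⊹ (+ s) a b)) (cong (+ s ·_) (⊹-comm a b)))))))
   (box-shift g (λ b → 1ℤ * v (x ⊹ + s · b)) (λ h → cong (1ℤ *_) (dil x h)) a))))
  (trans (∑-const (box g) _) (cong (λ m → + m * Pr g s v x) (length-box g))) where
  length-box : ∀ g → length (box g) ≡ g N.* g
  length-box g = trans (length-cartesian _,_ (res g) (res g)) (cong₂ N._*_ (res-length g) (res-length g))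

Pr-periodic : ∀ {q v} g s → Periodic² q v → Periodic² q (Pr g s v)
Pr-periodic g s = conv-periodic (box g) (λ _ → 1ℤ) (+ s ·_)

-- Kloosterman operators and the operator form of Weil's bound.

mod-resp : ∀ {x y x' y' M} → x ≡ x' → y ≡ y' → x ≡ y [ M ] → x' ≡ y' [ M ]
mod-resp refl refl h = h

solution? : ∀ q c (a : G) → Dec (+ q ZD.∣ fst a * snd a - c)
solution? q c a = + q ∣? (fst a * snd a - c)

-- The Kloosterman operator mod r dilated by s: the shifts are s (u , w) with u w ≡ c mod r.
κᵈ : ℕ → ℕ → ℤ → (G → ℤ) → G → ℤ
κᵈ s r c = conv (box r) (λ a → indicator (solution? r c a)) (+ s ·_)

κ : ℕ → ℤ → (G → ℤ) → G → ℤ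
κ = κᵈ 1

-- A character of frequency x is an eigenvector of `κ q c` with a Kloosterman sum K(x) as
-- eigenvalue, and of `Pr g s` with eigenvalue g² or 0 as g divides x or not. As s g² = q g, the
-- bound says that |K(x)|² is at most A q times the sum of the listed g that divide x.
record Bound (q A : ℕ) (L : List (ℕ × ℕ)) : Set where
 field
  factors : All (λ gs → fst gs N.* snd gs ≡ q) L
  bound   : ∀ c → Coprime ∣ c ∣ q → ∀ v → Periodic² q v →
       Inner.normSq q (κ q c v) ≤ + A * ∑ L (λ gs → + snd gs * Inner.⟨_,_⟩ q (Pr (fst gs) (snd gs) v) v)

box-average : ∀ q r s .{{_ : NonZero q}} (f : G → ℤ) → Periodic² q f → ∑ (box q) (λ x → ∑ (box r) (λ a → f (x ⊹ + s · a))) ≡ + length (box r) * ∑ (box q) f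
box-average q r s f per = trans (∑-swap (box q) (box r) _) (trans (∑-cong (box r) (λ a → box-shift q f per (+ s · a))) (∑-const (box r) _))

length-box-pos : ∀ r .{{_ : NonZero r}} → 0ℤ < + length (box r)
length-box-pos (suc r) = ℤ.+<+ (N.s≤s N.z≤n)

1· : ∀ x → + 1 · x ≡ x
1· (a , b) = cong₂ _,_ (ZP.*-identityˡ a) (ZP.*-identityˡ b)

-- On the coset of x under multiples of s the dilated operator is the operator mod r acting on a ↦ v
-- (x + s a). The bound mod r is applied to each of these functions and summed over x, which counts
-- every point once for each element of the box mod r.
dilated-bound : ∀ {r A L} → Bound r A L → ∀ s q .{{_ : NonZero q}} .{{_ : NonZero r}} → s N.* r ≡ q → ∀ c → Coprime ∣ c ∣ r → ∀ v → Periodic² q v →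
        Inner.normSq q (κᵈ s r c v) ≤ + A * ∑ L (λ gs → + snd gs * Inner.⟨_,_⟩ q (Pr (fst gs) (s N.* snd gs) v) v)
dilated-bound {r} {A} {L} B s q sr c cop v per = *-cancelˡ-pos (length-box-pos r) (begin
 n * Inner.normSq q (κᵈ s r c v)
  ≡⟨ sym (box-average q r s (λ x → κᵈ s r c v x * κᵈ s r c v x) (λ h → cong₂ _*_ (κper h) (κper h))) ⟩
 ∑ (box q) (λ x → ∑ (box r) (λ a → κᵈ s r c v (x ⊹ + s · a) * κᵈ s r c v (x ⊹ + s · a)))
  ≡⟨ ∑-cong (box q) (λ x → ∑-cong (box r) (λ a → cong₂ _*_ (sym (κ-dil x a)) (sym (κ-dil x a)))) ⟩
 ∑ (box q) (λ x → Inner.normSq r (κ r c (z x)))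
  ≤⟨ ∑-mono (box q) (λ {x} _ → Bound.bound B c cop (z x) (dilate-periodic {v = v} per s r sr x)) ⟩
 ∑ (box q) (λ x → + A * ∑ L (λ gs → + snd gs * Inner.⟨_,_⟩ r (Pr (fst gs) (snd gs) (z x)) (z x)))
  ≡⟨ ∑-*ˡ (+ A) (box q) _ ⟩
 + A * ∑ (box q) (λ x → ∑ L (λ gs → + snd gs * Inner.⟨_,_⟩ r (Pr (fst gs) (snd gs) (z x)) (z x)))
  ≡⟨ cong (+ A *_) (trans (∑-swap (box q) L _) (∑-cong L (λ gs → trans (∑-*ˡ (+ snd gs) (box q) _) (trans (cong (+ snd gs *_) (avg gs)) (lem (+ snd gs) n _))))) ⟩
 + A * ∑ L (λ gs → n * (+ snd gs * Inner.⟨_,_⟩ q (Pr (fst gs) (s N.* snd gs) v) v))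
  ≡⟨ trans (cong (+ A *_) (∑-*ˡ n L _)) (lem (+ A) n _) ⟩
 n * (+ A * ∑ L (λ gs → + snd gs * Inner.⟨_,_⟩ q (Pr (fst gs) (s N.* snd gs) v) v)) ∎) where
 open ZP.≤-Reasoning
 n = + length (box r)
 z : G → G → ℤ
 z x a = v (x ⊹ + s · a)
 κper : Periodic² q (κᵈ s r c v)
 κper = conv-periodic (box r) (λ a → indicator (solution? r c a)) (+ s ·_) {v = v} per
 lem : ∀ a b c → a * (b * c) ≡ b * (a * c)
 lem = solve-∀
 κ-dil : ∀ x a → κ r c (z x) a ≡ κᵈ s r c v (x ⊹ + s · a)
 κ-dil x a = ∑-cong (box r) (λ b → cong (λ y → indicator (solution? r c b) * v y) (trans (cong (λ y → x ⊹ + s · (a ⊹ y)) (1· b)) (trans (cong (x ⊹_) (·-⊹ (+ s) a b)) (sym (⊹-assoc x (+ s · a) (+ s · b))))))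
 Pr-dil : ∀ g t x a → Pr g t (z x) a ≡ Pr g (s N.* t) v (x ⊹ + s · a)
 Pr-dil g t x a = ∑-cong (box g) (λ b → cong (λ y → 1ℤ * v y) (trans (cong (x ⊹_) (trans (·-⊹ (+ s) a (+ t · b)) (cong (+ s · a ⊹_) (trans (·-· (+ s) (+ t) b) (cong (_· b) (sym (ZP.pos-* s t))))))) (sym (⊹-assoc x (+ s · a) (+ (s N.* t) · b)))))
 avg : ∀ gs → ∑ (box q) (λ x → Inner.⟨_,_⟩ r (Pr (fst gs) (snd gs) (z x)) (z x)) ≡ n * Inner.⟨_,_⟩ q (Pr (fst gs) (s N.* snd gs) v) v
 avg (g , t) = trans (∑-cong (box q) (λ x → ∑-cong (box r) (λ a → cong (_* z x a) (Pr-dil g t x a))))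
  (box-average q r s (λ x → Pr g (s N.* t) v x * v x) (λ h → cong₂ _*_ (Pr-periodic {v = v} g (s N.* t) per h) (per h)))

coprime-square : ∀ {a b} → Coprime a b → Coprime (a N.* a) b
coprime-square {a} {b} c {d} (d∣aa , d∣b) = c (Coprimality.coprime-divisor {d} {a} {a} (λ { (e∣d , e∣a) → c (e∣a , ND.∣-trans e∣d d∣b) }) d∣aa , d∣b)

-- Coprime moduli.

module CRT (m n : ℕ) .{{_ : NonZero m}} .{{_ : NonZero n}} .{{mn≢0 : NonZero (m N.* n)}} (cop : Coprime m n) where
 private q = m N.* n

 box-crt : ∀ v → Periodic² q v → ∑ (box q) v ≡ ∑ (box m) (λ a → ∑ (box n) (λ b → v (+ n · a ⊹ + m · b)))
 box-crt = box-lift {q} {m} {n} (λ i j → + n * i + + m * j) (res-crt m n cop)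

 Coprime-* : ∀ {k} → Coprime k q → Coprime k m × Coprime k n
 Coprime-* c = (λ { (d , e) → c (d , ND.∣m⇒∣m*n n e) }) , (λ { (d , e) → c (d , ND.∣n⇒∣m*n m e) }) where
  import Data.Nat.Divisibility as ND

 -- Modulo M the product of two residues of the form N i + M j is N² times the product of the i, so
 -- the constant c has to be divided by N².
 reduced : ∀ c {M N} → Coprime ∣ c ∣ M → Coprime M N → ∃ λ c' → + N * + N * c' ≡ c [ M ] × Coprime ∣ c' ∣ M
 reduced c {M} {N} cM MN = let e , h = unit-mod {M} {c = + N} (Coprimality.sym MN) in e * e * c , rel e h , cop' e h where
  rel : ∀ e → + N * e ≡ + 1 [ M ] → + N * + N * (e * e * c) ≡ c [ M ]
  rel e h = mod-resp (lem (+ N) e c) (lem' c) (mod-* (mod-* h h) (mod-refl {i = c})) where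
   lem : ∀ n e c → n * e * (n * e) * c ≡ n * n * (e * e * c)
   lem = solve-∀
   lem' : ∀ c → + 1 * + 1 * c ≡ c
   lem' = solve-∀
  cop' : ∀ e → + N * e ≡ + 1 [ M ] → Coprime ∣ e * e * c ∣ M
  cop' e h {d} (d∣ , d∣M) = cM (ZD.∣⇒∣ᵤ d∣c , d∣M) where
   import Data.Nat.Divisibility as ND
   d∣ecc : + d ZD.∣ e * e * c
   d∣ecc = ZD.∣ᵤ⇒∣ d∣
   d∣M' : + d ZD.∣ + M
   d∣M' = ZD.∣ᵤ⇒∣ d∣M
   d∣c : + d ZD.∣ c
   d∣c = subst (+ d ZD.∣_) (lem (+ N * + N * (e * e * c)) c) (ZD.∣m∣n⇒∣m-n (ZD.∣n⇒∣m*n (+ N * + N) d∣ecc) (ZD.∣-trans d∣M' (divs (rel e h)))) where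
    lem : ∀ u c → u - (u - c) ≡ c
    lem = solve-∀

 ∣-coprime-join : ∀ {i} → i ≡ + 0 [ m ] → i ≡ + 0 [ n ] → i ≡ + 0 [ q ]
 ∣-coprime-join {i} a (mk (divides k e)) = subst (_≡ + 0 [ q ]) (sym i≡) (subst (λ z → k * + n ≡ + 0 [ z ]) (NP.*-comm n m)
   (mod-resp (ZP.*-comm (+ n) k) (ZP.*-zeroʳ (+ n)) (mod-scale n k≡0))) where
  i≡ : i ≡ k * + n
  i≡ = trans (sym (ZP.+-identityʳ i)) e
  k≡0 : k ≡ + 0 [ m ]
  k≡0 = mod-cancel {c = + n} (Coprimality.sym cop) (mod-resp (trans i≡ (ZP.*-comm k (+ n))) (sym (ZP.*-zeroʳ (+ n))) a)

 κ-crt : ∀ c c₁ c₂ → + n * + n * c₁ ≡ c [ m ] → + m * + m * c₂ ≡ c [ n ] → ∀ v → Periodic² q v → ∀ x → κ q c v x ≡ κᵈ n m c₁ (κᵈ m n c₂ v) x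
 κ-crt c c₁ c₂ h₁ h₂ v per x = trans (trans (∑-cong (box q) (λ a → cong (λ y → indicator (solution? q c a) * v (x ⊹ y)) (1· a))) (box-crt _ periodic))
   (trans (∑-cong (box m) (λ a → ∑-cong (box n) (λ b → cong₂ _*_ (split a b) (cong v (sym (⊹-assoc x (+ n · a) (+ m · b)))))))
    (sym (conv-conv (box m) (λ a → indicator (solution? m c₁ a)) (+ n ·_) (box n) (λ b → indicator (solution? n c₂ b)) (+ m ·_) v x))) where
  periodic : Periodic² q (λ a → indicator (solution? q c a) * v (x ⊹ a))
  periodic {a} {b} h@(mk² h₁ h₂) = cong₂ _*_ (indicator-⇔ (solution? q c a) (solution? q c b)
    (λ s → divs (mod-trans (mod-sym (mod-* h₁ h₂)) (mk s))) (λ s → divs (mod-trans (mod-* h₁ h₂) (mk s))))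
   (per (mod²-⊹ {x = x} {x} (mod²-reflexive refl) h))
  module _ (a b : G) where
   u₁ = fst a
   w₁ = snd a
   u₂ = fst b
   w₂ = snd b
   U = + n * u₁ + + m * u₂
   W = + n * w₁ + + m * w₂
   mod-m : U * W ≡ + n * + n * (u₁ * w₁) [ m ]
   mod-m = mod-by (+ n * u₁ * w₂ + u₂ * (+ n * w₁) + + m * (u₂ * w₂)) (lem (+ n) (+ m) u₁ u₂ w₁ w₂) where
    lem : ∀ n m u₁ u₂ w₁ w₂ → (n * u₁ + m * u₂) * (n * w₁ + m * w₂) - n * n * (u₁ * w₁) ≡ (n * u₁ * w₂ + u₂ * (n * w₁) + m * (u₂ * w₂)) * m
    lem = solve-∀
   mod-n : U * W ≡ + m * + m * (u₂ * w₂) [ n ]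
   mod-n = mod-by (u₁ * (+ m * w₂) + + m * u₂ * w₁ + + n * (u₁ * w₁)) (lem (+ n) (+ m) u₁ u₂ w₁ w₂) where
    lem : ∀ n m u₁ u₂ w₁ w₂ → (n * u₁ + m * u₂) * (n * w₁ + m * w₂) - m * m * (u₂ * w₂) ≡ (u₁ * (m * w₂) + m * u₂ * w₁ + n * (u₁ * w₁)) * n
    lem = solve-∀
   n²cop : Coprime ∣ + n * + n ∣ m
   n²cop = subst (λ k → Coprime k m) (sym (ZP.abs-* (+ n) (+ n))) (coprime-square (Coprimality.sym cop))
   m²cop : Coprime ∣ + m * + m ∣ n
   m²cop = subst (λ k → Coprime k n) (sym (ZP.abs-* (+ m) (+ m))) (coprime-square cop)
   split : indicator (solution? q c (+ n · a ⊹ + m · b)) ≡ indicator (solution? m c₁ a) * indicator (solution? n c₂ b)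
   split = go (solution? m c₁ a) (solution? n c₂ b) where
    toM : + q ZD.∣ U * W - c → + m ZD.∣ u₁ * w₁ - c₁
    toM s = divs (mod-cancel {c = + n * + n} n²cop (mod-trans (mod-sym mod-m) (mod-trans (mod-coarsenˡ n (mk s)) (mod-sym h₁))))
    toN : + q ZD.∣ U * W - c → + n ZD.∣ u₂ * w₂ - c₂
    toN s = divs (mod-cancel {c = + m * + m} m²cop (mod-trans (mod-sym mod-n) (mod-trans (mod-coarsen m (mk s)) (mod-sym h₂))))
    join : + m ZD.∣ u₁ * w₁ - c₁ → + n ZD.∣ u₂ * w₂ - c₂ → + q ZD.∣ U * W - c
    join s t = mod-0⇒∣ (∣-coprime-join (∣⇒mod-0 (divs (mod-trans mod-m (mod-trans (mod-*ˡ (+ n * + n) (mk s)) h₁)))) (∣⇒mod-0 (divs (mod-trans mod-n (mod-trans (mod-*ˡ (+ m * + m) (mk t)) h₂)))))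
    go : (d : Dec (+ m ZD.∣ u₁ * w₁ - c₁)) (e : Dec (+ n ZD.∣ u₂ * w₂ - c₂)) → indicator (solution? q c (+ n · a ⊹ + m · b)) ≡ indicator d * indicator e
    go (yes s) (yes t) = indicator-yes (solution? q c (+ n · a ⊹ + m · b)) (join s t)
    go (yes _) (no ¬t) = indicator-no (solution? q c (+ n · a ⊹ + m · b)) (λ s → ¬t (toN s))
    go (no ¬s) _ = indicator-no (solution? q c (+ n · a ⊹ + m · b)) (λ s → ¬s (toM s))

Pr-self : ∀ q .{{_ : NonZero q}} g s → g N.* s ≡ q → ∀ {v w} → Periodic² q v → Periodic² q w → Inner.⟨_,_⟩ q (Pr g s v) w ≡ Inner.⟨_,_⟩ q v (Pr g s w)
Pr-self q g s gs {v} {w} pv pw = trans (conv-adjoint (box g) (λ _ → 1ℤ) (+ s ·_) q {v} {w} pv pw)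
 (Inner.inner-cong q {v} (λ _ → refl) (λ x → Pr-neg g s gs {w} pw x))

-- `Pr` is self-adjoint and its square is g² times itself. This passes between the form in which a
-- `Bound` is stated and the norms to which it applies.
Pr-inner : ∀ q .{{_ : NonZero q}} g s → g N.* s ≡ q → ∀ {v w} → Periodic² q v → Periodic² q w →
      Inner.⟨_,_⟩ q (Pr g s w) (Pr g s v) ≡ + (g N.* g) * Inner.⟨_,_⟩ q (Pr g s w) v
Pr-inner q g s gs {v} {w} pv pw = trans (Inner.inner-comm q (Pr g s w) (Pr g s v)) (trans (Pr-self q g s gs {v} {Pr g s w} pv (Pr-periodic {v = w} g s pw))
 (trans (Inner.inner-cong q {v} (λ _ → refl) (λ x → Pr-Pr g s gs {w} pw x))
  (trans (∑-cong (box q) (λ x → lem (v x) (+ (g N.* g)) (Pr g s w x))) (∑-*ˡ (+ (g N.* g)) (box q) _)))) where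
 lem : ∀ v c p → v * (c * p) ≡ c * (p * v)
 lem = solve-∀

module Compose (m n : ℕ) .{{_ : NonZero m}} .{{_ : NonZero n}} .{{mn≢0 : NonZero (m N.* n)}} (cop : Coprime m n) where
 open CRT m n cop
 import Data.Nat.Divisibility as ND
 private
  q = m N.* n
  open Inner q

 Pr-crt : ∀ {g₁ s₁ g₂ s₂} → g₁ N.* s₁ ≡ m → g₂ N.* s₂ ≡ n → ∀ {v} → Periodic² q v → ∀ x →
      Pr g₁ (n N.* s₁) (Pr g₂ (m N.* s₂) v) x ≡ Pr (g₁ N.* g₂) (s₁ N.* s₂) v x
 Pr-crt {g₁} {s₁} {g₂} {s₂} refl refl {v} per x = trans (conv-conv (box g₁) (λ _ → 1ℤ) (+ (n N.* s₁) ·_) (box g₂) (λ _ → 1ℤ) (+ (m N.* s₂) ·_) v x)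
   (sym (trans (C.box-crt (λ a → 1ℤ * v (x ⊹ + s · a)) (λ h → cong (1ℤ *_) (dilate-periodic {v = v} per s g (lem0 s₁ s₂ g₁ g₂) x h)))
    (∑-cong (box g₁) (λ a → ∑-cong (box g₂) (λ b → cong (λ y → 1ℤ * v y) (place a b)))))) where
  g = g₁ N.* g₂
  s = s₁ N.* s₂
  cop' : Coprime g₁ g₂
  cop' (d , e) = cop (ND.∣m⇒∣m*n s₁ d , ND.∣m⇒∣m*n s₂ e)
  g₁≢0 : NonZero g₁
  g₁≢0 = N.≢-nonZero λ { refl → N.≢-nonZero⁻¹ (g₁ N.* s₁) refl }
  g₂≢0 : NonZero g₂
  g₂≢0 = N.≢-nonZero λ { refl → N.≢-nonZero⁻¹ (g₂ N.* s₂) refl }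
  module C = CRT g₁ g₂ {{g₁≢0}} {{g₂≢0}} {{NP.m*n≢0 g₁ g₂ {{g₁≢0}} {{g₂≢0}}}} cop'
  open import Data.Nat.Tactic.RingSolver using () renaming (solve-∀ to solveℕ)
  lem0 : ∀ s₁ s₂ g₁ g₂ → s₁ N.* s₂ N.* (g₁ N.* g₂) ≡ g₁ N.* s₁ N.* (g₂ N.* s₂)
  lem0 = solveℕ
  lem1 : ∀ s₁ s₂ g₂ → s₁ N.* s₂ N.* g₂ ≡ g₂ N.* s₂ N.* s₁
  lem1 = solveℕ
  lem2 : ∀ s₁ s₂ g₁ → s₁ N.* s₂ N.* g₁ ≡ g₁ N.* s₁ N.* s₂
  lem2 = solveℕ
  scale : ∀ i j (a : G) k → i N.* j ≡ k → + i · (+ j · a) ≡ + k · a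
  scale i j a k e = trans (·-· (+ i) (+ j) a) (cong (_· a) (trans (sym (ZP.pos-* i j)) (cong +_ e)))
  place : ∀ a b → x ⊹ + s · (+ g₂ · a ⊹ + g₁ · b) ≡ x ⊹ + (n N.* s₁) · a ⊹ + (m N.* s₂) · b
  place a b = trans (cong (x ⊹_) (trans (·-⊹ (+ s) (+ g₂ · a) (+ g₁ · b)) (cong₂ _⊹_ (scale s g₂ a (n N.* s₁) (lem1 s₁ s₂ g₂)) (scale s g₁ b (m N.* s₂) (lem2 s₁ s₂ g₁))))) (sym (⊹-assoc x _ _))

 multiply : ℕ × ℕ → ℕ × ℕ → ℕ × ℕ
 multiply (g₁ , s₁) (g₂ , s₂) = g₁ N.* g₂ , s₁ N.* s₂

 -- The bound for m is applied with the operator mod n already inside, as z. Each resulting form in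
 -- z is, up to g², the squared norm of `Pr` of z; `Pr` commutes past the operator mod n, whose own
 -- bound then applies to `Pr` of v. The factors g² cancel at the end.
 compose : ∀ {A₁ A₂ L₁ L₂} → Bound m A₁ L₁ → Bound n A₂ L₂ → Bound q (A₁ N.* A₂) (cartesianProductWith multiply L₁ L₂)
 compose {A₁} {A₂} {L₁} {L₂} B₁ B₂ = record
  { factors = All.tabulate (λ h → let a , b , a∈ , b∈ , e = ∈-cartesianProductWith⁻ multiply L₁ L₂ h in
    trans (cong (λ gs → fst gs N.* snd gs) e) (trans (lem (fst a) (snd a) (fst b) (snd b)) (cong₂ N._*_ (All.lookup (Bound.factors B₁) a∈) (All.lookup (Bound.factors B₂) b∈))))
  ; bound = main } where
  open import Data.List.Membership.Propositional.Properties using (∈-cartesianProductWith⁻)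
  open import Data.Nat.Tactic.RingSolver using () renaming (solve-∀ to solveℕ)
  lem : ∀ g₁ s₁ g₂ s₂ → g₁ N.* g₂ N.* (s₁ N.* s₂) ≡ g₁ N.* s₁ N.* (g₂ N.* s₂)
  lem = solveℕ
  main : ∀ c → Coprime ∣ c ∣ q → ∀ v → Periodic² q v →
      normSq (κ q c v) ≤ + (A₁ N.* A₂) * ∑ (cartesianProductWith multiply L₁ L₂) (λ gs → + snd gs * ⟨ Pr (fst gs) (snd gs) v , v ⟩)
  main c cq v per = begin
   normSq (κ q c v)
    ≡⟨ inner-cong (κ-crt c c₁ c₂ h₁ h₂ v per) (κ-crt c c₁ c₂ h₁ h₂ v per) ⟩
   normSq (κᵈ n m c₁ z)
    ≤⟨ dilated-bound B₁ n q (NP.*-comm n m) c₁ cop₁ z zper ⟩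
   + A₁ * ∑ L₁ (λ gs → + snd gs * ⟨ Pr (fst gs) (n N.* snd gs) z , z ⟩)
    ≤⟨ *-monoˡ-nonneg {+ A₁} (ℤ.+≤+ N.z≤n) (∑-mono L₁ (λ {gs} gs∈ → *-monoˡ-nonneg {+ snd gs} (ℤ.+≤+ N.z≤n) (inner (fst gs) (snd gs) (All.lookup (Bound.factors B₁) gs∈)))) ⟩
   + A₁ * ∑ L₁ (λ gs → + snd gs * (+ A₂ * ∑ L₂ (λ hs → + snd hs * ⟨ Pr (fst gs N.* fst hs) (snd gs N.* snd hs) v , v ⟩)))
    ≡⟨ cong (+ A₁ *_) (trans (∑-cong L₁ (λ gs → collect gs)) (∑-*ˡ (+ A₂) L₁ _)) ⟩
   + A₁ * (+ A₂ * ∑ L₁ (λ gs → ∑ L₂ (λ hs → + (snd gs N.* snd hs) * ⟨ Pr (fst gs N.* fst hs) (snd gs N.* snd hs) v , v ⟩)))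
    ≡⟨ trans (sym (ZP.*-assoc (+ A₁) (+ A₂) _)) (cong₂ _*_ (sym (ZP.pos-* A₁ A₂)) (sym (∑-cartesianProductWith multiply L₁ L₂ _))) ⟩
   + (A₁ N.* A₂) * ∑ (cartesianProductWith multiply L₁ L₂) (λ gs → + snd gs * ⟨ Pr (fst gs) (snd gs) v , v ⟩) ∎ where
   open ZP.≤-Reasoning
   r₁ = reduced c (fst (Coprime-* cq)) cop
   r₂ = reduced c (snd (Coprime-* cq)) (Coprimality.sym cop)
   c₁ = fst r₁
   c₂ = fst r₂
   h₁ = fst (snd r₁)
   h₂ = fst (snd r₂)
   cop₁ = snd (snd r₁)
   cop₂ = snd (snd r₂)
   z = κᵈ m n c₂ v
   zper : Periodic² q z
   zper = conv-periodic (box n) (λ a → indicator (solution? n c₂ a)) (+ m ·_) {v = v} per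
   collect : ∀ gs → + snd gs * (+ A₂ * ∑ L₂ (λ hs → + snd hs * ⟨ Pr (fst gs N.* fst hs) (snd gs N.* snd hs) v , v ⟩)) ≡
        + A₂ * ∑ L₂ (λ hs → + (snd gs N.* snd hs) * ⟨ Pr (fst gs N.* fst hs) (snd gs N.* snd hs) v , v ⟩)
   collect gs = trans (swap (+ snd gs) (+ A₂) _) (cong (+ A₂ *_) (trans (sym (∑-*ˡ (+ snd gs) L₂ _)) (∑-cong L₂ (λ hs → trans (sym (ZP.*-assoc (+ snd gs) (+ snd hs) _)) (cong (_* ⟨ Pr (fst gs N.* fst hs) (snd gs N.* snd hs) v , v ⟩) (sym (ZP.pos-* (snd gs) (snd hs)))))))) where
    swap : ∀ a b c → a * (b * c) ≡ b * (a * c)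
    swap = solve-∀
   inner : ∀ g s → g N.* s ≡ m → ⟨ Pr g (n N.* s) z , z ⟩ ≤ + A₂ * ∑ L₂ (λ hs → + snd hs * ⟨ Pr (g N.* fst hs) (s N.* snd hs) v , v ⟩)
   inner g s gs = *-cancelˡ-pos {+ (g N.* g)} g²-pos (begin
    + (g N.* g) * ⟨ Pr g (n N.* s) z , z ⟩
     ≡⟨ sym (Pr-inner q g (n N.* s) gns {z} {z} zper zper) ⟩
    normSq (Pr g (n N.* s) z)
     ≡⟨ inner-cong comm comm ⟩
    normSq (κᵈ m n c₂ w)
     ≤⟨ dilated-bound B₂ m q refl c₂ cop₂ w wper ⟩
    + A₂ * ∑ L₂ (λ hs → + snd hs * ⟨ Pr (fst hs) (m N.* snd hs) w , w ⟩)
     ≡⟨ cong (+ A₂ *_) (trans (cong-L₂ (λ hs hs∈ → trans (cong (+ snd hs *_) (double hs (All.lookup (Bound.factors B₂) hs∈))) (swap (+ snd hs) (+ (g N.* g)) _))) (∑-*ˡ (+ (g N.* g)) L₂ _)) ⟩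
    + A₂ * (+ (g N.* g) * ∑ L₂ (λ hs → + snd hs * ⟨ Pr (g N.* fst hs) (s N.* snd hs) v , v ⟩))
     ≡⟨ swap (+ A₂) (+ (g N.* g)) _ ⟩
    + (g N.* g) * (+ A₂ * ∑ L₂ (λ hs → + snd hs * ⟨ Pr (g N.* fst hs) (s N.* snd hs) v , v ⟩)) ∎) where
    swap : ∀ a b c → a * (b * c) ≡ b * (a * c)
    swap = solve-∀
    w = Pr g (n N.* s) v
    wper : Periodic² q w
    wper = Pr-periodic {v = v} g (n N.* s) per
    gns : g N.* (n N.* s) ≡ q
    gns = trans (lem' g n s) (cong (N._* n) gs) where
     lem' : ∀ g n s → g N.* (n N.* s) ≡ g N.* s N.* n
     lem' = solveℕ
    g²-pos : 0ℤ < + (g N.* g)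
    g²-pos = ℤ.+<+ (NP.*-mono-< {0} {g} {0} {g} g>0 g>0) where
     g>0 : 0 N.< g
     g>0 = NP.n≢0⇒n>0 λ { refl → N.≢-nonZero⁻¹ m (sym gs) }
    comm : ∀ x → Pr g (n N.* s) z x ≡ κᵈ m n c₂ w x
    comm = conv-comm (box g) (λ _ → 1ℤ) (+ (n N.* s) ·_) (box n) (λ a → indicator (solution? n c₂ a)) (+ m ·_) v
    cong-L₂ : ∀ {f f' : ℕ × ℕ → ℤ} → (∀ hs → hs ∈ L₂ → f hs ≡ f' hs) → ∑ L₂ f ≡ ∑ L₂ f'
    cong-L₂ e = ∑-cong∈ L₂ (λ {hs} hs∈ → e hs hs∈)
    double : ∀ hs → fst hs N.* snd hs ≡ n → ⟨ Pr (fst hs) (m N.* snd hs) w , w ⟩ ≡ + (g N.* g) * ⟨ Pr (g N.* fst hs) (s N.* snd hs) v , v ⟩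
    double (g' , s') e = trans (inner-cong {w = w} comm' (λ _ → refl)) (trans (Pr-inner q g (n N.* s) gns {v} {Pr g' (m N.* s') v} per (Pr-periodic {v = v} g' (m N.* s') per))
      (cong (+ (g N.* g) *_) (inner-cong {w = v} (λ x → Pr-crt {g} {s} {g'} {s'} gs e {v} per x) (λ _ → refl)))) where
     comm' : ∀ x → Pr g' (m N.* s') w x ≡ Pr g (n N.* s) (Pr g' (m N.* s') v) x
     comm' = conv-comm (box g') (λ _ → 1ℤ) (+ (m N.* s') ·_) (box g) (λ _ → 1ℤ) (+ (n N.* s) ·_) v

module PlaneIdentities (R : CommutativeRing 0ℓ 0ℓ) where
 open CommutativeRing R renaming (_+_ to _⊕_; _*_ to _⊗_; -_ to ⊝_; refl to ≈refl; sym to ≈sym; trans to ≈trans)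
 open RingSolver R

 line-shift : ∀ z s y u t → (z ⊕ ⊝ (s ⊗ y)) ⊕ u ≈ (z ⊕ (u ⊕ s ⊗ t)) ⊕ ⊝ (s ⊗ (y ⊕ t))
 line-shift = solve 5 (λ z s y u t → (z :- s :* y) :+ u := (z :+ (u :+ s :* t)) :- (s :* (y :+ t))) ≈refl

 line-move : ∀ z s y y' → (z ⊕ s ⊗ y) ⊕ ⊝ (s ⊗ y') ≈ z ⊕ ⊝ (⊝ (s ⊗ (y ⊕ ⊝ y')))
 line-move = solve 4 (λ z s y y' → (z :+ s :* y) :- (s :* y') := z :- (:- (s :* (y :- y')))) ≈refl

 line-back : ∀ z s y → (z ⊕ s ⊗ y) ⊕ ⊝ (s ⊗ y) ≈ z
 line-back = solve 3 (λ z s y → (z :+ s :* y) :- s :* y := z) ≈refl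

 affine-form : ∀ z d s → z ⊕ ⊝ (0# ⊕ s ⊗ (⊝ d)) ≈ z ⊕ ⊝ (⊝ (s ⊗ d))
 affine-form = solve 3 (λ z d s → z :- (con (+ 0) :+ s :* :- d) := z :- (:- (s :* d))) ≈refl

 sub-self : ∀ a b → a ⊕ ⊝ b ≈ 0# → a ≈ b
 sub-self a b e = ≈trans (solve 2 (λ a b → a := (a :- b) :+ b) ≈refl a b) (≈trans (+-congʳ e) (+-identityˡ b))

 neg-arg : ∀ u s c' → u ⊕ (s ⊗ c') ≈ ⊝ (⊝ u ⊕ ⊝ (s ⊗ c'))
 neg-arg = solve 3 (λ u s c' → u :+ (s :* c') := :- (:- u :- (s :* c'))) ≈refl

-- Polynomials over a prime field: division, irreducibility, factorisation.

module FiniteField (p : ℕ) (pr : Prime p) where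
 open PrimeField p pr
 open Poly residueRing
 private
  module F = CommutativeRing residueRing
  module P = CommutativeRing polyRing
  module FR = Algebra.Properties.Ring F.ring
  module I = RingIdentities polyRing
  module CF = CharP residueRing p pr
  module CP = CharP polyRing p pr
  module A = AffineIdentities residueRing

 elems : List F
 elems = allFin p

 allVec : ∀ n → List (Vec F n)
 allVec zero = [] ∷ []
 allVec (suc n) = cartesianProductWith _∷_ elems (allVec n)

 ∈-allVec : ∀ {n} (v : Vec F n) → v ∈ allVec n
 ∈-allVec [] = here refl
 ∈-allVec (c ∷ v) = ∈-cartesianProductWith⁺ _∷_ (∈-allFin c) (∈-allVec v)

 elems-unique : Unique elems
 elems-unique = Uniqueₚ.allFin⁺ p

 allVec-unique : ∀ n → Unique (allVec n)
 allVec-unique zero = [] ∷ []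
 allVec-unique (suc n) = Uniqueₚ.cartesianProductWith⁺ _∷_ (λ { refl → refl , refl }) elems-unique (allVec-unique n)

 -- The leading 1 is implicit, so the monic polynomials of degree n are exactly the vectors of
 -- length n, which can be enumerated without repetition.
 mon : ∀ {n} → Vec F n → Pol
 mon [] = one
 mon (c ∷ v) = c ∷ mon v

 pol : ∀ {n} → Vec F n → Pol
 pol [] = []
 pol (c ∷ v) = c ∷ pol v

 tail : Pol → Pol
 tail [] = []
 tail (_ ∷ f) = f

 coef-tail : ∀ f i → coef (tail f) i ≡ coef f (suc i)
 coef-tail [] i = refl
 coef-tail (_ ∷ f) i = refl

 vec : ∀ n → Pol → Vec F n
 vec zero f = []
 vec (suc n) f = coef f 0 ∷ vec n (tail f)

 mon-monic : ∀ {n} (v : Vec F n) → Monic n (mon v)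
 mon-monic [] = monic-one
 mon-monic (c ∷ v) = mk (lead (mon-monic v)) (below-∷ (below (mon-monic v)))

 mon-vec : ∀ n {f} → Monic n f → mon (vec n f) ≋ f
 mon-vec zero {f} m .at zero = sym (lead m)
 mon-vec zero {f} m .at (suc i) = sym (vanish (below m) (suc i) (N.s≤s N.z≤n))
 mon-vec (suc n) m .at zero = refl
 mon-vec (suc n) {f} m .at (suc i) =
  trans (at (mon-vec n {tail f} (mk (trans (coef-tail f n) (lead m)) (mk λ j q → trans (coef-tail f j) (vanish (below m) (suc j) (N.s≤s q))))) i)
      (coef-tail f i)

 pol-vec : ∀ n {f} → Below n f → pol (vec n f) ≋ f
 pol-vec zero b .at i = sym (vanish b i N.z≤n)
 pol-vec (suc n) b .at zero = refl
 pol-vec (suc n) {f} b .at (suc i) =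
  trans (at (pol-vec n {tail f} (mk λ j q → trans (coef-tail f j) (vanish b (suc j) (N.s≤s q)))) i) (coef-tail f i)

 pol-below : ∀ {n} (v : Vec F n) → Below n (pol v)
 pol-below [] = mk λ _ _ → refl
 pol-below (c ∷ v) = below-∷ (pol-below v)

 mon-injective : ∀ {n} (u v : Vec F n) → mon u ≋ mon v → u ≡ v
 mon-injective [] [] e = refl
 mon-injective (c ∷ u) (d ∷ v) e = cong₂ _∷_ (at e 0) (mon-injective u v (mk λ i → at e (suc i)))

 pol-injective : ∀ {n} (u v : Vec F n) → pol u ≋ pol v → u ≡ v
 pol-injective [] [] e = refl
 pol-injective (c ∷ u) (d ∷ v) e = cong₂ _∷_ (at e 0) (pol-injective u v (mk λ i → at e (suc i)))

 infix 4 _∣ₚ_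
 record _∣ₚ_ (g f : Pol) : Set where
  constructor divides
  field
   quot : Pol
   eq   : f ≋ g ⊠ quot

 ∣ₚ-resp : ∀ {g g' f f'} → g ≋ g' → f ≋ f' → g ∣ₚ f → g' ∣ₚ f'
 ∣ₚ-resp d e (divides m h) = divides m (P.trans (P.sym e) (P.trans h (P.*-congʳ {m} d)))

 ∣ₚ-trans : ∀ {f g h} → f ∣ₚ g → g ∣ₚ h → f ∣ₚ h
 ∣ₚ-trans {f} (divides a d) (divides b e) = divides (a ⊠ b) (P.trans e (P.trans (P.*-congʳ {b} d) (P.*-assoc f a b)))

 -- Recursion on coefficients: if f = g q + r then a + X f = g X q + (a + X r), and one multiple of
 -- `g` removes the coefficient of degree n.
 divMod : ∀ {n g} → Monic n g → ∀ f → Σ Pol λ q → Σ Pol λ r → (f ≋ g ⊠ q ⊞ r) × Below n r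
 divMod {n} {g} m [] = [] , [] , ≋-sym (P.trans (⊞-identityʳ (g ⊠ [])) (⊠-zeroʳ g)) , mk λ _ _ → refl
 divMod {n} {g} m (a ∷ f) with divMod m f
 ... | q , r , e , b = (0# ∷ q) ⊞ (s ∷ []) , (a ∷ r) ⊞ ⊟ (s ⋆ g) , eq , small where
  open CommutativeRing residueRing using (0#)
  s = coef (a ∷ r) n
  eq : (a ∷ f) ≋ g ⊠ ((0# ∷ q) ⊞ (s ∷ [])) ⊞ ((a ∷ r) ⊞ ⊟ (s ⋆ g))
  eq = P.trans (P.trans (∷-cong (sym (F.+-identityˡ a)) e) (P.sym (∷-⊞-∷ 0# (g ⊠ q) a r)))
   (P.trans (P.+-congʳ (P.sym (P.trans (P.*-comm g (0# ∷ q)) (P.trans (0∷-⊠ q g) (∷-cong refl (P.*-comm q g))))))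
    (P.trans (I.id1 g (0# ∷ q) (a ∷ r) (s ∷ []))
     (P.+-congˡ (P.+-congˡ (P.-‿cong ([ s ]⊠ g))))))
  small : Below n ((a ∷ r) ⊞ ⊟ (s ⋆ g))
  small .vanish i n≤i = trans (coef-⊞ (a ∷ r) (⊟ (s ⋆ g)) i)
   (trans (cong (coef (a ∷ r) i ⊕_) (trans (coef-⊟ (s ⋆ g) i) (cong ⊝_ (coef-⋆ s g i)))) (go (NP.m≤n⇒m<n∨m≡n n≤i))) where
   go : n N.< i ⊎ n ≡ i → coef (a ∷ r) i ⊕ ⊝ (s ⊗ coef g i) ≡ 𝟘
   go (inj₂ refl) = trans (cong (λ z → s ⊕ ⊝ z) (trans (cong (s ⊗_) (lead m)) (F.*-identityʳ s))) (F.-‿inverseʳ s)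
   go (inj₁ n<i) = trans (cong₂ (λ u v → u ⊕ ⊝ v) (vanish (below-∷ {a = a} b) i n<i) (trans (cong (s ⊗_) (vanish (below m) i n<i)) (F.zeroʳ s))) (F.-‿inverseʳ 𝟘)

 -- The length of a list says little about the degree, but over a field with decidable equality the
 -- top nonzero coefficient can be found, or the polynomial seen to be zero.
 data Leading (f : Pol) : Set where
  none : f ≋ [] → Leading f
  some : ∀ n → Below (suc n) f → coef f n ≢ 𝟘 → Leading f

 leading : ∀ f → Leading f
 leading [] = none P.refl
 leading (a ∷ f) with leading f
 ... | some n b c≢0 = some (suc n) (below-∷ b) c≢0
 ... | none f≋0 with a Fin.≟ 𝟘
 ...   | yes a≡0 = none (mk λ { zero → a≡0 ; (suc i) → at f≋0 i })
 ...   | no a≢0 = some 0 (mk λ { (suc i) _ → at f≋0 i }) a≢0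

 leading-< : ∀ {n e f} → Below n f → coef f e ≢ 𝟘 → e N.< n
 leading-< {n} {e} b c≢0 with e N.<? n
 ... | yes e<n = e<n
 ... | no e≮n = ⊥-elim (c≢0 (vanish b e (NP.≮⇒≥ e≮n)))

 monic-normalize : ∀ {n f} → Below (suc n) f → coef f n ≢ 𝟘 → Monic n (coef f n ⁻¹ ⋆ f)
 monic-normalize {n} {f} b c≢0 =
  mk (trans (coef-⋆ (coef f n ⁻¹) f n) (trans (F.*-comm _ _) (⁻¹-inverse c≢0))) (below-⋆ (coef f n ⁻¹) b)

 monic-⊠-coef : ∀ {n g e m} → Monic n g → Below (suc e) m → coef (g ⊠ m) (n N.+ e) ≡ coef m e
 monic-⊠-coef {n} {g} {e} {m} mg b = trans (coef-⊠-top (below mg) b) (trans (cong (_⊗ coef m e) (lead mg)) (F.*-identityˡ _))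

 monic-⊠-below : ∀ {n g m} → Monic n g → Below n (g ⊠ m) → m ≋ []
 monic-⊠-below {n} {g} {m} mg b with leading m
 ... | none z = z
 ... | some e be c≢0 = ⊥-elim (c≢0 (trans (sym (monic-⊠-coef mg be)) (vanish b (n N.+ e) (NP.m≤m+n n e))))

 monic-cancel : ∀ {n g a b} → Monic n g → g ⊠ a ≋ g ⊠ b → a ≋ b
 monic-cancel {n} {g} {a} {b} mg e = P.trans (I.id2 a b)
  (P.trans (P.+-congʳ (monic-⊠-below mg (below-resp {f = []} (P.sym diff) (mk λ _ _ → refl)))) (P.+-identityˡ b)) where
  diff : g ⊠ (a ⊞ ⊟ b) ≋ []
  diff = P.trans (I.id3 g a b) (P.trans (P.+-congʳ e) (P.-‿inverseʳ (g ⊠ b)))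

 ∣ₚ-below : ∀ {n g f} → Monic n g → Below n f → g ∣ₚ f → f ≋ []
 ∣ₚ-below {g = g} mg b (divides m e) =
  P.trans e (P.trans (P.*-congˡ {g} (monic-⊠-below mg (below-resp e b))) (P.zeroʳ g))

 ∣ₚ? : ∀ {n g} → Monic n g → ∀ f → Dec (g ∣ₚ f)
 ∣ₚ? {n} {g} mg f = go (divMod mg f) where
  go₂ : ∀ q r → f ≋ g ⊠ q ⊞ r → Below n r → Leading r → Dec (g ∣ₚ f)
  go₂ q r e b (none r≋0) = yes (divides q (P.trans e (P.trans (P.+-congˡ r≋0) (P.+-identityʳ (g ⊠ q)))))
  go₂ q r e b (some k _ c≢0) = no λ { (divides m h) → c≢0 (at (∣ₚ-below mg b (divides (m ⊞ ⊟ q) (I.remainder g m q r f e h))) k) }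
  go : (Σ Pol λ q → Σ Pol λ r → (f ≋ g ⊠ q ⊞ r) × Below n r) → Dec (g ∣ₚ f)
  go (q , r , e , b) = go₂ q r e b (leading r)

 record Irr {d : ℕ} (P : Vec F d) : Set where
  constructor irr
  field
   positive  : 1 N.≤ d
   noDivisor : ∀ {e} (Q : Vec F e) → 1 N.≤ e → e N.< d → ¬ (mon Q ∣ₚ mon P)
 open Irr public

 ProperFactor : Pol → ℕ → Set
 ProperFactor f k = Σ ℕ λ e → Σ (Vec F e) λ Q → 1 N.≤ e × e N.< k × mon Q ∣ₚ f

 factorBelow : ∀ f k → (∀ {e} (Q : Vec F e) → 1 N.≤ e → e N.< k → ¬ (mon Q ∣ₚ f)) ⊎ ProperFactor f k
 factorBelow f zero = inj₁ λ _ _ ()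
 factorBelow f (suc k) with factorBelow f k
 ... | inj₂ (e , Q , 1≤e , e<k , d) = inj₂ (e , Q , 1≤e , NP.m≤n⇒m≤1+n e<k , d)
 ... | inj₁ none< with 1 N.≤? k
 ...   | no k<1 = inj₁ λ Q 1≤e e<sk → ⊥-elim (k<1 (NP.≤-trans 1≤e (NP.≤-pred e<sk)))
 ...   | yes 1≤k with any? (λ Q → ∣ₚ? (mon-monic Q) f) (allVec k)
 ...     | yes a with find a
 ...       | Q , _ , d = inj₂ (k , Q , 1≤k , NP.n<1+n k , d)
 factorBelow f (suc k) | inj₁ none< | yes 1≤k | no ¬a = inj₁ λ {e} → go {e} where
  go : ∀ {e} (Q : Vec F e) → 1 N.≤ e → e N.< suc k → ¬ (mon Q ∣ₚ f)
  go {e} Q 1≤e e<sk with NP.m≤n⇒m<n∨m≡n (NP.≤-pred e<sk)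
  ... | inj₁ e<k = none< Q 1≤e e<k
  ... | inj₂ refl = λ d → ¬a (lose (∈-allVec Q) d)

 irr? : ∀ {d} (P : Vec F d) → Dec (Irr P)
 irr? {d} P with 1 N.≤? d
 ... | no ¬1≤d = no λ i → ¬1≤d (positive i)
 ... | yes 1≤d with factorBelow (mon P) d
 ...   | inj₁ h = yes (irr 1≤d h)
 ...   | inj₂ (e , Q , a , b , c) = no λ i → noDivisor i Q a b c

 irreducibleFactor : ∀ k n (f : Vec F n) → n N.≤ k → 1 N.≤ n →
           Σ ℕ λ d → Σ (Vec F d) λ P → Irr P × mon P ∣ₚ mon f
 irreducibleFactor zero zero f n≤k ()
 irreducibleFactor (suc k) n f n≤k 1≤n with factorBelow (mon f) n
 ... | inj₁ h = n , f , irr 1≤n h , divides one (P.sym (P.*-identityʳ _))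
 ... | inj₂ (e , Q , 1≤e , e<n , q) with irreducibleFactor k e Q (NP.≤-pred (NP.≤-trans e<n n≤k)) 1≤e
 ...   | d , P , i , h = d , P , i , ∣ₚ-trans h q

 -- Euclid's algorithm: dividing P by a normalised multiple of f leaves a remainder of smaller degree.
 inverseMod : ∀ {d} {P : Vec F d} → Irr P → ∀ n f → n N.≤ d → Below n f → ¬ (f ≋ []) →
        Σ Pol λ u → Σ Pol λ m → f ⊠ u ≋ one ⊞ mon P ⊠ m
 inverseMod i zero f n≤d b f≢0 = ⊥-elim (f≢0 (below-0 b))
 inverseMod {d} {P} i (suc n) f n≤d b f≢0 = go (leading f) where
  Goal = Σ Pol λ u → Σ Pol λ m → f ⊠ u ≋ one ⊞ mon P ⊠ m
  module _ (e : ℕ) (be : Below (suc (suc e)) f) (c≢0 : coef f (suc e) ≢ 𝟘) where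
   c' = coef f (suc e) ⁻¹
   f₁ = c' ⋆ f
   m₁ : Monic (suc e) f₁
   m₁ = monic-normalize be c≢0
   deg : suc e N.< suc n
   deg = leading-< b c≢0
   go₃ : ∀ q r → mon P ≋ f₁ ⊠ q ⊞ r → Below (suc e) r → Leading r → Goal
   go₃ q r eq br (none r≋0) = ⊥-elim (noDivisor i (vec (suc e) f₁) (N.s≤s N.z≤n) (NP.≤-trans deg n≤d)
    (∣ₚ-resp {g = f₁} (P.sym (mon-vec (suc e) m₁)) P.refl (divides q (P.trans eq (P.trans (P.+-congˡ r≋0) (P.+-identityʳ (f₁ ⊠ q)))))))
   go₃ q r eq br (some k _ r≢0) =
    let u , m , h = inverseMod i n r (NP.≤-trans (NP.n≤1+n n) n≤d) (below-mono (NP.≤-pred deg) br) (λ z → r≢0 (at z k))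
    in (c' ∷ []) ⊠ (⊟ (q ⊠ u)) , m ⊞ ⊟ u , I.inverse-step (mon P) f f₁ (c' ∷ []) q r u m (P.sym ([ c' ]⊠ f)) eq h
   go₂ : (Σ Pol λ q → Σ Pol λ r → (mon P ≋ f₁ ⊠ q ⊞ r) × Below (suc e) r) → Goal
   go₂ (q , r , eq , br) = go₃ q r eq br (leading r)
  go : Leading f → Goal
  go (none z) = ⊥-elim (f≢0 z)
  go (some zero be c≢0) = (coef f 0 ⁻¹ ∷ []) , [] ,
   P.trans (P.*-comm f (coef f 0 ⁻¹ ∷ [])) (P.trans ([ coef f 0 ⁻¹ ]⊠ f)
    (P.trans (P.sym (mon-vec 0 (monic-normalize be c≢0)))
     (P.sym (P.trans (P.+-congˡ (⊠-zeroʳ (mon P))) (P.+-identityʳ one)))))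
  go (some (suc e) be c≢0) = go₂ e be c≢0 (divMod (m₁ e be c≢0) (mon P))

 inverseMod' : ∀ {d} {P : Vec F d} → Irr P → ∀ f → ¬ (mon P ∣ₚ f) → Σ Pol λ u → Σ Pol λ m → f ⊠ u ≋ one ⊞ mon P ⊠ m
 inverseMod' {d} {P} i f ∤f =
  let q , r , eq , br = divMod (mon-monic P) f
      u , m , h = inverseMod i d r NP.≤-refl br (λ z → ∤f (divides q (P.trans eq (P.trans (P.+-congˡ z) (P.+-identityʳ (mon P ⊠ q))))))
  in u , m ⊞ q ⊠ u , I.inverse-lift (mon P) f q r u m eq h

 irr-prime : ∀ {d} {P : Vec F d} → Irr P → ∀ f g → mon P ∣ₚ f ⊠ g → mon P ∣ₚ f ⊎ mon P ∣ₚ g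
 irr-prime {d} {P} i f g (divides k e) = go (∣ₚ? (mon-monic P) f) where
  go : Dec (mon P ∣ₚ f) → mon P ∣ₚ f ⊎ mon P ∣ₚ g
  go (yes h) = inj₁ h
  go (no ∤f) =
   let u , m , h = inverseMod' i f ∤f
   in inj₂ (divides (k ⊠ u ⊞ ⊟ (m ⊠ g)) (I.prime-step (mon P) f g k u m e h))

 MonicPol : Set
 MonicPol = Σ ℕ (Vec F)

 monic-≢0 : ∀ {n f} → Monic n f → ¬ (f ≋ [])
 monic-≢0 {n} m z = 0≢1 (trans (sym (at z n)) (lead m))

 irr-∣-irr : ∀ {d e} {P : Vec F d} {Q : Vec F e} → Irr P → Irr Q → mon P ∣ₚ mon Q → (d , P) ≡ (e , Q)
 irr-∣-irr {d} {e} {P} {Q} i j h with NP.<-cmp d e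
 ... | tri< d<e _ _ = ⊥-elim (noDivisor j P (positive i) d<e h)
 ... | tri> _ _ e<d = ⊥-elim (monic-≢0 (mon-monic Q) (∣ₚ-below (mon-monic P) (below-mono e<d (below (mon-monic Q))) h))
 ... | tri≈ _ refl _ = cong (d ,_) (mon-injective P Q (P.sym
    (P.trans (I.id14 (mon P) (mon Q)) (P.trans (P.+-congʳ {mon P} zeroDiff) (P.+-identityˡ (mon P)))))) where
  zeroDiff : mon Q ⊞ ⊟ mon P ≋ []
  zeroDiff = ∣ₚ-below (mon-monic P) small (divides (_∣ₚ_.quot h ⊞ ⊟ one)
    (P.trans (P.+-congʳ (_∣ₚ_.eq h)) (P.trans (P.+-congˡ (P.-‿cong (P.sym (P.*-identityʳ (mon P)))))
     (I.id15 (mon P) (_∣ₚ_.quot h) one)))) where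
   small : Below d (mon Q ⊞ ⊟ mon P)
   small .vanish k d≤k = trans (coef-⊞ (mon Q) (⊟ mon P) k) (trans (cong (coef (mon Q) k ⊕_) (coef-⊟ (mon P) k)) (go (NP.m≤n⇒m<n∨m≡n d≤k))) where
    go : d N.< k ⊎ d ≡ k → coef (mon Q) k ⊕ ⊝ coef (mon P) k ≡ 𝟘
    go (inj₁ d<k) = trans (cong₂ (λ u v → u ⊕ ⊝ v) (vanish (below (mon-monic Q)) k d<k) (vanish (below (mon-monic P)) k d<k)) (F.-‿inverseʳ 𝟘)
    go (inj₂ refl) = trans (cong₂ (λ u v → u ⊕ ⊝ v) (lead (mon-monic Q)) (lead (mon-monic P))) (F.-‿inverseʳ 𝟙ᶠ)

 Irreducible : MonicPol → Set
 Irreducible (_ , P) = Irr P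

 monicPol : MonicPol → Pol
 monicPol (_ , P) = mon P

 productOf : List MonicPol → Pol
 productOf [] = one
 productOf (P ∷ Ps) = monicPol P ⊠ productOf Ps

 degreeOf : List MonicPol → ℕ
 degreeOf [] = 0
 degreeOf (P ∷ Ps) = fst P N.+ degreeOf Ps

 productOf-monic : ∀ Ps → Monic (degreeOf Ps) (productOf Ps)
 productOf-monic [] = monic-one
 productOf-monic (P ∷ Ps) = monic-⊠ (mon-monic (snd P)) (productOf-monic Ps)

 productOf-∣ₚ : ∀ Ps → Unique Ps → All Irreducible Ps → ∀ f → All (λ P → monicPol P ∣ₚ f) Ps → productOf Ps ∣ₚ f
 productOf-∣ₚ [] u i f ds = divides f (P.sym (P.*-identityˡ f))
 productOf-∣ₚ (P ∷ Ps) (P∉ ∷ u) (iP ∷ i) f (divides f' e ∷ ds)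
  with productOf-∣ₚ Ps u i f' (All.tabulate λ {Q} Q∈ → step (All.lookup i Q∈) (All.lookup P∉ Q∈) (All.lookup ds Q∈)) where
  step : ∀ {Q} → Irreducible Q → P ≢ Q → monicPol Q ∣ₚ f → monicPol Q ∣ₚ f'
  step {Q} iQ P≢Q h with irr-prime iQ (monicPol P) f' (∣ₚ-resp {monicPol Q} P.refl e h)
  ... | inj₁ Q∣P = ⊥-elim (P≢Q (sym (irr-∣-irr iQ iP Q∣P)))
  ... | inj₂ Q∣f' = Q∣f'
 ... | divides m h = divides m (P.trans e (P.trans (P.*-congˡ {monicPol P} h) (P.sym (P.*-assoc (monicPol P) (productOf Ps) m))))

 -- Distinct irreducible divisors have a product that still divides f. Stepanov's method applies
 -- this to a nonzero auxiliary polynomial with many prescribed divisors.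
 degree-bound : ∀ Ps → Unique Ps → All Irreducible Ps → ∀ {n} f → Below n f → ¬ (f ≋ []) → All (λ P → monicPol P ∣ₚ f) Ps →
         degreeOf Ps N.≤ n
 degree-bound Ps u i {n} f b f≢0 ds with degreeOf Ps N.≤? n
 ... | yes le = le
 ... | no ¬le = ⊥-elim (f≢0 (∣ₚ-below (productOf-monic Ps) (below-mono (NP.≰⇒≥ ¬le) b) (productOf-∣ₚ Ps u i f ds)))

 length-elems : length elems ≡ p
 length-elems = Listₚ.length-tabulate (λ x → x)

 length-allVec : ∀ n → length (allVec n) ≡ p N.^ n
 length-allVec zero = refl
 length-allVec (suc n) = trans (go elems) (cong₂ N._*_ length-elems (length-allVec n)) where
  cons : F → Vec F n → Vec F (suc n)
  cons = _∷_
  go : ∀ (xs : List F) → length (cartesianProductWith cons xs (allVec n)) ≡ length xs N.* length (allVec n)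
  go [] = refl
  go (x ∷ xs) = trans (Listₚ.length-++ (map (cons x) (allVec n))) (cong₂ N._+_ (Listₚ.length-map (cons x) (allVec n)) (go xs))

 ×-⟦⟧ : ∀ n → n CF.×ₛ 𝟙ᶠ ≡ ⟦ + n ⟧
 ×-⟦⟧ zero = refl
 ×-⟦⟧ (suc n) = trans (cong (𝟙ᶠ ⊕_) (×-⟦⟧ n)) (⟦⟧-⊕ (+ 1) (+ n))

 charF : p CF.×ₛ 𝟙ᶠ ≡ 𝟘
 charF = trans (×-⟦⟧ p) (⟦⟧-cong (mod-by (+ 1) (trans (ZP.+-identityʳ (+ p)) (sym (ZP.*-identityˡ (+ p))))))

 fermat : ∀ c → c CF.^ p ≡ c
 fermat c = subst (λ z → z CF.^ p ≡ z) (trans (×-⟦⟧ (toℕ c)) (⟦toℤ⟧ c)) (CF.Frobenius.multiple-fixed charF (toℕ c))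

 constant : F → Pol
 constant c = c ∷ []

 constantHom : Hom residueRing polyRing
 constantHom = record
  { fun = constant
  ; cong = λ e → ∷-cong e ≋-refl
  ; homo-+ = λ x y → P.sym (P.trans (∷-⊞-∷ x [] y []) (∷-cong refl (P.+-identityˡ [])))
  ; homo-* = λ x y → P.sym (P.trans ([ x ]⊠ (y ∷ [])) (mk λ { zero → coef-⋆ x (y ∷ []) 0 ; (suc i) → trans (coef-⋆ x (y ∷ []) (suc i)) (F.zeroʳ x) }))
  ; homo-0 = mk λ { zero → refl ; (suc i) → refl }
  ; homo-1 = P.refl
  }
 open Hom constantHom public using () renaming (homo-+ to constant-+; homo-* to constant-*; homo-0 to constant-0; homo-neg to constant-neg)

 constant-^ : ∀ c n → constant (c CF.^ n) ≋ constant c CP.^ n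
 constant-^ c zero = P.refl
 constant-^ c (suc n) = P.trans (constant-* c _) (P.*-congˡ {constant c} (constant-^ c n))

 charP : p CP.×ₛ one ≋ []
 charP = P.trans (P.sym (go p)) (P.trans (∷-cong charF ≋-refl) constant-0) where
  go : ∀ n → constant (n CF.×ₛ 𝟙ᶠ) ≋ n CP.×ₛ one
  go zero = constant-0
  go (suc n) = P.trans (constant-+ 𝟙ᶠ _) (P.+-congˡ {one} (go n))

 constant-fermat : ∀ c → constant c CP.^ p ≋ constant c
 constant-fermat c = P.trans (P.sym (constant-^ c p)) (∷-cong (fermat c) ≋-refl)

 private
  module PP = Poly polyRing
  module L = LinearFactors residueRing
  open PolyMap constantHom

 infixl 8 _∘ₚ_
 _∘ₚ_ : Pol → Pol → Pol
 f ∘ₚ g = PP.eval (polyMap f) g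

 ∘ₚ-cong : ∀ {f f'} g → f ≋ f' → f ∘ₚ g ≋ f' ∘ₚ g
 ∘ₚ-cong {f} {f'} g e = PP.eval-cong (polyMap f) (polyMap f') g (polyMap-cong e)

 ∘ₚ-⊠ : ∀ f f' g → (f ⊠ f') ∘ₚ g ≋ f ∘ₚ g ⊠ f' ∘ₚ g
 ∘ₚ-⊠ f f' g = P.trans (PP.eval-cong (polyMap (f ⊠ f')) (polyMap f PP.⊠ polyMap f') g (polyMap-⊠ f f')) (PP.eval-⊠ (polyMap f) (polyMap f') g)

 ∘ₚ-⊞ : ∀ f f' g → (f ⊞ f') ∘ₚ g ≋ f ∘ₚ g ⊞ f' ∘ₚ g
 ∘ₚ-⊞ f f' g = P.trans (PP.eval-cong (polyMap (f ⊞ f')) (polyMap f PP.⊞ polyMap f') g (polyMap-⊞ f f')) (PP.eval-⊞ (polyMap f) (polyMap f') g)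

 linear-∘ₚ : ∀ c g → L.linear c ∘ₚ g ≋ g ⊞ ⊟ constant c
 linear-∘ₚ c g = P.trans (P.+-cong (constant-neg c) (P.*-congˡ {g} (P.trans (P.+-congˡ {one} (P.zeroʳ g)) (P.+-identityʳ one))))
  (P.trans (P.+-comm (⊟ constant c) (g ⊠ one)) (P.+-congʳ {⊟ constant c} (P.*-identityʳ g)))

 X-∘ₚ : ∀ g → X ∘ₚ g ≋ g
 X-∘ₚ g = P.trans (P.+-cong constant-0 (P.*-congˡ {g} (P.trans (P.+-congˡ {one} (P.zeroʳ g)) (P.+-identityʳ one))))
  (P.trans (P.+-identityˡ (g ⊠ one)) (P.*-identityʳ g))

 X^-∘ₚ : ∀ n g → (X ^ₚ n) ∘ₚ g ≋ g CP.^ n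
 X^-∘ₚ zero g = P.trans (P.+-congˡ {one} (P.zeroʳ g)) (P.+-identityʳ one)
 X^-∘ₚ (suc n) g = P.trans (∘ₚ-⊠ X (X ^ₚ n) g) (P.*-cong (X-∘ₚ g) (X^-∘ₚ n g))

 linears : List MonicPol
 linears = map (λ c → 1 , (⊝ c) ∷ []) elems

 private
  linears-irr : All Irreducible linears
  linears-irr = All.tabulate λ Q∈ → go (∈-map⁻ _ Q∈) where
   go : ∀ {Q} → (∃ λ c → c ∈ elems × Q ≡ (1 , (⊝ c) ∷ [])) → Irreducible Q
   go (c , _ , refl) = irr (N.s≤s N.z≤n) λ Q 1≤e e<1 _ → NP.<-irrefl refl (NP.<-≤-trans e<1 1≤e)

  ⊝-injective : ∀ {x y} → ⊝ x ≡ ⊝ y → x ≡ y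
  ⊝-injective {x} {y} e = trans (sym (FP.-‿involutive x)) (trans (cong ⊝_ e) (FP.-‿involutive y)) where
   import Algebra.Properties.Ring
   module FP = Algebra.Properties.Ring F.ring

  linears-unique : Unique linears
  linears-unique = unique-map _ (λ {x} {y} _ _ e → ⊝-injective (inj e)) elems-unique where
   inj : ∀ {x y : F} → _≡_ {A = MonicPol} (1 , x ∷ []) (1 , y ∷ []) → x ≡ y
   inj refl = refl

  root-∣ₚ : ∀ c f → eval f c ≡ 𝟘 → L.linear c ∣ₚ f
  root-∣ₚ c f root =
   let q , r , e , b = divMod (L.linear-monic c) f
       r≋ : r ≋ coef r 0 ∷ []
       r≋ = mk λ { zero → refl ; (suc i) → vanish b (suc i) (N.s≤s N.z≤n) }
       r₀ : coef r 0 ≡ 𝟘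
       r₀ = trans (sym (trans (cong (coef r 0 ⊕_) (F.zeroʳ c)) (F.+-identityʳ _)))
         (trans (sym (eval-cong r (coef r 0 ∷ []) c r≋))
          (trans (sym (F.+-identityˡ _))
           (trans (cong (_⊕ eval r c) (sym (trans (eval-⊠ (L.linear c) q c) (trans (cong (_⊗ eval q c) (L.eval-linear c)) (F.zeroˡ _)))))
            (trans (sym (eval-⊞ (L.linear c ⊠ q) r c)) (trans (sym (eval-cong f _ c e)) root)))))
   in divides q (P.trans e (P.trans (P.+-congˡ {L.linear c ⊠ q} (P.trans r≋ (P.trans (∷-cong r₀ ≋-refl) constant-0))) (P.+-identityʳ _)))

  eval-X : ∀ c → eval X c ≡ c
  eval-X c = trans (F.+-identityˡ _) (trans (cong (c ⊗_) (trans (cong (𝟙ᶠ ⊕_) (F.zeroʳ c)) (F.+-identityʳ 𝟙ᶠ))) (F.*-identityʳ c))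

  eval-X^ : ∀ n c → eval (X ^ₚ n) c ≡ c CF.^ n
  eval-X^ zero c = trans (cong (𝟙ᶠ ⊕_) (F.zeroʳ c)) (F.+-identityʳ 𝟙ᶠ)
  eval-X^ (suc n) c = trans (eval-⊠ X (X ^ₚ n) c) (cong₂ _⊗_ (eval-X c) (eval-X^ n c))

  degree-linears : ∀ xs → degreeOf (map (λ c → 1 , (⊝ c) ∷ []) xs) ≡ length xs
  degree-linears [] = refl
  degree-linears (x ∷ xs) = cong suc (degree-linears xs)

 monic-∣ₚ-monic : ∀ {n f g} → Monic n f → Monic n g → f ∣ₚ g → g ≋ f
 monic-∣ₚ-monic {n} {f} {g} mf mg (divides m e) =
  P.trans (I.id2 g f) (P.trans (P.+-congʳ {f} (∣ₚ-below mf small (divides (m ⊞ ⊟ one)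
   (P.trans (P.+-cong e (P.-‿cong (P.sym (P.*-identityʳ f)))) (P.sym (I.id3 f m one)))))) (P.+-identityˡ f)) where
  small : Below n (g ⊞ ⊟ f)
  small .vanish k n≤k = trans (coef-⊞ g (⊟ f) k) (trans (cong (coef g k ⊕_) (coef-⊟ f k)) (go (NP.m≤n⇒m<n∨m≡n n≤k))) where
   go : n N.< k ⊎ n ≡ k → coef g k ⊕ ⊝ coef f k ≡ 𝟘
   go (inj₁ n<k) = trans (cong₂ (λ u v → u ⊕ ⊝ v) (vanish (below mg) k n<k) (vanish (below mf) k n<k)) (F.-‿inverseʳ 𝟘)
   go (inj₂ refl) = trans (cong₂ (λ u v → u ⊕ ⊝ v) (lead mg) (lead mf)) (F.-‿inverseʳ 𝟙ᶠ)

 -- By Fermat each X - c divides the left side, hence so does their product; both sides are monic of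
 -- degree p.
 X^p-X : X ^ₚ p ⊞ ⊟ X ≋ productOf linears
 X^p-X = monic-∣ₚ-monic (subst (λ n → Monic n (productOf linears)) deg (productOf-monic linears))
   (monic-⊞ (monic-X^ p) (below-⊟ (below-mono 2≤p (below monic-X))))
   (productOf-∣ₚ linears linears-unique linears-irr _ (All.tabulate λ Q∈ → go (∈-map⁻ _ Q∈))) where
  deg : degreeOf linears ≡ p
  deg = trans (degree-linears elems) (Listₚ.length-tabulate (λ x → x))
  2≤p : 2 N.≤ p
  2≤p = N.nonTrivial⇒n>1 p {{Data.Nat.Primality.prime⇒nonTrivial pr}} where
   import Data.Nat.Primality
  go : ∀ {Q} → (∃ λ c → c ∈ elems × Q ≡ (1 , (⊝ c) ∷ [])) → monicPol Q ∣ₚ X ^ₚ p ⊞ ⊟ X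
  go (c , _ , refl) = root-∣ₚ c _ (trans (eval-cong _ (X ^ₚ p ⊞ (⊝ 𝟙ᶠ) ⋆ X) c (P.+-congˡ {X ^ₚ p} (mk λ i → trans (coef-⊟ X i) (sym (trans (coef-⋆ (⊝ 𝟙ᶠ) X i) (FR.-1*x≈-x _))))))
   (trans (eval-⊞ (X ^ₚ p) _ c) (trans (cong₂ _⊕_ (trans (eval-X^ p c) (fermat c))
    (trans (eval-⋆ (⊝ 𝟙ᶠ) X c) (trans (FR.-1*x≈-x _) (cong ⊝_ (eval-X c)))))
    (F.-‿inverseʳ c))))

 frobenius-minus-id : ∀ g → g CP.^ p ⊞ ⊟ g ≋ productOf linears ∘ₚ g
 frobenius-minus-id g = P.trans (P.+-cong (P.sym (X^-∘ₚ p g)) (minus g))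
  (P.trans (P.sym (∘ₚ-⊞ (X ^ₚ p) (⊟ X) g)) (∘ₚ-cong g X^p-X)) where
  minus : ∀ g → ⊟ g ≋ (⊟ X) ∘ₚ g
  minus g = P.sym (P.trans (I.id2 _ (⊟ g)) (P.trans (P.+-congʳ {⊟ g} (P.trans (P.+-congˡ {(⊟ X) ∘ₚ g} (PRG.-‿involutive g))
   (P.trans (P.+-congˡ {(⊟ X) ∘ₚ g} (P.sym (X-∘ₚ g))) (P.trans (P.sym (∘ₚ-⊞ (⊟ X) X g)) (P.trans (∘ₚ-cong g (P.-‿inverseˡ X)) P.refl))))) (P.+-identityˡ (⊟ g)))) where
   import Algebra.Properties.Ring
   module PRG = Algebra.Properties.Ring P.ring

 -- Residue fields, Frobenius conjugates and traces.

 module ResidueField {d : ℕ} (P : Vec F d) (i : Irr P) where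
  open Quotient polyRing (mon P) public
  module K = CommutativeRing quotientRing

  module CK = CharP quotientRing p pr

  ~⇒∣ₚ : ∀ {f} → f ~ [] → mon P ∣ₚ f
  ~⇒∣ₚ (mk m e) = divides m (P.trans e (P.+-identityˡ _))

  ∣ₚ⇒~ : ∀ {f} → mon P ∣ₚ f → f ~ []
  ∣ₚ⇒~ (divides m e) = mk m (P.trans e (P.sym (P.+-identityˡ _)))

  ×ₛ-same : ∀ n f → n CP.×ₛ f ≡ n CK.×ₛ f
  ×ₛ-same zero f = refl
  ×ₛ-same (suc n) f = cong (f ⊞_) (×ₛ-same n f)

  ^-same : ∀ f n → f CP.^ n ≡ f CK.^ n
  ^-same f zero = refl
  ^-same f (suc n) = cong (f ⊠_) (^-same f n)

  charK : p CK.×ₛ one ~ []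
  charK = subst (_~ []) (×ₛ-same p one) (≈⇒~ charP)

  module FrobK = CK.Frobenius charK

  constant-fixed : ∀ c → constant c CK.^ p ~ constant c
  constant-fixed c = subst (_~ constant c) (^-same (constant c) p) (≈⇒~ (constant-fermat c))

  domain : ∀ f g → f ⊠ g ~ [] → f ~ [] ⊎ g ~ []
  domain f g h = Sum.map ∣ₚ⇒~ ∣ₚ⇒~ (irr-prime i f g (~⇒∣ₚ h))

  invert : ∀ f → ¬ (f ~ []) → ∃ λ u → f ⊠ u ~ one
  invert f f≁0 = let u , m , h = inverseMod' i f (λ z → f≁0 (∣ₚ⇒~ z)) in u , mk m h

  cancel : ∀ f g h → ¬ (f ~ []) → f ⊠ g ~ f ⊠ h → g ~ h
  cancel f g h f≁0 e = K.trans (K.sym (step g)) (K.trans (K.*-congˡ {u} e) (step h)) where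
   u = fst (invert f f≁0)
   step : ∀ g → u ⊠ (f ⊠ g) ~ g
   step g = K.trans (K.sym (K.*-assoc u f g)) (K.trans (K.*-congʳ {g} (K.trans (K.*-comm u f) (snd (invert f f≁0)))) (K.*-identityˡ g))

  1≁0 : ¬ (one ~ [])
  1≁0 h = monic-≢0 monic-one (∣ₚ-below (mon-monic P) (below-mono (positive i) (below monic-one)) (~⇒∣ₚ h))

  reduce : Pol → Vec F d
  reduce f = vec d (fst (snd (divMod (mon-monic P) f)))

  reduce-~ : ∀ f → pol (reduce f) ~ f
  reduce-~ f = let q , r , e , b = divMod (mon-monic P) f
   in K.trans (≈⇒~ (pol-vec d b)) (K.sym (mk q (P.trans e (P.+-comm _ r))))

  pol-~-injective : ∀ (u v : Vec F d) → pol u ~ pol v → u ≡ v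
  pol-~-injective u v (mk m e) = pol-injective u v (P.trans (I.id2 (pol u) (pol v)) (P.trans (P.+-congʳ {pol v}
   (∣ₚ-below (mon-monic P) (below-⊞ (pol-below u) (below-⊟ (pol-below v))) (divides m (diff (pol u) (pol v) (mon P ⊠ m) e)))) (P.+-identityˡ (pol v)))) where
   diff : ∀ a b c → a ≋ b ⊞ c → a ⊞ ⊟ b ≋ c
   diff a b c h = P.trans (P.+-congʳ {⊟ b} (P.trans h (P.+-comm b c))) (P.trans (P.+-assoc c b (⊟ b)) (P.trans (P.+-congˡ {c} (P.-‿inverseʳ b)) (P.+-identityʳ c)))

  private
   module ΣM = Sums K.*-commutativeMonoid

   _≟ᵛ_ : (u v : Vec F d) → Dec (u ≡ v)
   _≟ᵛ_ = Vecₚ.≡-dec Fin._≟_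

   0ᵛ : Vec F d
   0ᵛ = vec d []

   pol-0ᵛ : pol 0ᵛ ≋ []
   pol-0ᵛ = pol-vec d {[]} (mk λ _ _ → refl)

   nonzero : List (Vec F d)
   nonzero = filter (λ v → ¬? (v ≟ᵛ 0ᵛ)) (allVec d)

   nonzero-unique : Unique nonzero
   nonzero-unique = Uniqueₚ.filter⁺ _ (allVec-unique d)

   ∈-nonzero : ∀ {v} → v ≢ 0ᵛ → v ∈ nonzero
   ∈-nonzero {v} v≢0 = ∈-filter⁺ (λ v → ¬? (v ≟ᵛ 0ᵛ)) (∈-allVec v) v≢0

   nonzero-≁ : ∀ {v} → v ∈ nonzero → ¬ (pol v ~ [])
   nonzero-≁ {v} v∈ h = snd (∈-filter⁻ (λ v → ¬? (v ≟ᵛ 0ᵛ)) {xs = allVec d} v∈) (pol-~-injective v 0ᵛ (K.trans h (K.sym (≈⇒~ pol-0ᵛ))))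

   length-nonzero : suc (length nonzero) ≡ p N.^ d
   length-nonzero = trans (↭-length (unique-↭ {xs = 0ᵛ ∷ nonzero} {allVec d}
     (All.tabulate (λ {v} v∈ e → snd (∈-filter⁻ (λ v → ¬? (v ≟ᵛ 0ᵛ)) {xs = allVec d} v∈) (sym e)) ∷ nonzero-unique) (allVec-unique d)
     (λ {v} _ → ∈-allVec v) back)) (length-allVec d) where
    back : ∀ {v} → v ∈ allVec d → v ∈ 0ᵛ ∷ nonzero
    back {v} _ = go (v ≟ᵛ 0ᵛ) where
     go : Dec (v ≡ 0ᵛ) → v ∈ 0ᵛ ∷ nonzero
     go (yes e) = here e
     go (no v≢0) = there (∈-nonzero v≢0)

   ∏-scale : ∀ θ (vs : List (Vec F d)) → ΣM.∑ vs (λ v → θ ⊠ pol v) ~ θ CK.^ length vs ⊠ ΣM.∑ vs pol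
   ∏-scale θ [] = K.sym (K.*-identityˡ one)
   ∏-scale θ (v ∷ vs) = K.trans (K.*-congˡ {θ ⊠ pol v} (∏-scale θ vs))
    (swap θ (pol v) (θ CK.^ length vs) (ΣM.∑ vs pol)) where
    swap : ∀ a b c e → (a ⊠ b) ⊠ (c ⊠ e) ~ (a ⊠ c) ⊠ (b ⊠ e)
    swap a b c e = ≈⇒~ (CS.interchange a b c e) where
     import Algebra.Properties.CommutativeSemigroup
     module CS = Algebra.Properties.CommutativeSemigroup P.*-commutativeSemigroup

   ∏-≁0 : ∀ (vs : List (Vec F d)) → (∀ {v} → v ∈ vs → ¬ (pol v ~ [])) → ¬ (ΣM.∑ vs pol ~ [])
   ∏-≁0 [] h = 1≁0
   ∏-≁0 (v ∷ vs) h e = [ h (here refl) , ∏-≁0 vs (λ z → h (there z)) ]′ (domain (pol v) (ΣM.∑ vs pol) e)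

  -- Fermat's theorem in the residue field: multiplication by θ permutes the nonzero residues.
  residue-fermat : ∀ θ → ¬ (θ ~ []) → θ CK.^ (p N.^ d) ~ θ
  residue-fermat θ θ≁0 = subst (λ n → θ CK.^ n ~ θ) length-nonzero
   (K.trans (K.*-congˡ {θ} (cancel Π (θ CK.^ length nonzero) one (∏-≁0 nonzero nonzero-≁) fixed)) (K.*-identityʳ θ)) where
   Π = ΣM.∑ nonzero pol
   θ⁻¹ = fst (invert θ θ≁0)
   g : Vec F d → Vec F d
   g v = reduce (θ ⊠ pol v)
   into : ∀ {v} → v ∈ nonzero → g v ∈ nonzero
   into {v} v∈ = ∈-nonzero λ e → go (domain θ (pol v) (K.trans (K.sym (reduce-~ _)) (K.trans (K.reflexive (cong pol e)) (≈⇒~ pol-0ᵛ)))) where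
    go : θ ~ [] ⊎ pol v ~ [] → ⊥
    go (inj₁ a) = θ≁0 a
    go (inj₂ b) = nonzero-≁ v∈ b
   inj : ∀ {u v} → u ∈ nonzero → v ∈ nonzero → g u ≡ g v → u ≡ v
   inj {u} {v} _ _ e = pol-~-injective u v (cancel θ (pol u) (pol v) θ≁0
    (K.trans (K.sym (reduce-~ _)) (K.trans (K.reflexive (cong pol e)) (reduce-~ _))))
   undo : ∀ v → θ ⊠ pol (reduce (θ⁻¹ ⊠ pol v)) ~ pol v
   undo v = K.trans (K.*-congˡ {θ} (reduce-~ (θ⁻¹ ⊠ pol v))) (K.trans (K.sym (K.*-assoc θ θ⁻¹ (pol v)))
    (K.trans (K.*-congʳ {pol v} (snd (invert θ θ≁0))) (K.*-identityˡ (pol v))))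
   sur : ∀ {v} → v ∈ nonzero → Σ (Vec F d) λ u → u ∈ nonzero × g u ≡ v
   sur {v} v∈ = u , ∈-nonzero (λ e → nonzero-≁ v∈ (K.trans (K.sym (undo v)) (K.trans (K.*-congˡ {θ} (K.trans (K.reflexive (cong pol e)) (≈⇒~ pol-0ᵛ))) (K.zeroʳ θ)))) ,
     pol-~-injective (g u) v (K.trans (reduce-~ (θ ⊠ pol u)) (undo v))
    where u = reduce (θ⁻¹ ⊠ pol v)
   fixed : Π ⊠ θ CK.^ length nonzero ~ Π ⊠ one
   fixed = K.trans (K.*-comm Π _) (K.trans (K.sym (∏-scale θ nonzero)) (K.trans (ΣM.∑-cong nonzero (λ v → K.sym (reduce-~ (θ ⊠ pol v))))
    (K.trans (K.sym (ΣM.∑-reindex g pol nonzero-unique nonzero-unique into inj sur)) (K.sym (K.*-identityʳ Π)))))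

  -- Substituting g in the factorisation of X^p - X shows that g^p - g is the product of all g - c,
  -- and the residue field has no zero divisors.
  fixed⇒constant : ∀ g → g CK.^ p ~ g → ∃ λ c → g ~ constant c
  fixed⇒constant g h = split elems (K.trans (K.sym (≈⇒~ (frobenius-minus-id g))) (K.trans (K.+-congʳ {⊟ g} (subst (_~ g) (sym (^-same g p)) h)) (K.-‿inverseʳ g))) where
   split : ∀ xs → productOf (map (λ c → 1 , (⊝ c) ∷ []) xs) ∘ₚ g ~ [] → ∃ λ c → g ~ constant c
   split [] e = ⊥-elim (1≁0 (K.trans (K.sym (≈⇒~ (X^-∘ₚ 0 g))) e))
   split (x ∷ xs) e = [ (λ a → x , K.trans (≈⇒~ (I.id2 g (constant x))) (K.trans (K.+-congʳ {constant x} a) (K.+-identityˡ (constant x)))) , split xs ]′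
     (domain (g ⊞ ⊟ constant x) (rest ∘ₚ g) (K.trans (≈⇒~ (P.trans (P.*-congʳ {rest ∘ₚ g} (P.sym (linear-∘ₚ x g))) (P.sym (∘ₚ-⊠ (mon ((⊝ x) ∷ [])) rest g)))) e))
    where rest = productOf (map (λ c → 1 , (⊝ c) ∷ []) xs)

 module TraceForm (a : F) where

  -- Minus the sum of the roots; in degree 0 this is the empty sum.
  subtop : ∀ {n} → Vec F n → F
  subtop {zero} v = 𝟘
  subtop {suc n} v = coef (mon v) n

  -- The value of f' / f at 0, which is minus the sum of the inverse roots.
  logDerivative : ∀ {n} → Vec F n → F
  logDerivative v = coef (mon v) 1 ⊗ coef (mon v) 0 ⁻¹

  -- For f = ∏ (X - z), this is ∑ (z + a / z).
  τ : ∀ {n} → Vec F n → F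
  τ v = ⊝ (subtop v ⊕ a ⊗ logDerivative v)

 module Trace {d : ℕ} (P : Vec F d) (i : Irr P) (c₀≢0 : coef (mon P) 0 ≢ 𝟘) where
  open ResidueField P i
  private
   module PK = Poly quotientRing
   module PPK = CommutativeRing PK.polyRing
   module LK = LinearFactors quotientRing
  open FrobK

  frobeniusHom : Hom quotientRing quotientRing
  frobeniusHom = record
   { fun = λ x → x CK.^ p
   ; cong = CK.^-congˡ p
   ; homo-+ = CK.frobenius-+ charK
   ; homo-* = λ x y → CK.^-distrib-* x y p
   ; homo-0 = frobenius-0
   ; homo-1 = 1^ p
   }

  constantHomK : Hom residueRing quotientRing
  constantHomK = record
   { fun = constant
   ; cong = λ e → ≈⇒~ (Hom.cong constantHom e)
   ; homo-+ = λ x y → ≈⇒~ (constant-+ x y)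
   ; homo-* = λ x y → ≈⇒~ (constant-* x y)
   ; homo-0 = ≈⇒~ constant-0
   ; homo-1 = K.refl
   }
  private
   module φ = PolyMap frobeniusHom
   module ι = PolyMap constantHomK

  X≁0 : ¬ (X ~ [])
  X≁0 h = go (2 N.≤? d) where
   P∣X = ~⇒∣ₚ h
   go : Dec (2 N.≤ d) → ⊥
   go (yes 2≤d) = monic-≢0 monic-X (∣ₚ-below (mon-monic P) (below-mono 2≤d (below monic-X)) P∣X)
   go (no ¬2≤d) = c₀≢0 (sym (at (monic-∣ₚ-monic (subst (λ n → Monic n (mon P)) d≡1 (mon-monic P)) monic-X P∣X) 0)) where
    d≡1 : d ≡ 1
    d≡1 = NP.≤-antisym (NP.≤-pred (NP.≰⇒> ¬2≤d)) (positive i)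

  X⁻¹ : Pol
  X⁻¹ = fst (invert X X≁0)

  conj conj⁻¹ : ℕ → Pol
  conj j = X CK.^ (p N.^ j)
  conj⁻¹ j = X⁻¹ CK.^ (p N.^ j)

  conj-inverse : ∀ j → conj j ⊠ conj⁻¹ j ~ one
  conj-inverse j = K.trans (K.sym (CK.^-distrib-* X X⁻¹ (p N.^ j))) (K.trans (CK.^-congˡ (p N.^ j) (snd (invert X X≁0))) (1^ (p N.^ j)))

  conj-suc : ∀ j → conj j CK.^ p ~ conj (suc j)
  conj-suc j = K.sym (^-p^suc X j)

  periodic : ∀ θ → ¬ (θ ~ []) → ∀ j → θ CK.^ (p N.^ (d N.+ j)) ~ θ CK.^ (p N.^ j)
  periodic θ θ≁0 j = K.trans (K.reflexive (cong (θ CK.^_) (NP.^-distribˡ-+-* p d j)))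
   (K.trans (K.sym (CK.^-assocʳ θ (p N.^ d) (p N.^ j))) (CK.^-congˡ (p N.^ j) (residue-fermat θ θ≁0)))

  -- The characteristic polynomial of the class of X, built from its conjugates. Frobenius permutes
  -- the factors, so the coefficients are fixed and hence constants; the polynomial over the prime
  -- field so obtained is monic of degree d and vanishes at X, so it is P. Traces can then be read
  -- off the coefficients of P.
  Γ : PK.Pol
  Γ = LK.∏linear d conj

  private
   φG : φ.polyMap Γ PK.≋ Γ
   φG = PPK.trans (polyMap-∏linear frobeniusHom d conj)
    (PPK.trans (LK.∏linear-cong d conj-suc)
     (LK.∏linear-rotate d conj (K.trans (K.reflexive (cong conj (sym (NP.+-identityʳ d)))) (periodic X X≁0 0))))

   coefficient : ∀ k → ∃ λ c → PK.coef Γ k ~ constant c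
   coefficient k = fixed⇒constant (PK.coef Γ k) (K.trans (K.sym (φ.coef-polyMap Γ k)) (PK.at φG k))

   build : ∀ n → (ℕ → F) → Vec F n
   build zero c = []
   build (suc n) c = c 0 ∷ build n (λ k → c (suc k))

   coef-build : ∀ n c k → k N.< n → coef (mon (build n c)) k ≡ c k
   coef-build (suc n) c zero _ = refl
   coef-build (suc n) c (suc k) (N.s≤s k<n) = coef-build n _ k k<n

   Q : Vec F d
   Q = build d (λ k → fst (coefficient k))

   G≋Q : Γ PK.≋ ι.polyMap (mon Q)
   G≋Q = PK.mk λ k → K.trans (go k (NP.<-cmp k d)) (K.sym (ι.coef-polyMap (mon Q) k)) where
    open import Relation.Binary.Definitions using (Tri; tri<; tri≈; tri>)
    go : ∀ k → Tri (k N.< d) (k ≡ d) (d N.< k) → PK.coef Γ k ~ constant (coef (mon Q) k)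
    go k (tri< k<d _ _) = K.trans (snd (coefficient k)) (K.reflexive (cong constant (sym (coef-build d _ k k<d))))
    go k (tri≈ _ refl _) = K.trans (PK.lead (LK.∏linear-monic d conj)) (K.reflexive (cong constant (sym (lead (mon-monic Q)))))
    go k (tri> _ _ d<k) = K.trans (PK.vanish (PK.below (LK.∏linear-monic d conj)) k d<k)
     (K.trans (K.sym (≈⇒~ constant-0)) (K.reflexive (cong constant (sym (vanish (below (mon-monic Q)) k d<k)))))

   eval-root : ∀ f → PK.eval (ι.polyMap f) X ≋ f
   eval-root [] = P.refl
   eval-root (c ∷ f) = P.trans (P.+-congˡ {constant c} (P.trans (P.*-congˡ {X} (eval-root f)) (X⊠ f)))
    (P.trans (∷-⊞-∷ c [] 𝟘 f) (∷-cong (F.+-identityʳ c) (P.+-identityˡ f)))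

   evalG : ∀ n → 1 N.≤ n → PK.eval (LK.∏linear n conj) X ~ []
   evalG (suc n) _ = K.trans (K.sym (eval-at (LK.∏linear (suc n) conj) (K.*-identityʳ X))) (LK.eval-∏linear n conj) where
    eval-at : ∀ f {x y} → x ~ y → PK.eval f x ~ PK.eval f y
    eval-at [] e = K.refl
    eval-at (b ∷ f) e = K.+-congˡ {b} (K.*-cong e (eval-at f e))

   Q≋P : mon Q ≋ mon P
   Q≋P = monic-∣ₚ-monic (mon-monic P) (mon-monic Q) (~⇒∣ₚ (K.trans (K.sym (≈⇒~ (eval-root (mon Q))))
    (K.trans (K.sym (PK.eval-cong Γ (ι.polyMap (mon Q)) X G≋Q)) (evalG d (positive i)))))

  coef-G : ∀ k → PK.coef Γ k ~ constant (coef (mon P) k)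
  coef-G k = K.trans (PK.at G≋Q k) (K.trans (ι.coef-polyMap (mon Q) k) (K.reflexive (cong constant (at Q≋P k))))

  private
   neg-swap : ∀ {x y} → x ~ ⊟ y → y ~ ⊟ x
   neg-swap {x} {y} e = K.trans (K.sym (KR.-‿involutive y)) (K.-‿cong (K.sym e)) where
    import Algebra.Properties.Ring
    module KR = Algebra.Properties.Ring K.ring

  module _ (a : F) where
   open TraceForm a

   ∑conj : LK.∑ℕ d conj ~ constant (⊝ subtop P)
   ∑conj = go d P (positive i) coef-G where
    go : ∀ n (v : Vec F n) → 1 N.≤ n → (∀ k → PK.coef (LK.∏linear n conj) k ~ constant (coef (mon v) k)) → LK.∑ℕ n conj ~ constant (⊝ subtop v)
    go (suc n) v _ h = K.trans (neg-swap (K.trans (K.sym (h n)) (LK.∏linear-subtop n conj))) (K.sym (≈⇒~ (constant-neg (subtop v))))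

   ∑conj⁻¹ : LK.∑ℕ d conj⁻¹ ~ constant (⊝ logDerivative P)
   ∑conj⁻¹ = K.trans (K.sym (K.*-identityˡ _)) (K.trans (K.*-congʳ {s} (K.trans (≈⇒~ (Hom.cong constantHom (sym (trans (F.*-comm _ _) (⁻¹-inverse c₀≢0))))) (≈⇒~ (constant-* (c₀ ⁻¹) c₀))))
     (K.trans (K.*-assoc (constant (c₀ ⁻¹)) (constant c₀) s) (K.trans (K.*-congˡ {constant (c₀ ⁻¹)} rel)
      (K.trans (K.sym (≈⇒~ (constant-* (c₀ ⁻¹) (⊝ c₁)))) (≈⇒~ (Hom.cong constantHom (trans (sym (FR.-‿distribʳ-* _ _)) (cong ⊝_ (F.*-comm _ _))))))))) where
    import Algebra.Properties.Ring
    s = LK.∑ℕ d conj⁻¹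
    c₀ = coef (mon P) 0
    c₁ = coef (mon P) 1
    rel : constant c₀ ⊠ s ~ constant (⊝ c₁)
    rel = K.trans (neg-swap (K.trans (K.sym (coef-G 1)) (K.trans (LK.∏linear-coef₁ d conj conj⁻¹ conj-inverse) (K.-‿cong (K.*-congʳ {s} (coef-G 0))))))
     (K.sym (≈⇒~ (constant-neg c₁)))

   summand : ℕ → Pol
   summand j = conj j ⊞ constant a ⊠ conj⁻¹ j

   trace : LK.∑ℕ d summand ~ constant (τ P)
   trace = K.trans (LK.∑ℕ-+ d conj (λ j → constant a ⊠ conj⁻¹ j)) (K.trans (K.+-cong ∑conj (K.trans (LK.∑ℕ-* d (constant a) conj⁻¹) (K.*-congˡ {constant a} ∑conj⁻¹)))
    (≈⇒~ (P.trans (P.+-congˡ {constant (⊝ subtop P)} (P.sym (constant-* a (⊝ logDerivative P)))) (P.trans (P.sym (constant-+ _ _))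
     (Hom.cong constantHom (trans (cong (⊝ subtop P ⊕_) (sym (FR.-‿distribʳ-* a (logDerivative P)))) (FR.-‿+-comm (subtop P) _)))))))

   X⁻¹≁0 : ¬ (X⁻¹ ~ [])
   X⁻¹≁0 h = 1≁0 (K.trans (K.sym (snd (invert X X≁0))) (K.trans (K.*-congˡ {X} h) (K.zeroʳ X)))

   -- The conjugates repeat with period d, so a sum of j d of them runs j times through the cycle.
   -- This is the trace from the extension with p^(j d) elements, which is never constructed.
   trace-multiple : ∀ j → LK.∑ℕ (j N.* d) summand ~ constant (⟦ + j ⟧ ⊗ τ P)
   trace-multiple zero = K.trans (K.sym (≈⇒~ constant-0)) (≈⇒~ (Hom.cong constantHom (sym (F.zeroˡ _))))
   trace-multiple (suc j) = K.trans (LK.∑ℕ-split d (j N.* d) summand)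
    (K.trans (K.+-cong trace (K.trans (LK.∑ℕ-cong (j N.* d) (λ k → K.+-cong (periodic X X≁0 k) (K.*-congˡ {constant a} (periodic X⁻¹ X⁻¹≁0 k)))) (trace-multiple j)))
     (≈⇒~ (P.trans (P.sym (constant-+ _ _)) (Hom.cong constantHom (trans (cong (_⊕ ⟦ + j ⟧ ⊗ τ P) (sym (F.*-identityˡ _)))
      (trans (sym (F.distribʳ (τ P) 𝟙ᶠ ⟦ + j ⟧)) (cong (_⊗ τ P) (⟦⟧-⊕ (+ 1) (+ j)))))))))

   X^q : ∀ j → X CK.^ (p N.^ (j N.* d)) ~ X
   X^q zero = K.*-identityʳ X
   X^q (suc j) = K.trans (periodic X X≁0 (j N.* d)) (X^q j)

 -- Stepanov's method for the trace of u + a / u.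

 module Stepanov (a t : F) (μ : ℕ) where
  open TraceForm a
  private
   module LP = LinearFactors polyRing
   module ST = StepanovTerm polyRing
   module FG = Algebra.Properties.Group F.+-group

  comb : ∀ {n} → Vec F n → (ℕ → Pol) → Pol
  comb [] f = []
  comb (c ∷ v) f = constant c ⊠ f 0 ⊞ comb v (λ m → f (suc m))

  infixl 6 _⊖_
  _⊖_ : ∀ {n} → Vec F n → Vec F n → Vec F n
  [] ⊖ [] = []
  (x ∷ u) ⊖ (y ∷ v) = (x ⊕ ⊝ y) ∷ (u ⊖ v)

  comb-⊖ : ∀ {n} (u v : Vec F n) f → comb (u ⊖ v) f ≋ comb u f ⊞ ⊟ comb v f
  comb-⊖ [] [] f = P.sym (P.-‿inverseʳ [])
  comb-⊖ (x ∷ u) (y ∷ v) f = P.trans (P.+-cong (P.*-congʳ {f 0} (P.trans (constant-+ x (⊝ y)) (P.+-congˡ {constant x} (constant-neg y)))) (comb-⊖ u v (λ m → f (suc m))))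
   (ST.combine (constant x) (constant y) (f 0) (comb u (λ m → f (suc m))) (comb v (λ m → f (suc m))))

  ⊖-zero : ∀ {n} (u v : Vec F n) → (∀ m → coef (pol (u ⊖ v)) m ≡ 𝟘) → u ≡ v
  ⊖-zero [] [] h = refl
  ⊖-zero (x ∷ u) (y ∷ v) h = cong₂ _∷_ (FG.x∙y⁻¹≈ε⇒x≈y x y (h 0)) (⊖-zero u v (λ m → h (suc m)))

  data CombLeading {n} (v : Vec F n) (D : ℕ) (h : Pol) : Set where
   allZero : (∀ m → coef (pol v) m ≡ 𝟘) → h ≋ [] → CombLeading v D h
   atIndex : ∀ e → e N.< n → Below (suc (D N.+ e)) h → coef h (D N.+ e) ≢ 𝟘 → CombLeading v D h

  combLeading : ∀ {n} (v : Vec F n) D f → (∀ m → Monic (D N.+ m) (f m)) → CombLeading v D (comb v f)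
  combLeading [] D f mon = allZero (λ _ → refl) P.refl
  combLeading {suc n} (c ∷ v) D f mon = go (combLeading v (suc D) (λ m → f (suc m)) (λ m → subst (λ k → Monic k (f (suc m))) (NP.+-suc D m) (mon (suc m)))) (c Fin.≟ 𝟘) where
   h' = comb v (λ m → f (suc m))
   cf = constant c ⊠ f 0
   m₀ : Monic D (f 0)
   m₀ = subst (λ k → Monic k (f 0)) (NP.+-identityʳ D) (mon 0)
   cf-below : Below (suc D) cf
   cf-below = below-resp (P.sym ([ c ]⊠ (f 0))) (below-⋆ c (below m₀))
   go : CombLeading v (suc D) h' → Dec (c ≡ 𝟘) → CombLeading (c ∷ v) D (cf ⊞ h')
   go (allZero z hz) (yes c≡0) = allZero (λ { zero → c≡0 ; (suc m) → z m })
    (P.trans (P.+-cong (P.trans (P.*-congʳ {f 0} (P.trans (Hom.cong constantHom c≡0) constant-0)) (P.zeroˡ (f 0))) hz) (P.+-identityˡ []))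
   go (allZero z hz) (no c≢0) = atIndex 0 (N.s≤s N.z≤n)
    (below-⊞ (subst (λ k → Below (suc k) cf) (sym (NP.+-identityʳ D)) cf-below) (below-resp {f = []} (P.sym hz) (mk λ _ _ → refl)))
    λ e → c≢0 (trans (sym (trans (coef-⊞ cf h' (D N.+ 0)) (trans (cong₂ _⊕_ top (at hz (D N.+ 0))) (F.+-identityʳ c)))) e) where
    top : coef cf (D N.+ 0) ≡ c
    top = trans (cong (coef cf) (NP.+-identityʳ D)) (trans (at ([ c ]⊠ (f 0)) D) (trans (coef-⋆ c (f 0) D) (trans (cong (c ⊗_) (lead m₀)) (F.*-identityʳ c))))
   go (atIndex e e<n b c≢0) _ = atIndex (suc e) (N.s≤s e<n)
    (subst (λ k → Below (suc k) (cf ⊞ h')) (sym (NP.+-suc D e)) (below-⊞ (below-mono (N.s≤s (NP.m≤n⇒m≤1+n (NP.m≤m+n D e))) cf-below) b))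
    λ z → c≢0 (trans (sym (trans (coef-⊞ cf h' (suc (D N.+ e))) (trans (cong (_⊕ coef h' (suc (D N.+ e))) (vanish cf-below (suc (D N.+ e)) (N.s≤s (NP.m≤m+n D e)))) (F.+-identityˡ _))))
        (trans (cong (coef (cf ⊞ h')) (sym (NP.+-suc D e))) z))

  comb-below : ∀ {n} M (v : Vec F n) f → (∀ m → m N.< n → Below M (f m)) → Below M (comb v f)
  comb-below M [] f b = mk λ _ _ → refl
  comb-below M (c ∷ v) f b = below-⊞ (below-resp (P.sym ([ c ]⊠ (f 0))) (below-⋆ c (b 0 (N.s≤s N.z≤n)))) (comb-below M v _ (λ m m<n → b (suc m) (N.s≤s m<n)))

  -- The points lie in the field with r² elements. `N` is the number of free coefficients, `D₀ + N`
  -- bounds the degree of the auxiliary polynomial, and `M` bounds the degree left after its r-th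
  -- power is reduced. The 4 in `Κ` is the least number that gives M < N when p = 2 and Λ = 1.
  ν Λ r Κ N M D₀ : ℕ
  ν = suc μ
  Λ = p N.^ μ
  r = p N.^ ν
  Κ = Λ N.+ 4
  N = Κ N.* r
  M = Λ N.* r N.+ r N.+ Κ
  D₀ = (p N.∸ 1) N.* Λ

  instance
   Λ≢0 : N.NonZero Λ
   Λ≢0 = NP.m^n≢0 p μ

  -- X^Λ times the conjugate X^(p^j) + a X^(-p^j). For j below `ν` one has p^j ≤ Λ, so the truncated
  -- subtraction is a true one and the denominators are cleared.
  Wterm : ℕ → Pol
  Wterm j = X ^ₚ (Λ N.+ p N.^ j) ⊞ constant a ⊠ X ^ₚ (Λ N.∸ p N.^ j)

  Ξ W Y : Pol
  Ξ = X ^ₚ Λ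
  W = LP.∑ℕ ν Wterm
  Y = constant t ⊠ Ξ ⊞ ⊟ W

  -- In mixed radix m = l + Λ (i + p k) with l < Λ and i < p. The exponents make `H m` monic of
  -- degree D₀ + m, so nontrivial combinations of the `H m` cannot vanish. Filling up with Ξ^(p-1-i)
  -- makes the factor between the r-th power of `H m` and `Z m` independent of m.
  H Z : ℕ → Pol
  H m = X ^ₚ (m % Λ N.+ (m / Λ) / p N.* r) ⊠ (Ξ ^ₚ (p N.∸ 1 N.∸ (m / Λ) % p) ⊠ W ^ₚ ((m / Λ) % p))
  Z m = X ^ₚ (m % Λ N.* r N.+ (m / Λ) / p) ⊠ (Ξ ^ₚ (p N.∸ 1 N.∸ (m / Λ) % p) ⊠ Y ^ₚ ((m / Λ) % p))

  private
   1<p : 1 N.< p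
   1<p = N.nonTrivial⇒n>1 p {{prime⇒nonTrivial pr}}

   p^j≤Λ : ∀ {j} → j N.≤ μ → p N.^ j N.≤ Λ
   p^j≤Λ j≤μ = NP.^-monoʳ-≤ p j≤μ

   X^-below : ∀ {k n} → k N.≤ n → Below (suc n) (X ^ₚ k)
   X^-below k≤n = below-mono (N.s≤s k≤n) (below (monic-X^ _))

   aX^-below : ∀ {k n} → k N.≤ n → Below (suc n) (constant a ⊠ X ^ₚ k)
   aX^-below {k} k≤n = below-resp (P.sym ([ a ]⊠ (X ^ₚ k))) (below-⋆ a (X^-below k≤n))

   partial-below : ∀ n g b → (∀ j → j N.< n → Below b (g j)) → Below b (LP.∑ℕ n g)
   partial-below zero g b h = mk λ _ _ → refl
   partial-below (suc n) g b h = below-⊞ (h 0 (N.s≤s N.z≤n)) (partial-below n _ b (λ j j<n → h (suc j) (N.s≤s j<n)))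

  W-monic : Monic (Λ N.+ Λ) W
  W-monic = monic-resp (P.trans (P.+-comm _ _) (P.trans (P.+-congˡ {LP.∑ℕ μ g} (P.trans (P.sym (P.+-identityʳ _)) (P.+-congʳ {[]} (P.reflexive (cong g (sym (NP.+-identityʳ μ)))))))
    (P.trans (P.sym (LP.∑ℕ-split μ 1 g)) (P.reflexive (cong (λ n → LP.∑ℕ n g) (NP.+-comm μ 1))))))
   (monic-⊞ (monic-⊞ (monic-X^ (Λ N.+ Λ)) low) (partial-below μ g (Λ N.+ Λ) λ j j<μ → below-⊞
    (below-mono (NP.+-monoʳ-< Λ (NP.^-monoʳ-< p 1<p j<μ)) (below (monic-X^ (Λ N.+ p N.^ j)))) (lowj j))) where
   g = Wterm
   lowj : ∀ j → Below (Λ N.+ Λ) (constant a ⊠ X ^ₚ (Λ N.∸ p N.^ j))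
   lowj j = below-mono (NP.≤-trans (NP.≤-reflexive (NP.+-comm 1 Λ)) (NP.+-monoʳ-≤ Λ (N.>-nonZero⁻¹ Λ))) (aX^-below (NP.m∸n≤m Λ (p N.^ j)))
   low = lowj μ

  private
   i≤p-1 : ∀ m → (m / Λ) % p N.≤ p N.∸ 1
   i≤p-1 m = NP.≤-pred (subst (suc ((m / Λ) % p) N.≤_) (sym (NP.m+[n∸m]≡n (NP.<⇒≤ 1<p))) (m%n<n (m / Λ) p))

  H-monic : ∀ m → Monic (D₀ N.+ m) (H m)
  H-monic m = subst (λ k → Monic k (H m)) deg
   (monic-⊠ (monic-X^ (l N.+ k N.* r)) (monic-⊠ (monic-^ b (monic-X^ Λ)) (monic-^ i W-monic))) where
   l = m % Λ
   k = (m / Λ) / p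
   i = (m / Λ) % p
   b = p N.∸ 1 N.∸ i
   deg : l N.+ k N.* r N.+ (b N.* Λ N.+ i N.* (Λ N.+ Λ)) ≡ D₀ N.+ m
   deg = trans (lem l k p Λ b i) (cong₂ (λ u v → u N.* Λ N.+ v) (NP.m∸n+n≡m (i≤p-1 m))
    (trans (cong (λ z → l N.+ z N.* Λ) (sym (m≡m%n+[m/n]*n (m / Λ) p))) (sym (m≡m%n+[m/n]*n m Λ)))) where
    lem : ∀ l k p Λ b i → l N.+ k N.* (p N.* Λ) N.+ (b N.* Λ N.+ i N.* (Λ N.+ Λ)) ≡ (b N.+ i) N.* Λ N.+ (l N.+ (i N.+ k N.* p) N.* Λ)
    lem = solveℕ

  Z-below : ∀ m → m N.< N → Below M (Z m)
  Z-below m m<N = below-mono bound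
   (below-⊠ (below (monic-X^ (l N.* r N.+ k))) (below-⊠ (below (monic-^ b (monic-X^ Λ))) (below-^ i Y-below))) where
   l = m % Λ
   k = (m / Λ) / p
   i = (m / Λ) % p
   b = p N.∸ 1 N.∸ i
   Y-below : Below (suc (Λ N.+ Λ)) Y
   Y-below = below-⊞ (below-resp (P.sym ([ t ]⊠ Ξ)) (below-⋆ t (X^-below (NP.m≤m+n Λ Λ)))) (below-⊟ (below W-monic))
   k<Κ : k N.< Κ
   k<Κ = NP.*-cancelʳ-< r k Κ (NP.≤-<-trans (subst (k N.* r N.≤_) (sym (trans (m≡m%n+[m/n]*n m Λ) (trans (cong (λ z → l N.+ z N.* Λ) (m≡m%n+[m/n]*n (m / Λ) p)) (lem l i k p Λ)))) (NP.m≤n+m _ _)) m<N) where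
    lem : ∀ l i k p Λ → l N.+ (i N.+ k N.* p) N.* Λ ≡ l N.+ i N.* Λ N.+ k N.* (p N.* Λ)
    lem = solveℕ
   bound : suc (l N.* r N.+ k N.+ (b N.* Λ N.+ i N.* (Λ N.+ Λ))) N.≤ M
   bound = begin
    suc (l N.* r N.+ k N.+ (b N.* Λ N.+ i N.* (Λ N.+ Λ)))   ≡⟨ lem1 (l N.* r) k b i Λ ⟩
    l N.* r N.+ (suc k N.+ ((b N.+ i) N.* Λ N.+ i N.* Λ))    ≤⟨ NP.+-monoʳ-≤ (l N.* r) (NP.+-mono-≤ k<Κ (NP.+-mono-≤ (NP.*-monoˡ-≤ Λ b+i≤p) (NP.*-monoˡ-≤ Λ i≤p))) ⟩
    l N.* r N.+ (Κ N.+ (r N.+ r))                              ≡⟨ lem2 l r Κ ⟩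
    suc l N.* r N.+ r N.+ Κ                                    ≤⟨ NP.+-monoˡ-≤ Κ (NP.+-monoˡ-≤ r (NP.*-monoˡ-≤ r (m%n<n m Λ))) ⟩
    M                                                          ∎ where
    open NP.≤-Reasoning
    i≤p : i N.≤ p
    i≤p = NP.<⇒≤ (m%n<n (m / Λ) p)
    b+i≤p : b N.+ i N.≤ p
    b+i≤p = NP.≤-trans (NP.≤-reflexive (NP.m∸n+n≡m (i≤p-1 m))) (NP.m∸n≤m p 1)
    lem1 : ∀ x k b i Λ → suc (x N.+ k N.+ (b N.* Λ N.+ i N.* (Λ N.+ Λ))) ≡ x N.+ (suc k N.+ ((b N.+ i) N.* Λ N.+ i N.* Λ))
    lem1 = solveℕ
    lem2 : ∀ l r K → l N.* r N.+ (K N.+ (r N.+ r)) ≡ suc l N.* r N.+ r N.+ K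
    lem2 = solveℕ

  M<N : M N.< N
  M<N = begin-strict
   Λ N.* r N.+ r N.+ (Λ N.+ 4)             ≤⟨ NP.+-monoʳ-≤ (Λ N.* r N.+ r) (NP.+-monoʳ-≤ Λ (NP.*-monoʳ-≤ 4 (N.>-nonZero⁻¹ Λ))) ⟩
   Λ N.* r N.+ r N.+ (Λ N.+ 4 N.* Λ)       <⟨ NP.+-monoʳ-< (Λ N.* r N.+ r) (NP.+-monoˡ-< (4 N.* Λ) (NP.m<m*n Λ 2 (NP.≤-refl))) ⟩
   Λ N.* r N.+ r N.+ (Λ N.* 2 N.+ 4 N.* Λ) ≡⟨ lem1 (Λ N.* r) r Λ ⟩
   Λ N.* r N.+ r N.+ 3 N.* (2 N.* Λ)       ≤⟨ NP.+-monoʳ-≤ (Λ N.* r N.+ r) (NP.*-monoʳ-≤ 3 (NP.*-monoˡ-≤ Λ 1<p)) ⟩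
   Λ N.* r N.+ r N.+ 3 N.* r               ≡⟨ lem2 Λ r ⟩
   (Λ N.+ 4) N.* r                         ∎ where
   open NP.≤-Reasoning
   lem1 : ∀ x r L → x N.+ r N.+ (L N.* 2 N.+ 4 N.* L) ≡ x N.+ r N.+ 3 N.* (2 N.* L)
   lem1 = solveℕ
   lem2 : ∀ L r → L N.* r N.+ r N.+ 3 N.* r ≡ (L N.+ 4) N.* r
   lem2 = solveℕ

  module _ {d : ℕ} (Q : Vec F d) (iQ : Irr Q) (c₀≢0 : coef (mon Q) 0 ≢ 𝟘) (j : ℕ) (jd : j N.* d ≡ ν N.+ ν) (jτ : ⟦ + j ⟧ ⊗ τ Q ≡ t) where
   open Trace Q iQ c₀≢0
   open ResidueField Q iQ using (quotientRing; module K; module CK; module FrobK; _~_; ≈⇒~; ~⇒∣ₚ; ^-same; invert; constant-fixed; domain; 1≁0)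
   private
    module LK = LinearFactors quotientRing
    module SK = StepanovTerm quotientRing

    ∑-same : ∀ n z → LP.∑ℕ n z ≡ LK.∑ℕ n z
    ∑-same zero z = refl
    ∑-same (suc n) z = cong (z 0 ⊞_) (∑-same n _)

    w : Pol
    w = LK.∑ℕ ν (summand a)

    r' = N.pred r

    r≡ : suc r' ≡ r
    r≡ = NP.suc-pred r {{NP.m^n≢0 p ν}}

    Ξ≡ : Ξ ≡ X CK.^ Λ
    Ξ≡ = ^-same X Λ

    X^-split : ∀ m n → X CK.^ m ⊠ X CK.^ n ~ X ^ₚ (m N.+ n)
    X^-split m n = K.trans (K.sym (CK.^-homo-* X m n)) (K.reflexive (sym (^-same X (m N.+ n))))

    -- W = Ξ w, because X^(Λ - p^k) is Ξ times the p^k-th power of the inverse of X.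
    W~ : W ~ Ξ ⊠ w
    W~ = K.trans (K.reflexive (∑-same ν Wterm)) (K.trans (LK.∑ℕ-cong< ν (λ k k<ν → term k (NP.≤-pred k<ν))) (LK.∑ℕ-* ν Ξ (summand a))) where
     term : ∀ k → k N.≤ μ → X ^ₚ (Λ N.+ p N.^ k) ⊞ constant a ⊠ X ^ₚ (Λ N.∸ p N.^ k) ~ Ξ ⊠ summand a k
     term k k≤μ = K.trans (K.+-cong up (K.*-congˡ {constant a} down)) (K.trans (K.+-congˡ (swap (constant a) Ξ (conj⁻¹ k))) (K.sym (K.distribˡ Ξ (conj k) (constant a ⊠ conj⁻¹ k)))) where
      swap : ∀ x y z → x ⊠ (y ⊠ z) ~ y ⊠ (x ⊠ z)
      swap x y z = ≈⇒~ (CS.x∙yz≈y∙xz x y z) where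
       module CS = Algebra.Properties.CommutativeSemigroup P.*-commutativeSemigroup
      up : X ^ₚ (Λ N.+ p N.^ k) ~ Ξ ⊠ conj k
      up = K.trans (K.sym (X^-split Λ (p N.^ k))) (K.reflexive (cong (_⊠ conj k) (sym Ξ≡)))
      e = Λ N.∸ p N.^ k
      down : X ^ₚ e ~ Ξ ⊠ conj⁻¹ k
      down = K.trans (K.sym (K.*-identityʳ (X ^ₚ e))) (K.trans (K.*-congˡ {X ^ₚ e} (K.sym (conj-inverse k)))
       (K.trans (K.sym (K.*-assoc (X ^ₚ e) (conj k) (conj⁻¹ k))) (K.*-congʳ {conj⁻¹ k}
        (K.trans (K.reflexive (cong (_⊠ conj k) (^-same X e))) (K.trans (X^-split e (p N.^ k)) (K.reflexive (cong (X ^ₚ_) (NP.m∸n+n≡m (p^j≤Λ k≤μ)))))))))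

    power-shift : ∀ x k → (x CK.^ (p N.^ k)) CK.^ r ~ x CK.^ (p N.^ (ν N.+ k))
    power-shift x k = K.trans (CK.^-assocʳ x (p N.^ k) r) (K.reflexive (cong (x CK.^_)
     (trans (NP.*-comm (p N.^ k) r) (sym (NP.^-distribˡ-+-* p ν k)))))

    constant^r : ∀ c → constant c CK.^ r ~ constant c
    constant^r c = FrobK.fixed^ (constant c) ν (constant-fixed c)

    ∑ℕ-frobenius : ∀ n z → LK.∑ℕ n z CK.^ r ~ LK.∑ℕ n (λ k → z k CK.^ r)
    ∑ℕ-frobenius zero z = FrobK.frobenius^-0 ν
    ∑ℕ-frobenius (suc n) z = K.trans (FrobK.frobenius^-+ ν (z 0) _) (K.+-congˡ {z 0 CK.^ r} (∑ℕ-frobenius n _))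

    -- The 2 ν conjugates fall into the first ν, whose sum is w, and the r-th powers of these;
    -- together they form the trace of X + a / X, which is t by assumption.
    w+w^r : w ⊞ w CK.^ r ~ constant t
    w+w^r = K.trans (K.+-congˡ {w} (K.trans (∑ℕ-frobenius ν (summand a)) (LK.∑ℕ-cong ν shifted)))
     (K.trans (K.sym (LK.∑ℕ-split ν ν (summand a))) (K.trans (K.reflexive (cong (λ n → LK.∑ℕ n (summand a)) (sym jd)))
      (K.trans (trace-multiple a j) (K.reflexive (cong constant jτ))))) where
     shifted : ∀ k → summand a k CK.^ r ~ summand a (ν N.+ k)
     shifted k = K.trans (FrobK.frobenius^-+ ν (conj k) (constant a ⊠ conj⁻¹ k)) (K.+-cong (power-shift X k)
      (K.trans (CK.^-distrib-* (constant a) (conj⁻¹ k) r) (K.*-cong (constant^r a) (power-shift X⁻¹ k))))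

    V : Pol
    V = constant t ⊞ ⊟ w

    W^r : W CK.^ r ~ Ξ CK.^ r ⊠ V
    W^r = K.trans (CK.^-congˡ r W~) (K.trans (CK.^-distrib-* Ξ w r) (K.*-congˡ {Ξ CK.^ r} (SK.minus w+w^r)))

    Y~ : Y ~ Ξ ⊠ V
    Y~ = SK.scaled-minus W~ (constant t)

    X^rr : X CK.^ (r N.* r) ~ X
    X^rr = K.trans (K.reflexive (cong (X CK.^_) (trans (sym (NP.^-distribˡ-+-* p ν ν)) (cong (p N.^_) (sym jd))))) (X^q a j)

    U : Pol
    U = Ξ CK.^ (r' N.* (p N.∸ 1))

    form : ∀ (A : Pol) n (B : Pol) b (C : Pol) i → A ^ₚ n ⊠ (B ^ₚ b ⊠ C ^ₚ i) ≡ A CK.^ n ⊠ (B CK.^ b ⊠ C CK.^ i)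
    form A n B b C i = cong₂ _⊠_ (^-same A n) (cong₂ _⊠_ (^-same B b) (^-same C i))

    term^r : ∀ m → H m CK.^ r ~ U ⊠ Z m
    term^r m = ≡.subst₂ (λ h z → h CK.^ r ~ U ⊠ z) (sym (form X (l N.+ k N.* r) Ξ b W i)) (sym (form X (l N.* r N.+ k) Ξ b Y i))
     (K.trans (subst (λ s → (X CK.^ (l N.+ k N.* s) ⊠ (Ξ CK.^ b ⊠ W CK.^ i)) CK.^ s ~ Ξ CK.^ (r' N.* (b N.+ i)) ⊠ (X CK.^ (l N.* s N.+ k) ⊠ (Ξ CK.^ b ⊠ Y CK.^ i))) r≡
       (SK.stepanovTerm r' X Ξ V W Y (subst (λ s → X CK.^ (s N.* s) ~ X) (sym r≡) X^rr) (subst (λ s → W CK.^ s ~ Ξ CK.^ s ⊠ V) (sym r≡) W^r) Y~ l k b i))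
      (K.reflexive (cong (λ e → Ξ CK.^ (r' N.* e) ⊠ (X CK.^ (l N.* r N.+ k) ⊠ (Ξ CK.^ b ⊠ Y CK.^ i))) (NP.m∸n+n≡m (i≤p-1 m))))) where
     l = m % Λ
     k = (m / Λ) / p
     i = (m / Λ) % p
     b = p N.∸ 1 N.∸ i

    comb^r : ∀ {n} (v : Vec F n) f g → (∀ m → f m CK.^ r ~ U ⊠ g m) → comb v f CK.^ r ~ U ⊠ comb v g
    comb^r [] f g h = K.trans (FrobK.frobenius^-0 ν) (K.sym (K.zeroʳ U))
    comb^r (c ∷ v) f g h = K.trans (FrobK.frobenius^-+ ν (constant c ⊠ f 0) _)
     (K.trans (K.+-cong (K.trans (CK.^-distrib-* (constant c) (f 0) r) (K.trans (K.*-cong (constant^r c) (h 0)) (≈⇒~ (CS.x∙yz≈y∙xz (constant c) U (g 0)))))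
               (comb^r v _ _ (λ m → h (suc m))))
      (K.sym (K.distribˡ U (constant c ⊠ g 0) _))) where
     module CS = Algebra.Properties.CommutativeSemigroup P.*-commutativeSemigroup

    power-zero : ∀ x n → x CK.^ n ~ [] → x ~ []
    power-zero x zero h = ⊥-elim (1≁0 h)
    power-zero x (suc n) h = [ (λ z → z) , power-zero x n ]′ (domain x (x CK.^ n) h)

   -- The r-th power of `comb v H` is `U` times `comb v Z` in the residue field, hence zero, and a
   -- domain has no nilpotent elements. The relation for `Z` is one of polynomials and so serves all
   -- Q at once.
   divides-comb : ∀ {n} (v : Vec F n) → comb v Z ≋ [] → mon Q ∣ₚ comb v H
   divides-comb v z = ~⇒∣ₚ (power-zero (comb v H) r (K.trans (comb^r v H Z term^r) (K.trans (K.*-congˡ {U} (≈⇒~ z)) (K.zeroʳ U))))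

  record Point (Q : MonicPol) : Set where
   field
    irreducible : Irreducible Q
    coef₀≢0     : coef (monicPol Q) 0 ≢ 𝟘
    multiple    : ℕ
    degree      : multiple N.* fst Q ≡ ν N.+ ν
    traceIs     : ⟦ + multiple ⟧ ⊗ τ (snd Q) ≡ t

  -- If the degrees added up to more than the bound, v ↦ comb v Z would be an injection of F^N into F^M.
  stepanov : ∀ Qs → Unique Qs → All Point Qs → degreeOf Qs N.≤ D₀ N.+ N
  stepanov Qs u pts = go (degreeOf Qs N.≤? D₀ N.+ N) where
   go : Dec (degreeOf Qs N.≤ D₀ N.+ N) → degreeOf Qs N.≤ D₀ N.+ N
   go (yes le) = le
   go (no ¬le) = ⊥-elim (NP.<-irrefl refl (NP.<-≤-trans (NP.^-monoʳ-< p 1<p M<N) count)) where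
    kernel : ∀ (v : Vec F N) → comb v Z ≋ [] → ∀ m → coef (pol v) m ≡ 𝟘
    kernel v z = case (combLeading v D₀ H H-monic) where
     case : CombLeading v D₀ (comb v H) → ∀ m → coef (pol v) m ≡ 𝟘
     case (allZero h _) = h
     -- Here `comb v H` is nonzero of degree D₀ + e with e < N and divisible by every member of
     -- `Qs`, against the assumed total degree.
     case (atIndex e e<N b c≢0) = ⊥-elim (¬le (NP.≤-trans
      (degree-bound Qs u (All.map Point.irreducible pts) (comb v H) b (λ h → c≢0 (at h _))
       (All.map (λ {Q} pt → divides-comb (snd Q) (Point.irreducible pt) (Point.coef₀≢0 pt) (Point.multiple pt) (Point.degree pt) (Point.traceIs pt) v z) pts))
      (NP.≤-trans (NP.≤-reflexive (sym (NP.+-suc D₀ e))) (NP.+-monoʳ-≤ D₀ e<N))))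
    image : Vec F N → Vec F M
    image v = vec M (comb v Z)
    image-inj : ∀ {x y} → x ∈ allVec N → y ∈ allVec N → image x ≡ image y → x ≡ y
    image-inj {x} {y} _ _ e = ⊖-zero x y (kernel (x ⊖ y) (P.trans (comb-⊖ x y Z)
     (P.trans (P.+-congʳ {⊟ comb y Z} (P.trans (P.sym (pol-vec M (comb-below M x Z Z-below))) (P.trans (P.reflexive (cong pol e)) (pol-vec M (comb-below M y Z Z-below))))) (P.-‿inverseʳ (comb y Z)))))
    count : p N.^ N N.≤ p N.^ M
    count = ≡.subst₂ N._≤_ (trans (Listₚ.length-map image (allVec N)) (length-allVec N)) (length-allVec M)
     (unique-⊆-length (map image (allVec N)) (unique-map image image-inj (allVec-unique N)) (λ {v} _ → ∈-allVec v))

 F-domain : ∀ {x y} → x ≢ 𝟘 → y ≢ 𝟘 → x ⊗ y ≢ 𝟘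
 F-domain {x} {y} x≢0 y≢0 e = y≢0 (trans (sym (F.*-identityˡ y)) (trans (cong (_⊗ y) (trans (sym (⁻¹-inverse x≢0)) (F.*-comm x (x ⁻¹))))
  (trans (F.*-assoc (x ⁻¹) x y) (trans (cong (x ⁻¹ ⊗_) e) (F.zeroʳ (x ⁻¹))))))

 ∑-bijection : (f f' : F → F) → (∀ x → f (f' x) ≡ x) → (∀ x → f' (f x) ≡ x) → (g : F → ℤ) → ∑ elems (λ x → g (f x)) ≡ ∑ elems g
 ∑-bijection f f' r l g = sym (∑-reindex f g elems-unique elems-unique (λ _ → ∈-allFin _)
  (λ {x} {y} _ _ e → trans (sym (l x)) (trans (cong f' e) (l y))) (λ {y} _ → f' y , ∈-allFin _ , r y))

 ∑-translate : ∀ x g → ∑ elems (λ t → g (x ⊕ t)) ≡ ∑ elems g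
 ∑-translate x = ∑-bijection (x ⊕_) (_⊕ ⊝ x) (A.undo-shift' x) (A.shift-undo x)

 ∑-affine : ∀ x s u → u ≢ 𝟘 → ∀ g → ∑ elems (λ c → g (x ⊕ ⊝ (s ⊕ c ⊗ u))) ≡ ∑ elems g
 ∑-affine x s u u≢0 = ∑-bijection (λ c → x ⊕ ⊝ (s ⊕ c ⊗ u)) (λ t → ((x ⊕ ⊝ s) ⊕ ⊝ t) ⊗ u ⁻¹)
  (A.affine-inverse x s u (u ⁻¹) (⁻¹-inverse u≢0)) (A.affine-inverse' x s u (u ⁻¹) (⁻¹-inverse u≢0))

 -- Newton's identities over monic polynomials.

 module Kloosterman (a : F) (a≢0 : a ≢ 𝟘) where
  open TraceForm a
  private
   module FI = FieldIdentities residueRing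

  infixr 7 _⊛_
  _⊛_ : ∀ {m n} → Vec F m → Vec F n → Vec F (m N.+ n)
  _⊛_ {m} {n} u v = vec (m N.+ n) (mon u ⊠ mon v)

  mon-⊛ : ∀ {m n} (u : Vec F m) (v : Vec F n) → mon (u ⊛ v) ≋ mon u ⊠ mon v
  mon-⊛ {m} {n} u v = mon-vec (m N.+ n) (monic-⊠ (mon-monic u) (mon-monic v))

  c₀ : ∀ {n} → Vec F n → F
  c₀ v = coef (mon v) 0

  c₀-⊛ : ∀ {m n} (u : Vec F m) (v : Vec F n) → c₀ (u ⊛ v) ≡ c₀ u ⊗ c₀ v
  c₀-⊛ u v = trans (at (mon-⊛ u v) 0) (coef-⊠-0 (mon u) (mon v))

  subtop-⊛ : ∀ {m n} (u : Vec F m) (v : Vec F n) → subtop (u ⊛ v) ≡ subtop u ⊕ subtop v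
  subtop-⊛ {zero} {zero} [] [] = sym (F.+-identityˡ 𝟘)
  subtop-⊛ {zero} {suc n} [] v = trans (at (P.trans (mon-⊛ [] v) (P.*-identityˡ (mon v))) n) (sym (F.+-identityˡ _))
  subtop-⊛ {suc m} {zero} u [] = trans (at (P.trans (mon-⊛ u []) (P.*-identityʳ (mon u))) (m N.+ 0))
   (trans (cong (coef (mon u)) (NP.+-identityʳ m)) (sym (F.+-identityʳ _)))
  subtop-⊛ {suc m} {suc n} u v = trans (at (mon-⊛ u v) (m N.+ suc n)) (trans (cong (coef (mon u ⊠ mon v)) (NP.+-suc m n))
   (trans (coef-⊠-subtop {m} {n} (below (mon-monic u)) (below (mon-monic v)))
    (cong₂ _⊕_ (trans (cong (coef (mon u) m ⊗_) (lead (mon-monic v))) (F.*-identityʳ _)) (trans (cong (_⊗ coef (mon v) n) (lead (mon-monic u))) (F.*-identityˡ _)))))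

  τ-⊛ : ∀ {m n} (u : Vec F m) (v : Vec F n) → c₀ u ≢ 𝟘 → c₀ v ≢ 𝟘 → τ (u ⊛ v) ≡ τ u ⊕ τ v
  τ-⊛ u v u≢0 v≢0 = trans (cong₂ (λ s l → ⊝ (s ⊕ a ⊗ l)) (subtop-⊛ u v) logs) (FI.trace-sum (subtop u) (subtop v) a (logDerivative u) (logDerivative v)) where
   logs : logDerivative (u ⊛ v) ≡ logDerivative u ⊕ logDerivative v
   logs = trans (cong₂ _⊗_ (trans (at (mon-⊛ u v) 1) (coef-⊠-1 (mon u) (mon v))) (cong _⁻¹ (c₀-⊛ u v)))
    (FI.quotient-sum (c₀ u) (coef (mon u) 1) (c₀ v) (coef (mon v) 1) (c₀ u ⁻¹) (c₀ v ⁻¹) ((c₀ u ⊗ c₀ v) ⁻¹)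
     (⁻¹-inverse u≢0) (⁻¹-inverse v≢0) (⁻¹-inverse (F-domain u≢0 v≢0)))

  power : ∀ {d} → Vec F d → ∀ j → Vec F (j N.* d)
  power P zero = []
  power P (suc j) = P ⊛ power P j

  c₀-power : ∀ {d} (P : Vec F d) j → c₀ P ≢ 𝟘 → c₀ (power P j) ≢ 𝟘
  c₀-power P zero h e = 0≢1 (sym e)
  c₀-power P (suc j) h e = F-domain h (c₀-power P j h) (trans (sym (c₀-⊛ P (power P j))) e)

  τ-[] : τ [] ≡ 𝟘
  τ-[] = trans (cong ⊝_ (trans (F.+-identityˡ _) (trans (cong (a ⊗_) (F.zeroˡ _)) (F.zeroʳ a)))) (FR.-0#≈0#)

  τ-power : ∀ {d} (P : Vec F d) j → c₀ P ≢ 𝟘 → τ (power P j) ≡ ⟦ + j ⟧ ⊗ τ P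
  τ-power P zero h = trans τ-[] (sym (F.zeroˡ (τ P)))
  τ-power P (suc j) h = trans (τ-⊛ P (power P j) h (c₀-power P j h)) (trans (cong₂ _⊕_ (sym (F.*-identityˡ (τ P))) (τ-power P j h))
   (trans (sym (F.distribʳ (τ P) 𝟙ᶠ ⟦ + j ⟧)) (cong (_⊗ τ P) (⟦⟧-⊕ (+ 1) (+ j)))))

  Divides : ∀ {d n} → Vec F d → ℕ → Vec F n → Set
  Divides P j f = mon (power P j) ∣ₚ mon f

  divides? : ∀ {d n} (P : Vec F d) j (f : Vec F n) → Dec (Divides P j f)
  divides? P j f = ∣ₚ? (mon-monic (power P j)) (mon f)

  cofactor : ∀ {d n} (P : Vec F d) j (f : Vec F n) → Divides P j f → j N.* d N.≤ n
  cofactor {d} {n} P j f h with j N.* d N.≤? n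
  ... | yes le = le
  ... | no ¬le = ⊥-elim (monic-≢0 (mon-monic f) (∣ₚ-below (mon-monic (power P j)) (below-mono (NP.≰⇒> ¬le) (below (mon-monic f))) h))

  monicQuotient : ∀ {m n} (u : Vec F m) (f : Vec F (m N.+ n)) → mon u ∣ₚ mon f → Σ (Vec F n) λ g → f ≡ u ⊛ g
  monicQuotient {m} {n} u f (divides q e) = vec n q , mon-injective f (u ⊛ vec n q)
    (P.trans e (P.trans (P.*-congˡ {mon u} (P.sym (mon-vec n q-monic))) (P.sym (mon-⊛ u (vec n q))))) where
   go : Leading q → Monic n q
   go (none z) = ⊥-elim (monic-≢0 (mon-monic f) (P.trans e (P.trans (P.*-congˡ {mon u} z) (P.zeroʳ (mon u)))))
   go (some k b c≢0) = subst (λ k → Monic k q) k≡n (mk (trans (sym top) (trans (cong (coef (mon f)) (cong (m N.+_) k≡n)) (lead (mon-monic f)))) b) where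
    top : coef (mon f) (m N.+ k) ≡ coef q k
    top = trans (at e (m N.+ k)) (monic-⊠-coef (mon-monic u) b)
    k≤n : k N.≤ n
    k≤n = NP.+-cancelˡ-≤ m k n (NP.≤-pred (leading-< (below (mon-monic f)) (λ z → c≢0 (trans (sym top) z))))
    n≤k : n N.≤ k
    n≤k = NP.≮⇒≥ λ k<n → 0≢1 (trans (sym (vanish (below-⊠ (below (mon-monic u)) b) (m N.+ n) (NP.≤-trans (NP.≤-reflexive (sym (NP.+-suc m k))) (NP.+-monoʳ-≤ m k<n))))
     (trans (sym (at e (m N.+ n))) (lead (mon-monic f))))
    k≡n : k ≡ n
    k≡n = NP.≤-antisym k≤n n≤k
   q-monic : Monic n q
   q-monic = go (leading q)

  -- The prime X is left out: it corresponds to u = 0, where u + a / u has no meaning.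
  irrs : ∀ d → List (Vec F d)
  irrs d = filter (λ P → irr? P ×-dec ¬? (c₀ P Fin.≟ 𝟘)) (allVec d)

  ∈-irrs⁺ : ∀ {d} {P : Vec F d} → Irr P → c₀ P ≢ 𝟘 → P ∈ irrs d
  ∈-irrs⁺ {P = P} i h = ∈-filter⁺ (λ P → irr? P ×-dec ¬? (c₀ P Fin.≟ 𝟘)) (∈-allVec P) (i , h)

  ∈-irrs⁻ : ∀ {d} {P : Vec F d} → P ∈ irrs d → Irr P × c₀ P ≢ 𝟘
  ∈-irrs⁻ {d} P∈ = snd (∈-filter⁻ (λ P → irr? P ×-dec ¬? (c₀ P Fin.≟ 𝟘)) {xs = allVec d} P∈)

  layer : ℕ → List MonicPol
  layer d = map (d ,_) (irrs d)

  primes : ℕ → List MonicPol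
  primes zero = []
  primes (suc n) = layer (suc n) ++ primes n

  module _ where
   open import Data.List.Membership.Propositional.Properties using (∈-++⁺ˡ; ∈-++⁺ʳ; ∈-++⁻)

   ∈-primes⁺ : ∀ {n d} {P : Vec F d} → d N.≤ n → Irr P → c₀ P ≢ 𝟘 → (d , P) ∈ primes n
   ∈-primes⁺ {zero} {d} d≤0 i h = ⊥-elim (NP.<-irrefl refl (NP.≤-trans (positive i) d≤0))
   ∈-primes⁺ {suc n} {d} d≤n i h with NP.m≤n⇒m<n∨m≡n d≤n
   ... | inj₁ d<n = ∈-++⁺ʳ (layer (suc n)) (∈-primes⁺ (NP.≤-pred d<n) i h)
   ... | inj₂ refl = ∈-++⁺ˡ (∈-map⁺ (suc n ,_) (∈-irrs⁺ i h))

   ∈-primes⁻ : ∀ n {Q} → Q ∈ primes n → Irreducible Q × c₀ (snd Q) ≢ 𝟘 × fst Q N.≤ n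
   ∈-primes⁻ (suc n) {Q} Q∈ with ∈-++⁻ (layer (suc n)) Q∈
   ... | inj₂ h = let i , c , le = ∈-primes⁻ n h in i , c , NP.m≤n⇒m≤1+n le
   ... | inj₁ h with ∈-map⁻ (suc n ,_) h
   ...   | P , P∈ , refl = let i , c = ∈-irrs⁻ P∈ in i , c , NP.≤-refl

   primes-unique : ∀ n → Unique (primes n)
   primes-unique zero = []
   primes-unique (suc n) = Uniqueₚ.++⁺ (unique-map (suc n ,_) (λ _ _ → λ { refl → refl }) (Uniqueₚ.filter⁺ _ (allVec-unique (suc n)))) (primes-unique n) disjoint where
    disjoint : ∀ {Q} → ¬ (Q ∈ layer (suc n) × Q ∈ primes n)
    disjoint (h , h') with ∈-map⁻ (suc n ,_) h
    ... | P , _ , refl = NP.<-irrefl refl (snd (snd (∈-primes⁻ n h')))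

  _≟ₘ_ : (Q R : MonicPol) → Dec (Q ≡ R)
  _≟ₘ_ = Productₚ.≡-dec N._≟_ (Vecₚ.≡-dec Fin._≟_)

  -- Multiplicity bookkeeping for f = P ⊛ g.
  divides-other : ∀ {d e n} {P : Vec F d} {Q : Vec F e} (g : Vec F n) → Irr P → Irr Q → ¬ (mon P ∣ₚ mon Q) →
          ∀ j → Divides Q j (P ⊛ g) → Divides Q j g
  divides-other {P = P} {Q} g iP iQ P∤Q j (divides m e) = go (irr-prime iP (mon (power Q j)) m (divides (mon g) (P.trans (P.sym e) (mon-⊛ P g)))) where
   P∤power : ∀ j → ¬ (mon P ∣ₚ mon (power Q j))
   P∤power zero h = monic-≢0 monic-one (∣ₚ-below (mon-monic P) (below-mono (positive iP) (below monic-one)) h)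
   P∤power (suc j) h = [ P∤Q , P∤power j ]′ (irr-prime iP (mon Q) (mon (power Q j)) (∣ₚ-resp {mon P} P.refl (mon-⊛ Q (power Q j)) h))
   go : mon P ∣ₚ mon (power Q j) ⊎ mon P ∣ₚ m → Divides Q j g
   go (inj₁ h) = ⊥-elim (P∤power j h)
   go (inj₂ (divides m' e')) = divides m' (monic-cancel (mon-monic P) (P.trans (P.sym (mon-⊛ P g)) (P.trans e (P.trans (P.*-congˡ {mon (power Q j)} e')
    (swap (mon (power Q j)) (mon P) m'))))) where
    import Algebra.Properties.CommutativeSemigroup
    module CS = Algebra.Properties.CommutativeSemigroup P.*-commutativeSemigroup
    swap : ∀ x y z → x ⊠ (y ⊠ z) ≋ y ⊠ (x ⊠ z)
    swap = CS.x∙yz≈y∙xz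

  divides-other⁻ : ∀ {d e n} {P : Vec F d} {Q : Vec F e} (g : Vec F n) j → Divides Q j g → Divides Q j (P ⊛ g)
  divides-other⁻ {P = P} g j h = ∣ₚ-trans h (divides (mon P) (P.trans (mon-⊛ P g) (P.*-comm (mon P) (mon g))))

  divides-suc : ∀ {d n} {P : Vec F d} (g : Vec F n) j → Divides P (suc j) (P ⊛ g) → Divides P j g
  divides-suc {P = P} g j (divides m e) = divides m (monic-cancel (mon-monic P) (P.trans (P.sym (mon-⊛ P g))
   (P.trans e (P.trans (P.*-congʳ {m} (mon-⊛ P (power P j))) (P.*-assoc (mon P) (mon (power P j)) m)))))

  divides-suc⁻ : ∀ {d n} {P : Vec F d} (g : Vec F n) j → Divides P j g → Divides P (suc j) (P ⊛ g)
  divides-suc⁻ {P = P} g j (divides m e) = divides m (P.trans (mon-⊛ P g) (P.trans (P.*-congˡ {mon P} e)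
   (P.trans (P.sym (P.*-assoc (mon P) (mon (power P j)) m)) (P.*-congʳ {m} (P.sym (mon-⊛ P (power P j)))))))

  -- The degree of Q times its exponent in f, the exponent being counted as the number of j ≥ 1 with
  -- Q^j dividing f. `B` is a cutoff, harmless once it is at least the degree of f.
  multiplicity : ℕ → ∀ {n} → MonicPol → Vec F n → ℤ
  multiplicity B (d , P) f = ∑ (range B) (λ j → + d * indicator (divides? P j f))

  multiplicity-⊛ : ∀ B {d n} (P : Vec F d) (g : Vec F n) → Irr P → d N.+ n N.≤ B → ∀ Q → Irreducible Q →
           multiplicity B Q (P ⊛ g) ≡ multiplicity B Q g + + d * indicator (Q ≟ₘ (d , P))
  multiplicity-⊛ zero {d} P g iP le Q iQ = ⊥-elim (NP.<-irrefl refl (NP.≤-trans (positive iP) (NP.≤-trans (NP.m≤m+n d _) le)))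
  multiplicity-⊛ (suc B) {d} {n} P g iP le Q@(e , R) iQ = go (Q ≟ₘ (d , P)) where
   go : (dec : Dec (Q ≡ (d , P))) → multiplicity (suc B) Q (P ⊛ g) ≡ multiplicity (suc B) Q g + + d * indicator dec
   go (no Q≢P) = trans (∑-cong (range (suc B)) (λ j → cong (+ e *_) (indicator-⇔ (divides? R j (P ⊛ g)) (divides? R j g)
     (divides-other g iP iQ (λ h → Q≢P (sym (irr-∣-irr iP iQ h))) j) (divides-other⁻ {P = P} g j))))
    (sym (trans (cong (λ z → multiplicity (suc B) Q g + z) (ZP.*-zeroʳ (+ d))) (ZP.+-identityʳ _)))
   -- The powers P^(j+1) dividing P g match the powers P^j dividing g. Shifting the range leaves j =
   -- 1, the new factor, and drops the top power, whose degree is too large for g.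
   go (yes refl) = trans (∑-range-shift B (λ j → + d * indicator (divides? P j (P ⊛ g)))) (cong₂ _+_
     (trans (∑-cong (range B) (λ j → cong (+ d *_) (indicator-⇔ (divides? P (suc j) (P ⊛ g)) (divides? P j g) (divides-suc g j) (divides-suc⁻ g j))))
      (sym (trans (cong (_+ ∑ (range B) (λ j → + d * indicator (divides? P j g))) last) (ZP.+-identityˡ _))))
     (cong (+ d *_) (indicator-yes (divides? P 1 (P ⊛ g)) (divides-suc⁻ g 0 (divides (mon g) (P.sym (P.*-identityˡ (mon g)))))))) where
    last : + d * indicator (divides? P (suc B) g) ≡ 0ℤ
    last = trans (cong (+ d *_) (indicator-no (divides? P (suc B) g) λ h → NP.<-irrefl refl
     (NP.<-≤-trans (NP.<-≤-trans (NP.m<n+m n (positive iP)) le) (NP.≤-trans (NP.≤-trans (NP.≤-reflexive (sym (NP.*-identityʳ (suc B)))) (NP.*-monoʳ-≤ (suc B) (positive iP))) (cofactor P (suc B) g h)))))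
     (ZP.*-zeroʳ (+ d))

  -- Unique factorisation seen by degrees: one irreducible factor is removed at a time, and a
  -- nonzero constant term keeps X from being among them. `k` bounds the recursion, `B` is the
  -- common cutoff for degrees and exponents.
  degree-formula : ∀ k B {n} (f : Vec F n) → n N.≤ k → n N.≤ B → c₀ f ≢ 𝟘 → ∑ (primes B) (λ Q → multiplicity B Q f) ≡ + n
  degree-formula k B {zero} [] n≤k n≤B f≢0 = ∑-ε∈ (primes B) λ {Q} Q∈ → ∑-ε∈ (range B) λ {j} j∈ →
    trans (cong (+ fst Q *_) (indicator-no (divides? (snd Q) j []) λ h → NP.<-irrefl refl
     (NP.≤-trans (NP.*-mono-≤ (fst (∈-range⁻ B j∈)) (positive (fst (∈-primes⁻ B Q∈)))) (cofactor (snd Q) j [] h)))) (ZP.*-zeroʳ (+ fst Q))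
  degree-formula (suc k) B {n@(suc _)} f n≤k n≤B f≢0 = step (irreducibleFactor n n f NP.≤-refl (N.s≤s N.z≤n)) where
   split : ∀ {d n'} (P : Vec F d) → Irr P → d N.+ n' ≡ n → (f' : Vec F (d N.+ n')) → c₀ f' ≢ 𝟘 → mon P ∣ₚ mon f' →
       ∑ (primes B) (λ Q → multiplicity B Q f') ≡ + (d N.+ n')
   split {d} {n'} P iP e f' f'≢0 h = conclude (monicQuotient P f' h) where
    conclude : (Σ (Vec F n') λ g → f' ≡ P ⊛ g) → ∑ (primes B) (λ Q → multiplicity B Q f') ≡ + (d N.+ n')
    conclude (g , refl) = trans (∑-cong∈ (primes B) (λ {Q} Q∈ → multiplicity-⊛ B P g iP d+n'≤B Q (fst (∈-primes⁻ B Q∈))))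
     (trans (∑-∙ (primes B) (λ Q → multiplicity B Q g) _)
      (trans (cong₂ _+_ (degree-formula k B g n'≤k (NP.≤-trans (NP.m≤n+m n' d) d+n'≤B) g≢0) one-P) (trans (ZP.+-comm (+ n') (+ d)) (sym (ZP.pos-+ d n'))))) where
     d+n'≤B : d N.+ n' N.≤ B
     d+n'≤B = subst (N._≤ B) (sym e) n≤B
     n'≤k : n' N.≤ k
     n'≤k = NP.≤-pred (NP.≤-trans (NP.m<n+m n' (positive iP)) (subst (N._≤ suc k) (sym e) n≤k))
     g≢0 : c₀ g ≢ 𝟘
     g≢0 z = f'≢0 (trans (c₀-⊛ P g) (trans (cong (c₀ P ⊗_) z) (F.zeroʳ (c₀ P))))
     P≢0 : c₀ P ≢ 𝟘
     P≢0 z = f'≢0 (trans (c₀-⊛ P g) (trans (cong (_⊗ c₀ g) z) (F.zeroˡ (c₀ g))))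
     one-P : ∑ (primes B) (λ Q → + d * indicator (Q ≟ₘ (d , P))) ≡ + d
     one-P = trans (∑-single (primes-unique B) (∈-primes⁺ (NP.≤-trans (NP.m≤m+n d n') d+n'≤B) iP P≢0)
       (λ {Q} _ Q≢P → trans (cong (+ d *_) (indicator-no (Q ≟ₘ (d , P)) Q≢P)) (ZP.*-zeroʳ (+ d))))
      (trans (cong (+ d *_) (indicator-yes ((d , P) ≟ₘ (d , P)) refl)) (ZP.*-identityʳ (+ d)))
   step : (Σ ℕ λ d → Σ (Vec F d) λ P → Irr P × mon P ∣ₚ mon f) → ∑ (primes B) (λ Q → multiplicity B Q f) ≡ + n
   step (d , P , iP , h) = transport (n N.∸ d) (NP.m+[n∸m]≡n d≤n) f refl f≢0 h where
    d≤n : d N.≤ n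
    d≤n = NP.≮⇒≥ λ n<d → monic-≢0 (mon-monic f) (∣ₚ-below (mon-monic P) (below-mono n<d (below (mon-monic f))) h)
    transport : ∀ {n″} n' → (e : d N.+ n' ≡ n″) (f : Vec F n″) → n″ ≡ n → c₀ f ≢ 𝟘 → mon P ∣ₚ mon f → ∑ (primes B) (λ Q → multiplicity B Q f) ≡ + n″
    transport n' refl f e = split P iP e f

  Φ : (F → ℤ) → F → ∀ {n} → Vec F n → ℤ
  Φ v x f = indicator (¬? (c₀ f Fin.≟ 𝟘)) * v (x ⊕ τ f)

  -- The n-th coefficient of an L-function with operator coefficients: `τ` is additive, so the shift
  -- by `τ f` is multiplicative in f. It plays the part of a complete homogeneous symmetric
  -- function.
  h : ℕ → (F → ℤ) → F → ℤ
  h n v x = ∑ (allVec n) (Φ v x)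

  Φ-power : ∀ v x {d m} (P : Vec F d) j (g : Vec F m) → c₀ P ≢ 𝟘 → Φ v x (power P j ⊛ g) ≡ Φ v (x ⊕ ⟦ + j ⟧ ⊗ τ P) g
  Φ-power v x P j g P≢0 = go (c₀ g Fin.≟ 𝟘) where
   pw = power P j
   pw≢0 = c₀-power P j P≢0
   go : Dec (c₀ g ≡ 𝟘) → Φ v x (pw ⊛ g) ≡ Φ v (x ⊕ ⟦ + j ⟧ ⊗ τ P) g
   go (yes z) = trans (cong (_* v (x ⊕ τ (pw ⊛ g))) (indicator-no (¬? (c₀ (pw ⊛ g) Fin.≟ 𝟘)) (λ nz → nz (trans (c₀-⊛ pw g) (trans (cong (c₀ pw ⊗_) z) (F.zeroʳ _))))))
    (sym (cong (_* v ((x ⊕ ⟦ + j ⟧ ⊗ τ P) ⊕ τ g)) (indicator-no (¬? (c₀ g Fin.≟ 𝟘)) (λ nz → nz z))))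
   go (no nz) = cong₂ _*_ (trans (indicator-yes (¬? (c₀ (pw ⊛ g) Fin.≟ 𝟘)) (λ z → F-domain pw≢0 nz (trans (sym (c₀-⊛ pw g)) z))) (sym (indicator-yes (¬? (c₀ g Fin.≟ 𝟘)) nz)))
    (cong v (trans (cong (x ⊕_) (trans (τ-⊛ pw g pw≢0 nz) (cong (_⊕ τ g) (τ-power P j P≢0)))) (sym (F.+-assoc x _ (τ g)))))

  multiples : ∀ v x {d} (P : Vec F d) j m → c₀ P ≢ 𝟘 →
        ∑ (allVec (j N.* d N.+ m)) (λ f → indicator (divides? P j f) * Φ v x f) ≡ h m v (x ⊕ ⟦ + j ⟧ ⊗ τ P)
  multiples v x {d} P j m P≢0 = trans (∑-filter (divides? P j) (allVec n) (Φ v x))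
    (trans (∑-reindex (pw ⊛_) (Φ v x) (allVec-unique m) (Uniqueₚ.filter⁺ (divides? P j) (allVec-unique n)) into inj sur)
     (∑-cong (allVec m) (λ g → Φ-power v x P j g P≢0))) where
   n = j N.* d N.+ m
   pw = power P j
   into : ∀ {g} → g ∈ allVec m → pw ⊛ g ∈ filter (divides? P j) (allVec n)
   into {g} _ = ∈-filter⁺ (divides? P j) (∈-allVec (pw ⊛ g)) (divides (mon g) (mon-⊛ pw g))
   inj : ∀ {x y} → x ∈ allVec m → y ∈ allVec m → pw ⊛ x ≡ pw ⊛ y → x ≡ y
   inj {x} {y} _ _ e = mon-injective x y (monic-cancel (mon-monic pw) (P.trans (P.sym (mon-⊛ pw x)) (P.trans (P.reflexive (cong mon e)) (mon-⊛ pw y))))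
   sur : ∀ {f} → f ∈ filter (divides? P j) (allVec n) → Σ (Vec F m) λ g → g ∈ allVec m × pw ⊛ g ≡ f
   sur {f} f∈ = let g , e = monicQuotient pw f (snd (∈-filter⁻ (divides? P j) {xs = allVec n} f∈)) in g , ∈-allVec g , sym e

  -- The k-th power sum. A nonzero u in the field with p^k elements has a minimal polynomial Q with
  -- j deg Q = k, shared by deg Q elements, and the trace of u + a / u is j τ(Q). So this is the sum
  -- of v (x + Tr(u + a / u)) over all such u.
  κᴮ : ℕ → ℕ → (F → ℤ) → F → ℤ
  κᴮ B k v x = ∑ (primes B) (λ Q → ∑ (range B) (λ j → + fst Q * (indicator (j N.* fst Q N.≟ k) * v (x ⊕ ⟦ + j ⟧ ⊗ τ (snd Q)))))

  κ₀ : ℕ → (F → ℤ) → F → ℤ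
  κ₀ n = κᴮ n n

  regroup : ∀ n v x {d} (P : Vec F d) j → Irr P → c₀ P ≢ 𝟘 → 1 N.≤ j →
       ∑ (allVec n) (λ f → indicator (divides? P j f) * Φ v x f) ≡
       ∑ (range n) (λ k → indicator (j N.* d N.≟ k) * h (n N.∸ k) v (x ⊕ ⟦ + j ⟧ ⊗ τ P))
  regroup n v x {d} P j iP P≢0 1≤j = go (j N.* d N.≤? n) where
   g = λ k → indicator (j N.* d N.≟ k) * h (n N.∸ k) v (x ⊕ ⟦ + j ⟧ ⊗ τ P)
   off : ∀ {k} → k ≢ j N.* d → g k ≡ 0ℤ
   off {k} ne = cong (_* h (n N.∸ k) v (x ⊕ ⟦ + j ⟧ ⊗ τ P)) (indicator-no (j N.* d N.≟ k) (λ e → ne (sym e)))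
   go : Dec (j N.* d N.≤ n) → ∑ (allVec n) (λ f → indicator (divides? P j f) * Φ v x f) ≡ ∑ (range n) g
   go (no ¬le) = trans (∑-ε (allVec n) (λ f → cong (_* Φ v x f) (indicator-no (divides? P j f) (λ z → ¬le (cofactor P j f z)))))
    (sym (∑-ε∈ (range n) (λ k∈ → off (λ { refl → ¬le (snd (∈-range⁻ n k∈)) }))))
   go (yes le) = trans (transport (NP.m+[n∸m]≡n le))
    (sym (trans (∑-single (range-unique n) (∈-range⁺ (NP.*-mono-≤ 1≤j (positive iP)) le) (λ _ ne → off ne))
     (trans (cong (_* h (n N.∸ j N.* d) v (x ⊕ ⟦ + j ⟧ ⊗ τ P)) (indicator-yes (j N.* d N.≟ j N.* d) refl)) (ZP.*-identityˡ _)))) where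
    transport : ∀ {m n} → j N.* d N.+ m ≡ n → ∑ (allVec n) (λ f → indicator (divides? P j f) * Φ v x f) ≡ h m v (x ⊕ ⟦ + j ⟧ ⊗ τ P)
    transport {m} refl = multiples v x P j m P≢0

  -- The logarithmic derivative of the Euler product: n is written as the sum of deg Q over all Q^j
  -- dividing f, and then f is written as Q^j g.
  newton : ∀ n v x → + n * h n v x ≡ ∑ (range n) (λ k → κᴮ n k (h (n N.∸ k) v) x)
  newton n v x = begin
   + n * h n v x
    ≡⟨ sym (∑-*ˡ (+ n) (allVec n) (Φ v x)) ⟩
   ∑ (allVec n) (λ f → + n * Φ v x f)
    ≡⟨ ∑-cong (allVec n) (λ f → expand f (c₀ f Fin.≟ 𝟘)) ⟩
   ∑ (allVec n) (λ f → ∑ (primes n) (λ Q → ∑ (range n) (λ j → term Q j f)))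
    ≡⟨ ∑-swap (allVec n) (primes n) _ ⟩
   ∑ (primes n) (λ Q → ∑ (allVec n) (λ f → ∑ (range n) (λ j → term Q j f)))
    ≡⟨ ∑-cong∈ (primes n) (λ {Q} Q∈ → trans (∑-swap (allVec n) (range n) _) (∑-cong∈ (range n) (λ {j} j∈ → inner Q j Q∈ j∈))) ⟩
   ∑ (primes n) (λ Q → ∑ (range n) (λ j → ∑ (range n) (λ k → target Q j k)))
    ≡⟨ ∑-cong (primes n) (λ Q → ∑-swap (range n) (range n) (target Q)) ⟩
   ∑ (primes n) (λ Q → ∑ (range n) (λ k → ∑ (range n) (λ j → target Q j k)))
    ≡⟨ ∑-swap (primes n) (range n) _ ⟩
   ∑ (range n) (λ k → κᴮ n k (h (n N.∸ k) v) x) ∎ where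
   open ≡.≡-Reasoning
   term : MonicPol → ℕ → Vec F n → ℤ
   term Q j f = + fst Q * (indicator (divides? (snd Q) j f) * Φ v x f)
   target : MonicPol → ℕ → ℕ → ℤ
   target Q j k = + fst Q * (indicator (j N.* fst Q N.≟ k) * h (n N.∸ k) v (x ⊕ ⟦ + j ⟧ ⊗ τ (snd Q)))
   collect : ∀ f → ∑ (primes n) (λ Q → ∑ (range n) (λ j → term Q j f)) ≡ ∑ (primes n) (λ Q → multiplicity n Q f) * Φ v x f
   collect f = trans (∑-cong (primes n) (λ Q → trans (∑-cong (range n) (λ j → sym (ZP.*-assoc (+ fst Q) _ (Φ v x f)))) (∑-*ʳ (Φ v x f) (range n) _))) (∑-*ʳ (Φ v x f) (primes n) _)
   expand : ∀ f → Dec (c₀ f ≡ 𝟘) → + n * Φ v x f ≡ ∑ (primes n) (λ Q → ∑ (range n) (λ j → term Q j f))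
   expand f (no f≢0) = sym (trans (collect f) (cong (_* Φ v x f) (degree-formula n n f NP.≤-refl NP.≤-refl f≢0)))
   expand f (yes z) = trans (cong (+ n *_) Φ0) (trans (ZP.*-zeroʳ (+ n)) (sym (trans (collect f) (trans (cong (∑ (primes n) (λ Q → multiplicity n Q f) *_) Φ0) (ZP.*-zeroʳ (∑ (primes n) (λ Q → multiplicity n Q f))))))) where
    Φ0 : Φ v x f ≡ 0ℤ
    Φ0 = cong (_* v (x ⊕ τ f)) (indicator-no (¬? (c₀ f Fin.≟ 𝟘)) (λ nz → nz z))
   inner : ∀ Q j → Q ∈ primes n → j ∈ range n → ∑ (allVec n) (term Q j) ≡ ∑ (range n) (target Q j)
   inner Q j Q∈ j∈ = trans (∑-*ˡ (+ fst Q) (allVec n) _) (trans (cong (+ fst Q *_)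
    (let i , c , _ = ∈-primes⁻ n Q∈ in regroup n v x (snd Q) j i c (fst (∈-range⁻ n j∈)))) (sym (∑-*ˡ (+ fst Q) (range n) _)))

  ∑-primes : ∀ B f → ∑ (primes B) f ≡ ∑ (range B) (λ d → ∑ (layer d) f)
  ∑-primes zero f = refl
  ∑-primes (suc B) f = trans (∑-++ (layer (suc B)) (primes B) f) (cong (λ z → ∑ (layer (suc B)) f + z) (∑-primes B f))

  κᴮ-independent : ∀ {k B} → 1 N.≤ k → k N.≤ B → ∀ v x → κᴮ B k v x ≡ κ₀ k v x
  κᴮ-independent {k} {B} 1≤k k≤B v x = trans (∑-primes B (g B)) (trans (∑-range-extend (λ d → ∑ (layer d) (g B)) k≤B large)
    (trans (sym (∑-primes k (g B))) (∑-cong∈ (primes k) (λ {Q} Q∈ → ∑-range-extend (t Q) k≤B (λ j k<j → off Q j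
     (NP.>⇒≢ (NP.<-≤-trans k<j (NP.≤-trans (NP.≤-reflexive (sym (NP.*-identityʳ j))) (NP.*-monoʳ-≤ j (positive (fst (∈-primes⁻ k Q∈))))))))))))  where
   t : MonicPol → ℕ → ℤ
   t Q j = + fst Q * (indicator (j N.* fst Q N.≟ k) * v (x ⊕ ⟦ + j ⟧ ⊗ τ (snd Q)))
   g : ℕ → MonicPol → ℤ
   g B Q = ∑ (range B) (t Q)
   off : ∀ Q j → j N.* fst Q ≢ k → t Q j ≡ 0ℤ
   off Q j ne = trans (cong (λ z → + fst Q * (z * v (x ⊕ ⟦ + j ⟧ ⊗ τ (snd Q)))) (indicator-no (j N.* fst Q N.≟ k) ne)) (ZP.*-zeroʳ (+ fst Q))
   large : ∀ d → k N.< d → ∑ (layer d) (g B) ≡ 0ℤ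
   large d k<d = ∑-ε∈ (layer d) λ {Q} Q∈ → ∑-ε∈ (range B) λ {j} j∈ → off Q j (ne Q Q∈ j j∈) where
    ne : ∀ Q → Q ∈ layer d → ∀ j → j ∈ range B → j N.* fst Q ≢ k
    ne Q Q∈ j j∈ with ∈-map⁻ (d ,_) Q∈
    ... | P , _ , refl = NP.>⇒≢ (NP.<-≤-trans k<d (NP.≤-trans (NP.≤-reflexive (sym (NP.*-identityˡ d))) (NP.*-monoˡ-≤ d (fst (∈-range⁻ B j∈)))))

  newton' : ∀ n v x → + n * h n v x ≡ ∑ (range n) (λ k → κ₀ k (h (n N.∸ k) v) x)
  newton' n v x = trans (newton n v x) (∑-cong∈ (range n) (λ {k} k∈ → let a , b = ∈-range⁻ n k∈ in κᴮ-independent a b (h (n N.∸ k) v) x))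

  κ-cong : ∀ n {v w} → (∀ x → v x ≡ w x) → ∀ x → κ₀ n v x ≡ κ₀ n w x
  κ-cong n e x = ∑-cong (primes n) (λ Q → ∑-cong (range n) (λ j → cong (λ z → + fst Q * (indicator (j N.* fst Q N.≟ n) * z)) (e _)))

  κ-zero : ∀ n {v} → (∀ x → v x ≡ 0ℤ) → ∀ x → κ₀ n v x ≡ 0ℤ
  κ-zero n z x = ∑-ε (primes n) (λ Q → ∑-ε (range n) (λ j → trans (cong (λ z → + fst Q * (indicator (j N.* fst Q N.≟ n) * z)) (z _))
   (trans (cong (+ fst Q *_) (ZP.*-zeroʳ (indicator (j N.* fst Q N.≟ n)))) (ZP.*-zeroʳ (+ fst Q)))))

  κ-scale : ∀ n c v x → κ₀ n (λ y → c * v y) x ≡ c * κ₀ n v x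
  κ-scale n c v x = trans (∑-cong (primes n) (λ Q → trans (∑-cong (range n) (λ j → lem (+ fst Q) (indicator (j N.* fst Q N.≟ n)) c _)) (∑-*ˡ c (range n) _))) (∑-*ˡ c (primes n) _) where
   lem : ∀ d i c v → d * (i * (c * v)) ≡ c * (d * (i * v))
   lem = solve-∀

  h-0 : ∀ v x → h 0 v x ≡ v x
  h-0 v x = trans (ZP.+-identityʳ _) (trans (cong (_* v (x ⊕ τ [])) (indicator-yes (¬? (c₀ [] Fin.≟ 𝟘)) (λ e → 0≢1 (sym e))))
   (trans (ZP.*-identityˡ _) (cong v (trans (cong (x ⊕_) τ-[]) (F.+-identityʳ x)))))

  -- The Kloosterman operator, written with u = - c.
  kloosterman : (F → ℤ) → F → ℤ
  kloosterman v x = ∑ elems (λ c → indicator (¬? (c Fin.≟ 𝟘)) * v (x ⊕ ⊝ (c ⊕ a ⊗ c ⁻¹)))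

  h-1 : ∀ v x → h 1 v x ≡ kloosterman v x
  h-1 v x = trans (∑-cartesianProductWith _∷_ elems (allVec 0) (Φ v x))
   (∑-cong elems (λ c → trans (ZP.+-identityʳ _) (cong (λ z → indicator (¬? (c Fin.≟ 𝟘)) * v (x ⊕ ⊝ (c ⊕ a ⊗ z))) (F.*-identityˡ (c ⁻¹)))))

  module _ (v : F → ℤ) (zeroSum : ∑ elems v ≡ 0ℤ) where
   private
    2-term : ∀ x c₀ → c₀ ≢ 𝟘 → Dec (c₀ ≡ ⊝ a) → ∀ (δ : Dec (c₀ ≡ ⊝ a)) → ∑ elems (λ c₁ → v (x ⊕ ⊝ (c₁ ⊕ a ⊗ (c₁ ⊗ c₀ ⁻¹)))) ≡ indicator δ * (+ p * v x)
    2-term x c₀ c₀≢0 (yes e) δ = trans (∑-cong elems (λ c₁ → cong v (trans (cong (x ⊕_) (trans (A.factor c₁ a (c₀ ⁻¹)) (trans (cong (λ z → ⊝ (c₁ ⊗ z)) unit0) (trans (cong ⊝_ (F.zeroʳ c₁)) FR.-0#≈0#)))) (F.+-identityʳ x))))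
     (trans (∑-const elems (v x)) (trans (cong (λ n → + n * v x) length-elems) (sym (trans (cong (_* (+ p * v x)) (indicator-yes δ e)) (ZP.*-identityˡ _))))) where
     unit0 : 𝟙ᶠ ⊕ a ⊗ c₀ ⁻¹ ≡ 𝟘
     unit0 = trans (cong₂ _⊕_ (sym (⁻¹-inverse c₀≢0)) (cong (_⊗ c₀ ⁻¹) (trans (sym (A.double-neg a)) (cong ⊝_ (sym e))))) (trans (sym (F.distribʳ (c₀ ⁻¹) c₀ (⊝ c₀))) (trans (cong (_⊗ c₀ ⁻¹) (F.-‿inverseʳ c₀)) (F.zeroˡ _)))
    2-term x c₀ c₀≢0 (no ne) δ = trans (∑-cong elems (λ c₁ → cong (λ z → v (x ⊕ z)) (trans (A.factor c₁ a (c₀ ⁻¹)) (cong ⊝_ (sym (F.+-identityˡ _))))))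
     (trans (∑-affine x 𝟘 (𝟙ᶠ ⊕ a ⊗ c₀ ⁻¹) unit≢0 v) (trans zeroSum (sym (cong (_* (+ p * v x)) (indicator-no δ ne))))) where
     unit≢0 : 𝟙ᶠ ⊕ a ⊗ c₀ ⁻¹ ≢ 𝟘
     unit≢0 z = ne (trans (sym (F.+-identityʳ c₀)) (trans (cong (c₀ ⊕_) (sym (F.-‿inverseʳ a))) (trans (sym (F.+-assoc c₀ a (⊝ a))) (trans (cong (_⊕ ⊝ a) sum0) (F.+-identityˡ (⊝ a)))))) where
      sum0 : c₀ ⊕ a ≡ 𝟘
      sum0 = trans (cong₂ _⊕_ (sym (F.*-identityˡ c₀)) (trans (sym (F.*-identityʳ a)) (trans (cong (a ⊗_) (sym (trans (F.*-comm _ _) (⁻¹-inverse c₀≢0)))) (sym (F.*-assoc a (c₀ ⁻¹) c₀)))))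
       (trans (sym (F.distribʳ c₀ 𝟙ᶠ (a ⊗ c₀ ⁻¹))) (trans (cong (_⊗ c₀) z) (F.zeroˡ c₀)))

    ⊝a≢0 : ⊝ a ≢ 𝟘
    ⊝a≢0 e = a≢0 (trans (sym (A.double-neg a)) (trans (cong ⊝_ e) FR.-0#≈0#))

   -- For X² + c₁ X + c₀ the shift is -c₁ (1 + a / c₀). Summed over c₁ it sweeps out the total of v,
   -- which is 0, unless c₀ = -a, when all p shifts are trivial.
   h-2 : ∀ x → h 2 v x ≡ + p * v x
   h-2 x = trans (∑-cartesianProductWith _∷_ elems (allVec 1) (Φ v x)) (trans (∑-cong elems (λ c₀ → col c₀ (c₀ Fin.≟ 𝟘)))
     (trans (∑-single elems-unique (∈-allFin (⊝ a)) (λ {c} _ ne → cong (_* (+ p * v x)) (indicator-no (c Fin.≟ ⊝ a) ne)))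
      (trans (cong (_* (+ p * v x)) (indicator-yes (⊝ a Fin.≟ ⊝ a) refl)) (ZP.*-identityˡ _)))) where
    col : ∀ c₀ → Dec (c₀ ≡ 𝟘) → ∑ (allVec 1) (λ w → Φ v x (c₀ ∷ w)) ≡ indicator (c₀ Fin.≟ ⊝ a) * (+ p * v x)
    col c₀ (yes z) = trans (∑-ε (allVec 1) (λ w → cong (_* v (x ⊕ τ (c₀ ∷ w))) (indicator-no (¬? (c₀ Fin.≟ 𝟘)) (λ nz → nz z))))
     (sym (cong (_* (+ p * v x)) (indicator-no (c₀ Fin.≟ ⊝ a) (λ e → ⊝a≢0 (trans (sym e) z)))))
    col c₀ (no nz) = trans (∑-cartesianProductWith _∷_ elems (allVec 0) (λ w → Φ v x (c₀ ∷ w)))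
     (trans (∑-cong elems (λ c₁ → trans (ZP.+-identityʳ _) (trans (cong (_* v (x ⊕ τ (c₀ ∷ c₁ ∷ []))) (indicator-yes (¬? (c₀ Fin.≟ 𝟘)) nz)) (ZP.*-identityˡ _))))
      (2-term x c₀ nz (c₀ Fin.≟ ⊝ a) (c₀ Fin.≟ ⊝ a)))

   -- From degree 3 on the coefficient c₁ is not the one below the top, so it enters `τ` only
   -- through a c₁ / c₀, and the sum over c₁ alone sweeps out the total of v.
   h-3 : ∀ n x → h (3 N.+ n) v x ≡ 0ℤ
   h-3 n x = trans (∑-cartesianProductWith _∷_ elems (allVec (2 N.+ n)) (Φ v x)) (∑-ε elems (λ c₀ → col c₀ (c₀ Fin.≟ 𝟘))) where
    col : ∀ c₀ → Dec (c₀ ≡ 𝟘) → ∑ (allVec (2 N.+ n)) (λ w → Φ v x (c₀ ∷ w)) ≡ 0ℤ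
    col c₀ (yes z) = ∑-ε (allVec (2 N.+ n)) (λ w → cong (_* v (x ⊕ τ (c₀ ∷ w))) (indicator-no (¬? (c₀ Fin.≟ 𝟘)) (λ nz → nz z)))
    col c₀ (no nz) = trans (∑-cartesianProductWith _∷_ elems (allVec (1 N.+ n)) (λ w → Φ v x (c₀ ∷ w)))
     (trans (∑-swap elems (allVec (1 N.+ n)) (λ c₁ w → Φ v x (c₀ ∷ c₁ ∷ w))) (∑-ε (allVec (1 N.+ n)) row)) where
     u = a ⊗ c₀ ⁻¹
     u≢0 : u ≢ 𝟘
     u≢0 z = a≢0 (trans (sym (F.*-identityʳ a)) (trans (cong (a ⊗_) (sym (trans (F.*-comm _ _) (⁻¹-inverse nz)))) (trans (sym (F.*-assoc a (c₀ ⁻¹) c₀)) (trans (cong (_⊗ c₀) z) (F.zeroˡ c₀)))))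
     row : ∀ w → ∑ elems (λ c₁ → Φ v x (c₀ ∷ c₁ ∷ w)) ≡ 0ℤ
     row w@(c₂ ∷ cs) = trans (∑-cong elems (λ c₁ → trans (cong (_* v (x ⊕ τ (c₀ ∷ c₁ ∷ w))) (indicator-yes (¬? (c₀ Fin.≟ 𝟘)) nz)) (trans (ZP.*-identityˡ _)
       (cong (λ z → v (x ⊕ ⊝ (coef (mon w) n ⊕ z))) (trans (cong (a ⊗_) (F.*-comm c₁ (c₀ ⁻¹))) (trans (sym (F.*-assoc a (c₀ ⁻¹) c₁)) (F.*-comm u c₁)))))))
      (trans (∑-affine x (coef (mon w) n) u u≢0 v) zeroSum)

   κ-1 : ∀ x → κ₀ 1 v x ≡ kloosterman v x
   κ-1 x = trans (sym (κ-cong 1 (h-0 v) x)) (trans (sym (ZP.+-identityʳ _)) (trans (sym (newton' 1 v x)) (trans (ZP.*-identityˡ _) (h-1 v x))))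

   κ-2 : ∀ x → κ₀ 2 v x + κ₀ 1 (kloosterman v) x ≡ + 2 * (+ p * v x)
   κ-2 x = trans (cong₂ _+_ (sym (κ-cong 2 (h-0 v) x)) (trans (sym (κ-cong 1 (h-1 v) x)) (sym (ZP.+-identityʳ _)))) (trans (sym (newton' 2 v x)) (cong (+ 2 *_) (h-2 x)))

   -- Newton's identity in degree 3 + n: on functions of sum zero the L-function is 1 + kl T + p T²,
   -- so only three terms survive.
   κ-rec : ∀ n x → κ₀ (3 N.+ n) v x + (κ₀ (2 N.+ n) (kloosterman v) x + + p * κ₀ (1 N.+ n) v x) ≡ 0ℤ
   κ-rec n x = trans (sym sumForm) (trans (sym (newton' N v x)) (trans (cong (+ N *_) (h-3 n x)) (ZP.*-zeroʳ (+ N)))) where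
    N = 3 N.+ n
    f = λ k → κ₀ k (h (N N.∸ k) v) x
    low : ∀ {k} → k ∈ range n → f k ≡ 0ℤ
    low {k} k∈ = κ-zero k (λ y → trans (cong (λ m → h m v y) (NP.+-∸-assoc 3 (snd (∈-range⁻ n k∈)))) (h-3 (n N.∸ k) y)) x
    diff : ∀ j → j N.+ n N.∸ n ≡ j
    diff j = NP.m+n∸n≡m j n
    sumForm : ∑ (range N) f ≡ κ₀ (3 N.+ n) v x + (κ₀ (2 N.+ n) (kloosterman v) x + + p * κ₀ (1 N.+ n) v x)
    sumForm = cong₂ _+_ (κ-cong (3 N.+ n) (λ y → trans (cong (λ m → h m v y) (NP.n∸n≡0 n)) (h-0 v y)) x)
     (cong₂ _+_ (κ-cong (2 N.+ n) (λ y → trans (cong (λ m → h m v y) (diff 1)) (h-1 v y)) x)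
      (trans (cong (λ z → f (1 N.+ n) + z) (∑-ε∈ (range n) low)) (trans (ZP.+-identityʳ _)
       (trans (κ-cong (1 N.+ n) (λ y → trans (cong (λ m → h m v y) (diff 2)) (h-2 y)) x) (κ-scale (1 N.+ n) (+ p) v x)))))

  private
   one-F : F → ℤ
   one-F _ = 1ℤ

  h-const : ∀ n x → h (suc n) one-F x ≡ (+ p - 1ℤ) * + (p N.^ n)
  h-const n x = trans (∑-cartesianProductWith _∷_ elems (allVec n) (Φ one-F x))
   (trans (∑-cong elems (λ c → trans (∑-cong (allVec n) (λ w → ZP.*-identityʳ (indicator (¬? (c Fin.≟ 𝟘))))) (trans (∑-const (allVec n) _) (cong (λ m → + m * indicator (¬? (c Fin.≟ 𝟘))) (length-allVec n)))))
    (trans (∑-*ˡ (+ (p N.^ n)) elems _) (trans (cong (+ (p N.^ n) *_) count) (ZP.*-comm (+ (p N.^ n)) _)))) where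
   complement : ∀ c → indicator (¬? (c Fin.≟ 𝟘)) ≡ 1ℤ - indicator (c Fin.≟ 𝟘)
   complement c = go (c Fin.≟ 𝟘) where
    go : (d : Dec (c ≡ 𝟘)) → indicator (¬? d) ≡ 1ℤ - indicator d
    go (yes _) = refl
    go (no _) = refl
   count : ∑ elems (λ c → indicator (¬? (c Fin.≟ 𝟘))) ≡ + p - 1ℤ
   count = trans (∑-cong elems complement) (trans (∑-minus elems (λ _ → 1ℤ) _) (cong₂ _-_ (trans (∑-const elems 1ℤ) (trans (ZP.*-identityʳ _) (cong +_ length-elems)))
    (trans (∑-single elems-unique (∈-allFin 𝟘) (λ {c} _ ne → indicator-no (c Fin.≟ 𝟘) ne)) (indicator-yes (𝟘 Fin.≟ 𝟘) refl))))

  private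
   module _ (x : F) where
    T : ℕ → ℤ
    T k = κ₀ k one-F x

    T-const : ∀ k m v → (∀ y → v y ≡ m) → κ₀ k v x ≡ m * T k
    T-const k m v e = trans (κ-cong k (λ y → trans (e y) (sym (ZP.*-identityʳ m))) x) (κ-scale k m one-F x)

    tailSum : ℕ → ℤ
    tailSum m = ∑ (range m) (λ k → (+ p - 1ℤ) * + (p N.^ (m N.∸ k)) * T k)

    newton-const : ∀ m → + suc m * ((+ p - 1ℤ) * + (p N.^ m)) ≡ T (suc m) + tailSum m
    newton-const m = trans (cong (+ suc m *_) (sym (h-const m x))) (trans (newton' (suc m) one-F x) (cong₂ _+_
     (trans (T-const (suc m) 1ℤ _ (λ y → trans (cong (λ j → h j one-F y) (NP.n∸n≡0 m)) (h-0 one-F y))) (ZP.*-identityˡ _))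
     (∑-cong∈ (range m) (λ {k} k∈ → T-const k _ _ (λ y → trans (cong (λ j → h j one-F y) (NP.+-∸-assoc 1 (snd (∈-range⁻ m k∈)))) (h-const (m N.∸ k) y))))))

    tailSum-suc : ∀ m → tailSum (suc m) ≡ (+ p - 1ℤ) * T (suc m) + + p * tailSum m
    tailSum-suc m = cong₂ _+_ (trans (cong (λ j → (+ p - 1ℤ) * + (p N.^ j) * T (suc m)) (NP.n∸n≡0 m)) (cong (_* T (suc m)) (ZP.*-identityʳ (+ p - 1ℤ))))
     (trans (∑-cong∈ (range m) (λ {k} k∈ → trans (cong (λ j → (+ p - 1ℤ) * + (p N.^ j) * T k) (NP.+-∸-assoc 1 (snd (∈-range⁻ m k∈))))
       (trans (cong (λ z → (+ p - 1ℤ) * z * T k) (ZP.pos-* p (p N.^ (m N.∸ k)))) (lem (+ p) (+ (p N.^ (m N.∸ k))) (T k)))))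
      (∑-*ˡ (+ p) (range m) _)) where
     lem : ∀ p q t → (p - 1ℤ) * (p * q) * t ≡ p * ((p - 1ℤ) * q * t)
     lem = solve-∀

    T-step : ∀ m → tailSum m ≡ + suc m * ((+ p - 1ℤ) * + (p N.^ m)) - (+ (p N.^ suc m) - 1ℤ) → T (suc m) ≡ + (p N.^ suc m) - 1ℤ
    T-step m e = trans (lem (T (suc m)) (tailSum m)) (trans (cong₂ _-_ (sym (newton-const m)) e) (lem' (+ suc m * ((+ p - 1ℤ) * + (p N.^ m))) (+ (p N.^ suc m) - 1ℤ))) where
     lem : ∀ t a → t ≡ (t + a) - a
     lem = solve-∀
     lem' : ∀ u w → u - (u - w) ≡ w
     lem' = solve-∀

    tailSum-formula : ∀ m → tailSum m ≡ + suc m * ((+ p - 1ℤ) * + (p N.^ m)) - (+ (p N.^ suc m) - 1ℤ)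
    tailSum-formula zero = trans (lem (+ p)) (cong (λ z → 1ℤ * ((+ p - 1ℤ) * 1ℤ) - (+ z - 1ℤ)) (sym (NP.*-identityʳ p))) where
     lem : ∀ p → 0ℤ ≡ 1ℤ * ((p - 1ℤ) * 1ℤ) - (p - 1ℤ)
     lem = solve-∀
    tailSum-formula (suc m) = trans (tailSum-suc m) (trans (cong₂ (λ t s → (+ p - 1ℤ) * t + + p * s) (T-step m (tailSum-formula m)) (tailSum-formula m))
     (trans (cong (λ z → (+ p - 1ℤ) * (z - 1ℤ) + + p * (+ suc m * ((+ p - 1ℤ) * + (p N.^ m)) - (z - 1ℤ))) (ZP.pos-* p (p N.^ m)))
      (trans (lem (+ p) (+ (p N.^ m)) (+ suc m))
       (cong₂ (λ u w → (1ℤ + + suc m) * ((+ p - 1ℤ) * u) - (w - 1ℤ)) (sym (ZP.pos-* p (p N.^ m))) (sym (trans (ZP.pos-* p (p N.* p N.^ m)) (cong (+ p *_) (ZP.pos-* p (p N.^ m))))))))) where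
     lem : ∀ p q s → (p - 1ℤ) * (p * q - 1ℤ) + p * (s * ((p - 1ℤ) * q) - (p * q - 1ℤ)) ≡ (1ℤ + s) * ((p - 1ℤ) * (p * q)) - (p * (p * q) - 1ℤ)
     lem = solve-∀

  -- On constants the L-function is (1 - T) / (1 - p T), with power sums p^n - 1: the number of
  -- nonzero elements of the field with p^n elements. The induction carries along `tailSum`, the
  -- part of Newton's identity from lower degrees.
  total : ∀ n x → κ₀ (suc n) (λ _ → 1ℤ) x ≡ + (p N.^ suc n) - 1ℤ
  total n x = T-step x n (tailSum-formula x n)

  pointCount : ℕ → F → ℤ
  pointCount n t = ∑ (primes n) (λ Q → ∑ (range n) (λ j → + fst Q * (indicator (j N.* fst Q N.≟ n) * indicator (⟦ + j ⟧ ⊗ τ (snd Q) Fin.≟ t))))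

  κ-pointCount : ∀ n v x → κ₀ n v x ≡ ∑ elems (λ t → pointCount n t * v (x ⊕ t))
  κ-pointCount n v x = sym (trans (∑-cong elems (λ t → sym (trans (∑-cong (primes n) (λ Q → ∑-*ʳ (v (x ⊕ t)) (range n) _)) (∑-*ʳ (v (x ⊕ t)) (primes n) _))))
   (trans (∑-swap elems (primes n) _) (∑-cong (primes n) (λ Q → trans (∑-swap elems (range n) _) (∑-cong (range n) (λ j →
    trans (∑-single {x = ⟦ + j ⟧ ⊗ τ (snd Q)} elems-unique (∈-allFin _) (λ {t} _ ne → trans (cong (λ z → + fst Q * (indicator (j N.* fst Q N.≟ n) * z) * v (x ⊕ t)) (indicator-no (_ Fin.≟ t) (λ e → ne (sym e)))) (lem0 (+ fst Q) (indicator (j N.* fst Q N.≟ n)) (v (x ⊕ t)))))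
     (trans (cong (λ z → + fst Q * (indicator (j N.* fst Q N.≟ n) * z) * v (x ⊕ ⟦ + j ⟧ ⊗ τ (snd Q))) (indicator-yes (_ Fin.≟ ⟦ + j ⟧ ⊗ τ (snd Q)) refl)) (lem1 (+ fst Q) (indicator (j N.* fst Q N.≟ n)) _)))))))) where
   lem0 : ∀ d i v → d * (i * 0ℤ) * v ≡ 0ℤ
   lem0 = solve-∀
   lem1 : ∀ d i v → d * (i * 1ℤ) * v ≡ d * (i * v)
   lem1 = solve-∀

  pointCount-total : ∀ n → ∑ elems (pointCount (suc n)) ≡ + (p N.^ suc n) - 1ℤ
  pointCount-total n = trans (sym (trans (κ-pointCount (suc n) (λ _ → 1ℤ) 𝟘) (∑-cong elems (λ t → ZP.*-identityʳ _)))) (total n 𝟘)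

  degreeOf-∑ : ∀ Qs → + degreeOf Qs ≡ ∑ Qs (λ Q → + fst Q)
  degreeOf-∑ [] = refl
  degreeOf-∑ (Q ∷ Qs) = trans (ZP.pos-+ (fst Q) (degreeOf Qs)) (cong (λ z → + fst Q + z) (degreeOf-∑ Qs))

  -- For each Q at most one j satisfies j deg Q = n, so the count is the total degree of the Q that
  -- occur, which `stepanov` bounds.
  pointCount-bound : ∀ μ t → pointCount (suc μ N.+ suc μ) t ≤ + (Stepanov.D₀ a t μ N.+ Stepanov.N a t μ)
  pointCount-bound μ t = ZP.≤-trans (∑-mono (primes n) (λ {Q} Q∈ → single Q (fst (∈-primes⁻ n Q∈)) (hit? Q)))
    (ZP.≤-trans (ZP.≤-reflexive (trans (∑-filter hit? (primes n) (λ Q → + fst Q)) (sym (degreeOf-∑ Qs)))) (ℤ.+≤+ (stepanov Qs (Uniqueₚ.filter⁺ hit? (primes-unique n)) (All.tabulate point)))) where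
   open Stepanov a t μ
   n = ν N.+ ν
   Hit : MonicPol → ℕ → Set
   Hit Q j = j N.* fst Q ≡ n × ⟦ + j ⟧ ⊗ τ (snd Q) ≡ t
   hit? : ∀ Q → Dec (Any.Any (Hit Q) (range n))
   hit? Q = any? (λ j → (j N.* fst Q N.≟ n) ×-dec (⟦ + j ⟧ ⊗ τ (snd Q) Fin.≟ t)) (range n)
   Qs = filter hit? (primes n)
   point : ∀ {Q} → Q ∈ Qs → Point Q
   point {Q} Q∈ = let Q∈' , hit = ∈-filter⁻ hit? {xs = primes n} Q∈
                      i , c , _ = ∈-primes⁻ n Q∈'
                      j , _ , e , e' = find hit
    in record { irreducible = i ; coef₀≢0 = c ; multiple = j ; degree = e ; traceIs = e' }
   term : MonicPol → ℕ → ℤ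
   term Q j = + fst Q * (indicator (j N.* fst Q N.≟ n) * indicator (⟦ + j ⟧ ⊗ τ (snd Q) Fin.≟ t))
   term-0 : ∀ Q j → ¬ Hit Q j → term Q j ≡ 0ℤ
   term-0 Q j miss = go (j N.* fst Q N.≟ n) (⟦ + j ⟧ ⊗ τ (snd Q) Fin.≟ t) where
    go : (d : Dec (j N.* fst Q ≡ n)) (e : Dec (⟦ + j ⟧ ⊗ τ (snd Q) ≡ t)) → + fst Q * (indicator d * indicator e) ≡ 0ℤ
    go (yes d) (yes e) = ⊥-elim (miss (d , e))
    go (yes _) (no _) = ZP.*-zeroʳ (+ fst Q)
    go (no _) _ = ZP.*-zeroʳ (+ fst Q)
   term-1 : ∀ Q j → Hit Q j → term Q j ≡ + fst Q
   term-1 Q j (d , e) = trans (cong₂ (λ u w → + fst Q * (u * w)) (indicator-yes (j N.* fst Q N.≟ n) d) (indicator-yes (⟦ + j ⟧ ⊗ τ (snd Q) Fin.≟ t) e)) (ZP.*-identityʳ (+ fst Q))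
   single : ∀ Q → Irreducible Q → (δ : Dec (Any.Any (Hit Q) (range n))) → ∑ (range n) (term Q) ≤ indicator δ * + fst Q
   single Q i (no miss) = ZP.≤-reflexive (∑-ε∈ (range n) (λ {j} j∈ → term-0 Q j (λ hit → miss (lose j∈ hit))))
   single Q i (yes hit) = let j , j∈ , e , e' = find hit in ZP.≤-reflexive (trans (∑-single (range-unique n) j∈
    (λ {k} _ ne → term-0 Q k (λ { (f , _) → ne (NP.*-cancelʳ-≡ k j (fst Q) {{N.>-nonZero (positive i)}} (trans f (sym e))) })))
    (trans (term-1 Q j (e , e')) (sym (ZP.*-identityˡ (+ fst Q)))))

  -- Weil's bound for the one-variable Kloosterman operator.

  open InnerProduct elems

  s : F → F
  s c = ⊝ (c ⊕ a ⊗ c ⁻¹)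

  χ : F → ℤ
  χ c = indicator (¬? (c Fin.≟ 𝟘))

  kl : (F → ℤ) → F → ℤ
  kl = kloosterman

  kl-cong : ∀ {v w} → (∀ x → v x ≡ w x) → ∀ x → kl v x ≡ kl w x
  kl-cong e x = ∑-cong elems (λ c → cong (χ c *_) (e (x ⊕ s c)))

  kl-linear : ∀ c d v w x → kl (λ y → c * v y + d * w y) x ≡ c * kl v x + d * kl w x
  kl-linear c d v w x = trans (∑-cong elems (λ u → lem c d (χ u) (v (x ⊕ s u)) (w (x ⊕ s u)))) (trans (∑-∙ elems _ _) (cong₂ _+_ (∑-*ˡ c elems _) (∑-*ˡ d elems _))) where
   lem : ∀ c d i v w → i * (c * v + d * w) ≡ c * (i * v) + d * (i * w)
   lem = solve-∀

  ∑-translateʳ : ∀ x g → ∑ elems (λ t → g (t ⊕ x)) ≡ ∑ elems g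
  ∑-translateʳ x g = trans (∑-cong elems (λ t → cong g (F.+-comm t x))) (∑-translate x g)

  kl-zeroSum : ∀ v → ∑ elems v ≡ 0ℤ → ∑ elems (kl v) ≡ 0ℤ
  kl-zeroSum v z = trans (∑-swap elems elems (λ x c → χ c * v (x ⊕ s c))) (∑-ε elems (λ c → trans (∑-*ˡ (χ c) elems (λ x → v (x ⊕ s c))) (trans (cong (χ c *_) (trans (∑-translateʳ (s c) v) z)) (ZP.*-zeroʳ (χ c)))))

  private
   inverse-neg : ∀ c → c ≢ 𝟘 → (⊝ c) ⁻¹ ≡ ⊝ (c ⁻¹)
   inverse-neg c c≢0 = trans (sym (F.*-identityʳ _)) (trans (cong ((⊝ c) ⁻¹ ⊗_) (sym unit)) (trans (sym (F.*-assoc _ (⊝ c) (⊝ (c ⁻¹))))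
    (trans (cong (_⊗ ⊝ (c ⁻¹)) (trans (F.*-comm _ _) (⁻¹-inverse ⊝c≢0))) (F.*-identityˡ _)))) where
    ⊝c≢0 : ⊝ c ≢ 𝟘
    ⊝c≢0 e = c≢0 (trans (sym (A.double-neg c)) (trans (cong ⊝_ e) FR.-0#≈0#))
    unit : (⊝ c) ⊗ (⊝ (c ⁻¹)) ≡ 𝟙ᶠ
    unit = trans (sym (FR.-‿distribˡ-* c (⊝ (c ⁻¹)))) (trans (cong ⊝_ (sym (FR.-‿distribʳ-* c (c ⁻¹)))) (trans (A.double-neg _) (⁻¹-inverse c≢0)))

   s-neg : ∀ c → c ≢ 𝟘 → s (⊝ c) ≡ ⊝ s c
   s-neg c c≢0 = cong ⊝_ (trans (cong (λ z → ⊝ c ⊕ a ⊗ z) (inverse-neg c c≢0)) (trans (cong (⊝ c ⊕_) (sym (FR.-‿distribʳ-* a (c ⁻¹)))) (FR.-‿+-comm c (a ⊗ c ⁻¹))))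

   χ-neg : ∀ c → χ (⊝ c) ≡ χ c
   χ-neg c = indicator-⇔ (¬? (⊝ c Fin.≟ 𝟘)) (¬? (c Fin.≟ 𝟘)) (λ ne z → ne (trans (cong ⊝_ z) FR.-0#≈0#)) (λ ne z → ne (trans (sym (A.double-neg c)) (trans (cong ⊝_ z) FR.-0#≈0#)))

  -- The substitution c ↦ - c negates c + a / c.
  kl-self : ∀ v w → ⟨ kl v , w ⟩ ≡ ⟨ v , kl w ⟩
  kl-self v w = begin
   ∑ elems (λ x → kl v x * w x)
    ≡⟨ ∑-cong elems (λ x → sym (∑-*ʳ (w x) elems _)) ⟩
   ∑ elems (λ x → ∑ elems (λ c → χ c * v (x ⊕ s c) * w x))
    ≡⟨ ∑-swap elems elems _ ⟩
   ∑ elems (λ c → ∑ elems (λ x → χ c * v (x ⊕ s c) * w x))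
    ≡⟨ ∑-cong elems (λ c → ∑-cong elems (λ x → cong (λ z → χ c * v (x ⊕ s c) * w z) (sym (back x (s c))))) ⟩
   ∑ elems (λ c → ∑ elems (λ x → χ c * v (x ⊕ s c) * w ((x ⊕ s c) ⊕ ⊝ s c)))
    ≡⟨ ∑-cong elems (λ c → ∑-translateʳ (s c) (λ y → χ c * v y * w (y ⊕ ⊝ s c))) ⟩
   ∑ elems (λ c → ∑ elems (λ y → χ c * v y * w (y ⊕ ⊝ s c)))
    ≡⟨ ∑-cong elems (λ c → flip c (c Fin.≟ 𝟘)) ⟩
   ∑ elems (λ c → ∑ elems (λ y → χ (⊝ c) * v y * w (y ⊕ s (⊝ c))))
    ≡⟨ ∑-bijection ⊝_ ⊝_ A.double-neg A.double-neg (λ c → ∑ elems (λ y → χ c * v y * w (y ⊕ s c))) ⟩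
   ∑ elems (λ c → ∑ elems (λ y → χ c * v y * w (y ⊕ s c)))
    ≡⟨ ∑-swap elems elems _ ⟩
   ∑ elems (λ y → ∑ elems (λ c → χ c * v y * w (y ⊕ s c)))
    ≡⟨ ∑-cong elems (λ y → trans (∑-cong elems (λ c → lem (χ c) (v y) (w (y ⊕ s c)))) (∑-*ˡ (v y) elems _)) ⟩
   ∑ elems (λ y → v y * kl w y) ∎ where
   open ≡.≡-Reasoning
   lem : ∀ i v w → i * v * w ≡ v * (i * w)
   lem = solve-∀
   back : ∀ x t → (x ⊕ t) ⊕ ⊝ t ≡ x
   back x t = trans (cong (_⊕ ⊝ t) (F.+-comm x t)) (A.shift-undo t x)
   flip : ∀ c → Dec (c ≡ 𝟘) → ∑ elems (λ y → χ c * v y * w (y ⊕ ⊝ s c)) ≡ ∑ elems (λ y → χ (⊝ c) * v y * w (y ⊕ s (⊝ c)))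
   flip c (yes z) = ∑-cong elems (λ y → trans (zero-χ c z (v y) (w (y ⊕ ⊝ s c))) (sym (trans (cong (λ i → i * v y * w (y ⊕ s (⊝ c))) (χ-neg c)) (zero-χ c z (v y) (w (y ⊕ s (⊝ c))))))) where
    zero-χ : ∀ c → c ≡ 𝟘 → ∀ a b → χ c * a * b ≡ 0ℤ
    zero-χ c z a b = cong (λ i → i * a * b) (indicator-no (¬? (c Fin.≟ 𝟘)) (λ ne → ne z))
   flip c (no ne) = ∑-cong elems (λ y → cong₂ (λ i t → i * v y * w (y ⊕ t)) (sym (χ-neg c)) (sym (s-neg c ne)))

  -- Writing 1 + kl T + p T² as (1 - α T)(1 - β T), this is α² + β² = kl² - 2 p, and (αβ)² = p².
  -- Only even power sums are needed, as `stepanov` treats even degrees 2 ν.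
  B : (F → ℤ) → F → ℤ
  B v x = 1ℤ * kl (kl v) x + - (+ 2 * + p) * v x

  B-cong : ∀ {v w} → (∀ x → v x ≡ w x) → ∀ x → B v x ≡ B w x
  B-cong e x = cong₂ (λ s t → 1ℤ * s + - (+ 2 * + p) * t) (kl-cong (kl-cong e) x) (e x)

  B-linear : ∀ c d v w x → B (λ y → c * v y + d * w y) x ≡ c * B v x + d * B w x
  B-linear c d v w x = trans (cong (λ z → 1ℤ * z + - (+ 2 * + p) * (c * v x + d * w x)) (trans (kl-cong (kl-linear c d v w) x) (kl-linear c d (kl v) (kl w) x)))
   (lem c d (+ 2 * + p) (kl (kl v) x) (kl (kl w) x) (v x) (w x)) where
   lem : ∀ c d q a b v w → 1ℤ * (c * a + d * b) + - q * (c * v + d * w) ≡ c * (1ℤ * a + - q * v) + d * (1ℤ * b + - q * w)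
   lem = solve-∀

  B-self : ∀ v w → ⟨ B v , w ⟩ ≡ ⟨ v , B w ⟩
  B-self v w = trans (inner-linear 1ℤ q (kl (kl v)) v w) (trans (cong (λ z → 1ℤ * z + q * ⟨ v , w ⟩) (trans (kl-self (kl v) w) (kl-self v (kl w))))
   (trans (cong₂ (λ s t → 1ℤ * s + q * t) (inner-comm v (kl (kl w))) (inner-comm v w)) (trans (sym (inner-linear 1ℤ q (kl (kl w)) w v)) (inner-comm (B w) v))))
   where q = - (+ 2 * + p)

  B-zeroSum : ∀ v → ∑ elems v ≡ 0ℤ → ∑ elems (B v) ≡ 0ℤ
  B-zeroSum v z = trans (∑-∙ elems _ _) (cong₂ _+_ (trans (∑-*ˡ 1ℤ elems _) (cong (1ℤ *_) (kl-zeroSum (kl v) (kl-zeroSum v z)))) (trans (∑-*ˡ (- (+ 2 * + p)) elems v) (trans (cong (- (+ 2 * + p) *_) z) (ZP.*-zeroʳ (- (+ 2 * + p))))))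

  Q : ℤ
  Q = + p * + p

  open Dickson elems B Q B-cong B-linear

  κ-linear : ∀ n c d v w x → κ₀ n (λ y → c * v y + d * w y) x ≡ c * κ₀ n v x + d * κ₀ n w x
  κ-linear n c d v w x = trans (κ-pointCount n (λ y → c * v y + d * w y) x) (trans (∑-cong elems (λ t → lem c d (pointCount n t) (v (x ⊕ t)) (w (x ⊕ t))))
   (trans (∑-∙ elems _ _) (trans (cong₂ _+_ (∑-*ˡ c elems _) (∑-*ˡ d elems _)) (cong₂ (λ s t → c * s + d * t) (sym (κ-pointCount n v x)) (sym (κ-pointCount n w x)))))) where
   lem : ∀ c d i v w → i * (c * v + d * w) ≡ c * (i * v) + d * (i * w)
   lem = solve-∀

  twice : ℕ → ℕ
  twice zero = 0
  twice (suc j) = suc (suc (twice j))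

  twice≡ : ∀ j → twice j ≡ j N.+ j
  twice≡ zero = refl
  twice≡ (suc j) = cong suc (trans (cong suc (twice≡ j)) (sym (NP.+-suc j j)))

  -- The power sum of degree n is -(α^n + β^n). A recurrence in steps of two comes from three
  -- consecutive instances of `κ-rec`, with `κ-2` in place of the last at the bottom, combined so
  -- that the odd degrees cancel.
  κ-E : ∀ j v → ∑ elems v ≡ 0ℤ → ∀ x → κ₀ (twice (suc j)) v x ≡ - E (suc j) v x
  κ-E zero v z x = trans (lem (κ₀ 2 v x) (κ₀ 1 (kl v) x)) (trans (cong₂ _-_ (κ-2 v z x) (κ-1 (kl v) (kl-zeroSum v z) x)) (lem' (+ p) (v x) (kl (kl v) x))) where
   lem : ∀ a b → a ≡ (a + b) - b
   lem = solve-∀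
   lem' : ∀ p v k → + 2 * (p * v) - k ≡ - (1ℤ * k + - (+ 2 * p) * v)
   lem' = solve-∀
  κ-E (suc zero) v z x = begin
   κ₀ 4 v x
    ≡⟨ lem (κ₀ 4 v x) (κ₀ 3 (kl v) x) (κ₀ 2 (kl (kl v)) x) (κ₀ 1 (kl v) x) (κ₀ 2 v x) (+ p) ⟩
   (κ₀ 4 v x + (κ₀ 3 (kl v) x + + p * κ₀ 2 v x)) - (κ₀ 3 (kl v) x + (κ₀ 2 (kl (kl v)) x + + p * κ₀ 1 (kl v) x)) + + p * (κ₀ 2 v x + κ₀ 1 (kl v) x) + (1ℤ * κ₀ 2 (kl (kl v)) x + - (+ 2 * + p) * κ₀ 2 v x)
    ≡⟨ cong₂ _+_ (cong₂ _+_ (cong₂ _-_ (κ-rec v z 1 x) (κ-rec (kl v) (kl-zeroSum v z) 0 x)) (cong (+ p *_) (κ-2 v z x))) (sym (κ-linear 2 1ℤ (- (+ 2 * + p)) (kl (kl v)) v x)) ⟩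
   0ℤ - 0ℤ + + p * (+ 2 * (+ p * v x)) + κ₀ 2 (B v) x
    ≡⟨ cong (λ t → 0ℤ - 0ℤ + + p * (+ 2 * (+ p * v x)) + t) (κ-E zero (B v) (B-zeroSum v z) x) ⟩
   0ℤ - 0ℤ + + p * (+ 2 * (+ p * v x)) + - E 1 (B v) x
    ≡⟨ lem' (+ p) (v x) (E 1 (B v) x) ⟩
   - E 2 v x ∎ where
   open ≡.≡-Reasoning
   lem : ∀ k4 k3 k2 k1 k p → k4 ≡ (k4 + (k3 + p * k)) - (k3 + (k2 + p * k1)) + p * (k + k1) + (1ℤ * k2 + - (+ 2 * p) * k)
   lem = solve-∀
   lem' : ∀ p v e → 0ℤ - 0ℤ + p * (+ 2 * (p * v)) + - e ≡ - (1ℤ * e + - (p * p) * (+ 2 * v))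
   lem' = solve-∀
  κ-E (suc (suc j)) v z x = begin
   κ₀ (5 N.+ n) v x
    ≡⟨ lem (κ₀ (5 N.+ n) v x) (κ₀ (4 N.+ n) (kl v) x) (κ₀ (3 N.+ n) (kl (kl v)) x) (κ₀ (2 N.+ n) (kl v) x) (κ₀ (3 N.+ n) v x) (κ₀ (1 N.+ n) v x) (+ p) ⟩
   (κ₀ (5 N.+ n) v x + (κ₀ (4 N.+ n) (kl v) x + + p * κ₀ (3 N.+ n) v x)) - (κ₀ (4 N.+ n) (kl v) x + (κ₀ (3 N.+ n) (kl (kl v)) x + + p * κ₀ (2 N.+ n) (kl v) x))
    + + p * (κ₀ (3 N.+ n) v x + (κ₀ (2 N.+ n) (kl v) x + + p * κ₀ (1 N.+ n) v x)) + (1ℤ * κ₀ (3 N.+ n) (kl (kl v)) x + - (+ 2 * + p) * κ₀ (3 N.+ n) v x) - Q * κ₀ (1 N.+ n) v x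
    ≡⟨ cong₂ (λ s t → s + t - Q * κ₀ (1 N.+ n) v x) (cong₂ _+_ (cong₂ _-_ (κ-rec v z (2 N.+ n) x) (κ-rec (kl v) (kl-zeroSum v z) (1 N.+ n) x)) (cong (+ p *_) (κ-rec v z n x))) (sym (κ-linear (3 N.+ n) 1ℤ (- (+ 2 * + p)) (kl (kl v)) v x)) ⟩
   0ℤ - 0ℤ + + p * 0ℤ + κ₀ (3 N.+ n) (B v) x - Q * κ₀ (1 N.+ n) v x
    ≡⟨ cong₂ (λ s t → 0ℤ - 0ℤ + + p * 0ℤ + s - Q * t) (κ-E (suc j) (B v) (B-zeroSum v z) x) (κ-E j v z x) ⟩
   0ℤ - 0ℤ + + p * 0ℤ + - E (2 N.+ j) (B v) x - Q * - E (1 N.+ j) v x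
    ≡⟨ lem' (+ p) Q (E (2 N.+ j) (B v) x) (E (1 N.+ j) v x) ⟩
   - E (3 N.+ j) v x ∎ where
   open ≡.≡-Reasoning
   n = suc (twice j)
   lem : ∀ k5 k4 k3 k2 m3 m1 p → k5 ≡ (k5 + (k4 + p * m3)) - (k4 + (k3 + p * k2)) + p * (m3 + (k2 + p * m1)) + (1ℤ * k3 + - (+ 2 * p) * m3) - (p * p) * m1
   lem = solve-∀
   lem' : ∀ p q e f → 0ℤ - 0ℤ + p * 0ℤ + - e - q * - f ≡ - (1ℤ * e + - q * f)
   lem' = solve-∀

  1<p : 1 N.< p
  1<p = N.nonTrivial⇒n>1 p {{prime⇒nonTrivial pr}}

  -- The form is minus the sum of Nₜ C(t). As v has sum zero, adding a constant U to all counts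
  -- changes nothing; with U the bound of `stepanov` all U - Nₜ are nonnegative, each C(t) is at
  -- most the squared norm, and the sum of U - Nₜ is known from the total of the counts. It is only
  -- of order p r because U is r² / p up to O(r).
  E-bound : ∀ μ v → ∑ elems v ≡ 0ℤ → ⟨ E (suc μ) v , v ⟩ ≤ + 6 * (+ p * + (p N.^ suc μ)) * normSq v
  E-bound μ v z = begin
   ⟨ E ν v , v ⟩                                ≡⟨ rewriteE ⟩
   ∑ elems (λ t → (U - Nₜ t) * C t)             ≤⟨ ∑-mono elems (λ {t} _ → *-monoˡ-nonneg (ZP.i≤j⇒0≤j-i (count t)) (C≤X t)) ⟩
   ∑ elems (λ t → (U - Nₜ t) * ∥v∥)               ≡⟨ ∑-*ʳ ∥v∥ elems _ ⟩
   ∑ elems (λ t → U - Nₜ t) * ∥v∥                 ≡⟨ cong (_* ∥v∥) (trans (∑-minus elems (λ _ → U) Nₜ) (cong₂ _-_ (trans (∑-const elems U) (cong (λ m → + m * U) length-elems)) totals)) ⟩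
   (+ p * U - (+ (p N.^ n) - 1ℤ)) * ∥v∥           ≤⟨ ZP.*-monoʳ-≤-nonNeg ∥v∥ {{ℤ.nonNegative (normSq-nonneg v)}} numeric ⟩
   + 6 * (+ p * + (p N.^ suc μ)) * ∥v∥            ∎ where
   open ZP.≤-Reasoning
   ν = suc μ
   n = ν N.+ ν
   ∥v∥ = normSq v
   D₀ = Stepanov.D₀ a 𝟘 μ
   N = Stepanov.N a 𝟘 μ
   Λ = Stepanov.Λ a 𝟘 μ
   r = Stepanov.r a 𝟘 μ
   Κ = Stepanov.Κ a 𝟘 μ
   U = + (D₀ N.+ N)
   Nₜ = pointCount n
   count : ∀ t → Nₜ t ≤ U
   count t = pointCount-bound μ t
   C : F → ℤ
   C t = ⟨ (λ x → v (x ⊕ t)) , v ⟩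
   C≤X : ∀ t → C t ≤ ∥v∥
   C≤X t = *-cancelˡ-pos {+ 2} (ℤ.+<+ (N.s≤s N.z≤n)) (ZP.≤-trans (2inner≤ (λ x → v (x ⊕ t)) v) (ZP.≤-reflexive (trans (cong (_+ ∥v∥) (∑-translateʳ t (λ y → v y * v y))) (lem ∥v∥)))) where
    lem : ∀ x → x + x ≡ + 2 * x
    lem = solve-∀
   totals : ∑ elems Nₜ ≡ + (p N.^ n) - 1ℤ
   totals = pointCount-total (μ N.+ ν)
   rewriteE : ⟨ E ν v , v ⟩ ≡ ∑ elems (λ t → (U - Nₜ t) * C t)
   rewriteE = sym (begin-equality
    ∑ elems (λ t → (U - Nₜ t) * C t)
     ≡⟨ ∑-cong elems (λ t → sym (∑-*ˡ (U - Nₜ t) elems _)) ⟩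
    ∑ elems (λ t → ∑ elems (λ x → (U - Nₜ t) * (v (x ⊕ t) * v x)))
     ≡⟨ ∑-swap elems elems _ ⟩
    ∑ elems (λ x → ∑ elems (λ t → (U - Nₜ t) * (v (x ⊕ t) * v x)))
     ≡⟨ ∑-cong elems (λ x → trans (∑-cong elems (λ t → sym (ZP.*-assoc (U - Nₜ t) (v (x ⊕ t)) (v x)))) (trans (∑-*ʳ (v x) elems _) (cong (_* v x) (inner x)))) ⟩
    ∑ elems (λ x → E ν v x * v x) ∎) where
    inner : ∀ x → ∑ elems (λ t → (U - Nₜ t) * v (x ⊕ t)) ≡ E ν v x
    inner x = trans (∑-cong elems (λ t → lem U (Nₜ t) (v (x ⊕ t)))) (trans (∑-minus elems (λ t → U * v (x ⊕ t)) (λ t → Nₜ t * v (x ⊕ t)))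
     (trans (cong₂ _-_ (trans (∑-*ˡ U elems (λ t → v (x ⊕ t))) (trans (cong (U *_) (trans (∑-translate x v) z)) (ZP.*-zeroʳ U)))
       (trans (sym (κ-pointCount n v x)) (trans (cong (λ m → κ₀ m v x) (sym (twice≡ ν))) (κ-E μ v z x)))) (lem' (E ν v x)))) where
     lem : ∀ u n v → (u - n) * v ≡ u * v - n * v
     lem = solve-∀
     lem' : ∀ e → 0ℤ - - e ≡ e
     lem' = solve-∀
   numericℕ : p N.* (D₀ N.+ N) N.+ 1 N.≤ p N.^ n N.+ 6 N.* (p N.* r)
   numericℕ = ℕR.begin
    p N.* (D₀ N.+ N) N.+ 1                              ℕR.≤⟨ NP.+-mono-≤ (NP.*-monoʳ-≤ p (NP.+-monoˡ-≤ N (NP.*-monoˡ-≤ Λ (NP.m∸n≤m p 1)))) 1≤pr ⟩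
    p N.* (r N.+ (Λ N.+ 4) N.* r) N.+ p N.* r           ℕR.≡⟨ lem p Λ ⟩
    r N.* r N.+ 6 N.* (p N.* r)                         ℕR.≡⟨ cong (N._+ 6 N.* (p N.* r)) (sym (NP.^-distribˡ-+-* p ν ν)) ⟩
    p N.^ n N.+ 6 N.* (p N.* r)                         ℕR.∎ where
    module ℕR = NP.≤-Reasoning
    1≤pr : 1 N.≤ p N.* r
    1≤pr = NP.*-mono-≤ (NP.<⇒≤ 1<p) (N.>-nonZero⁻¹ r {{NP.m^n≢0 p ν}})
    lem : ∀ p L → p N.* (p N.* L N.+ (L N.+ 4) N.* (p N.* L)) N.+ p N.* (p N.* L) ≡ p N.* L N.* (p N.* L) N.+ 6 N.* (p N.* (p N.* L))
    lem = solveℕ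
   numeric : + p * U - (+ (p N.^ n) - 1ℤ) ≤ + 6 * (+ p * + r)
   numeric = ≤-by {z = (+ (p N.^ n N.+ 6 N.* (p N.* r))) - (+ (p N.* (D₀ N.+ N) N.+ 1))} (ZP.i≤j⇒0≤j-i (ℤ.+≤+ numericℕ))
    (trans (lem (+ p * U) (+ (p N.^ n)) (+ 6 * (+ p * + r))) (sym (cong₂ _-_ (trans (ZP.pos-+ (p N.^ n) _) (cong (λ z → + (p N.^ n) + z) (trans (ZP.pos-* 6 (p N.* r)) (cong (+ 6 *_) (ZP.pos-* p r)))))
     (trans (ZP.pos-+ (p N.* (D₀ N.+ N)) 1) (cong (_+ 1ℤ) (ZP.pos-* p (D₀ N.+ N))))))) where
    lem : ∀ u q s → s - (u - (q - 1ℤ)) ≡ (q + s) - (u + 1ℤ)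
    lem = solve-∀

  module _ (v : F → ℤ) (z : ∑ elems v ≡ 0ℤ) where
   private
    ∥v∥ = normSq v
    a₁ = ⟨ B v , v ⟩

    P : ℕ → ℤ
    P i = + (p N.^ (2 N.^ i))

    -- `δ i` is the excess over the expected bound 2 p^(2^i) times the squared norm. The index
    -- doubles each time so that `E-double-inner` leads from one value to the next.
    b δ : ℕ → ℤ
    b i = ⟨ E (2 N.^ i) v , v ⟩
    δ i = b i - + 2 * P i * ∥v∥

    2^≡ : ∀ i → 2 N.^ suc i ≡ 2 N.^ i N.+ 2 N.^ i
    2^≡ i = cong (2 N.^ i N.+_) (NP.+-identityʳ _)

    P-suc : ∀ i → P (suc i) ≡ P i * P i
    P-suc i = trans (cong (λ e → + (p N.^ e)) (2^≡ i)) (trans (cong +_ (NP.^-distribˡ-+-* p (2 N.^ i) (2 N.^ i))) (ZP.pos-* (p N.^ (2 N.^ i)) (p N.^ (2 N.^ i))))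

    Q^ : ∀ j → Q ℤ.^ j ≡ + (p N.^ j) * + (p N.^ j)
    Q^ zero = refl
    Q^ (suc j) = trans (cong (Q *_) (Q^ j)) (trans (lem (+ p) (+ (p N.^ j))) (cong₂ _*_ (sym (ZP.pos-* p (p N.^ j))) (sym (ZP.pos-* p (p N.^ j))))) where
     lem : ∀ p q → p * p * (q * q) ≡ p * q * (p * q)
     lem = solve-∀

    P-pos : ∀ i → 0ℤ < P i
    P-pos i = ℤ.+<+ (N.>-nonZero⁻¹ (p N.^ (2 N.^ i)) {{NP.m^n≢0 p (2 N.^ i)}})

    P≥0 : ∀ i → 0ℤ ≤ P i
    P≥0 i = ZP.<⇒≤ (P-pos i)

    b-suc : ∀ i → b (suc i) ≡ normSq (E (2 N.^ i) v) - + 2 * (P i * P i * ∥v∥)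
    b-suc i = trans (cong (λ j → ⟨ E j v , v ⟩) (2^≡ i)) (trans (E-double-inner B-self (2 N.^ i) v) (cong (λ q → normSq (E (2 N.^ i) v) - + 2 * (q * ∥v∥)) (Q^ (2 N.^ i))))

    -- Write n for the squared norm of v. Cauchy-Schwarz and `E-double-inner` give n δ(i+1) ≥ b² - 4
    -- P² n² = δ(i) (δ(i) + 4 P n), and the square of δ(i) is dropped.
    δ-growth : 0ℤ < ∥v∥ → ∀ i → + 4 * P i * δ i ≤ δ (suc i)
    δ-growth X>0 i = *-cancelˡ-pos X>0 (≤-by {z = (∥v∥ * n - b i * b i) + δ i * δ i} (ZP.+-mono-≤ (ZP.i≤j⇒0≤j-i (cauchy-schwarz v (E (2 N.^ i) v) X>0)) (square-nonneg (δ i)))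
     (trans (cong₂ (λ u w → ∥v∥ * (u - + 2 * w * ∥v∥) - ∥v∥ * (+ 4 * P i * δ i)) (b-suc i) (P-suc i)) (lem ∥v∥ n (b i) (P i)))) where
     n = normSq (E (2 N.^ i) v)
     lem : ∀ ∥v∥ n b P → ∥v∥ * ((n - + 2 * (P * P * ∥v∥)) - + 2 * (P * P) * ∥v∥) - ∥v∥ * (+ 4 * P * (b - + 2 * P * ∥v∥)) ≡ (∥v∥ * n - b * b) + (b - + 2 * P * ∥v∥) * (b - + 2 * P * ∥v∥)
     lem = solve-∀

    δ-lower : 0ℤ < ∥v∥ → + 1 ≤ δ 0 → ∀ i → + (4 N.^ i) * P i ≤ + p * δ i
    δ-lower X>0 h zero = ZP.≤-trans (ZP.≤-reflexive (trans (ZP.*-identityˡ (P 0)) (trans (cong +_ (NP.*-identityʳ p)) (sym (ZP.*-identityʳ (+ p)))))) (*-monoˡ-nonneg {+ p} (ℤ.+≤+ N.z≤n) h)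
    δ-lower X>0 h (suc i) = begin
     + (4 N.^ suc i) * P (suc i)            ≡⟨ cong₂ _*_ (ZP.pos-* 4 (4 N.^ i)) (P-suc i) ⟩
     + 4 * + (4 N.^ i) * (P i * P i)        ≡⟨ lem (+ (4 N.^ i)) (P i) ⟩
     + 4 * P i * (+ (4 N.^ i) * P i)        ≤⟨ *-monoˡ-nonneg {+ 4 * P i} (*-nonneg {+ 4} {P i} (ℤ.+≤+ N.z≤n) (P≥0 i)) (δ-lower X>0 h i) ⟩
     + 4 * P i * (+ p * δ i)                ≡⟨ lem' (P i) (+ p) (δ i) ⟩
     + p * (+ 4 * P i * δ i)                ≤⟨ *-monoˡ-nonneg {+ p} (ℤ.+≤+ N.z≤n) (δ-growth X>0 i) ⟩
     + p * δ (suc i)                        ∎ where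
     open ZP.≤-Reasoning
     lem : ∀ f P → + 4 * f * (P * P) ≡ + 4 * P * (f * P)
     lem = solve-∀
     lem' : ∀ P p d → + 4 * P * (p * d) ≡ p * (+ 4 * P * d)
     lem' = solve-∀

    δ-upper : ∀ i → + p * δ i ≤ P i * (+ 6 * (+ p * + p) * ∥v∥)
    δ-upper i = begin
     + p * δ i                                ≤⟨ *-monoˡ-nonneg {+ p} (ℤ.+≤+ N.z≤n) (≤-by {z = + 2 * P i * ∥v∥} (*-nonneg {+ 2 * P i} {∥v∥} (*-nonneg {+ 2} {P i} (ℤ.+≤+ N.z≤n) (P≥0 i)) (normSq-nonneg v)) (lem (b i) (+ 2 * P i * ∥v∥))) ⟩
     + p * b i                                ≤⟨ *-monoˡ-nonneg {+ p} (ℤ.+≤+ N.z≤n) bound ⟩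
     + p * (+ 6 * (+ p * P i) * ∥v∥)            ≡⟨ lem' (+ p) (P i) ∥v∥ ⟩
     P i * (+ 6 * (+ p * + p) * ∥v∥)            ∎ where
     open ZP.≤-Reasoning
     lem : ∀ b u → b - (b - u) ≡ u
     lem = solve-∀
     lem' : ∀ p P ∥v∥ → p * (+ 6 * (p * P) * ∥v∥) ≡ P * (+ 6 * (p * p) * ∥v∥)
     lem' = solve-∀
     bound : b i ≤ + 6 * (+ p * P i) * ∥v∥
     bound = subst (λ j → ⟨ E j v , v ⟩ ≤ + 6 * (+ p * + (p N.^ j)) * ∥v∥) (NP.suc-pred (2 N.^ i) {{NP.m^n≢0 2 i}}) (E-bound (N.pred (2 N.^ i)) v z)

    n<4^n : ∀ n → n N.< 4 N.^ n
    n<4^n zero = N.s≤s N.z≤n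
    n<4^n (suc n) = NP.≤-trans (N.s≤s (n<4^n n)) (NP.≤-trans (NP.≤-reflexive (NP.+-comm 1 (4 N.^ n))) (NP.+-monoʳ-≤ (4 N.^ n) (NP.≤-trans (N.>-nonZero⁻¹ (4 N.^ n) {{NP.m^n≢0 4 n}}) (NP.m≤m+n (4 N.^ n) _))))

    -- The ratio of p δ(i) to P(i) is at least 4^i by growth, yet at most `M` by `E-bound`. Taking i
    -- = M itself is enough, since M < 4^M.
    contradiction : 0ℤ < ∥v∥ → + 1 ≤ δ 0 → ⊥
    contradiction X>0 h = NP.<-irrefl refl (NP.<-≤-trans (n<4^n m) (ZP.drop‿+≤+ (ZP.≤-trans 4^≤ M≤))) where
     M = + 6 * (+ p * + p) * ∥v∥
     m = ℤ.∣ M ∣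
     4^≤ : + (4 N.^ m) ≤ M
     4^≤ = *-cancelˡ-pos (P-pos m) (ZP.≤-trans (ZP.≤-reflexive (ZP.*-comm (P m) _)) (ZP.≤-trans (δ-lower X>0 h m) (δ-upper m)))
     M≤ : M ≤ + m
     M≤ = ZP.≤-reflexive (sym (ZP.0≤i⇒+∣i∣≡i (*-nonneg {+ 6 * (+ p * + p)} {∥v∥} (*-nonneg {+ 6} {+ p * + p} (ℤ.+≤+ N.z≤n) (square-nonneg (+ p))) (normSq-nonneg v))))

    X-pos : 0ℤ < a₁ → 0ℤ < ∥v∥
    X-pos a₁>0 = go (0ℤ ℤ.<? ∥v∥) where
     n = normSq (B v)
     go : Dec (0ℤ < ∥v∥) → 0ℤ < ∥v∥
     go (yes h) = h
     go (no ¬h) = ⊥-elim (ZP.<-irrefl refl (ZP.≤-<-trans (ZP.≤-trans (normSq-nonneg (λ x → 1ℤ * B v x + d * v x)) (ZP.≤-trans (ZP.≤-reflexive (normSq-linear 1ℤ d (B v) v)) upper)) (ℤ.-<+ {1} {0}))) where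
      -- If the squared norm of v were 0, that of B v + d v would be n + 2 d a₁; with a₁ ≥ 1 this
      -- choice of d makes it at most -2.
      d = - (n + 1ℤ)
      X≡0 : ∥v∥ ≡ 0ℤ
      X≡0 = ZP.≤-antisym (ZP.≮⇒≥ ¬h) (normSq-nonneg v)
      upper : 1ℤ * 1ℤ * n + + 2 * (1ℤ * d) * a₁ + d * d * ∥v∥ ≤ ℤ.-[1+ 1 ]
      upper = ≤-by {z = n + + 2 * ((n + 1ℤ) * (a₁ - 1ℤ))} (ZP.+-mono-≤ (normSq-nonneg (B v)) (*-nonneg {+ 2} {(n + 1ℤ) * (a₁ - 1ℤ)} (ℤ.+≤+ N.z≤n) (*-nonneg {n + 1ℤ} {a₁ - 1ℤ} (ZP.+-mono-≤ (normSq-nonneg (B v)) (ℤ.+≤+ {n = 1} N.z≤n)) (ZP.i≤j⇒0≤j-i (ZP.i<j⇒suc[i]≤j a₁>0)))))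
       (trans (cong (λ x → ℤ.-[1+ 1 ] - (1ℤ * 1ℤ * n + + 2 * (1ℤ * d) * a₁ + d * d * x)) X≡0) (lem n a₁)) where
       lem : ∀ n a → ℤ.-[1+ 1 ] - (1ℤ * 1ℤ * n + + 2 * (1ℤ * - (n + 1ℤ)) * a + - (n + 1ℤ) * - (n + 1ℤ) * 0ℤ) ≡ n + + 2 * ((n + 1ℤ) * (a - 1ℤ))
       lem = solve-∀

   -- As kl is self-adjoint, the squared norm of kl v is ⟨ B v , v ⟩ plus 2 p times that of v. So
   -- the claim is that `δ 0` is not positive, and a positive integer is at least 1.
   weil : normSq (kl v) ≤ + 4 * + p * ∥v∥
   weil = go (a₁ ℤ.≤? + 2 * + p * ∥v∥) where
    a₁≡ : a₁ ≡ 1ℤ * normSq (kl v) + - (+ 2 * + p) * ∥v∥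
    a₁≡ = trans (inner-linear 1ℤ (- (+ 2 * + p)) (kl (kl v)) v v) (cong (λ t → 1ℤ * t + - (+ 2 * + p) * ∥v∥) (kl-self (kl v) v))
    go : Dec (a₁ ≤ + 2 * + p * ∥v∥) → normSq (kl v) ≤ + 4 * + p * ∥v∥
    go (yes h) = ≤-by {z = + 2 * + p * ∥v∥ - a₁} (ZP.i≤j⇒0≤j-i h) (trans (lem (+ p) ∥v∥ (normSq (kl v))) (cong (λ t → + 2 * + p * ∥v∥ - t) (sym a₁≡))) where
     lem : ∀ p ∥v∥ n → + 4 * p * ∥v∥ - n ≡ + 2 * p * ∥v∥ - (1ℤ * n + - (+ 2 * p) * ∥v∥)
     lem = solve-∀
    go (no ¬h) = ⊥-elim (contradiction (X-pos (ZP.≤-<-trans (*-nonneg {+ 2 * + p} {∥v∥} (*-nonneg {+ 2} {+ p} (ℤ.+≤+ N.z≤n) (ℤ.+≤+ N.z≤n)) (normSq-nonneg v)) a₁>)) δ₀≥1) where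
     a₁> : + 2 * + p * ∥v∥ < a₁
     a₁> = ZP.≰⇒> ¬h
     δ₀≥1 : 1ℤ ≤ δ 0
     δ₀≥1 = subst (λ q → 1ℤ ≤ a₁ - + 2 * + q * ∥v∥) (sym (NP.*-identityʳ p)) (≤-by (ZP.i≤j⇒0≤j-i (ZP.i<j⇒suc[i]≤j a₁>)) (lem a₁ (+ 2 * + p * ∥v∥))) where
      lem : ∀ a u → (a - u) - 1ℤ ≡ a - (1ℤ + u)
      lem = solve-∀

 -- From one variable to the plane by the Radon transform.

 module Plane (ĉ : F) (ĉ≢0 : ĉ ≢ 𝟘) where
  private
   module Id = PlaneIdentities residueRing
   module Line = InnerProduct elems

  F² : Set
  F² = F × F

  plane : List F²
  plane = cartesianProduct elems elems

  open InnerProduct plane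

  ∑-plane : ∀ (f : F² → ℤ) → ∑ plane f ≡ ∑ elems (λ x → ∑ elems (λ y → f (x , y)))
  ∑-plane = ∑-cartesianProductWith _,_ elems elems

  χ : F → ℤ
  χ u = indicator (¬? (u Fin.≟ 𝟘))

  K : (F² → ℤ) → F² → ℤ
  K v (x , y) = ∑ elems (λ u → χ u * v (x ⊕ u , y ⊕ ĉ ⊗ u ⁻¹))

  -- The sum of v over the line x + s y = z; `R∞` treats the remaining direction, the lines of
  -- constant y.
  R : (F² → ℤ) → F → F → ℤ
  R v s z = ∑ elems (λ y → v (z ⊕ ⊝ (s ⊗ y) , y))

  R∞ : (F² → ℤ) → F → ℤ
  R∞ v z = ∑ elems (λ x → v (x , z))

  private
   ∑-translateʳ : ∀ t g → ∑ elems (λ x → g (x ⊕ t)) ≡ ∑ elems g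
   ∑-translateʳ t g = trans (∑-cong elems (λ x → cong g (F.+-comm x t))) (∑-translate t g)

   ∑-square : ∀ {A : Set} (xs : List A) (f : A → ℤ) → ∑ xs f * ∑ xs f ≡ ∑ xs (λ a → ∑ xs (λ b → f a * f b))
   ∑-square xs f = trans (sym (∑-*ʳ (∑ xs f) xs f)) (∑-cong xs (λ a → sym (∑-*ˡ (f a) xs f)))

  -- Two distinct points lie on exactly one line, and a point lies on p + 1 lines.
  radon : ∀ v → ∑ elems (λ s → Line.normSq (R v s)) + Line.normSq (R∞ v) ≡ + p * normSq v + ∑ plane v * ∑ plane v
  radon v = trans (cong₂ _+_ finite infinite) (trans (sym (∑-∙ elems _ _)) (trans (∑-cong elems (λ y → trans (sym (∑-∙ elems _ _)) (trans (∑-cong elems (λ y' → pair y y' (y Fin.≟ y'))) (∑-∙ elems _ _)))) (trans (∑-∙ elems _ _) (cong₂ _+_ diag total)))) where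
   corr : F → F → ℤ
   corr y y' = ∑ elems (λ z → ∑ elems (λ s → v (z , y) * v (z ⊕ ⊝ (⊝ (s ⊗ (y ⊕ ⊝ y'))) , y')))
   all² : F → F → ℤ
   all² y y' = ∑ elems (λ z → ∑ elems (λ t → v (z , y) * v (t , y')))
   δ : F → F → ℤ
   δ y y' = indicator (y Fin.≟ y')
   finite : ∑ elems (λ s → Line.normSq (R v s)) ≡ ∑ elems (λ y → ∑ elems (λ y' → corr y y'))
   finite = begin
    ∑ elems (λ s → ∑ elems (λ z → R v s z * R v s z))
     ≡⟨ ∑-cong elems (λ s → ∑-cong elems (λ z → ∑-square elems _)) ⟩
    ∑ elems (λ s → ∑ elems (λ z → ∑ elems (λ y → ∑ elems (λ y' → v (z ⊕ ⊝ (s ⊗ y) , y) * v (z ⊕ ⊝ (s ⊗ y') , y')))))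
     ≡⟨ ∑-cong elems (λ s → trans (∑-swap elems elems _) (∑-cong elems (λ y → ∑-swap elems elems _))) ⟩
    ∑ elems (λ s → ∑ elems (λ y → ∑ elems (λ y' → ∑ elems (λ z → v (z ⊕ ⊝ (s ⊗ y) , y) * v (z ⊕ ⊝ (s ⊗ y') , y')))))
     ≡⟨ ∑-cong elems (λ s → ∑-cong elems (λ y → ∑-cong elems (λ y' → trans (sym (∑-translateʳ (s ⊗ y) (λ z → v (z ⊕ ⊝ (s ⊗ y) , y) * v (z ⊕ ⊝ (s ⊗ y') , y'))))
        (∑-cong elems (λ z → cong₂ (λ a b → v (a , y) * v (b , y')) (Id.line-back z s y) (Id.line-move z s y y')))))) ⟩
    ∑ elems (λ s → ∑ elems (λ y → ∑ elems (λ y' → ∑ elems (λ z → v (z , y) * v (z ⊕ ⊝ (⊝ (s ⊗ (y ⊕ ⊝ y'))) , y')))))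
     ≡⟨ trans (∑-swap elems elems _) (∑-cong elems (λ y → trans (∑-swap elems elems _) (∑-cong elems (λ y' → ∑-swap elems elems _)))) ⟩
    ∑ elems (λ y → ∑ elems (λ y' → corr y y')) ∎ where
    open ≡.≡-Reasoning
   infinite : Line.normSq (R∞ v) ≡ ∑ elems (λ y → ∑ elems (λ y' → δ y y' * all² y y'))
   infinite = ∑-cong elems (λ y → trans (∑-square elems (λ x → v (x , y))) (sym (trans (∑-single {f = λ y' → δ y y' * all² y y'} {x = y} elems-unique (∈-allFin y) (λ {y'} _ ne → cong (_* all² y y') (indicator-no (y Fin.≟ y') (λ e → ne (sym e)))))
    (trans (cong (_* all² y y) (indicator-yes (y Fin.≟ y) refl)) (ZP.*-identityˡ _)))))
   pair : ∀ y y' → Dec (y ≡ y') → corr y y' + δ y y' * all² y y' ≡ δ y y' * (+ p * ∑ elems (λ z → v (z , y) * v (z , y))) + all² y y'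
   pair y y' (yes refl) = trans (cong₂ _+_ same oneᴾ) (cong (_+ all² y y) (sym (trans (cong (_* (+ p * ∑ elems (λ z → v (z , y) * v (z , y)))) (indicator-yes (y Fin.≟ y) refl)) (ZP.*-identityˡ _)))) where
    oneᴾ : δ y y * all² y y ≡ all² y y
    oneᴾ = trans (cong (_* all² y y) (indicator-yes (y Fin.≟ y) refl)) (ZP.*-identityˡ _)
    same : corr y y ≡ + p * ∑ elems (λ z → v (z , y) * v (z , y))
    same = trans (∑-cong elems (λ z → trans (∑-cong elems (λ s → cong (λ t → v (z , y) * v (t , y)) (trans (cong (λ t → z ⊕ ⊝ (⊝ (s ⊗ t))) (F.-‿inverseʳ y)) (trans (cong (λ t → z ⊕ ⊝ (⊝ t)) (F.zeroʳ s)) (trans (cong (z ⊕_) (A.double-neg 𝟘)) (F.+-identityʳ z))))))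
     (trans (∑-const elems _) (cong (λ n → + n * (v (z , y) * v (z , y))) length-elems)))) (∑-*ˡ (+ p) elems _)
   pair y y' (no ne) = trans (cong₂ _+_ spread (cong (_* all² y y') (indicator-no (y Fin.≟ y') ne))) (trans (ZP.+-comm (all² y y') 0ℤ) (cong (_+ all² y y') (sym (cong (_* (+ p * ∑ elems (λ z → v (z , y) * v (z , y)))) (indicator-no (y Fin.≟ y') ne))))) where
    d = y ⊕ ⊝ y'
    -d≢0 : ⊝ d ≢ 𝟘
    -d≢0 e = ne (Id.sub-self y y' (trans (sym (A.double-neg d)) (trans (cong ⊝_ e) FR.-0#≈0#)))
    spread : corr y y' ≡ all² y y'
    spread = ∑-cong elems (λ z → trans (∑-cong elems (λ s → cong (λ t → v (z , y) * v (t , y')) (sym (Id.affine-form z d s)))) (∑-affine z 𝟘 (⊝ d) -d≢0 (λ t → v (z , y) * v (t , y'))))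
   diag : ∑ elems (λ y → ∑ elems (λ y' → δ y y' * (+ p * ∑ elems (λ z → v (z , y) * v (z , y))))) ≡ + p * normSq v
   diag = trans (∑-cong elems (λ y → trans (∑-*ʳ (+ p * ∑ elems (λ z → v (z , y) * v (z , y))) elems (δ y)) (trans (cong (_* (+ p * ∑ elems (λ z → v (z , y) * v (z , y)))) (trans (∑-single {x = y} elems-unique (∈-allFin y) (λ {y'} _ ne → indicator-no (y Fin.≟ y') (λ e → ne (sym e)))) (indicator-yes (y Fin.≟ y) refl))) (ZP.*-identityˡ _))))
    (trans (∑-*ˡ (+ p) elems _) (cong (+ p *_) (trans (∑-swap elems elems _) (sym (∑-plane _)))))
   total : ∑ elems (λ y → ∑ elems (λ y' → all² y y')) ≡ ∑ plane v * ∑ plane v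
   total = trans (∑-cong elems (λ y → ∑-cong elems (λ y' → trans (∑-cong elems (λ z → ∑-*ˡ (v (z , y)) elems _)) (∑-*ʳ (∑ elems (λ t → v (t , y'))) elems _))))
    (trans (sym (∑-square elems (λ y → ∑ elems (λ z → v (z , y))))) (cong (λ t → t * t) (trans (∑-swap elems elems _) (sym (∑-plane v)))))

  module _ (v : F² → ℤ) (zeroSum : ∑ plane v ≡ 0ℤ) where
   private
    R-zeroSum : ∀ s → ∑ elems (R v s) ≡ 0ℤ
    R-zeroSum s = trans (∑-swap elems elems _) (trans (∑-cong elems (λ y → ∑-translateʳ (⊝ (s ⊗ y)) (λ x → v (x , y)))) (trans (∑-swap elems elems _) (trans (sym (∑-plane v)) zeroSum)))

    R∞-zeroSum : ∑ elems (R∞ v) ≡ 0ℤ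
    R∞-zeroSum = trans (∑-swap elems elems _) (trans (sym (∑-plane v)) zeroSum)

    -- A shift by (u , w) moves the line x + s y = z to the one with z + u + s w. On each direction
    -- the plane operator thus becomes the one-variable operator for u + s ĉ / u.
    R-K : ∀ s z → R (K v) s z ≡ ∑ elems (λ u → χ u * R v s (z ⊕ (u ⊕ s ⊗ (ĉ ⊗ u ⁻¹))))
    R-K s z = trans (∑-swap elems elems _) (∑-cong elems (λ u → trans (∑-*ˡ (χ u) elems _) (cong (χ u *_)
     (trans (∑-cong elems (λ y → cong (λ t → v (t , y ⊕ ĉ ⊗ u ⁻¹)) (Id.line-shift z s y u (ĉ ⊗ u ⁻¹))))
      (∑-translateʳ (ĉ ⊗ u ⁻¹) (λ y → v ((z ⊕ (u ⊕ s ⊗ (ĉ ⊗ u ⁻¹))) ⊕ ⊝ (s ⊗ y) , y)))))))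

    R∞-K : ∀ z → R∞ (K v) z ≡ ∑ elems (λ u → χ u * R∞ v (z ⊕ ĉ ⊗ u ⁻¹))
    R∞-K z = trans (∑-swap elems elems _) (∑-cong elems (λ u → trans (∑-*ˡ (χ u) elems _) (cong (χ u *_) (∑-translateʳ u (λ x → v (x , z ⊕ ĉ ⊗ u ⁻¹))))))

    punctured : ∀ g → ∑ elems g ≡ 0ℤ → ∑ elems (λ u → χ u * g u) ≡ - g 𝟘
    punctured g z = trans (∑-cong elems (λ u → complement u (u Fin.≟ 𝟘))) (trans (∑-minus elems g _) (trans (cong₂ _-_ z (trans (∑-single {f = λ u → indicator (u Fin.≟ 𝟘) * g u} elems-unique (∈-allFin 𝟘) (λ {u} _ ne → cong (_* g u) (indicator-no (u Fin.≟ 𝟘) ne))) (trans (cong (_* g 𝟘) (indicator-yes (𝟘 Fin.≟ 𝟘) refl)) (ZP.*-identityˡ (g 𝟘))))) (ZP.+-identityˡ (- g 𝟘)))) where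
     complement : ∀ u (d : Dec (u ≡ 𝟘)) → indicator (¬? d) * g u ≡ g u - indicator d * g u
     complement u (yes _) = sym (trans (cong (λ t → g u - t) (ZP.*-identityˡ (g u))) (ZP.+-inverseʳ (g u)))
     complement u (no _) = trans (ZP.*-identityˡ (g u)) (sym (ZP.+-identityʳ (g u)))

    neg-norm : ∀ (w w' : F → ℤ) → (∀ z → w' z ≡ - w z) → Line.normSq w' ≤ + 4 * + p * Line.normSq w
    neg-norm w w' e = ZP.≤-trans (ZP.≤-reflexive (trans (Line.inner-cong e e) (∑-cong elems (λ z → lem (w z)))))
     (≤-by {z = (+ 4 * + p - 1ℤ) * Line.normSq w} (*-nonneg {+ 4 * + p - 1ℤ} (ZP.i≤j⇒0≤j-i 1≤4p) (Line.normSq-nonneg w)) (lem' (+ 4 * + p) (Line.normSq w))) where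
     lem : ∀ w → - w * - w ≡ w * w
     lem = solve-∀
     lem' : ∀ c n → c * n - n ≡ (c - 1ℤ) * n
     lem' = solve-∀
     1≤4p : 1ℤ ≤ + 4 * + p
     1≤4p = subst (1ℤ ≤_) (ZP.pos-* 4 p) (ℤ.+≤+ (NP.≤-trans (N.>-nonZero⁻¹ p {{prime⇒nonZero pr}}) (NP.m≤m+n p _)))

    inverse-bij : ∀ (g : F → ℤ) → ∑ elems (λ u → χ u * g (ĉ ⊗ u ⁻¹)) ≡ ∑ elems (λ t → χ t * g t)
    inverse-bij g = trans (∑-cong elems (λ u → swapped u (u Fin.≟ 𝟘))) (∑-bijection f f f-f f-f (λ t → χ t * g t)) where
     f' : ∀ u → Dec (u ≡ 𝟘) → F
     f' u (yes _) = 𝟘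
     f' u (no _) = ĉ ⊗ u ⁻¹
     f : F → F
     f u = f' u (u Fin.≟ 𝟘)
     f-0 : ∀ {u} → u ≡ 𝟘 → f u ≡ 𝟘
     f-0 {u} z = go (u Fin.≟ 𝟘) where
      go : (d : Dec (u ≡ 𝟘)) → f' u d ≡ 𝟘
      go (yes _) = refl
      go (no nz) = ⊥-elim (nz z)
     f-1 : ∀ {u} → u ≢ 𝟘 → f u ≡ ĉ ⊗ u ⁻¹
     f-1 {u} nz = go (u Fin.≟ 𝟘) where
      go : (d : Dec (u ≡ 𝟘)) → f' u d ≡ ĉ ⊗ u ⁻¹
      go (yes z) = ⊥-elim (nz z)
      go (no _) = refl
     inv≢0 : ∀ {u} → u ≢ 𝟘 → u ⁻¹ ≢ 𝟘
     inv≢0 {u} nz e = 0≢1 (trans (sym (F.zeroʳ u)) (trans (cong (u ⊗_) (sym e)) (⁻¹-inverse nz)))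
     w≢0 : ∀ {u} → u ≢ 𝟘 → ĉ ⊗ u ⁻¹ ≢ 𝟘
     w≢0 nz = F-domain ĉ≢0 (inv≢0 nz)
     f-f : ∀ u → f (f u) ≡ u
     f-f u = go (u Fin.≟ 𝟘) where
      go : Dec (u ≡ 𝟘) → f (f u) ≡ u
      go (yes z) = trans (f-0 (f-0 z)) (sym z)
      go (no nz) = trans (f-1 (λ e → w≢0 nz (trans (sym (f-1 nz)) e))) (trans (cong (λ t → ĉ ⊗ t ⁻¹) (f-1 nz)) (trans (sym (F.*-identityʳ _)) (trans (cong ((ĉ ⊗ (ĉ ⊗ u ⁻¹) ⁻¹) ⊗_) (sym (trans (F.*-comm (u ⁻¹) u) (⁻¹-inverse nz)))) (trans (sym (F.*-assoc _ (u ⁻¹) u)) (trans (cong (_⊗ u) rearr) (F.*-identityˡ u)))))) where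
       rearr : (ĉ ⊗ (ĉ ⊗ u ⁻¹) ⁻¹) ⊗ u ⁻¹ ≡ 𝟙ᶠ
       rearr = trans (F.*-assoc ĉ _ (u ⁻¹)) (trans (cong (ĉ ⊗_) (F.*-comm _ (u ⁻¹))) (trans (sym (F.*-assoc ĉ (u ⁻¹) _)) (⁻¹-inverse (w≢0 nz))))
     swapped : ∀ u → Dec (u ≡ 𝟘) → χ u * g (ĉ ⊗ u ⁻¹) ≡ χ (f u) * g (f u)
     swapped u (yes z) = trans (cong (_* g (ĉ ⊗ u ⁻¹)) (indicator-no (¬? (u Fin.≟ 𝟘)) (λ nz → nz z))) (sym (cong (_* g (f u)) (indicator-no (¬? (f u Fin.≟ 𝟘)) (λ nz → nz (f-0 z)))))
     swapped u (no nz) = cong₂ _*_ (trans (indicator-yes (¬? (u Fin.≟ 𝟘)) nz) (sym (indicator-yes (¬? (f u Fin.≟ 𝟘)) (λ e → w≢0 nz (trans (sym (f-1 nz)) e))))) (cong g (sym (f-1 nz)))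

    -- For s = 0 the inner operator is the sum over all nonzero shifts, which is minus the identity
    -- on functions of sum zero. Otherwise `weil` applies with a = s ĉ, after u is replaced by -u to
    -- match its sign convention.
    line : ∀ s → Dec (s ≡ 𝟘) → Line.normSq (R (K v) s) ≤ + 4 * + p * Line.normSq (R v s)
    line s (yes refl) = neg-norm (R v 𝟘) (R (K v) 𝟘) (λ z → trans (R-K 𝟘 z) (trans (∑-cong elems (λ u → cong (λ t → χ u * R v 𝟘 (z ⊕ t)) (trans (cong (u ⊕_) (F.zeroˡ _)) (F.+-identityʳ u))))
     (trans (punctured (λ t → R v 𝟘 (z ⊕ t)) (trans (∑-translate z (R v 𝟘)) (R-zeroSum 𝟘))) (cong (λ t → - R v 𝟘 t) (F.+-identityʳ z)))))
    line s (no s≢0) = ZP.≤-trans (ZP.≤-reflexive (Line.inner-cong same same)) (Kloosterman.weil (s ⊗ ĉ) sĉ≢0 (R v s) (R-zeroSum s)) where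
     sĉ≢0 : s ⊗ ĉ ≢ 𝟘
     sĉ≢0 = F-domain s≢0 ĉ≢0
     same : ∀ z → R (K v) s z ≡ Kloosterman.kl (s ⊗ ĉ) sĉ≢0 (R v s) z
     same z = trans (R-K s z) (trans (∑-cong elems (λ u → flip u (u Fin.≟ 𝟘))) (∑-bijection ⊝_ ⊝_ A.double-neg A.double-neg (λ c → χ c * R v s (z ⊕ ⊝ (c ⊕ (s ⊗ ĉ) ⊗ c ⁻¹))))) where
      inv-neg : ∀ u → u ≢ 𝟘 → (⊝ u) ⁻¹ ≡ ⊝ (u ⁻¹)
      inv-neg u nz = trans (sym (F.*-identityʳ _)) (trans (cong ((⊝ u) ⁻¹ ⊗_) (sym unit)) (trans (sym (F.*-assoc _ (⊝ u) (⊝ (u ⁻¹)))) (trans (cong (_⊗ ⊝ (u ⁻¹)) (trans (F.*-comm _ _) (⁻¹-inverse nz'))) (F.*-identityˡ _)))) where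
       nz' : ⊝ u ≢ 𝟘
       nz' e = nz (trans (sym (A.double-neg u)) (trans (cong ⊝_ e) FR.-0#≈0#))
       unit : (⊝ u) ⊗ (⊝ (u ⁻¹)) ≡ 𝟙ᶠ
       unit = trans (sym (FR.-‿distribˡ-* u (⊝ (u ⁻¹)))) (trans (cong ⊝_ (sym (FR.-‿distribʳ-* u (u ⁻¹)))) (trans (A.double-neg _) (⁻¹-inverse nz)))
      χ-neg : ∀ u → χ (⊝ u) ≡ χ u
      χ-neg u = indicator-⇔ (¬? (⊝ u Fin.≟ 𝟘)) (¬? (u Fin.≟ 𝟘)) (λ ne z → ne (trans (cong ⊝_ z) FR.-0#≈0#)) (λ ne z → ne (trans (sym (A.double-neg u)) (trans (cong ⊝_ z) FR.-0#≈0#)))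
      flip : ∀ u → Dec (u ≡ 𝟘) → χ u * R v s (z ⊕ (u ⊕ s ⊗ (ĉ ⊗ u ⁻¹))) ≡ χ (⊝ u) * R v s (z ⊕ ⊝ (⊝ u ⊕ (s ⊗ ĉ) ⊗ (⊝ u) ⁻¹))
      flip u (yes e) = trans (cong (_* R v s (z ⊕ (u ⊕ s ⊗ (ĉ ⊗ u ⁻¹)))) (off e)) (sym (cong (_* R v s (z ⊕ ⊝ (⊝ u ⊕ (s ⊗ ĉ) ⊗ (⊝ u) ⁻¹))) (trans (χ-neg u) (off e)))) where
       off : u ≡ 𝟘 → χ u ≡ 0ℤ
       off e = indicator-no (¬? (u Fin.≟ 𝟘)) (λ nz → nz e)
      flip u (no nz) = cong₂ (λ i t → i * R v s (z ⊕ t)) (sym (χ-neg u)) (trans (cong (u ⊕_) (sym (F.*-assoc s ĉ (u ⁻¹)))) (trans (Id.neg-arg u (s ⊗ ĉ) (u ⁻¹)) (cong (λ t → ⊝ (⊝ u ⊕ t)) (trans (FR.-‿distribʳ-* (s ⊗ ĉ) (u ⁻¹)) (cong ((s ⊗ ĉ) ⊗_) (sym (inv-neg u nz)))))))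

    line∞ : Line.normSq (R∞ (K v)) ≤ + 4 * + p * Line.normSq (R∞ v)
    line∞ = neg-norm (R∞ v) (R∞ (K v)) (λ z → trans (R∞-K z) (trans (inverse-bij (λ t → R∞ v (z ⊕ t))) (trans (punctured (λ t → R∞ v (z ⊕ t)) (trans (∑-translate z (R∞ v)) R∞-zeroSum)) (cong (λ t → - R∞ v t) (F.+-identityʳ z)))))

   -- In `radon` the total of K v is discarded with a favourable sign and the total of v is zero, so
   -- the two norms can be compared direction by direction.
   zeroSum-bound : normSq (K v) ≤ + 4 * + p * normSq v
   zeroSum-bound = *-cancelˡ-pos {+ p} (ℤ.+<+ (N.>-nonZero⁻¹ p {{prime⇒nonZero pr}})) (begin
    + p * normSq (K v)                                                       ≤⟨ ≤-by (square-nonneg (∑ plane (K v))) (lem (+ p * normSq (K v)) (∑ plane (K v) * ∑ plane (K v))) ⟩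
    + p * normSq (K v) + ∑ plane (K v) * ∑ plane (K v)                       ≡⟨ sym (radon (K v)) ⟩
    ∑ elems (λ s → Line.normSq (R (K v) s)) + Line.normSq (R∞ (K v))               ≤⟨ ZP.+-mono-≤ (∑-mono elems (λ {s} _ → line s (s Fin.≟ 𝟘))) line∞ ⟩
    ∑ elems (λ s → c * Line.normSq (R v s)) + c * Line.normSq (R∞ v)               ≡⟨ trans (cong (_+ c * Line.normSq (R∞ v)) (∑-*ˡ c elems _)) (sym (ZP.*-distribˡ-+ c _ _)) ⟩
    c * (∑ elems (λ s → Line.normSq (R v s)) + Line.normSq (R∞ v))                 ≡⟨ cong (c *_) (trans (radon v) (trans (cong (λ t → + p * normSq v + t * t) zeroSum) (ZP.+-identityʳ _))) ⟩
    c * (+ p * normSq v)                                                     ≡⟨ lem' c (+ p) (normSq v) ⟩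
    + p * (c * normSq v)                                                     ∎) where
    open ZP.≤-Reasoning
    c = + 4 * + p
    lem : ∀ a b → a + b - a ≡ b
    lem = solve-∀
    lem' : ∀ c p n → c * (p * n) ≡ p * (c * n)
    lem' = solve-∀

  private
   n₀ : ℤ
   n₀ = ∑ elems χ

   one-plane : F² → ℤ
   one-plane _ = 1ℤ

   K-linear : ∀ c d v w x → K (λ y → c * v y + d * w y) x ≡ c * K v x + d * K w x
   K-linear c d v w (x , y) = trans (∑-cong elems (λ u → lem c d (χ u) (v _) (w _))) (trans (∑-∙ elems _ _) (cong₂ _+_ (∑-*ˡ c elems _) (∑-*ˡ d elems _))) where
    lem : ∀ c d i v w → i * (c * v + d * w) ≡ c * (i * v) + d * (i * w)
    lem = solve-∀

   K-one : ∀ x → K one-plane x ≡ n₀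
   K-one x = ∑-cong elems (λ u → ZP.*-identityʳ (χ u))

   ∑-K : ∀ v → ∑ plane (K v) ≡ n₀ * ∑ plane v
   ∑-K v = trans (∑-swap plane elems (λ z u → χ u * v (fst z ⊕ u , snd z ⊕ ĉ ⊗ u ⁻¹))) (trans (∑-cong elems (λ u → trans (∑-*ˡ (χ u) plane _) (cong (χ u *_) (shift u (ĉ ⊗ u ⁻¹))))) (∑-*ʳ (∑ plane v) elems χ)) where
    shift : ∀ s t → ∑ plane (λ z → v (fst z ⊕ s , snd z ⊕ t)) ≡ ∑ plane v
    shift s t = trans (∑-plane _) (trans (∑-cong elems (λ x → ∑-translateʳ t (λ y → v (x ⊕ s , y)))) (trans (∑-translateʳ s (λ x → ∑ elems (λ y → v (x , y)))) (sym (∑-plane v))))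

   n₀≥0 : 0ℤ ≤ n₀
   n₀≥0 = ∑-nonneg elems (λ u → indicator-nonneg (¬? (u Fin.≟ 𝟘)))

   n₀≤p : n₀ ≤ + p
   n₀≤p = ZP.≤-trans (∑-mono elems (λ {u} _ → indicator-≤1 (¬? (u Fin.≟ 𝟘)))) (ZP.≤-reflexive (trans (∑-const elems 1ℤ) (trans (ZP.*-identityʳ _) (cong +_ length-elems))))

   ones : normSq one-plane ≡ + p * + p
   ones = trans (∑-plane _) (trans (∑-cong elems (λ x → trans (∑-const elems 1ℤ) (trans (ZP.*-identityʳ _) (cong +_ length-elems)))) (trans (∑-const elems (+ p)) (cong (λ n → + n * + p) length-elems)))

  -- The zero-sum case is applied to p² v - S, which is p² times the part of v orthogonal to
  -- constants, scaled to stay integral. On constants K is multiplication by `n₀` ≤ p, which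
  -- accounts for the last term.
  plane-bound : ∀ v → normSq (K v) ≤ + 4 * + p * normSq v + ∑ plane v * ∑ plane v
  plane-bound v = *-cancelˡ-pos {P * P * (P * P)} P⁴>0 (≤-by {z = (c * normSq v₀ - normSq (K v₀)) + P * P * (S * S) * (c + (P + n₀) * (P - n₀))}
    (ZP.+-mono-≤ (ZP.i≤j⇒0≤j-i (zeroSum-bound v₀ v₀-zero)) (*-nonneg {P * P * (S * S)} (*-nonneg {P * P} (square-nonneg P) (square-nonneg S)) (ZP.+-mono-≤ {0ℤ} {c} 0≤c (*-nonneg {P + n₀} (ZP.+-mono-≤ {0ℤ} {P} (ℤ.+≤+ N.z≤n) n₀≥0) (ZP.i≤j⇒0≤j-i n₀≤p)))))
    (trans (lem P (normSq v) (normSq (K v)) S n₀) (sym (cong₂ (λ a b → (c * a - b) + P * P * (S * S) * (c + (P + n₀) * (P - n₀))) norm₀ normK)))) where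
   P = + p
   c = + 4 * P
   S = ∑ plane v
   v₀ : F² → ℤ
   v₀ x = P * P * v x + - S * one-plane x
   0≤c : 0ℤ ≤ c
   0≤c = *-nonneg {+ 4} {P} (ℤ.+≤+ N.z≤n) (ℤ.+≤+ N.z≤n)
   P⁴>0 : 0ℤ < P * P * (P * P)
   P⁴>0 = subst (0ℤ <_) (trans (ZP.pos-* (p N.* p) (p N.* p)) (cong (λ t → t * t) (ZP.pos-* p p))) (ℤ.+<+ (NP.*-mono-< {0} {p N.* p} {0} {p N.* p} pp>0 pp>0)) where
    p>0 : 0 N.< p
    p>0 = N.>-nonZero⁻¹ p {{prime⇒nonZero pr}}
    pp>0 : 0 N.< p N.* p
    pp>0 = NP.*-mono-< {0} {p} {0} {p} p>0 p>0
   ⟨w,1⟩ : ∀ w → ⟨ w , one-plane ⟩ ≡ ∑ plane w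
   ⟨w,1⟩ w = ∑-cong plane (λ x → ZP.*-identityʳ (w x))
   v₀-zero : ∑ plane v₀ ≡ 0ℤ
   v₀-zero = trans (sym (⟨w,1⟩ v₀)) (trans (inner-linear (P * P) (- S) v one-plane one-plane) (trans (cong₂ (λ a b → P * P * a + - S * b) (⟨w,1⟩ v) ones) (lem0 (P * P) S))) where
    lem0 : ∀ q s → q * s + - s * q ≡ 0ℤ
    lem0 = solve-∀
   norm₀ : normSq v₀ ≡ P * P * (P * P) * normSq v + + 2 * (P * P * - S) * S + - S * - S * (P * P)
   norm₀ = trans (normSq-linear (P * P) (- S) v one-plane) (cong₂ (λ a b → P * P * (P * P) * normSq v + + 2 * (P * P * - S) * a + - S * - S * b) (⟨w,1⟩ v) ones)
   K₀ : ∀ x → K v₀ x ≡ P * P * K v x + - S * n₀ * one-plane x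
   K₀ x = trans (K-linear (P * P) (- S) v one-plane x) (cong (λ z → P * P * K v x + z) (trans (cong (- S *_) (K-one x)) (sym (ZP.*-identityʳ (- S * n₀)))))
   normK : normSq (K v₀) ≡ P * P * (P * P) * normSq (K v) + + 2 * (P * P * (- S * n₀)) * (n₀ * S) + - S * n₀ * (- S * n₀) * (P * P)
   normK = trans (inner-cong K₀ K₀) (trans (normSq-linear (P * P) (- S * n₀) (K v) one-plane) (cong₂ (λ a b → P * P * (P * P) * normSq (K v) + + 2 * (P * P * (- S * n₀)) * a + - S * n₀ * (- S * n₀) * b) (trans (⟨w,1⟩ (K v)) (∑-K v)) ones))
   lem : ∀ P n k S m → P * P * (P * P) * (+ 4 * P * n + S * S) - P * P * (P * P) * k ≡
      (+ 4 * P * (P * P * (P * P) * n + + 2 * (P * P * - S) * S + - S * - S * (P * P)) - (P * P * (P * P) * k + + 2 * (P * P * (- S * m)) * (m * S) + - S * m * (- S * m) * (P * P))) + P * P * (S * S) * (+ 4 * P + (P + m) * (P - m))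
   lem = solve-∀

 ∑-elems : ∀ f → Periodic p f → ∑ (allFin p) (λ x → f (toℤ x)) ≡ ∑ (res p) f
 ∑-elems f per = complete (allFin p) toℤ p (Uniqueₚ.allFin⁺ p) (Listₚ.length-tabulate (λ x → x)) (λ _ _ h → toℤ-injective-mod h) f per

 ∑-box-plane : ∀ v → Periodic² p v → ∑ (box p) v ≡ ∑ (cartesianProduct (allFin p) (allFin p)) (λ z → v (toℤ (fst z) , toℤ (snd z)))
 ∑-box-plane v per = trans (∑-box p v) (trans (∑-cong (res p) (λ x → sym (∑-elems (λ y → v (x , y)) (periodicʳ p {v} per x))))
  (trans (sym (∑-elems (λ x → ∑ elems (λ y → v (x , toℤ y))) (λ h → ∑-cong elems (λ y → per (mk² h mod-refl))))) (sym (∑-cartesianProductWith _,_ elems elems _))))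

 module _ (c : ℤ) (cop : Coprime ∣ c ∣ p) where
  ĉ : F
  ĉ = ⟦ c ⟧

  ĉ≢0 : ĉ ≢ 𝟘
  ĉ≢0 e = N.nonTrivial⇒≢1 {{prime⇒nonTrivial pr}} (cop (p∣c , ND.∣-refl)) where
   p∣c : p ND.∣ ∣ c ∣
   p∣c = ZD.∣⇒∣ᵤ (mod-0⇒∣ (⟦⟧-injective {c} {+ 0} e))
  open Plane ĉ ĉ≢0

  hat : (G → ℤ) → F² → ℤ
  hat v (x , y) = v (toℤ x , toℤ y)

  toℤ-⊕ : ∀ x u → toℤ x + toℤ u ≡ toℤ (x ⊕ u) [ p ]
  toℤ-⊕ x u = ⟦⟧-injective (trans (sym (⟦⟧-⊕ (toℤ x) (toℤ u))) (trans (cong₂ _⊕_ (⟦toℤ⟧ x) (⟦toℤ⟧ u)) (sym (⟦toℤ⟧ (x ⊕ u)))))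

  solution⇒ : ∀ u w → + p ZD.∣ toℤ u * toℤ w - c → u ⊗ w ≡ ĉ
  solution⇒ u w s = trans (sym (cong₂ _⊗_ (⟦toℤ⟧ u) (⟦toℤ⟧ w))) (trans (⟦⟧-⊗ (toℤ u) (toℤ w)) (⟦⟧-cong (mk s)))

  ⇒solution : ∀ u w → u ⊗ w ≡ ĉ → + p ZD.∣ toℤ u * toℤ w - c
  ⇒solution u w e = divs (⟦⟧-injective (trans (sym (⟦⟧-⊗ (toℤ u) (toℤ w))) (trans (cong₂ _⊗_ (⟦toℤ⟧ u) (⟦toℤ⟧ w)) e)))

  κ-hat : ∀ v → Periodic² p v → ∀ x → κ p c v (toℤ (fst x) , toℤ (snd x)) ≡ K (hat v) x
  κ-hat v per (x , y) = trans (∑-cong (box p) (λ a → cong (λ z → indicator (solution? p c a) * v ((toℤ x , toℤ y) ⊹ z)) (1· a)))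
    (trans (∑-box-plane _ per') (trans (∑-plane _) (∑-cong elems (λ u → column u (u Fin.≟ 𝟘))))) where
   f : G → ℤ
   f a = indicator (solution? p c a) * v ((toℤ x , toℤ y) ⊹ a)
   per' : Periodic² p f
   per' {a} {b} h@(mk² h₁ h₂) = cong₂ _*_ (indicator-⇔ (solution? p c a) (solution? p c b) (λ s → divs (mod-trans (mod-sym (mod-* h₁ h₂)) (mk s))) (λ s → divs (mod-trans (mod-* h₁ h₂) (mk s))))
    (per (mod²-⊹ {x = toℤ x , toℤ y} {toℤ x , toℤ y} (mod²-reflexive refl) h))
   column : ∀ u → Dec (u ≡ 𝟘) → ∑ elems (λ w → f (toℤ u , toℤ w)) ≡ χ u * hat v (x ⊕ u , y ⊕ ĉ ⊗ u ⁻¹)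
   column u (yes z) = trans (∑-ε elems (λ w → cong (_* v ((toℤ x , toℤ y) ⊹ (toℤ u , toℤ w))) (indicator-no (solution? p c (toℤ u , toℤ w)) (λ s → ĉ≢0 (trans (sym (solution⇒ u w s)) (trans (cong (_⊗ w) z) (F.zeroˡ w)))))))
    (sym (cong (_* hat v (x ⊕ u , y ⊕ ĉ ⊗ u ⁻¹)) (indicator-no (¬? (u Fin.≟ 𝟘)) (λ nz → nz z))))
   column u (no nz) = trans (∑-single {f = λ w → f (toℤ u , toℤ w)} {x = w₀} (Uniqueₚ.allFin⁺ p) (∈-allFin w₀) (λ {w} _ ne → cong (_* v ((toℤ x , toℤ y) ⊹ (toℤ u , toℤ w))) (indicator-no (solution? p c (toℤ u , toℤ w)) (λ s → ne (unique w (solution⇒ u w s))))))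
    (cong₂ _*_ (trans (indicator-yes (solution? p c (toℤ u , toℤ w₀)) (⇒solution u w₀ w₀-ok)) (sym (indicator-yes (¬? (u Fin.≟ 𝟘)) nz))) (per (mk² (toℤ-⊕ x u) (toℤ-⊕ y w₀)))) where
    w₀ = ĉ ⊗ u ⁻¹
    w₀-ok : u ⊗ w₀ ≡ ĉ
    w₀-ok = trans (cong (u ⊗_) (F.*-comm ĉ (u ⁻¹))) (trans (sym (F.*-assoc u (u ⁻¹) ĉ)) (trans (cong (_⊗ ĉ) (⁻¹-inverse nz)) (F.*-identityˡ ĉ)))
    unique : ∀ w → u ⊗ w ≡ ĉ → w ≡ w₀
    unique w e = sym (trans (cong (_⊗ u ⁻¹) (sym e)) (trans (cong (_⊗ u ⁻¹) (F.*-comm u w)) (trans (F.*-assoc w u (u ⁻¹)) (trans (cong (w ⊗_) (⁻¹-inverse nz)) (F.*-identityʳ w)))))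

  open Inner p

  normSq-κ : ∀ v → Periodic² p v → normSq (κ p c v) ≤ + 4 * + p * normSq v + ∑ (box p) v * ∑ (box p) v
  normSq-κ v per = ZP.≤-trans (ZP.≤-reflexive (trans (∑-box-plane _ (λ h → cong₂ _*_ (κper h) (κper h))) (∑-cong plane (λ x → cong₂ _*_ (κ-hat v per x) (κ-hat v per x)))))
   (ZP.≤-trans (plane-bound (hat v)) (ZP.≤-reflexive (sym (cong₂ (λ a b → + 4 * + p * a + b * b) (∑-box-plane (λ x → v x * v x) (λ h → cong₂ _*_ (per h) (per h))) (∑-box-plane v per))))) where
   κper : Periodic² p (κ p c v)
   κper = conv-periodic (box p) (λ a → indicator (solution? p c a)) (+ 1 ·_) {v = v} per

 -- `Pr 1 p` is the identity and `Pr p 1` the sum over the whole plane, so the two forms are the two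
 -- terms of `plane-bound`.
 prime-bound : Bound p 4 ((1 , p) ∷ (p , 1) ∷ [])
 prime-bound = record
  { factors = NP.*-identityˡ p ∷ NP.*-identityʳ p ∷ []
  ; bound = λ c cop v per → ZP.≤-trans (normSq-κ c cop v per) (≤-by {z = + 3 * (∑ (box p) v * ∑ (box p) v)} (*-nonneg {+ 3} (ℤ.+≤+ N.z≤n) (square-nonneg (∑ (box p) v)))
    (trans (cong₂ (λ a b → + 4 * (+ p * a + (+ 1 * b + 0ℤ)) - (+ 4 * + p * normSq v + ∑ (box p) v * ∑ (box p) v)) (inner-cong {w = v} (trivial v) (λ _ → refl)) (full v per)) (lem (+ p) (normSq v) (∑ (box p) v)))) } where
  open Inner p
  lem : ∀ p n s → + 4 * (p * n + (+ 1 * (s * s) + 0ℤ)) - (+ 4 * p * n + s * s) ≡ + 3 * (s * s)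
  lem = solve-∀
  trivial : ∀ v x → Pr 1 p v x ≡ v x
  trivial v x = trans (ZP.+-identityʳ _) (trans (ZP.*-identityˡ _) (cong v (cong₂ _,_ (z (fst x)) (z (snd x))))) where
   z : ∀ a → a + + p * + 0 ≡ a
   z a = trans (cong (λ t → a + t) (ZP.*-zeroʳ (+ p))) (ZP.+-identityʳ a)
  full : ∀ v → Periodic² p v → ⟨ Pr p 1 v , v ⟩ ≡ ∑ (box p) v * ∑ (box p) v
  full v per = trans (∑-cong (box p) (λ x → cong (_* v x) (trans (∑-cong (box p) (λ a → trans (ZP.*-identityˡ _) (cong v (trans (cong (x ⊹_) (1· a)) (⊹-comm x a))))) (box-shift p v per x)))) (∑-*ˡ (∑ (box p) v) (box p) v)

-- Tools for prime powers: cyclic sums and almost orthogonality.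

coprime-* : ∀ {a b c} → Coprime a b → Coprime a c → Coprime a (b N.* c)
coprime-* {a} {b} {c} ab ac {d} (d∣a , d∣bc) = ac (d∣a , Coprimality.coprime-divisor {d} {b} {c} (λ { (e∣d , e∣b) → ab (ND.∣-trans e∣d d∣a , e∣b) }) d∣bc)

coprime-^ : ∀ {a b} n → Coprime a b → Coprime a (b N.^ n)
coprime-^ zero ab (d∣a , d∣1) = ND.∣1⇒≡1 d∣1
coprime-^ (suc n) ab = coprime-* ab (coprime-^ n ab)

prime-coprime : ∀ {p} → Prime p → ∀ u → ¬ (+ p ZD.∣ u) → Coprime ∣ u ∣ p
prime-coprime {p} pr u p∤u {d} (d∣u , d∣p) with prime⇒irreducible pr d∣p
... | inj₁ d≡1 = d≡1
... | inj₂ refl = ⊥-elim (p∤u (ZD.∣ᵤ⇒∣ d∣u))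

∑-res-count : ∀ d t .{{_ : NonZero d}} .{{_ : NonZero (d N.* t)}} a → ∑ (res (d N.* t)) (λ x → indicator (+ d ∣? (x - a))) ≡ + t
∑-res-count d t a = trans (res-mixed d t (λ x → indicator (+ d ∣? (x - a))) per) (trans (∑-cong (res d) (λ i → ∑-cong (res t) (λ j → drop i j)))
 (trans (∑-cong (res d) (λ i → trans (∑-const (res t) _) (cong (λ k → + k * indicator (+ d ∣? (i - a))) (res-length t)))) (trans (∑-*ˡ (+ t) (res d) _) (trans (cong (+ t *_) one) (ZP.*-identityʳ (+ t)))))) where
 transfer : ∀ {n x y} → x ≡ y [ n ] → + n ZD.∣ x - a → + n ZD.∣ y - a
 transfer h s = divs (mod-trans (mod-sym h) (mk s))
 per : Periodic (d N.* t) (λ x → indicator (+ d ∣? (x - a)))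
 per {x} {y} h = indicator-⇔ (+ d ∣? (x - a)) (+ d ∣? (y - a)) (transfer (mod-coarsenˡ t h)) (transfer (mod-sym (mod-coarsenˡ t h)))
 drop : ∀ i j → indicator (+ d ∣? (i + + d * j - a)) ≡ indicator (+ d ∣? (i - a))
 drop i j = indicator-⇔ (+ d ∣? (i + + d * j - a)) (+ d ∣? (i - a)) (transfer (mod-drop i j)) (transfer (mod-sym (mod-drop i j)))
 a₀ = a %ℕ d
 one : ∑ (res d) (λ i → indicator (+ d ∣? (i - a))) ≡ 1ℤ
 one = trans (∑-single {f = λ i → indicator (+ d ∣? (i - a))} (res-unique d) (∈-res⁺ (n%ℕd<d a d)) (λ {i} i∈ ne → indicator-no (+ d ∣? (i - a)) (λ s → ne (res-mod-injective i∈ (∈-res⁺ (n%ℕd<d a d)) (mod-trans (mk s) (mod-sym (mod-%ℕ a d)))))))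
  (indicator-yes (+ d ∣? (+ a₀ - a)) (divs (mod-%ℕ a d)))

bound-nonneg : ∀ q .{{_ : NonZero q}} g s → g N.* s ≡ q → ∀ {v} → Periodic² q v → 0ℤ ≤ Inner.⟨_,_⟩ q (Pr g s v) v
bound-nonneg q g s gs {v} per = *-cancelˡ-pos {+ (g N.* g)} (ℤ.+<+ (NP.*-mono-< {0} {g} {0} {g} g>0 g>0))
 (ZP.≤-trans (ZP.≤-reflexive (ZP.*-zeroʳ (+ (g N.* g)))) (ZP.≤-trans (Inner.normSq-nonneg q (Pr g s v)) (ZP.≤-reflexive (Pr-inner q g s gs {v} {v} per per)))) where
 g>0 : 0 N.< g
 g>0 = NP.n≢0⇒n>0 λ { refl → N.≢-nonZero⁻¹ q (sym gs) }

bound-mono : ∀ {q A A' L} .{{_ : NonZero q}} → A N.≤ A' → Bound q A L → Bound q A' L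
bound-mono {q} {A} {A'} {L} le B = record
 { factors = Bound.factors B
 ; bound = λ c cop v per → ZP.≤-trans (Bound.bound B c cop v per) (ZP.*-monoʳ-≤-nonNeg (S v) {{ℤ.nonNegative (nonneg v per)}} (ℤ.+≤+ le)) } where
 S : (G → ℤ) → ℤ
 S v = ∑ L (λ gs → + snd gs * Inner.⟨_,_⟩ q (Pr (fst gs) (snd gs) v) v)
 nonneg : ∀ v → Periodic² q v → 0ℤ ≤ S v
 nonneg v per = ZP.≤-trans (ZP.≤-reflexive (sym (∑-ε L (λ _ → refl)))) (∑-mono L {f = λ _ → 0ℤ} (λ {gs} gs∈ → *-nonneg {+ snd gs} (ℤ.+≤+ N.z≤n) (bound-nonneg q (fst gs) (snd gs) (All.lookup (Bound.factors B) gs∈) {v} per)))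

module Cyclic (q n : ℕ) .{{_ : NonZero q}} .{{_ : NonZero n}} (σ : G) (torsion : ∀ {i j} → i ≡ j [ n ] → i · σ ≡² j · σ [ q ]) where
 open Inner q

 -- The sum over the multiples of σ; `torsion` makes it depend on them only mod n. By `C-self` and
 -- `C-C` it is n times an orthogonal projection.
 C : (G → ℤ) → G → ℤ
 C = conv (res n) (λ _ → 1ℤ) (_· σ)

 C-periodic : ∀ {v} → Periodic² q v → Periodic² q (C v)
 C-periodic {v} = conv-periodic (res n) (λ _ → 1ℤ) (_· σ) {v = v}

 +-·σ : ∀ i j → (i + j) · σ ≡ i · σ ⊹ j · σ
 +-·σ i j = cong₂ _,_ (ZP.*-distribʳ-+ (fst σ) i j) (ZP.*-distribʳ-+ (snd σ) i j)

 module _ {v : G → ℤ} (per : Periodic² q v) where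
  orbit : ∀ x → Periodic n (λ i → 1ℤ * v (x ⊹ i · σ))
  orbit x h = cong (1ℤ *_) (per (mod²-⊹ {x = x} {x} (mod²-reflexive refl) (torsion h)))

  C-invariant : ∀ j x → C v (x ⊹ j · σ) ≡ C v x
  C-invariant j x = trans (∑-cong (res n) (λ i → cong (λ y → 1ℤ * v y) (trans (⊹-assoc x (j · σ) (i · σ)) (cong (x ⊹_) (sym (+-·σ j i)))))) (res-shift n (λ i → 1ℤ * v (x ⊹ i · σ)) (orbit x) j)

  C-neg : ∀ x → conv (res n) (λ _ → 1ℤ) (λ i → neg (i · σ)) v x ≡ C v x
  C-neg x = trans (∑-cong (res n) (λ i → cong (λ y → 1ℤ * v (x ⊹ y)) (neg-· i σ))) (res-unit n (λ i → 1ℤ * v (x ⊹ i · σ)) (orbit x) (- 1ℤ) (Coprimality.1-coprimeTo n)) where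
   neg-· : ∀ i σ → neg (i · σ) ≡ (- 1ℤ * i) · σ
   neg-· i (a , b) = cong₂ _,_ (lem i a) (lem i b) where
    lem : ∀ i a → - (i * a) ≡ - 1ℤ * i * a
    lem = solve-∀

  C-C : ∀ x → C (C v) x ≡ + n * C v x
  C-C x = trans (∑-cong (res n) (λ i → trans (ZP.*-identityˡ _) (C-invariant i x))) (trans (∑-const (res n) (C v x)) (cong (λ k → + k * C v x) (res-length n)))

 C-self : ∀ {v w} → Periodic² q v → Periodic² q w → ⟨ C v , w ⟩ ≡ ⟨ v , C w ⟩
 C-self {v} {w} pv pw = trans (conv-adjoint (res n) (λ _ → 1ℤ) (_· σ) q {v} {w} pv pw) (inner-cong {v} (λ _ → refl) (C-neg {w} pw))

 C-inner : ∀ {v w} → Periodic² q v → Periodic² q w → ⟨ C w , C v ⟩ ≡ + n * ⟨ C w , v ⟩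
 C-inner {v} {w} pv pw = trans (inner-comm (C w) (C v)) (trans (C-self {v} {C w} pv (C-periodic {w} pw)) (trans (inner-cong {v} (λ _ → refl) (C-C {w} pw))
  (trans (∑-cong (box q) (λ x → lem (v x) (+ n) (C w x))) (∑-*ˡ (+ n) (box q) _)))) where
  lem : ∀ v c p → v * (c * p) ≡ c * (p * v)
  lem = solve-∀

box-mixed : ∀ m n .{{_ : NonZero m}} .{{_ : NonZero (m N.* n)}} v → Periodic² (m N.* n) v →
      ∑ (box (m N.* n)) v ≡ ∑ (box m) (λ a → ∑ (box n) (λ b → v (a ⊹ + m · b)))
box-mixed m n = box-lift {m N.* n} {m} {n} (λ i j → i + + m * j) (res-mixed m n)

box-fold : ∀ m n .{{_ : NonZero m}} .{{_ : NonZero (m N.* n)}} v → Periodic² m v → ∑ (box (m N.* n)) v ≡ + length (box n) * ∑ (box m) v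
box-fold m n v per = trans (box-mixed m n v (λ { (mk² a b) → per (mk² (mod-coarsenˡ n a) (mod-coarsenˡ n b)) }))
 (trans (∑-cong (box m) (λ a → trans (∑-cong (box n) (λ b → per (mk² (mod-drop (fst a) (fst b)) (mod-drop (snd a) (snd b))))) (∑-const (box n) (v a)))) (∑-*ˡ (+ length (box n)) (box m) v))

Pr-refine : ∀ {q} .{{_ : NonZero q}} g s n {v} → g N.* s N.* n ≡ q → Periodic² q v → ∀ x → Pr g s (Pr n (g N.* s) v) x ≡ Pr (g N.* n) s v x
Pr-refine {q} g s n {v} e per x = trans (conv-conv (box g) (λ _ → 1ℤ) (+ s ·_) (box n) (λ _ → 1ℤ) (+ (g N.* s) ·_) v x)
 (trans (∑-cong (box g) (λ a → ∑-cong (box n) (λ b → cong (λ y → 1ℤ * v y) (place a b))))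
  (sym (box-mixed g n {{g≢0}} {{gn≢0}} (λ a → 1ℤ * v (x ⊹ + s · a)) (λ h → cong (1ℤ *_) (dilate-periodic {v = v} per s (g N.* n) e' x h))))) where
 e' : s N.* (g N.* n) ≡ q
 e' = trans (sym (NP.*-assoc s g n)) (trans (cong (N._* n) (NP.*-comm s g)) e)
 gn≢0 : NonZero (g N.* n)
 gn≢0 = N.≢-nonZero λ z → N.≢-nonZero⁻¹ q (trans (sym e') (trans (cong (s N.*_) z) (NP.*-zeroʳ s)))
 g≢0 : NonZero g
 g≢0 = N.≢-nonZero λ { refl → N.≢-nonZero⁻¹ (g N.* n) {{gn≢0}} refl }
 place : ∀ a b → x ⊹ + s · a ⊹ + (g N.* s) · b ≡ x ⊹ + s · (a ⊹ + g · b)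
 place a b = trans (⊹-assoc x _ _) (cong (x ⊹_) (sym (trans (·-⊹ (+ s) a (+ g · b)) (cong (+ s · a ⊹_) (trans (·-· (+ s) (+ g) b) (cong (_· b) (trans (ZP.*-comm (+ s) (+ g)) (sym (ZP.pos-* g s)))))))))

Pr-trivial : ∀ s v x → Pr 1 s v x ≡ v x
Pr-trivial s v x = trans (ZP.+-identityʳ _) (trans (ZP.*-identityˡ _) (cong v (cong₂ _,_ (lem (fst x) (+ s)) (lem (snd x) (+ s))))) where
 lem : ∀ x s → x + s * 0ℤ ≡ x
 lem = solve-∀

module AlmostOrthogonal {A E : Set} (xs : List A) (es : List E) (f : E → A → ℤ) where
 open InnerProduct xs

 total : A → ℤ
 total x = ∑ es (λ e → f e x)

 inner-total : ∀ w → ⟨ total , w ⟩ ≡ ∑ es (λ e → ⟨ f e , w ⟩)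
 inner-total w = trans (∑-cong xs (λ x → sym (∑-*ʳ (w x) es (λ e → f e x)))) (∑-swap xs es (λ x e → f e x * w x))

 normSq-total : normSq total ≡ ∑ es (λ e → ∑ es (λ e' → ⟨ f e , f e' ⟩))
 normSq-total = trans (inner-total total) (∑-cong es (λ e → trans (inner-comm (f e) total) (trans (inner-total (f e)) (∑-cong es (λ e' → inner-comm (f e') (f e))))))

 -- A form of Schur's test: the pair bound distributes each inner product over the two norms with
 -- weight χ, and by symmetry every norm collects one row sum of χ twice.
 almost-orthogonal : (χ : E → E → ℤ) (R : ℤ) → (∀ e e' → χ e e' ≡ χ e' e) → (∀ e → ∑ es (χ e) ≤ R) →
           (∀ e e' → + 2 * ⟨ f e , f e' ⟩ ≤ χ e e' * (normSq (f e) + normSq (f e'))) → normSq total ≤ R * ∑ es (λ e → normSq (f e))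
 almost-orthogonal χ R χ-sym row pair = *-cancelˡ-pos {+ 2} (ℤ.+<+ (N.s≤s N.z≤n)) (begin
  + 2 * normSq total
   ≡⟨ trans (cong (+ 2 *_) normSq-total) (trans (sym (∑-*ˡ (+ 2) es _)) (∑-cong es (λ e → sym (∑-*ˡ (+ 2) es _)))) ⟩
  ∑ es (λ e → ∑ es (λ e' → + 2 * ⟨ f e , f e' ⟩))
   ≤⟨ ∑-mono es (λ {e} _ → ∑-mono es (λ {e'} _ → pair e e')) ⟩
  ∑ es (λ e → ∑ es (λ e' → χ e e' * (n e + n e')))
   ≡⟨ ∑-cong es (λ e → trans (∑-cong es (λ e' → ZP.*-distribˡ-+ (χ e e') (n e) (n e'))) (∑-∙ es (λ e' → χ e e' * n e) (λ e' → χ e e' * n e'))) ⟩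
  ∑ es (λ e → ∑ es (λ e' → χ e e' * n e) + ∑ es (λ e' → χ e e' * n e'))
   ≡⟨ ∑-∙ es (λ e → ∑ es (λ e' → χ e e' * n e)) (λ e → ∑ es (λ e' → χ e e' * n e')) ⟩
  S + ∑ es (λ e → ∑ es (λ e' → χ e e' * n e'))
   ≡⟨ cong (λ t → S + t) (trans (∑-swap es es (λ e e' → χ e e' * n e')) (∑-cong es (λ e → ∑-cong es (λ e' → cong (_* n e) (χ-sym e' e))))) ⟩
  S + S
   ≡⟨ double S ⟩
  + 2 * S
   ≡⟨ cong (+ 2 *_) (∑-cong es (λ e → trans (∑-*ʳ (n e) es (χ e)) (ZP.*-comm (∑ es (χ e)) (n e)))) ⟩
  + 2 * ∑ es (λ e → n e * ∑ es (χ e))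
   ≤⟨ *-monoˡ-nonneg {+ 2} (ℤ.+≤+ N.z≤n) (∑-mono es (λ {e} _ → *-monoˡ-nonneg {n e} (normSq-nonneg (f e)) (row e))) ⟩
  + 2 * ∑ es (λ e → n e * R)
   ≡⟨ cong (+ 2 *_) (trans (∑-*ʳ R es n) (ZP.*-comm (∑ es n) R)) ⟩
  + 2 * (R * ∑ es n) ∎) where
  open ZP.≤-Reasoning
  n : E → ℤ
  n e = normSq (f e)
  S = ∑ es (λ e → ∑ es (λ e' → χ e e' * n e))
  double : ∀ s → s + s ≡ + 2 * s
  double = solve-∀

 normSq-total≤ : normSq total ≤ + length es * ∑ es (λ e → normSq (f e))
 normSq-total≤ = almost-orthogonal (λ _ _ → 1ℤ) (+ length es) (λ _ _ → refl) (λ _ → ZP.≤-reflexive (trans (∑-const es 1ℤ) (ZP.*-identityʳ _)))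
  (λ e e' → ZP.≤-trans (2inner≤ (f e) (f e')) (ZP.≤-reflexive (sym (ZP.*-identityˡ _))))

translate : (G → ℤ) → G → G → ℤ
translate f b x = f (x ⊹ b)

translate-periodic : ∀ {q f} → Periodic² q f → ∀ b → Periodic² q (translate f b)
translate-periodic per b h = per (mod²-⊹ h (mod²-reflexive refl))

-- The p-adic valuation of n is at most h, so multiplying by a suitable power t of p brings it to
-- exactly h.
exact-multiple : ∀ p h n → ¬ (+ (p N.^ suc h) ZD.∣ n) → ∃ λ t → ∃ λ u → t * n ≡ + (p N.^ h) * u × ¬ (+ p ZD.∣ u)
exact-multiple p zero n ¬d = 1ℤ , n , refl , λ d → ¬d (subst (λ k → + k ZD.∣ n) (sym (NP.*-identityʳ p)) d)
exact-multiple p (suc h) n ¬d = go (+ (p N.^ suc h) ∣? n) where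
 go : Dec (+ (p N.^ suc h) ZD.∣ n) → ∃ λ t → ∃ λ u → t * n ≡ + (p N.^ suc h) * u × ¬ (+ p ZD.∣ u)
 go (yes (divides u e)) = 1ℤ , u , trans (ZP.*-identityˡ n) (trans e (ZP.*-comm u _)) ,
  λ { (divides w e') → ¬d (divides w (trans e (trans (cong (_* + (p N.^ suc h)) e') (trans (ZP.*-assoc w (+ p) _) (cong (w *_) (sym (ZP.pos-* p (p N.^ suc h)))))))) }
 go (no ¬d') = let t , u , e , p∤u = exact-multiple p h n ¬d' in + p * t , u , trans (ZP.*-assoc (+ p) t n) (trans (cong (+ p *_) e) (trans (sym (ZP.*-assoc (+ p) (+ (p N.^ h)) u)) (cong (_* u) (sym (ZP.pos-* p (p N.^ h)))))) , p∤u

-- Prime powers: descent to the next lower power.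

module PrimePowers (p : ℕ) (pr : Prime p) where
 instance
  p≢0 : NonZero p
  p≢0 = prime⇒nonZero pr

 -- An inverse modulo p^k, with default value 0 on multiples of p, where the factor `unit` masks it.
 ι : ℕ → ℤ → ℤ
 ι k u = go (+ p ∣? u) where
  go : Dec (+ p ZD.∣ u) → ℤ
  go (yes _) = 0ℤ
  go (no p∤u) = fst (unit-mod {p N.^ k} {c = u} (coprime-^ k (prime-coprime pr u p∤u)))

 ι-inverse : ∀ k u → ¬ (+ p ZD.∣ u) → u * ι k u ≡ + 1 [ p N.^ k ]
 ι-inverse k u p∤u with + p ∣? u
 ... | yes d = ⊥-elim (p∤u d)
 ... | no p∤u' = snd (unit-mod {p N.^ k} {c = u} (coprime-^ k (prime-coprime pr u p∤u')))

 ι-inverse-≤ : ∀ {k K} → k N.≤ K → ∀ u → ¬ (+ p ZD.∣ u) → u * ι K u ≡ + 1 [ p N.^ k ]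
 ι-inverse-≤ {k} {K} k≤K u p∤u = mod-coarsen (p N.^ (K N.∸ k)) (subst (λ e → u * ι K u ≡ + 1 [ e ]) (trans (cong (p N.^_) (sym (NP.m∸n+n≡m k≤K))) (NP.^-distribˡ-+-* p (K N.∸ k) k)) (ι-inverse K u p∤u))

 unit : ℤ → ℤ
 unit u = indicator (¬? (+ p ∣? u))

 unit-mod-p : ∀ {u u'} → u ≡ u' [ p ] → unit u ≡ unit u'
 unit-mod-p {u} {u'} h = indicator-⇔ (¬? (+ p ∣? u)) (¬? (+ p ∣? u')) (λ n d → n (mod-0⇒∣ (mod-trans h (∣⇒mod-0 d)))) (λ n d → n (mod-0⇒∣ (mod-trans (mod-sym h) (∣⇒mod-0 d))))

 unit-yes : ∀ {u} → ¬ (+ p ZD.∣ u) → unit u ≡ 1ℤ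
 unit-yes {u} n = indicator-yes (¬? (+ p ∣? u)) n

 unit-no : ∀ {u} → + p ZD.∣ u → unit u ≡ 0ℤ
 unit-no {u} d = indicator-no (¬? (+ p ∣? u)) (λ n → n d)

 pow≢0 : ∀ k → NonZero (p N.^ k)
 pow≢0 k = NP.m^n≢0 p k

 p∣pow : ∀ k → + p ZD.∣ + (p N.^ suc k)
 p∣pow k = divides (+ (p N.^ k)) (trans (cong +_ (NP.*-comm p (p N.^ k))) (ZP.pos-* (p N.^ k) p))

 solve-w : ∀ k c u w₀ → ¬ (+ p ZD.∣ u) → u * w₀ ≡ c [ p N.^ k ] → ∀ g → Periodic (p N.^ k) g →
      ∑ (res (p N.^ k)) (λ w → indicator (solution? (p N.^ k) c (u , w)) * g w) ≡ g w₀
 solve-w k c u w₀ p∤u h g per = trans (∑-single {f = λ w → indicator (solution? n c (u , w)) * g w} (res-unique n) r∈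
   (λ {w} w∈ ne → cong (_* g w) (indicator-no (solution? n c (u , w)) (λ s → ne (res-mod-injective w∈ r∈ (mod-trans (mod-cancel {c = u} (coprime-^ k (prime-coprime pr u p∤u)) (mod-trans (mk s) (mod-sym h))) (mod-sym (mod-%ℕ w₀ n {{pow≢0 k}}))))))))
  (trans (cong (_* g r) (indicator-yes (solution? n c (u , r)) (divs (mod-trans (mod-*ˡ u (mod-%ℕ w₀ n {{pow≢0 k}})) h)))) (trans (ZP.*-identityˡ (g r)) (per (mod-%ℕ w₀ n {{pow≢0 k}})))) where
  n = p N.^ k
  r = + (_%ℕ_ w₀ n {{pow≢0 k}})
  r∈ : r ∈ res n
  r∈ = ∈-res⁺ (n%ℕd<d w₀ n {{pow≢0 k}})

 no-solution : ∀ k c → Coprime ∣ c ∣ (p N.^ suc k) → ∀ u → + p ZD.∣ u → ∀ w → ¬ (+ (p N.^ suc k) ZD.∣ u * w - c)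
 no-solution k c cop u p∣u w s = N.nonTrivial⇒≢1 {{prime⇒nonTrivial pr}} (cop (ZD.∣⇒∣ᵤ p∣c , ND.∣m⇒∣m*n (p N.^ k) ND.∣-refl)) where
  lem : ∀ a c → a - (a - c) ≡ c
  lem = solve-∀
  p∣c : + p ZD.∣ c
  p∣c = subst (+ p ZD.∣_) (lem (u * w) c) (ZD.∣m∣n⇒∣m-n (ZD.∣m⇒∣m*n w p∣u) (ZD.∣-trans (p∣pow k) s))

 -- When c is a unit the solutions of u w ≡ c are the pairs (u , c / u) with u a unit. `K` may
 -- exceed the exponent, so that one choice of inverses serves two consecutive moduli.
 unit-sum : ∀ k K c → Coprime ∣ c ∣ (p N.^ suc k) → suc k N.≤ K → ∀ f → Periodic² (p N.^ suc k) f →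
       ∑ (box (p N.^ suc k)) (λ a → indicator (solution? (p N.^ suc k) c a) * f a) ≡ ∑ (res (p N.^ suc k)) (λ u → unit u * f (u , c * ι K u))
 unit-sum k K c cop k≤K f per = trans (∑-box n _) (∑-cong (res n) (λ u → row u (+ p ∣? u))) where
  n = p N.^ suc k
  row : ∀ u → Dec (+ p ZD.∣ u) → ∑ (res n) (λ w → indicator (solution? n c (u , w)) * f (u , w)) ≡ unit u * f (u , c * ι K u)
  row u (yes d) = trans (∑-ε (res n) (λ w → cong (_* f (u , w)) (indicator-no (solution? n c (u , w)) (no-solution k c cop u d w)))) (sym (cong (_* f (u , c * ι K u)) (unit-no d)))
  row u (no p∤u) = trans (solve-w (suc k) c u (c * ι K u) p∤u (mod-resp (lem u c (ι K u)) (ZP.*-identityʳ c) (mod-*ˡ c inv)) (λ w → f (u , w)) (periodicʳ n {f} per u))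
   (sym (trans (cong (_* f (u , c * ι K u)) (unit-yes p∤u)) (ZP.*-identityˡ _))) where
   lem : ∀ u c i → c * (u * i) ≡ u * (c * i)
   lem = solve-∀
   inv : u * ι K u ≡ + 1 [ n ]
   inv = ι-inverse-≤ k≤K u p∤u

 κ-unit-sum : ∀ k K c → Coprime ∣ c ∣ (p N.^ suc k) → suc k N.≤ K → ∀ v → Periodic² (p N.^ suc k) v → ∀ x →
        κ (p N.^ suc k) c v x ≡ ∑ (res (p N.^ suc k)) (λ u → unit u * v (x ⊹ (u , c * ι K u)))
 κ-unit-sum k K c cop k≤K v per x = trans (∑-cong (box (p N.^ suc k)) (λ a → cong (λ y → indicator (solution? (p N.^ suc k) c a) * v (x ⊹ y)) (1· a)))
  (unit-sum k K c cop k≤K (λ a → v (x ⊹ a)) (λ h → per (mod²-⊹ {x = x} {x} (mod²-reflexive refl) h)))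

 fiber-periodic : ∀ k K c → suc k N.≤ K → ∀ {v} → Periodic² (p N.^ suc k) v → ∀ x → Periodic (p N.^ suc k) (λ u → unit u * v (x ⊹ (u , c * ι K u)))
 fiber-periodic k K c k≤K {v} per x {u} {u'} h = go (+ p ∣? u) where
  h-p : u ≡ u' [ p ]
  h-p = mod-coarsenˡ (p N.^ k) h
  same : unit u ≡ unit u'
  same = unit-mod-p h-p
  inv : ∀ u → ¬ (+ p ZD.∣ u) → u * ι K u ≡ + 1 [ p N.^ suc k ]
  inv u p∤u = ι-inverse-≤ k≤K u p∤u
  go : Dec (+ p ZD.∣ u) → unit u * v (x ⊹ (u , c * ι K u)) ≡ unit u' * v (x ⊹ (u' , c * ι K u'))
  go (yes d) = trans (cong (_* v (x ⊹ (u , c * ι K u))) (unit-no d)) (sym (cong (_* v (x ⊹ (u' , c * ι K u'))) (trans (sym same) (unit-no d))))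
  go (no p∤u) = cong₂ _*_ same (per (mod²-⊹ {x = x} {x} (mod²-reflexive refl) (mk² h (mod-*ˡ c (mod-cancel {c = u} (coprime-^ (suc k) (prime-coprime pr u p∤u)) (mod-trans (inv u p∤u) (mod-sym (mod-trans (mod-* h (mod-refl {i = ι K u'})) (inv u' p∤u'))))))))) where
   p∤u' : ¬ (+ p ZD.∣ u')
   p∤u' d = p∤u (mod-0⇒∣ (mod-trans h-p (∣⇒mod-0 d)))

 module Power (k : ℕ) where

  m q : ℕ
  m = p N.^ suc k
  q = p N.^ suc (suc k)

  instance
   m≢0 : NonZero m
   m≢0 = pow≢0 (suc k)
   q≢0 : NonZero q
   q≢0 = pow≢0 (suc (suc k))

  open Inner q

  private
   mp≡q : m N.* p ≡ q
   mp≡q = NP.*-comm m p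

  σ₂ : G
  σ₂ = 0ℤ , + m

  torsion₂ : ∀ {i j} → i ≡ j [ p ] → i · σ₂ ≡² j · σ₂ [ q ]
  torsion₂ {i} {j} h = mk² (mod-reflexive (trans (ZP.*-zeroʳ i) (sym (ZP.*-zeroʳ j)))) (subst (λ e → i * + m ≡ j * + m [ e ]) mp≡q (mod-resp (ZP.*-comm (+ m) i) (ZP.*-comm (+ m) j) (mod-scale m h)))

  module C₂ = Cyclic q p σ₂ torsion₂

  P₂ : (G → ℤ) → G → ℤ
  P₂ = C₂.C

  -- `P₂` keeps the frequencies whose second coordinate is divisible by p. The condition `P₂ v` = 0
  -- removes them, and on the others a Kloosterman sum has size √q up to a constant.
  Star : ℕ → Set
  Star A = ∀ c → Coprime ∣ c ∣ q → ∀ v → Periodic² q v → (∀ x → P₂ v x ≡ 0ℤ) → normSq (κ q c v) ≤ + A * (+ q * normSq v)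

  module _ (c : ℤ) (cop : Coprime ∣ c ∣ q) (v : G → ℤ) (per : Periodic² q v) where
   private
    K₀ = 2 N.+ k
    copm : Coprime ∣ c ∣ m
    copm (a , b) = cop (a , ND.∣n⇒∣m*n p b)

    κs : ∀ {z} → Periodic² q z → ∀ x → κ q c z x ≡ ∑ (res q) (λ u → unit u * z (x ⊹ (u , c * ι K₀ u)))
    κs {z} pz = κ-unit-sum (suc k) K₀ c cop NP.≤-refl z pz

   z : G → ℤ
   z = P₂ v

   zper : Periodic² q z
   zper = C₂.C-periodic {v} per

   y : G → ℤ
   y = Pr p m v

   private
    z-shift : ∀ i x → z (x ⊹ (0ℤ , + m * i)) ≡ z x
    z-shift i x = trans (cong (λ s → z (x ⊹ s)) (cong₂ _,_ (sym (ZP.*-zeroʳ i)) (ZP.*-comm (+ m) i))) (C₂.C-invariant {v} per i x)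

    y-split : ∀ x → y x ≡ ∑ (res p) (λ i → z (x ⊹ (+ m * i , 0ℤ)))
    y-split x = trans (∑-box p _) (∑-cong (res p) (λ i → ∑-cong (res p) (λ j → cong (λ s → 1ℤ * v s) (trans (cong (x ⊹_) (cong₂ _,_ (lem1 (+ m * i) j) (lem2 (+ m) j))) (sym (⊹-assoc x (+ m * i , 0ℤ) (j · σ₂))))))) where
     lem1 : ∀ a j → a ≡ a + j * 0ℤ
     lem1 = solve-∀
     lem2 : ∀ m j → m * j ≡ 0ℤ + j * m
     lem2 = solve-∀

    -- Moving u by m i moves the inverse by a multiple of m, which z does not see.
    moved : ∀ i x u → unit u * z (x ⊹ (u , c * ι K₀ u) ⊹ (+ m * i , 0ℤ)) ≡ unit (u + + m * i) * z (x ⊹ (u + + m * i , c * ι K₀ (u + + m * i)))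
    moved i x u = go (+ p ∣? u) where
     u' = u + + m * i
     u≡u' : u ≡ u' [ m ]
     u≡u' = mod-sym (mod-drop u i)
     same : unit u ≡ unit u'
     same = unit-mod-p {u} {u'} (mod-sym {i = u'} (mod-by (+ (p N.^ k) * i) (trans (lem u (+ m * i)) (trans (cong (_* i) (trans (ZP.pos-* p (p N.^ k)) (ZP.*-comm (+ p) (+ (p N.^ k))))) (lem' (+ (p N.^ k)) (+ p) i))))) where
      lem : ∀ u a → u + a - u ≡ a
      lem = solve-∀
      lem' : ∀ a p i → a * p * i ≡ a * i * p
      lem' = solve-∀
     go : Dec (+ p ZD.∣ u) → unit u * z (x ⊹ (u , c * ι K₀ u) ⊹ (+ m * i , 0ℤ)) ≡ unit u' * z (x ⊹ (u' , c * ι K₀ u'))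
     go (yes d) = trans (cong (_* z (x ⊹ (u , c * ι K₀ u) ⊹ (+ m * i , 0ℤ))) (unit-no d)) (sym (cong (_* z (x ⊹ (u' , c * ι K₀ u'))) (trans (sym same) (unit-no d))))
     go (no p∤u) = cong₂ _*_ same (trans (sym (z-shift j (x ⊹ (u , c * ι K₀ u) ⊹ (+ m * i , 0ℤ)))) (zper close)) where
      p∤u' : ¬ (+ p ZD.∣ u')
      p∤u' d = indicator-absurd (trans (sym (unit-yes p∤u)) (trans same (unit-no d))) where
       indicator-absurd : 1ℤ ≡ 0ℤ → ⊥
       indicator-absurd ()
      inv : u * ι K₀ u ≡ + 1 [ m ]
      inv = mod-coarsen p (ι-inverse K₀ u p∤u)
      inv' : u' * ι K₀ u' ≡ + 1 [ m ]
      inv' = mod-coarsen p (ι-inverse K₀ u' p∤u')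
      ι≡ : ι K₀ u' ≡ ι K₀ u [ m ]
      ι≡ = mod-cancel {c = u} (coprime-^ (suc k) (prime-coprime pr u p∤u)) (mod-trans (mod-* u≡u' (mod-refl {i = ι K₀ u'})) (mod-trans inv' (mod-sym inv)))
      cι≡ : c * ι K₀ u' ≡ c * ι K₀ u [ m ]
      cι≡ = mod-*ˡ c ι≡
      j = ZD._∣_.quotient (divs cι≡)
      close : x ⊹ (u , c * ι K₀ u) ⊹ (+ m * i , 0ℤ) ⊹ (0ℤ , + m * j) ≡² x ⊹ (u' , c * ι K₀ u') [ q ]
      close = mod²-reflexive (cong₂ _,_ (lem1 (fst x) u (+ m * i)) (trans (cong (λ t → snd x + c * ι K₀ u + 0ℤ + t) (trans (ZP.*-comm (+ m) j) (sym (ZD._∣_.equality (divs cι≡))))) (lem2 (snd x) (c * ι K₀ u) (c * ι K₀ u')))) where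
       lem1 : ∀ x u a → x + u + a + 0ℤ ≡ x + (u + a)
       lem1 = solve-∀
       lem2 : ∀ x a b → x + a + 0ℤ + (b - a) ≡ x + b
       lem2 = solve-∀

    uf-periodic : ∀ x → Periodic q (λ u → unit u * z (x ⊹ (u , c * ι K₀ u)))
    uf-periodic = fiber-periodic (suc k) K₀ c NP.≤-refl {z} zper

   -- The function y sums z over p shifts of the first coordinate by multiples of m, and each shift
   -- is absorbed by moving u. Together with `κq≡pκm` this identifies the operator mod q on `P₂ v`
   -- with the operator mod m on y, which has period m.
   κy≡pκz : ∀ x → κ q c y x ≡ + p * κ q c z x
   κy≡pκz x = begin
    κ q c y x
     ≡⟨ κs {y} (Pr-periodic {v = v} p m per) x ⟩
    ∑ (res q) (λ u → unit u * y (x ⊹ (u , c * ι K₀ u)))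
     ≡⟨ ∑-cong (res q) (λ u → trans (cong (unit u *_) (y-split (x ⊹ (u , c * ι K₀ u)))) (sym (∑-*ˡ (unit u) (res p) _))) ⟩
    ∑ (res q) (λ u → ∑ (res p) (λ i → unit u * z (x ⊹ (u , c * ι K₀ u) ⊹ (+ m * i , 0ℤ))))
     ≡⟨ ∑-swap (res q) (res p) _ ⟩
    ∑ (res p) (λ i → ∑ (res q) (λ u → unit u * z (x ⊹ (u , c * ι K₀ u) ⊹ (+ m * i , 0ℤ))))
     ≡⟨ ∑-cong (res p) (λ i → trans (∑-cong (res q) (λ u → trans (moved i x u) (cong (λ t → unit t * z (x ⊹ (t , c * ι K₀ t))) (ZP.+-comm u (+ m * i))))) (res-shift q (λ u → unit u * z (x ⊹ (u , c * ι K₀ u))) (uf-periodic x) (+ m * i))) ⟩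
    ∑ (res p) (λ i → ∑ (res q) (λ u → unit u * z (x ⊹ (u , c * ι K₀ u))))
     ≡⟨ trans (∑-const (res p) _) (cong₂ (λ n t → + n * t) (res-length p) (sym (κs {z} zper x))) ⟩
    + p * κ q c z x ∎ where
    open ≡.≡-Reasoning

   yper : Periodic² m y
   yper {x} {x'} (mk² h₁ h₂) = trans (cong y x≡) (shift (fst x' , snd x') (quo₁ , quo₂)) where
    quo₁ = ZD._∣_.quotient (divs h₁)
    quo₂ = ZD._∣_.quotient (divs h₂)
    x≡ : x ≡ x' ⊹ + m · (quo₁ , quo₂)
    x≡ = cong₂ _,_ (lem (fst x) (fst x') quo₁ (ZD._∣_.equality (divs h₁))) (lem (snd x) (snd x') quo₂ (ZD._∣_.equality (divs h₂))) where
     lem' : ∀ a b → a ≡ b + (a - b)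
     lem' = solve-∀
     lem : ∀ a b j → a - b ≡ j * + m → a ≡ b + + m * j
     lem a b j e = trans (lem' a b) (cong (λ t → b + t) (trans e (ZP.*-comm j (+ m))))
    shift : ∀ x a → y (x ⊹ + m · a) ≡ y x
    shift x a = trans (∑-cong (box p) (λ b → cong (λ s → 1ℤ * v s) (trans (⊹-assoc x (+ m · a) (+ m · b)) (cong (x ⊹_) (trans (sym (·-⊹ (+ m) a b)) (cong (+ m ·_) (⊹-comm a b)))))))
     (box-shift p (λ b → 1ℤ * v (x ⊹ + m · b)) (λ h → cong (1ℤ *_) (dilate-periodic {v = v} per m p mp≡q x h)) a)

   κq≡pκm : ∀ x → κ q c y x ≡ + p * κ m c y x
   κq≡pκm x = begin
    κ q c y x
     ≡⟨ κs {y} (Pr-periodic {v = v} p m per) x ⟩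
    ∑ (res q) f
     ≡⟨ cong (λ n → ∑ (res n) f) (sym mp≡q) ⟩
    ∑ (res (m N.* p)) f
     ≡⟨ res-mixed m p {{m≢0}} {{subst NonZero (sym mp≡q) q≢0}} f (λ h → fper (mod-coarsenˡ p h)) ⟩
    ∑ (res m) (λ i → ∑ (res p) (λ j → f (i + + m * j)))
     ≡⟨ ∑-cong (res m) (λ i → trans (∑-cong (res p) (λ j → fper (mod-drop i j))) (trans (∑-const (res p) (f i)) (cong (λ n → + n * f i) (res-length p)))) ⟩
    ∑ (res m) (λ i → + p * f i)
     ≡⟨ trans (∑-*ˡ (+ p) (res m) f) (cong (+ p *_) (sym (κ-unit-sum k K₀ c copm (NP.n≤1+n (suc k)) y yper x))) ⟩
    + p * κ m c y x ∎ where
    open ≡.≡-Reasoning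
    f : ℤ → ℤ
    f u = unit u * y (x ⊹ (u , c * ι K₀ u))
    fper : Periodic m f
    fper = fiber-periodic k K₀ c (NP.n≤1+n (suc k)) {y} yper x

  refine : ℕ × ℕ → ℕ × ℕ
  refine gs = fst gs N.* p , snd gs

  -- p times the part of w orthogonal to the image of `P₂`, unnormalised to stay integral.
  fluct : (G → ℤ) → G → ℤ
  fluct w x = + p * w x + - 1ℤ * P₂ w x

  P₂-fluct : ∀ {w} → Periodic² q w → ∀ x → P₂ (fluct w) x ≡ 0ℤ
  P₂-fluct {w} per x = trans (conv-linear (res p) (λ _ → 1ℤ) (_· σ₂) (+ p) (- 1ℤ) w (P₂ w) x) (trans (cong (λ t → + p * P₂ w x + - 1ℤ * t) (C₂.C-C {w} per x)) (lem (+ p) (P₂ w x))) where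
   lem : ∀ p z → p * z + - 1ℤ * (p * z) ≡ 0ℤ
   lem = solve-∀

  pythagoras : ∀ {w} → Periodic² q w → + p * + p * normSq w ≡ normSq (P₂ w) + normSq (fluct w)
  pythagoras {w} per = sym (trans (cong₂ _+_ z² (normSq-linear (+ p) (- 1ℤ) w (P₂ w))) (trans (cong₂ (λ a b → + p * a + (+ p * + p * normSq w + + 2 * (+ p * - 1ℤ) * a + - 1ℤ * - 1ℤ * b)) refl z²) (lem (+ p) (normSq w) ⟨ w , P₂ w ⟩))) where
   z² : normSq (P₂ w) ≡ + p * ⟨ w , P₂ w ⟩
   z² = trans (C₂.C-inner {w} {w} per per) (cong (+ p *_) (inner-comm (P₂ w) w))
   lem : ∀ p n i → p * i + (p * p * n + + 2 * (p * - 1ℤ) * i + - 1ℤ * - 1ℤ * (p * i)) ≡ p * p * n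
   lem = solve-∀

  -- Both parts of v are mapped separately, since κ commutes with `P₂`. The part from `P₂ v` is
  -- bounded modulo m, which turns each (g , s) into (g p , s); the rest is bounded by `Star`, which
  -- is the new term (1 , q).
  step : ∀ {A L} → Bound m A L → Star A → Bound q A ((1 , q) ∷ map refine L)
  step {A} {L} B star = record
   { factors = NP.*-identityˡ q ∷ Allₚ.map⁺ (All.map (λ {gs} e → trans (lem (fst gs) (snd gs) p) (trans (cong (N._* p) e) mp≡q)) (Bound.factors B))
   ; bound = main } where
   open import Data.Nat.Tactic.RingSolver using () renaming (solve-∀ to solveℕ)
   lem : ∀ g s p → g N.* p N.* s ≡ g N.* s N.* p
   lem = solveℕ
   main : ∀ c → Coprime ∣ c ∣ q → ∀ v → Periodic² q v → normSq (κ q c v) ≤ + A * ∑ ((1 , q) ∷ map refine L) (λ gs → + snd gs * ⟨ Pr (fst gs) (snd gs) v , v ⟩)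
   main c cop v per = *-cancelˡ-pos {P²} P²-pos (begin
    P² * normSq (κ q c v)
     ≡⟨ pythagoras {κ q c v} κper ⟩
    normSq (P₂ (κ q c v)) + normSq (fluct (κ q c v))
     ≡⟨ cong₂ _+_ (inner-cong {P₂ (κ q c v)} κP κP) (inner-cong {fluct (κ q c v)} κF κF) ⟩
    normSq (κ q c Z) + normSq (κ q c (fluct v))
     ≤⟨ ZP.+-mono-≤ coarse fine ⟩
    P² * (+ A * Σ') + P² * (+ A * (+ q * normSq v))
     ≡⟨ trans (collect P² (+ A) Σ' (+ q * normSq v)) (cong (λ t → P² * (+ A * t)) (sym split)) ⟩
    P² * (+ A * ∑ ((1 , q) ∷ map refine L) (λ gs → + snd gs * ⟨ Pr (fst gs) (snd gs) v , v ⟩)) ∎) where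
    open ZP.≤-Reasoning
    P² = + p * + p
    P²-pos : 0ℤ < P²
    P²-pos = subst (0ℤ <_) (ZP.pos-* p p) (ℤ.+<+ (N.>-nonZero⁻¹ (p N.* p) {{NP.m*n≢0 p p}}))
    Z Y : G → ℤ
    Z = z c cop v per
    Y = y c cop v per
    ω : G → ℤ
    ω a = indicator (solution? q c a)
    κper : Periodic² q (κ q c v)
    κper = conv-periodic (box q) ω (+ 1 ·_) {v = v} per
    κP : ∀ x → P₂ (κ q c v) x ≡ κ q c Z x
    κP = conv-comm (res p) (λ _ → 1ℤ) (_· σ₂) (box q) ω (+ 1 ·_) v
    κF : ∀ x → fluct (κ q c v) x ≡ κ q c (fluct v) x
    κF x = trans (cong (λ t → + p * κ q c v x + - 1ℤ * t) (κP x)) (sym (conv-linear (box q) ω (+ 1 ·_) (+ p) (- 1ℤ) v Z x))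
    Fper : Periodic² q (fluct v)
    Fper h = cong₂ (λ a b → + p * a + - 1ℤ * b) (per h) (C₂.C-periodic {v} per h)
    Σ' = ∑ L (λ gs → + snd gs * ⟨ Pr (fst gs N.* p) (snd gs) v , v ⟩)
    collect : ∀ p a s t → p * (a * s) + p * (a * t) ≡ p * (a * (t + s))
    collect = solve-∀
    split : ∑ ((1 , q) ∷ map refine L) (λ gs → + snd gs * ⟨ Pr (fst gs) (snd gs) v , v ⟩) ≡ + q * normSq v + Σ'
    split = cong₂ _+_ (cong (+ q *_) (inner-cong {w = v} (Pr-trivial q v) (λ _ → refl))) (∑-map refine L _)
    fine : normSq (κ q c (fluct v)) ≤ P² * (+ A * (+ q * normSq v))
    fine = ZP.≤-trans (star c cop (fluct v) Fper (P₂-fluct {v} per)) (ZP.≤-trans (*-monoˡ-nonneg {+ A} (ℤ.+≤+ N.z≤n) (*-monoˡ-nonneg {+ q} (ℤ.+≤+ N.z≤n) small)) (ZP.≤-reflexive (swap (+ A) (+ q) P² (normSq v)))) where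
     swap : ∀ a q p n → a * (q * (p * n)) ≡ p * (a * (q * n))
     swap = solve-∀
     minus : ∀ a b → a + b - b ≡ a
     minus = solve-∀
     small : normSq (fluct v) ≤ P² * normSq v
     small = ≤-by (normSq-nonneg Z) (trans (cong (_- normSq (fluct v)) (pythagoras {v} per)) (minus (normSq Z) (normSq (fluct v))))
    coarse : normSq (κ q c Z) ≤ P² * (+ A * Σ')
    coarse = begin
     normSq (κ q c Z)
      ≡⟨ inner-cong same same ⟩
     normSq (κ m c Y)
      ≡⟨ fold (λ x → κ m c Y x * κ m c Y x) (λ h → cong₂ _*_ (κYper h) (κYper h)) ⟩
     n² * Inner.normSq m (κ m c Y)
      ≤⟨ *-monoˡ-nonneg {n²} (ℤ.+≤+ N.z≤n) (Bound.bound B c (λ { (a , b) → cop (a , ND.∣n⇒∣m*n p b) }) Y Yper) ⟩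
     n² * (+ A * ∑ L (λ gs → + snd gs * Inner.⟨_,_⟩ m (Pr (fst gs) (snd gs) Y) Y))
      ≡⟨ trans (swap n² (+ A) _) (cong (+ A *_) (trans (sym (∑-*ˡ n² L _)) (∑-cong∈ L (λ {gs} gs∈ → trans (swap n² (+ snd gs) _) (trans (cong (+ snd gs *_) (term gs (All.lookup (Bound.factors B) gs∈))) (swap (+ snd gs) P² _)))))) ⟩
     + A * ∑ L (λ gs → P² * (+ snd gs * ⟨ Pr (fst gs N.* p) (snd gs) v , v ⟩))
      ≡⟨ trans (cong (+ A *_) (∑-*ˡ P² L _)) (swap (+ A) P² Σ') ⟩
     P² * (+ A * Σ') ∎ where
     n² = + length (box p)
     swap : ∀ a b c → a * (b * c) ≡ b * (a * c)
     swap = solve-∀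
     Yper : Periodic² m Y
     Yper = yper c cop v per
     κYper : Periodic² m (κ m c Y)
     κYper = conv-periodic (box m) (λ a → indicator (solution? m c a)) (+ 1 ·_) {v = Y} Yper
     same : ∀ x → κ q c Z x ≡ κ m c Y x
     same x = ZP.*-cancelˡ-≡ (+ p) _ _ (trans (sym (κy≡pκz c cop v per x)) (κq≡pκm c cop v per x))
     fold : ∀ f → Periodic² m f → ∑ (box q) f ≡ n² * ∑ (box m) f
     fold f pf = trans (cong (λ n → ∑ (box n) f) (sym mp≡q)) (box-fold m p {{m≢0}} {{subst NonZero (sym mp≡q) q≢0}} f pf)
     term : ∀ gs → fst gs N.* snd gs ≡ m → n² * Inner.⟨_,_⟩ m (Pr (fst gs) (snd gs) Y) Y ≡ P² * ⟨ Pr (fst gs N.* p) (snd gs) v , v ⟩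
     term (g , s) e = trans (sym (fold (λ x → Pr g s Y x * Y x) (λ h → cong₂ _*_ (Pr-periodic {v = Y} g s Yper h) (Yper h))))
      (trans (inner-cong {w = Y} (conv-comm (box g) (λ _ → 1ℤ) (+ s ·_) (box p) (λ _ → 1ℤ) (+ m ·_) v) (λ _ → refl))
      (trans (Pr-inner q p m refl {v} {Pr g s v} per (Pr-periodic {v = v} g s per))
      (cong₂ _*_ (ZP.pos-* p p) (inner-cong {w = v} (λ x → trans (sym (conv-comm (box g) (λ _ → 1ℤ) (+ s ·_) (box p) (λ _ → 1ℤ) (+ m ·_) v x))
       (trans (cong (λ n → Pr g s (Pr p n v) x) (sym e)) (Pr-refine g s p {v} (trans (cong (N._* p) e) mp≡q) per x))) (λ _ → refl)))))

  -- As l runs over residues mod p so does u l, and the shifts by u l σ₂ add up to `P₂ g`.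
  average-zero : ∀ f {g} → Periodic² q g → (∀ x → P₂ g x ≡ 0ℤ) → ∀ u → ¬ (+ p ZD.∣ u) → ∑ (res p) (λ l → ⟨ f , translate g ((u * l) · σ₂) ⟩) ≡ 0ℤ
  average-zero f {g} per P0 u p∤u = trans (∑-swap (res p) (box q) (λ l x → f x * g (x ⊹ (u * l) · σ₂)))
   (∑-ε (box q) (λ x → trans (∑-*ˡ (f x) (res p) (λ l → g (x ⊹ (u * l) · σ₂))) (trans (cong (f x *_) (trans (∑-cong (res p) (λ l → sym (ZP.*-identityˡ _)))
    (trans (res-unit p (λ i → 1ℤ * g (x ⊹ i · σ₂)) (C₂.orbit {g} per x) u (prime-coprime pr u p∤u)) (P0 x)))) (ZP.*-zeroʳ (f x)))))

  inner-translate : ∀ {f g} → Periodic² q f → Periodic² q g → ∀ s → ⟨ translate f s , translate g s ⟩ ≡ ⟨ f , g ⟩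
  inner-translate {f} {g} pf pg s = box-shift q (λ x → f x * g x) (λ h → cong₂ _*_ (pf h) (pg h)) s

  invariant-inner : ∀ {f g} → Periodic² q f → Periodic² q g → ∀ s t → (∀ x → f (x ⊹ s) ≡ f x) → (∀ x → g (x ⊹ t) ≡ g x) → ⟨ f , translate g (s ⊹ t) ⟩ ≡ ⟨ f , g ⟩
  invariant-inner {f} {g} pf pg s t fs gt = trans (inner-cong {f} {translate f s} {translate g (s ⊹ t)} {translate g s} (λ x → sym (fs x)) (λ x → trans (cong g (sym (⊹-assoc x s t))) (gt (x ⊹ s)))) (inner-translate {f} {g} pf pg s)

  P₂-translate : ∀ {g} → (∀ x → P₂ g x ≡ 0ℤ) → ∀ b x → P₂ (translate g b) x ≡ 0ℤ
  P₂-translate {g} P0 b x = trans (∑-cong (res p) (λ i → cong (λ y → 1ℤ * g y) (⊹-swap x (i · σ₂) b))) (P0 (x ⊹ b))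

  -- Stationary phase: the modulus as H² r with r = 1 or r = p.

  module Split (h r : ℕ) {{r≢0 : NonZero r}} (m≡ : m ≡ p N.^ suc h N.* r N.* p N.^ h) (H₁ : ℕ) (H≡ : p N.^ suc h ≡ r N.* H₁) (c : ℤ) (cop : Coprime ∣ c ∣ q) where
   H K : ℕ
   H = p N.^ suc h
   K = 2 N.+ k

   instance
    H≢0 : NonZero H
    H≢0 = pow≢0 (suc h)
    rH≢0 : NonZero (r N.* H)
    rH≢0 = NP.m*n≢0 r H

   q≡ : H N.* (r N.* H) ≡ q
   q≡ = sym (trans (cong (p N.*_) m≡) (lem p (p N.^ h) r)) where
    open import Data.Nat.Tactic.RingSolver using () renaming (solve-∀ to solveℕ)
    lem : ∀ p n r → p N.* (p N.* n N.* r N.* n) ≡ p N.* n N.* (r N.* (p N.* n))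
    lem = solveℕ

   M : ℤ
   M = + (H N.* r)

   M≡ : M ≡ + H * + r
   M≡ = ZP.pos-* H r

   q≡M : + q ≡ M * + H
   q≡M = trans (cong +_ (trans (sym q≡) (sym (NP.*-assoc H r H)))) (ZP.pos-* (H N.* r) H)

   w : ℤ → ℤ
   w e = c * ι K e

   -- The tangent direction (e , -c / e) of the hyperbola u w = c at u = e, scaled by M = H r. Since
   -- M H = q its order divides H.
   σ : ℤ → G
   σ e = M * e , - (M * w e)

   -- The point of the hyperbola with first coordinate e + H y, its inverse expanded as a geometric
   -- series. The cubic term carries H³, which q = H² r divides because r divides H.
   base : ℤ → ℤ → G
   base e y = e + + H * y , w e * (1ℤ - ι K e * + H * y + ι K e * ι K e * (+ H * + H) * (y * y))

   torsion : ∀ e {i j} → i ≡ j [ H ] → i · σ e ≡² j · σ e [ q ]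
   torsion e {i} {j} (mk (divides n eq)) = mk² (mod-by (n * e) (trans (lem1 i j M e) (scale e))) (mod-by (n * - w e) (trans (lem2 i j M (w e)) (scale (- w e)))) where
    lem1 : ∀ i j M e → i * (M * e) - j * (M * e) ≡ (i - j) * M * e
    lem1 = solve-∀
    lem2 : ∀ i j M e → i * - (M * e) - j * - (M * e) ≡ (i - j) * M * - e
    lem2 = solve-∀
    lem3 : ∀ n H M e → n * H * M * e ≡ n * e * (M * H)
    lem3 = solve-∀
    scale : ∀ e → (i - j) * M * e ≡ n * e * + q
    scale e = trans (cong (λ t → t * M * e) eq) (trans (lem3 n (+ H) M e) (cong (n * e *_) (sym q≡M)))

   module Π (e : ℤ) = Cyclic q H (σ e) (torsion e)

   -- The inverse of e + H t to second order in H.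
   base-solves : ∀ e y z → ¬ (+ p ZD.∣ e) → (e + + H * (y + + r * (e * z))) * snd (base e y ⊹ z · σ e) ≡ c [ q ]
   base-solves e y z p∤e with divs (ι-inverse K e p∤e)
   ... | divides j eq = mod-by (X * j + Y) (trans (cong (_- c) (cong (λ t → (e + + H * (y + + r * (e * z))) * (w e * (1ℤ - ι K e * + H * y + ι K e * ι K e * (+ H * + H) * (y * y)) + z * - (t * w e))) M≡))
     (trans (lem e (ι K e) (+ H) (+ r) y z c) (trans (cong₂ (λ s t → X * s + t) eq (trans (cong (λ t → c * (i * i * i * (+ H * + H * t) * (y * y * y)) + Y' * (+ H * + H * + r)) H₁≡) (lem' c i (+ H) (+ r) (+ H₁) y Y'))) (trans (cong (λ t → X * (j * + q) + Y * t) Q≡) (lem″ X j Y (+ q)))))) where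
    i = ι K e
    X = c * (1ℤ - i * + H * y + i * i * (+ H * + H) * (y * y))
    Y' = c * (e * i * z * (i * i * + H * (y * y) - i * y - + r * z) - i * y * z)
    Y = c * (i * i * i * + H₁ * (y * y * y)) + Y'
    H₁≡ : + H ≡ + r * + H₁
    H₁≡ = trans (cong +_ H≡) (ZP.pos-* r H₁)
    Q≡ : + H * + H * + r ≡ + q
    Q≡ = trans (rot (+ H) (+ r)) (trans (cong (_* + H) (sym M≡)) (sym q≡M)) where
     rot : ∀ h r → h * h * r ≡ h * r * h
     rot = solve-∀
    lem : ∀ e i H r y z c → (e + H * (y + r * (e * z))) * (c * i * (1ℤ - i * H * y + i * i * (H * H) * (y * y)) + z * - (H * r * (c * i))) - c ≡
       c * (1ℤ - i * H * y + i * i * (H * H) * (y * y)) * (e * i - + 1) + (c * (i * i * i * (H * H * H) * (y * y * y)) + c * (e * i * z * (i * i * H * (y * y) - i * y - r * z) - i * y * z) * (H * H * r))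
    lem = solve-∀
    lem' : ∀ c i H r H₁ y Y' → c * (i * i * i * (H * H * (r * H₁)) * (y * y * y)) + Y' * (H * H * r) ≡ (c * (i * i * i * H₁ * (y * y * y)) + Y') * (H * H * r)
    lem' = solve-∀
    lem″ : ∀ X j Y q → X * (j * q) + Y * q ≡ (X * j + Y) * q
    lem″ = solve-∀

   mod-H-p : ∀ a b → a + + H * b ≡ a [ p ]
   mod-H-p a b = mod-coarsenˡ (p N.^ h) (mod-drop {H} a b)

   -- Each u is written as e + H y + M e z. The unit e in front of z only permutes the values of z,
   -- and with it the sum over z becomes the cyclic sum along `σ e`.
   base-expand : ∀ v → Periodic² q v → ∀ x → κ q c v x ≡ ∑ (res H) (λ e → unit e * ∑ (res r) (λ y → Π.C e v (x ⊹ base e y)))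
   base-expand v per x = begin
    κ q c v x
     ≡⟨ κ-unit-sum (suc k) K c cop NP.≤-refl v per x ⟩
    ∑ (res q) φ
     ≡⟨ cong (λ n → ∑ (res n) φ) (sym q≡) ⟩
    ∑ (res (H N.* (r N.* H))) φ
     ≡⟨ res-mixed H (r N.* H) {{H≢0}} {{NP.m*n≢0 H (r N.* H)}} φ φper' ⟩
    ∑ (res H) (λ e → ∑ (res (r N.* H)) (λ t → φ (e + + H * t)))
     ≡⟨ ∑-cong (res H) (λ e → trans (res-mixed r H (λ t → φ (e + + H * t)) (λ g → φper' (mod-+ˡ e (mod-scale H g)))) (fibre e (+ p ∣? e))) ⟩
    ∑ (res H) (λ e → unit e * ∑ (res r) (λ y → Π.C e v (x ⊹ base e y))) ∎ where
    open ≡.≡-Reasoning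
    φ : ℤ → ℤ
    φ u = unit u * v (x ⊹ (u , c * ι K u))
    φper : Periodic q φ
    φper = fiber-periodic (suc k) K c NP.≤-refl {v} per x
    φper' : Periodic (H N.* (r N.* H)) φ
    φper' {i} {j} g = φper (subst (λ n → i ≡ j [ n ]) q≡ g)
    fibre : ∀ e → Dec (+ p ZD.∣ e) → ∑ (res r) (λ y → ∑ (res H) (λ z → φ (e + + H * (y + + r * z)))) ≡ unit e * ∑ (res r) (λ y → Π.C e v (x ⊹ base e y))
    fibre e (yes d) = trans (∑-ε (res r) (λ y → ∑-ε (res H) (λ z → vanish (y + + r * z)))) (sym (cong (_* ∑ (res r) (λ y → Π.C e v (x ⊹ base e y))) (unit-no d))) where
     vanish : ∀ t → φ (e + + H * t) ≡ 0ℤ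
     vanish t = cong (_* v (x ⊹ (e + + H * t , c * ι K (e + + H * t)))) (trans (unit-mod-p {e + + H * t} {e} (mod-H-p e t)) (unit-no d))
    fibre e (no p∤e) = trans (∑-cong (res r) (λ y → trans (sym (res-unit H (λ z → φ (e + + H * (y + + r * z))) (λ g → φper' (mod-+ˡ e (mod-scale H (mod-+ˡ y (mod-scale r g))))) e (coprime-^ (suc h) (prime-coprime pr e p∤e)))) (∑-cong (res H) (λ z → term y z))))
      (sym (trans (cong (_* ∑ (res r) (λ y → Π.C e v (x ⊹ base e y))) (unit-yes p∤e)) (ZP.*-identityˡ _))) where
     term : ∀ y z → φ (e + + H * (y + + r * (e * z))) ≡ 1ℤ * v (x ⊹ base e y ⊹ z · σ e)
     term y z = cong₂ _*_ (unit-yes p∤u) (trans (per (mod²-⊹ {x = x} {x} (mod²-reflexive refl) (mk² (mod-reflexive fst≡) snd≡))) (cong v (sym (⊹-assoc x (base e y) (z · σ e))))) where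
      u = e + + H * (y + + r * (e * z))
      p∤u : ¬ (+ p ZD.∣ u)
      p∤u d = p∤e (mod-0⇒∣ (mod-trans (mod-sym (mod-H-p e (y + + r * (e * z)))) (∣⇒mod-0 d)))
      fst≡ : u ≡ e + + H * y + z * (M * e)
      fst≡ = trans (lem e (+ H) (+ r) y z) (cong (λ t → e + + H * y + z * (t * e)) (sym M≡)) where
       lem : ∀ e H r y z → e + H * (y + r * (e * z)) ≡ e + H * y + z * (H * r * e)
       lem = solve-∀
      snd≡ : c * ι K u ≡ snd (base e y ⊹ z · σ e) [ q ]
      snd≡ = mod-cancel {c = u} (coprime-^ K (prime-coprime pr u p∤u)) (mod-trans (mod-resp (lem c u (ι K u)) (ZP.*-identityʳ c) (mod-*ˡ c (ι-inverse K u p∤u))) (mod-sym (base-solves e y z p∤e))) where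
       lem : ∀ c u i → c * (u * i) ≡ u * (c * i)
       lem = solve-∀

   module Components (v : G → ℤ) (per : Periodic² q v) (P0 : ∀ x → P₂ v x ≡ 0ℤ) where
    π : ℤ → G → ℤ
    π e = Π.C e v

    π-periodic : ∀ e → Periodic² q (π e)
    π-periodic e = Π.C-periodic e {v} per

    π-P₂ : ∀ e x → P₂ (π e) x ≡ 0ℤ
    π-P₂ e x = trans (conv-comm (res p) (λ _ → 1ℤ) (_· σ₂) (res H) (λ _ → 1ℤ) (_· σ e) v x) (conv-zero (res H) (λ _ → 1ℤ) (_· σ e) {v = P₂ v} P0 x)

    -- Unless e² ≡ e'² mod H, the steps of π e and π e' generate a shift by a unit multiple of m in the second coordinate.
    orthogonal : ∀ e e' → ¬ (+ p ZD.∣ e) → ¬ (+ p ZD.∣ e') → ¬ (+ H ZD.∣ e * e - e' * e') → ∀ b b' → ⟨ translate (π e) b , translate (π e') b' ⟩ ≡ 0ℤ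
    orthogonal e e' p∤e p∤e' ¬sq b b' = ZP.*-cancelˡ-≡ (+ p) I 0ℤ {{ℤ.≢-nonZero λ z → N.≢-nonZero⁻¹ p (ZP.+-injective z)}} (trans (trans (sym (trans (∑-cong (res p) same) (trans (∑-const (res p) I) (cong (λ n → + n * I) (res-length p))))) (average-zero f {g} gper (P₂-translate {π e'} (π-P₂ e') b') u p∤u)) (sym (ZP.*-zeroʳ (+ p)))) where
     f g : G → ℤ
     f = translate (π e) b
     g = translate (π e') b'
     fper : Periodic² q f
     fper = translate-periodic {f = π e} (π-periodic e) b
     gper : Periodic² q g
     gper = translate-periodic {f = π e'} (π-periodic e') b'
     I = ⟨ f , g ⟩
     n = e * w e' - e' * w e
     ¬n : ¬ (+ H ZD.∣ n)
     ¬n d = ¬sq (mod-0⇒∣ (mod-cancel {c = c} copH (mod-trans (mod-sym rel) (mod-resp refl (trans (ZP.*-zeroʳ (e * e')) (sym (ZP.*-zeroʳ c))) (mod-*ˡ (e * e') (∣⇒mod-0 d)))))) where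
      copH : Coprime ∣ c ∣ H
      copH (d∣c , d∣H) = cop (d∣c , ND.∣-trans d∣H (subst (H ND.∣_) q≡ (ND.m∣m*n (r N.* H))))
      inv : ∀ e → ¬ (+ p ZD.∣ e) → e * ι K e ≡ + 1 [ H ]
      inv e p∤e = mod-coarsenˡ (r N.* H) (subst (λ n → e * ι K e ≡ + 1 [ n ]) (sym q≡) (ι-inverse K e p∤e))
      rel : e * e' * n ≡ c * (e * e - e' * e') [ H ]
      rel = mod-resp (lem c e e' (ι K e) (ι K e')) (lem' c e e') (mod-+ (mod-*ˡ (c * (e * e)) (inv e' p∤e')) (mod-neg (mod-*ˡ (c * (e' * e')) (inv e p∤e)))) where
       lem : ∀ c e e' i i' → c * (e * e) * (e' * i') + - (c * (e' * e') * (e * i)) ≡ e * e' * (e * (c * i') - e' * (c * i))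
       lem = solve-∀
       lem' : ∀ c e e' → c * (e * e) * + 1 + - (c * (e' * e') * + 1) ≡ c * (e * e - e' * e')
       lem' = solve-∀
     t = fst (exact-multiple p h n ¬n)
     u = fst (snd (exact-multiple p h n ¬n))
     tn≡ = fst (snd (snd (exact-multiple p h n ¬n)))
     p∤u = snd (snd (snd (exact-multiple p h n ¬n)))
     same : ∀ l → ⟨ f , translate g ((u * l) · σ₂) ⟩ ≡ I
     same l = trans (inner-cong {f} (λ _ → refl) (λ x → cong (λ s → g (x ⊹ s)) shift≡)) (invariant-inner {f} {g} fper gper ((e' * t * l) · σ e) (- (e * t * l) · σ e')
       (λ x → trans (cong (π e) (⊹-swap x _ b)) (Π.C-invariant e {v} per (e' * t * l) (x ⊹ b))) (λ x → trans (cong (π e') (⊹-swap x _ b')) (Π.C-invariant e' {v} per (- (e * t * l)) (x ⊹ b')))) where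
      shift≡ : (u * l) · σ₂ ≡ (e' * t * l) · σ e ⊹ - (e * t * l) · σ e'
      shift≡ = cong₂ _,_ (lem1 u l e e' t M) (trans (cong (u * l *_) m≡') (trans (lem3 u l M (+ (p N.^ h))) (trans (cong (λ z → M * z * l) (sym tn≡)) (lem2 l e e' t M (w e) (w e'))))) where
       m≡' : + m ≡ M * + (p N.^ h)
       m≡' = trans (cong +_ m≡) (ZP.pos-* (H N.* r) (p N.^ h))
       lem1 : ∀ u l e e' t M → u * l * 0ℤ ≡ e' * t * l * (M * e) + - (e * t * l) * (M * e')
       lem1 = solve-∀
       lem2 : ∀ l e e' t M w w' → M * (t * (e * w' - e' * w)) * l ≡ e' * t * l * - (M * w) + - (e * t * l) * - (M * w')
       lem2 = solve-∀
       lem3 : ∀ u l M P → u * l * (M * P) ≡ M * (P * u) * l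
       lem3 = solve-∀

    F : ℤ → G → ℤ
    F e x = ∑ (res r) (λ y → translate (π e) (base e y) x)

    module F (e : ℤ) = AlmostOrthogonal (box q) (res r) (λ y → translate (π e) (base e y))

    -- The trivial bound for a sum of r translates. It loses nothing for r = 1, and only a factor 2
    -- for r = p = 2.
    normSq-F≤ : ∀ e → normSq (F e) ≤ + r * + r * normSq (π e)
    normSq-F≤ e = ZP.≤-trans (F.normSq-total≤ e) (ZP.≤-reflexive (trans (cong₂ _*_ (cong +_ (res-length r)) (trans (∑-cong (res r) (λ y → inner-translate {π e} {π e} (π-periodic e) (π-periodic e) (base e y))) (trans (∑-const (res r) (normSq (π e))) (cong (λ n → + n * normSq (π e)) (res-length r))))) (sym (ZP.*-assoc (+ r) (+ r) (normSq (π e))))))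

    module Conclude (ρ D t : ℕ) (Dt≡H : D N.* t ≡ H)
      (roots : ∀ e e' → ¬ (+ p ZD.∣ e) → ¬ (+ p ZD.∣ e') → + H ZD.∣ e * e - e' * e' → (+ D ZD.∣ e' - e) ⊎ (+ D ZD.∣ e' - - e))
      (gauss : ∀ e → ¬ (+ p ZD.∣ e) → normSq (F e) ≤ + ρ * + r * normSq (π e)) where

     private
      instance
       Dt≢0 : NonZero (D N.* t)
       Dt≢0 = subst NonZero (sym Dt≡H) H≢0
       D≢0 : NonZero D
       D≢0 = N.≢-nonZero λ { refl → N.≢-nonZero⁻¹ (D N.* t) refl }

     -- With t = H / D there are t residues e' mod H in each of the classes e and -e mod D; so R is
     -- the row sum of `χ`.
     R : ℤ
     R = + t + + t

     χ : ℤ → ℤ → ℤ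
     χ e e' = indicator (+ D ∣? (e' - e)) + indicator (+ D ∣? (e' - - e))

     χ-sym : ∀ e e' → χ e e' ≡ χ e' e
     χ-sym e e' = cong₂ _+_ (indicator-⇔ (+ D ∣? (e' - e)) (+ D ∣? (e - e')) (flip e' e) (flip e e')) (cong (λ z → indicator (+ D ∣? z)) (lem e e')) where
      flip : ∀ a b → + D ZD.∣ a - b → + D ZD.∣ b - a
      flip a b s = divs (mod-sym {i = a} {b} (mk s))
      lem : ∀ e e' → e' - - e ≡ e - - e'
      lem = solve-∀

     χ-row : ∀ e → ∑ (res H) (χ e) ≤ R
     χ-row e = ZP.≤-reflexive (trans (∑-∙ (res H) (λ e' → indicator (+ D ∣? (e' - e))) (λ e' → indicator (+ D ∣? (e' - - e)))) (cong₂ _+_ (count e) (count (- e)))) where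
      count : ∀ a → ∑ (res H) (λ e' → indicator (+ D ∣? (e' - a))) ≡ + t
      count a = trans (cong (λ n → ∑ (res n) (λ e' → indicator (+ D ∣? (e' - a)))) (sym Dt≡H)) (∑-res-count D t a)

     χ-nonneg : ∀ e e' → 0ℤ ≤ χ e e'
     χ-nonneg e e' = ZP.+-mono-≤ (indicator-nonneg (+ D ∣? (e' - e))) (indicator-nonneg (+ D ∣? (e' - - e)))

     χ-≥1 : ∀ e e' → (+ D ZD.∣ e' - e) ⊎ (+ D ZD.∣ e' - - e) → 1ℤ ≤ χ e e'
     χ-≥1 e e' (inj₁ d) = ZP.+-mono-≤ (ZP.≤-reflexive (sym (indicator-yes (+ D ∣? (e' - e)) d))) (indicator-nonneg (+ D ∣? (e' - - e)))
     χ-≥1 e e' (inj₂ d) = ZP.+-mono-≤ (indicator-nonneg (+ D ∣? (e' - e))) (ZP.≤-reflexive (sym (indicator-yes (+ D ∣? (e' - - e)) d)))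

     masked : (ℤ → G → ℤ) → ℤ → G → ℤ
     masked f e x = unit e * f e x

     masked-yes : ∀ f {e} → ¬ (+ p ZD.∣ e) → ∀ x → masked f e x ≡ f e x
     masked-yes f {e} p∤e x = trans (cong (_* f e x) (unit-yes p∤e)) (ZP.*-identityˡ _)

     masked-no : ∀ f {e} → + p ZD.∣ e → ∀ x → masked f e x ≡ 0ℤ
     masked-no f {e} d x = cong (_* f e x) (unit-no d)

     inner-zero : ∀ {f} → (∀ x → f x ≡ 0ℤ) → ∀ g → ⟨ f , g ⟩ ≡ 0ℤ
     inner-zero z g = ∑-ε (box q) (λ x → cong (_* g x) (z x))

     module Family (f : ℤ → G → ℤ) (orth : ∀ e e' → ¬ (+ p ZD.∣ e) → ¬ (+ p ZD.∣ e') → ¬ (+ H ZD.∣ e * e - e' * e') → ⟨ f e , f e' ⟩ ≡ 0ℤ) where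
      open AlmostOrthogonal (box q) (res H) (masked f) public

      pair : ∀ e e' → + 2 * ⟨ masked f e , masked f e' ⟩ ≤ χ e e' * (normSq (masked f e) + normSq (masked f e'))
      pair e e' = go (+ p ∣? e) (+ p ∣? e') (+ H ∣? (e * e - e' * e')) where
       N = normSq (masked f e) + normSq (masked f e')
       N≥0 : 0ℤ ≤ N
       N≥0 = ZP.+-mono-≤ (normSq-nonneg (masked f e)) (normSq-nonneg (masked f e'))
       zero-case : ⟨ masked f e , masked f e' ⟩ ≡ 0ℤ → + 2 * ⟨ masked f e , masked f e' ⟩ ≤ χ e e' * N
       zero-case z = ZP.≤-trans (ZP.≤-reflexive (cong (+ 2 *_) z)) (*-nonneg {χ e e'} {N} (χ-nonneg e e') N≥0)
       go : Dec (+ p ZD.∣ e) → Dec (+ p ZD.∣ e') → Dec (+ H ZD.∣ e * e - e' * e') → + 2 * ⟨ masked f e , masked f e' ⟩ ≤ χ e e' * N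
       go (yes d) _ _ = zero-case (inner-zero (masked-no f d) (masked f e'))
       go (no _) (yes d) _ = zero-case (trans (inner-comm (masked f e) (masked f e')) (inner-zero (masked-no f d) (masked f e)))
       go (no p∤e) (no p∤e') (no ¬sq) = zero-case (trans (inner-cong (masked-yes f p∤e) (masked-yes f p∤e')) (orth e e' p∤e p∤e' ¬sq))
       go (no p∤e) (no p∤e') (yes sq) = ZP.≤-trans (2inner≤ (masked f e) (masked f e')) (ZP.≤-trans (ZP.≤-reflexive (sym (ZP.*-identityˡ N))) (ZP.*-monoʳ-≤-nonNeg N {{ℤ.nonNegative N≥0}} (χ-≥1 e e' (roots e e' p∤e p∤e' sq))))

      normSq-bound : normSq total ≤ R * ∑ (res H) (λ e → normSq (masked f e))
      normSq-bound = almost-orthogonal χ R χ-sym χ-row pair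

     F-orth : ∀ e e' → ¬ (+ p ZD.∣ e) → ¬ (+ p ZD.∣ e') → ¬ (+ H ZD.∣ e * e - e' * e') → ⟨ F e , F e' ⟩ ≡ 0ℤ
     F-orth e e' p∤e p∤e' ¬sq = trans (F.inner-total e (F e')) (∑-ε (res r) (λ y → trans (inner-comm (translate (π e) (base e y)) (F e')) (trans (F.inner-total e' (translate (π e) (base e y)))
      (∑-ε (res r) (λ y' → trans (inner-comm (translate (π e') (base e' y')) (translate (π e) (base e y))) (orthogonal e e' p∤e p∤e' ¬sq (base e y) (base e' y')))))))

     π-orth : ∀ e e' → ¬ (+ p ZD.∣ e) → ¬ (+ p ZD.∣ e') → ¬ (+ H ZD.∣ e * e - e' * e') → ⟨ π e , π e' ⟩ ≡ 0ℤ
     π-orth e e' p∤e p∤e' ¬sq = trans (sym (inner-translate {π e} {π e'} (π-periodic e) (π-periodic e') (0ℤ , 0ℤ))) (orthogonal e e' p∤e p∤e' ¬sq (0ℤ , 0ℤ) (0ℤ , 0ℤ))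

     module FF = Family F F-orth
     module FP = Family π π-orth

     Y : ℤ
     Y = ⟨ FP.total , v ⟩

     π-norms : ∑ (res H) (λ e → normSq (masked π e)) ≡ + H * Y
     π-norms = trans (∑-cong (res H) (λ e → go e (+ p ∣? e))) (trans (∑-*ˡ (+ H) (res H) (λ e → ⟨ masked π e , v ⟩)) (cong (+ H *_) (sym (FP.inner-total v)))) where
      go : ∀ e → Dec (+ p ZD.∣ e) → normSq (masked π e) ≡ + H * ⟨ masked π e , v ⟩
      go e (yes d) = trans (inner-zero (masked-no π d) (masked π e)) (sym (trans (cong (+ H *_) (inner-zero (masked-no π d) v)) (ZP.*-zeroʳ (+ H))))
      go e (no p∤e) = trans (inner-cong (masked-yes π p∤e) (masked-yes π p∤e)) (trans (Π.C-inner e {v} {v} per per) (cong (+ H *_) (inner-cong {w = v} (λ x → sym (masked-yes π p∤e x)) (λ _ → refl))))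

     F-norms : ∑ (res H) (λ e → normSq (masked F e)) ≤ + ρ * + r * (+ H * Y)
     F-norms = ZP.≤-trans (∑-mono (res H) (λ {e} _ → go e (+ p ∣? e))) (ZP.≤-reflexive (trans (∑-*ˡ (+ ρ * + r) (res H) (λ e → normSq (masked π e))) (cong (+ ρ * + r *_) π-norms))) where
      go : ∀ e → Dec (+ p ZD.∣ e) → normSq (masked F e) ≤ + ρ * + r * normSq (masked π e)
      go e (yes d) = ZP.≤-reflexive (trans (inner-zero (masked-no F d) (masked F e)) (sym (trans (cong (+ ρ * + r *_) (inner-zero (masked-no π d) (masked π e))) (ZP.*-zeroʳ (+ ρ * + r)))))
      go e (no p∤e) = ZP.≤-trans (ZP.≤-reflexive (inner-cong (masked-yes F p∤e) (masked-yes F p∤e))) (ZP.≤-trans (gauss e p∤e) (ZP.≤-reflexive (cong (+ ρ * + r *_) (inner-cong (λ x → sym (masked-yes π p∤e x)) (λ x → sym (masked-yes π p∤e x))))))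

     R≥0 : 0ℤ ≤ R
     R≥0 = ℤ.+≤+ N.z≤n

     -- Let T be the sum of the masked `π e`. Almost orthogonality bounds its squared norm by R H Y,
     -- where Y is its inner product with v; then the squared norm of T - R H v is expanded.
     RHY≤ : R * (+ H * Y) ≤ R * + H * (R * + H) * normSq v
     RHY≤ = ZP.≤-trans (≤-by (ZP.+-mono-≤ (normSq-nonneg (λ x → 1ℤ * FP.total x + - (R * + H) * v x)) slack) (trans (lem (R * + H) Y (normSq FP.total) (normSq v) (R * (+ H * Y)) (ZP.*-assoc R (+ H) Y)) (cong (λ z → z + (R * (+ H * Y) - normSq FP.total)) (sym (normSq-linear 1ℤ (- (R * + H)) FP.total v))))) ZP.≤-refl where
      slack : 0ℤ ≤ R * (+ H * Y) - normSq FP.total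
      slack = ZP.i≤j⇒0≤j-i (ZP.≤-trans FP.normSq-bound (ZP.≤-reflexive (cong (R *_) π-norms)))
      lem : ∀ a y n s b → a * y ≡ b → a * a * s - b ≡ 1ℤ * 1ℤ * n + + 2 * (1ℤ * - a) * y + - a * - a * s + (b - n)
      lem a y n s .(a * y) refl = lem' a y n s where
       lem' : ∀ a y n s → a * a * s - a * y ≡ 1ℤ * 1ℤ * n + + 2 * (1ℤ * - a) * y + - a * - a * s + (a * y - n)
       lem' = solve-∀

     -- Almost orthogonality enters twice, for the pieces `F e` of κ v and, through `RHY≤`, for the
     -- projections `π e`; hence R². The remaining factors r and H² multiply to q.
     star : normSq (κ q c v) ≤ + ρ * (R * R) * (+ q * normSq v)
     star = begin
      normSq (κ q c v)
       ≡⟨ inner-cong (base-expand v per) (base-expand v per) ⟩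
      normSq FF.total
       ≤⟨ FF.normSq-bound ⟩
      R * ∑ (res H) (λ e → normSq (masked F e))
       ≤⟨ *-monoˡ-nonneg {R} R≥0 F-norms ⟩
      R * (+ ρ * + r * (+ H * Y))
       ≡⟨ lem1 R (+ ρ) (+ r) (+ H * Y) ⟩
      + ρ * + r * (R * (+ H * Y))
       ≤⟨ *-monoˡ-nonneg {+ ρ * + r} (*-nonneg {+ ρ} {+ r} (ℤ.+≤+ N.z≤n) (ℤ.+≤+ N.z≤n)) RHY≤ ⟩
      + ρ * + r * (R * + H * (R * + H) * normSq v)
       ≡⟨ trans (lem2 (+ ρ) (+ r) R (+ H) (normSq v)) (cong (λ z → + ρ * (R * R) * (z * normSq v)) (sym (trans q≡M (cong (_* + H) M≡)))) ⟩
      + ρ * (R * R) * (+ q * normSq v) ∎ where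
      open ZP.≤-Reasoning
      lem1 : ∀ R ρ r s → R * (ρ * r * s) ≡ ρ * r * (R * s)
      lem1 = solve-∀
      lem2 : ∀ ρ r R H n → ρ * r * (R * H * (R * H) * n) ≡ ρ * (R * R) * (H * r * H * n)
      lem2 = solve-∀

  -- For q = H² p the sum over y is a quadratic Gauss sum.
  module Gauss (p≢2 : p ≢ 2) (h : ℕ) (m≡ : m ≡ p N.^ suc h N.* p N.* p N.^ h) (c : ℤ) (cop : Coprime ∣ c ∣ q) (v : G → ℤ) (per : Periodic² q v) (P0 : ∀ x → P₂ v x ≡ 0ℤ) where
   open Split h p m≡ (p N.^ h) refl c cop
   open Components v per P0

   m≡H² : + m ≡ + H * + H
   m≡H² = trans (cong +_ (trans m≡ (trans (NP.*-assoc H p (p N.^ h)) refl))) (ZP.pos-* H H)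

   p∤2 : ¬ (+ p ZD.∣ + 2)
   p∤2 d = p≢2 (NP.≤-antisym (ND.∣⇒≤ (ZD.∣⇒∣ᵤ d)) (N.nonTrivial⇒n>1 p {{prime⇒nonTrivial pr}}))

   p∤c : ¬ (+ p ZD.∣ c)
   p∤c d = N.nonTrivial⇒≢1 {{prime⇒nonTrivial pr}} (cop (ZD.∣⇒∣ᵤ d , ND.∣m⇒∣m*n m ND.∣-refl))

   p∤* : ∀ {a b} → ¬ (+ p ZD.∣ a) → ¬ (+ p ZD.∣ b) → ¬ (+ p ZD.∣ a * b)
   p∤* {a} {b} ¬a ¬b d with prime-∣-* pr a b d
   ... | inj₁ x = ¬a x
   ... | inj₂ y = ¬b y

   module _ (e : ℤ) (p∤e : ¬ (+ p ZD.∣ e)) where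
    private
     i = ι K e
     g = π e

    p∤i : ¬ (+ p ZD.∣ i)
    p∤i d = N.nonTrivial⇒≢1 {{prime⇒nonTrivial pr}} (ND.∣1⇒≡1 (ZD.∣⇒∣ᵤ (mod-0⇒∣ (mod-trans (mod-sym (mod-coarsenˡ m (ι-inverse K e p∤e))) (∣⇒mod-0 (ZD.∣n⇒∣m*n e d))))))

    -- Changing y by p changes the base point, modulo q, by a multiple of `σ e`, under which `π e`
    -- is invariant.
    periodic-y : ∀ x → Periodic p (λ y → g (x ⊹ base e y))
    periodic-y x {y} {y'} (mk (divides l eq)) with divs (ι-inverse K e p∤e)
    ... | divides j eq' = trans (π-periodic e (mod²-⊹ {x = x} {x} (mod²-reflexive refl) close)) (trans (cong g (sym (⊹-assoc x (base e y') ((l * i) · σ e)))) (Π.C-invariant e {v} per (l * i) (x ⊹ base e y'))) where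
     y≡ : y ≡ y' + l * + p
     y≡ = trans (lem y y') (cong (λ t → y' + t) eq) where
      lem : ∀ y y' → y ≡ y' + (y - y')
      lem = solve-∀
     q≡' : + H * + p * + H ≡ + q
     q≡' = sym (trans q≡M (cong (_* + H) M≡))
     close : base e y ≡² base e y' ⊹ (l * i) · σ e [ q ]
     close = mk² (mod-by (- (+ H * + p * l * j)) (trans (cong₂ (λ s t → e + + H * s - (e + + H * y' + l * i * (t * e))) y≡ M≡) (trans (lem1 e i (+ H) (+ p) y' l) (trans (cong (λ t → - (+ H * + p * l) * t) eq') (lem3 (+ H * + p * l) j (+ q))))))
      (mod-by (w e * (i * i) * l * (+ 2 * y' + l * + p)) (trans (cong₂ (λ s t → w e * (1ℤ - i * + H * s + i * i * (+ H * + H) * (s * s)) - (w e * (1ℤ - i * + H * y' + i * i * (+ H * + H) * (y' * y')) + l * i * - (t * w e))) y≡ M≡) (trans (lem2 (w e) i (+ H) (+ p) y' l) (cong (w e * (i * i) * l * (+ 2 * y' + l * + p) *_) q≡')))) where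
      lem1 : ∀ e i H p y l → e + H * (y + l * p) - (e + H * y + l * i * (H * p * e)) ≡ - (H * p * l) * (e * i - + 1)
      lem1 = solve-∀
      lem2 : ∀ w i H p y l → w * (1ℤ - i * H * (y + l * p) + i * i * (H * H) * ((y + l * p) * (y + l * p))) - (w * (1ℤ - i * H * y + i * i * (H * H) * (y * y)) + l * i * - (H * p * w)) ≡ w * (i * i) * l * (+ 2 * y + l * p) * (H * p * H)
      lem2 = solve-∀
      lem3 : ∀ a j q → - a * (j * q) ≡ - (a * j) * q
      lem3 = solve-∀

    β : ℤ → G
    β δ = + H * δ , w e * (i * i * (+ H * + H) * (δ * δ) - i * + H * δ)

    u : ℤ → ℤ
    u δ = + 2 * (w e * (i * i)) * δ

    -- The increment of a quadratic function is linear in y. Its y-dependent part is a multiple of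
    -- H², and H² = m for r = p, so it is a multiple of σ₂.
    base-+ : ∀ δ y → base e (y + δ) ≡ base e y ⊹ ((u δ * y) · σ₂ ⊹ β δ)
    base-+ δ y = cong₂ _,_ (lem1 e (+ H) y δ (u δ)) (trans (lem2 (w e) i (+ H) y δ) (cong (λ t → w e * (1ℤ - i * + H * y + i * i * (+ H * + H) * (y * y)) + (u δ * y * t + w e * (i * i * (+ H * + H) * (δ * δ) - i * + H * δ))) (sym m≡H²))) where
     lem1 : ∀ e H y δ u → e + H * (y + δ) ≡ e + H * y + (u * y * 0ℤ + H * δ)
     lem1 = solve-∀
     lem2 : ∀ w i H y δ → w * (1ℤ - i * H * (y + δ) + i * i * (H * H) * ((y + δ) * (y + δ))) ≡ w * (1ℤ - i * H * y + i * i * (H * H) * (y * y)) + (+ 2 * (w * (i * i)) * δ * y * (H * H) + w * (i * i * (H * H) * (δ * δ) - i * H * δ))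
     lem2 = solve-∀

    correlation : ∀ δ y → ⟨ translate g (base e y) , translate g (base e (y + δ)) ⟩ ≡ ⟨ g , translate (translate g (β δ)) ((u δ * y) · σ₂) ⟩
    correlation δ y = trans (inner-cong {translate g (base e y)} (λ _ → refl) (λ x → cong g (trans (cong (x ⊹_) (base-+ δ y)) (trans (sym (⊹-assoc x (base e y) _)) (sym (⊹-assoc (x ⊹ base e y) ((u δ * y) · σ₂) (β δ)))))))
     (inner-translate {g} {translate (translate g (β δ)) ((u δ * y) · σ₂)} (π-periodic e) (translate-periodic {f = translate g (β δ)} (translate-periodic {f = g} (π-periodic e) (β δ)) ((u δ * y) · σ₂)) (base e y))

    T : ℤ → ℤ
    T δ = ∑ (res p) (λ y → ⟨ translate g (base e y) , translate g (base e (y + δ)) ⟩)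

    -- Oddness of p enters here: 2 w i² δ has to be a unit, so that the sum over y runs through the
    -- whole group of `P₂`.
    off-diagonal : ∀ {δ} → ¬ (+ p ZD.∣ δ) → T δ ≡ 0ℤ
    off-diagonal {δ} p∤δ = trans (∑-cong (res p) (correlation δ)) (average-zero g {translate g (β δ)} (translate-periodic {f = g} (π-periodic e) (β δ)) (P₂-translate {g} (π-P₂ e) (β δ)) (u δ) (p∤* {+ 2 * (w e * (i * i))} (p∤* {+ 2} p∤2 (p∤* {w e} (p∤* {c} p∤c p∤i) (p∤* {i} p∤i p∤i))) p∤δ))

    gauss : normSq (F e) ≤ + 1 * + p * normSq g
    gauss = ZP.≤-reflexive (begin
     normSq (F e)
      ≡⟨ F.normSq-total e ⟩
     ∑ (res p) (λ y → ∑ (res p) (λ y' → ⟨ translate g (base e y) , translate g (base e y') ⟩))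
      ≡⟨ ∑-cong (res p) (λ y → sym (res-shift p (λ y' → ⟨ translate g (base e y) , translate g (base e y') ⟩) (λ {a} {b} r → inner-cong {translate g (base e y)} (λ _ → refl) (λ x → periodic-y x {a} {b} r)) y)) ⟩
     ∑ (res p) (λ y → ∑ (res p) (λ δ → ⟨ translate g (base e y) , translate g (base e (y + δ)) ⟩))
      ≡⟨ ∑-swap (res p) (res p) _ ⟩
     ∑ (res p) T
      ≡⟨ ∑-single {f = T} (res-unique p) (∈-res⁺ {p} {0} (N.>-nonZero⁻¹ p)) (λ {δ} δ∈ ne → off-diagonal (λ d → ne (res-mod-injective δ∈ (∈-res⁺ {p} {0} (N.>-nonZero⁻¹ p)) (∣⇒mod-0 d)))) ⟩
     T 0ℤ
      ≡⟨ ∑-cong (res p) (λ y → trans (cong (λ z → ⟨ translate g (base e y) , translate g (base e z) ⟩) (ZP.+-identityʳ y)) (inner-translate {g} {g} (π-periodic e) (π-periodic e) (base e y))) ⟩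
     ∑ (res p) (λ _ → normSq g)
      ≡⟨ trans (∑-const (res p) (normSq g)) (cong (_* normSq g) (trans (cong +_ (res-length p)) (sym (ZP.*-identityˡ (+ p))))) ⟩
     + 1 * + p * normSq g ∎) where
     open ≡.≡-Reasoning

-- Congruences between squares, and the constants at prime powers.

roots-odd : ∀ {p} → Prime p → p ≢ 2 → ∀ h e e' → ¬ (+ p ZD.∣ e) → + (p N.^ h) ZD.∣ e * e - e' * e' → (+ (p N.^ h) ZD.∣ e' - e) ⊎ (+ (p N.^ h) ZD.∣ e' - - e)
roots-odd {p} pr p≢2 h e e' p∤e d = go (+ p ∣? (e' - e)) (+ p ∣? (e' - - e)) where
 H = p N.^ h
 prod : + H ZD.∣ (e' - e) * (e' - - e)
 prod = subst (+ H ZD.∣_) (lem e e') (ZD.∣n⇒∣m*n (- 1ℤ) d) where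
  lem : ∀ e e' → - 1ℤ * (e * e - e' * e') ≡ (e' - e) * (e' - - e)
  lem = solve-∀
 cancel : ∀ a b → ¬ (+ p ZD.∣ a) → + H ZD.∣ a * b → + H ZD.∣ b
 cancel a b p∤a s = mod-0⇒∣ (mod-cancel {c = a} (coprime-^ h (prime-coprime pr a p∤a)) (mod-resp refl (sym (ZP.*-zeroʳ a)) (∣⇒mod-0 s)))
 go : Dec (+ p ZD.∣ e' - e) → Dec (+ p ZD.∣ e' - - e) → (+ H ZD.∣ e' - e) ⊎ (+ H ZD.∣ e' - - e)
 go (no ¬a) _ = inj₂ (cancel (e' - e) (e' - - e) ¬a prod)
 go (yes _) (no ¬b) = inj₁ (cancel (e' - - e) (e' - e) ¬b (subst (+ H ZD.∣_) (ZP.*-comm (e' - e) (e' - - e)) prod))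
 go (yes a) (yes b) with prime-∣-* pr (+ 2) e (subst (+ p ZD.∣_) (lem e e') (ZD.∣m∣n⇒∣m-n b a)) where
  lem : ∀ e e' → (e' - - e) - (e' - e) ≡ + 2 * e
  lem = solve-∀
 ... | inj₁ d2 = ⊥-elim (p≢2 (NP.≤-antisym (ND.∣⇒≤ (ZD.∣⇒∣ᵤ d2)) (N.nonTrivial⇒n>1 p {{prime⇒nonTrivial pr}})))
 ... | inj₂ de = ⊥-elim (p∤e de)

parity : ∀ k → ∃ λ h → k ≡ h N.+ h ⊎ k ≡ suc (h N.+ h)
parity zero = 0 , inj₁ refl
parity (suc k) with parity k
... | h , inj₁ refl = h , inj₂ refl
... | h , inj₂ refl = suc h , inj₁ (cong suc (sym (NP.+-suc h h)))

module Exponents (p : ℕ) where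
 open import Data.Nat.Tactic.RingSolver using () renaming (solve-∀ to solveℕ)

 even-m : ∀ h → p N.^ suc (h N.+ h) ≡ p N.^ suc h N.* 1 N.* p N.^ h
 even-m h = trans (cong (p N.*_) (NP.^-distribˡ-+-* p h h)) (lem p (p N.^ h)) where
  lem : ∀ p n → p N.* (n N.* n) ≡ p N.* n N.* 1 N.* n
  lem = solveℕ

 odd-m : ∀ h → p N.^ suc (suc (h N.+ h)) ≡ p N.^ suc h N.* p N.* p N.^ h
 odd-m h = trans (cong (λ n → p N.* (p N.* n)) (NP.^-distribˡ-+-* p h h)) (lem p (p N.^ h)) where
  lem : ∀ p n → p N.* (p N.* (n N.* n)) ≡ p N.* n N.* p N.* n
  lem = solveℕ

-- For odd p the classes ± e are taken modulo D = H, so t = 1 and the constant is 2² = 4. In even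
-- exponents r = 1; in odd ones the Gauss sum gives ρ = 1 as well.
star-odd : ∀ p (pr : Prime p) → p ≢ 2 → ∀ k → PrimePowers.Power.Star p pr k 4
star-odd p pr p≢2 k c cop v per P0 with parity k
... | h , inj₁ refl = PrimePowers.Power.Split.Components.Conclude.star p pr (h N.+ h) h 1 (Exponents.even-m p h) (p N.^ suc h) (sym (NP.*-identityˡ _)) c cop v per P0
 1 (p N.^ suc h) 1 (NP.*-identityʳ _) (λ e e' p∤e _ → roots-odd pr p≢2 (suc h) e e' p∤e)
 (λ e _ → PrimePowers.Power.Split.Components.normSq-F≤ p pr (h N.+ h) h 1 (Exponents.even-m p h) (p N.^ suc h) (sym (NP.*-identityˡ _)) c cop v per P0 e)
... | h , inj₂ refl = PrimePowers.Power.Split.Components.Conclude.star p pr (suc (h N.+ h)) h p {{prime⇒nonZero pr}} (Exponents.odd-m p h) (p N.^ h) refl c cop v per P0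
 1 (p N.^ suc h) 1 (NP.*-identityʳ _) (λ e e' p∤e _ → roots-odd pr p≢2 (suc h) e e' p∤e) (PrimePowers.Power.Gauss.gauss p pr (suc (h N.+ h)) p≢2 h (Exponents.odd-m p h) c cop v per P0)

prime-2 : Prime 2
prime-2 = prime[2] where
 open import Data.Nat.Primality using (prime[2])

odd≡1 : ∀ e → ¬ (+ 2 ZD.∣ e) → e ≡ + 1 [ 2 ]
odd≡1 e ¬d = go (e %ℕ 2) (n%ℕd<d e 2) (mod-%ℕ e 2) where
 go : ∀ n → n N.< 2 → + n ≡ e [ 2 ] → e ≡ + 1 [ 2 ]
 go zero _ h = ⊥-elim (¬d (mod-0⇒∣ (mod-sym h)))
 go (suc zero) _ h = mod-sym h
 go (suc (suc n)) (N.s≤s (N.s≤s ())) h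

-- With e' - e = 2 a and e' + e = 2 (a + e), where e is odd, exactly one of a and a + e is odd; the
-- other takes all the divisibility. One factor 2 is lost against odd primes.
roots-two : ∀ h e e' → ¬ (+ 2 ZD.∣ e) → ¬ (+ 2 ZD.∣ e') → + (2 N.^ suc h) ZD.∣ e * e - e' * e' → (+ (2 N.^ h) ZD.∣ e' - e) ⊎ (+ (2 N.^ h) ZD.∣ e' - - e)
roots-two zero e e' _ _ _ = inj₁ (divides (e' - e) (sym (ZP.*-identityʳ (e' - e))))
roots-two (suc h) e e' odd odd' d = halve (divs (mod-trans (odd≡1 e' odd') (mod-sym (odd≡1 e odd)))) where
 n = 2 N.^ h
 N≡ : + (2 N.^ suc h) ≡ + n * + 2
 N≡ = trans (ZP.pos-* 2 n) (ZP.*-comm (+ 2) (+ n))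
 cancel : ∀ a b → ¬ (+ 2 ZD.∣ a) → + n ZD.∣ a * b → + n ZD.∣ b
 cancel a b ¬a s = mod-0⇒∣ (mod-cancel {c = a} (coprime-^ h (prime-coprime prime-2 a ¬a)) (mod-resp refl (sym (ZP.*-zeroʳ a)) (∣⇒mod-0 s)))
 double : ∀ {a x} → x ≡ a * + 2 → + n ZD.∣ a → + (2 N.^ suc h) ZD.∣ x
 double {a} {x} e (divides j eq) = divides j (trans e (trans (cong (_* + 2) eq) (trans (ZP.*-assoc j (+ n) (+ 2)) (cong (j *_) (sym N≡)))))
 halve : + 2 ZD.∣ e' - e → (+ (2 N.^ suc h) ZD.∣ e' - e) ⊎ (+ (2 N.^ suc h) ZD.∣ e' - - e)
 halve (divides a eq) = go (+ 2 ∣? a) where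
  sum≡ : e' - - e ≡ (a + e) * + 2
  sum≡ = trans (lem e e') (trans (cong (λ z → z + e * + 2) eq) (sym (ZP.*-distribʳ-+ (+ 2) a e))) where
   lem : ∀ e e' → e' - - e ≡ (e' - e) + e * + 2
   lem = solve-∀
  prod : + n ZD.∣ a * (a + e)
  prod = divides (- j) (ZP.*-cancelˡ-≡ (+ 4) _ _ (trans (lem1 a e) (trans (cong₂ _*_ (sym eq) (sym sum≡)) (trans (lem2 e e') (trans (cong -_ eq') (trans (cong (λ z → - (j * z)) (trans (ZP.pos-* 2 (2 N.^ suc h)) (cong (+ 2 *_) N≡))) (lem3 j (+ n)))))))) where
   j = ZD._∣_.quotient d
   eq' = ZD._∣_.equality d
   lem1 : ∀ a e → + 4 * (a * (a + e)) ≡ a * + 2 * ((a + e) * + 2)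
   lem1 = solve-∀
   lem2 : ∀ e e' → (e' - e) * (e' - - e) ≡ - (e * e - e' * e')
   lem2 = solve-∀
   lem3 : ∀ j n → - (j * (+ 2 * (n * + 2))) ≡ + 4 * (- j * n)
   lem3 = solve-∀
  go : Dec (+ 2 ZD.∣ a) → (+ (2 N.^ suc h) ZD.∣ e' - e) ⊎ (+ (2 N.^ suc h) ZD.∣ e' - - e)
  go (no ¬a) = inj₂ (double {a + e} sum≡ (cancel a (a + e) ¬a prod))
  go (yes 2∣a) = inj₁ (double {a} eq (cancel (a + e) a (λ s → odd (subst (+ 2 ZD.∣_) (lem a e) (ZD.∣m∣n⇒∣m-n s 2∣a))) (subst (+ n ZD.∣_) (ZP.*-comm a (a + e)) prod))) where
   lem : ∀ a e → a + e - a ≡ e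
   lem = solve-∀

-- The lost factor 2 means t = 2, hence R² = 16. Even exponents have ρ = 1; in odd ones the trivial
-- bound gives ρ = 2 and the constant 32.
star-two : ∀ k → PrimePowers.Power.Star 2 prime-2 k 32
star-two k c cop v per P0 with parity k
... | h , inj₁ refl = ZP.≤-trans (PrimePowers.Power.Split.Components.Conclude.star 2 prime-2 (h N.+ h) h 1 (Exponents.even-m 2 h) (2 N.^ suc h) (sym (NP.*-identityˡ _)) c cop v per P0
  1 (2 N.^ h) 2 (NP.*-comm (2 N.^ h) 2) (roots-two h) (λ e _ → PrimePowers.Power.Split.Components.normSq-F≤ 2 prime-2 (h N.+ h) h 1 (Exponents.even-m 2 h) (2 N.^ suc h) (sym (NP.*-identityˡ _)) c cop v per P0 e))
  (ZP.*-monoʳ-≤-nonNeg (+ q * Inner.normSq q v) {{ℤ.nonNegative (*-nonneg {+ q} (ℤ.+≤+ N.z≤n) (Inner.normSq-nonneg q v))}} (ℤ.+≤+ (NP.m≤m+n 16 16)))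
 where q = 2 N.^ (2 N.+ (h N.+ h))
... | h , inj₂ refl = PrimePowers.Power.Split.Components.Conclude.star 2 prime-2 (suc (h N.+ h)) h 2 (Exponents.odd-m 2 h) (2 N.^ h) refl c cop v per P0
 2 (2 N.^ h) 2 (NP.*-comm (2 N.^ h) 2) (roots-two h) (λ e _ → PrimePowers.Power.Split.Components.normSq-F≤ 2 prime-2 (suc (h N.+ h)) h 2 (Exponents.odd-m 2 h) (2 N.^ h) refl c cop v per P0 e)

-- `size` is the number of divisors of the prime power, with which `A` is to be compared.
record PrimePower (p k A : ℕ) : Set where
 field
  factors : List (ℕ × ℕ)
  bound   : Bound (p N.^ suc k) A factors
  unique  : Unique factors
  size    : length factors ≡ 2 N.+ k

prime-power : ∀ p (pr : Prime p) A → 4 N.≤ A → (∀ k → PrimePowers.Power.Star p pr k A) → ∀ k → PrimePower p k A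
prime-power p pr A 4≤A star zero = record
 { factors = (1 , p) ∷ (p , 1) ∷ []
 ; bound = subst (λ n → Bound n A ((1 , p) ∷ (p , 1) ∷ [])) (sym (NP.*-identityʳ p)) (bound-mono {{prime⇒nonZero pr}} 4≤A (FiniteField.prime-bound p pr))
 ; unique = ((λ e → N.nonTrivial⇒≢1 {{prime⇒nonTrivial pr}} (sym (cong fst e))) ∷ []) ∷ [] ∷ []
 ; size = refl } where
 open import Data.List.Relation.Unary.AllPairs using ([]; _∷_)
prime-power p pr A 4≤A star (suc k) = record
 { factors = (1 , p N.^ (2 N.+ k)) ∷ map (PrimePowers.Power.refine p pr k) Q.factors
 ; bound = PrimePowers.Power.step p pr k Q.bound (star k)
 ; unique = Allₚ.map⁺ (All.tabulate (λ {gs} _ e → N.nonTrivial⇒≢1 {{prime⇒nonTrivial pr}} (ND.∣1⇒≡1 (ND.divides (fst gs) (cong fst e))))) ∷ unique-map (PrimePowers.Power.refine p pr k) (λ _ _ e → cong₂ _,_ (NP.*-cancelʳ-≡ _ _ p {{prime⇒nonZero pr}} (cong fst e)) (cong snd e)) Q.unique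
 ; size = cong suc (trans (Listₚ.length-map (PrimePowers.Power.refine p pr k) Q.factors) Q.size) } where
 open import Data.List.Relation.Unary.AllPairs using ([]; _∷_)
 module Q = PrimePower (prime-power p pr A 4≤A star k)

-- Assembling the bound for a general modulus.

open import Defs using (d; Ioc)

-- The shape of `size` is multiplicative over coprime moduli. `B` is 1 as long as q is odd, since 4
-- is at most the square of the number of factors; a power of 2 costs B = 8 once, because 32 = 8 ·
-- 2².
record Modulus (q B : ℕ) : Set where
 field
  factors  : List (ℕ × ℕ)
  constant : ℕ
  bound    : Bound q constant factors
  unique   : Unique factors
  size     : constant N.≤ B N.* (length factors N.* length factors)

module _ {A B C : Set} (f : A → B → C) where
 cartesian-map : ∀ xs ys → cartesianProductWith f xs ys ≡ map (λ ab → f (fst ab) (snd ab)) (cartesianProduct xs ys)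
 cartesian-map [] ys = refl
 cartesian-map (x ∷ xs) ys = sym (trans (Listₚ.map-++ _ (map (x ,_) ys) _) (cong₂ Data.List._++_ (sym (Listₚ.map-∘ ys)) (sym (cartesian-map xs ys))))

 unique-cartesian : ∀ {xs ys} → Unique xs → Unique ys → (∀ {a a' b b'} → a ∈ xs → a' ∈ xs → b ∈ ys → b' ∈ ys → f a b ≡ f a' b' → a ≡ a' × b ≡ b') → Unique (cartesianProductWith f xs ys)
 unique-cartesian {xs} {ys} ux uy inj = subst Unique (sym (cartesian-map xs ys)) (unique-map _ (λ p∈ r∈ e → let a∈ , b∈ = ∈-cartesianProduct⁻ xs ys p∈ ; a'∈ , b'∈ = ∈-cartesianProduct⁻ xs ys r∈ ; x , y = inj a∈ a'∈ b∈ b'∈ e in cong₂ _,_ x y) (Uniqueₚ.cartesianProduct⁺ ux uy))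

coprime-factor : ∀ {m n a a' b b'} → Coprime m n → a ND.∣ m → b' ND.∣ n → a N.* b ≡ a' N.* b' → a ND.∣ a'
coprime-factor {a = a} {a'} {b} {b'} cop a∣m b'∣n e = Coprimality.coprime-divisor {a} {b'} {a'} (λ { (x , y) → cop (ND.∣-trans x a∣m , ND.∣-trans y b'∣n) }) (subst (a ND.∣_) (trans e (NP.*-comm a' b')) (ND.m∣m*n b))

factor-determined : ∀ {q} .{{_ : NonZero q}} {x y : ℕ × ℕ} → fst x N.* snd x ≡ q → fst y N.* snd y ≡ q → fst x ≡ fst y → x ≡ y
factor-determined {q} {g , s} {.g , s'} e e' refl = cong (g ,_) (NP.*-cancelˡ-≡ s s' g {{N.≢-nonZero λ { refl → N.≢-nonZero⁻¹ q (sym e) }}} (trans e (sym e')))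

combine : ∀ {m n B₁ B₂} .{{_ : NonZero m}} .{{_ : NonZero n}} → Coprime m n → Modulus m B₁ → Modulus n B₂ → Modulus (m N.* n) (B₁ N.* B₂)
combine {m} {n} {B₁} {B₂} cop M₁ M₂ = record
 { factors = cartesianProductWith multiply X.factors Y.factors
 ; constant = X.constant N.* Y.constant
 ; bound = compose X.bound Y.bound
 ; unique = unique-cartesian multiply X.unique Y.unique inj
 ; size = NP.≤-trans (NP.*-mono-≤ X.size Y.size) (NP.≤-reflexive (trans (lem B₁ (length X.factors) B₂ (length Y.factors)) (cong (λ l → B₁ N.* B₂ N.* (l N.* l)) (sym (length-cartesian multiply X.factors Y.factors))))) } where
 open Compose m n {{mn≢0 = NP.m*n≢0 m n}} cop
 open import Data.Nat.Tactic.RingSolver using () renaming (solve-∀ to solveℕ)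
 module X = Modulus M₁
 module Y = Modulus M₂
 lem : ∀ a x b y → a N.* (x N.* x) N.* (b N.* (y N.* y)) ≡ a N.* b N.* (x N.* y N.* (x N.* y))
 lem = solveℕ
 inj : ∀ {a a' b b'} → a ∈ X.factors → a' ∈ X.factors → b ∈ Y.factors → b' ∈ Y.factors → multiply a b ≡ multiply a' b' → a ≡ a' × b ≡ b'
 inj {a} {a'} {b} {b'} a∈ a'∈ b∈ b'∈ e = factor-determined fa fa' ga≡ , factor-determined fb fb' gb≡ where
  fa = All.lookup (Bound.factors X.bound) a∈
  fa' = All.lookup (Bound.factors X.bound) a'∈
  fb = All.lookup (Bound.factors Y.bound) b∈
  fb' = All.lookup (Bound.factors Y.bound) b'∈
  div : ∀ {x N} → fst x N.* snd x ≡ N → fst x ND.∣ N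
  div {x} h = subst (fst x ND.∣_) h (ND.m∣m*n (snd x))
  ga≡ : fst a ≡ fst a'
  ga≡ = ND.∣-antisym (coprime-factor {b = fst b} cop (div fa) (div fb') (cong fst e)) (coprime-factor {b = fst b'} cop (div fa') (div fb) (sym (cong fst e)))
  gb≡ : fst b ≡ fst b'
  gb≡ = NP.*-cancelˡ-≡ (fst b) (fst b') (fst a) {{N.≢-nonZero λ z → N.≢-nonZero⁻¹ m (trans (sym fa) (cong (N._* snd a) z))}} (trans (cong fst e) (cong (N._* fst b') (sym ga≡)))

modulus-1 : Modulus 1 1
modulus-1 = record
 { factors = (1 , 1) ∷ [] ; constant = 1 ; unique = [] ∷ [] ; size = NP.≤-refl
 ; bound = record { factors = refl ∷ [] ; bound = main } } where
 main : ∀ c → Coprime ∣ c ∣ 1 → ∀ v → Periodic² 1 v → Inner.normSq 1 (κ 1 c v) ≤ + 1 * ∑ ((1 , 1) ∷ []) (λ gs → + snd gs * Inner.⟨_,_⟩ 1 (Pr (fst gs) (snd gs) v) v)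
 main c cop v per = ZP.≤-reflexive (trans (Inner.inner-cong 1 κ≡ κ≡) (sym (trans (lem (Inner.⟨_,_⟩ 1 (Pr 1 1 v) v)) (Inner.inner-cong 1 {w = v} (Pr-trivial 1 v) (λ _ → refl))))) where
  lem : ∀ x → + 1 * (+ 1 * x + 0ℤ) ≡ x
  lem = solve-∀
  κ≡ : ∀ x → κ 1 c v x ≡ v x
  κ≡ x = trans (cong (λ i → i * v (x ⊹ + 1 · (0ℤ , 0ℤ)) + 0ℤ) (indicator-yes (solution? 1 c (0ℤ , 0ℤ)) (divides (0ℤ * 0ℤ - c) (sym (ZP.*-identityʳ _))))) (Pr-trivial 1 v x)

strip : ∀ p → 1 N.< p → ∀ fuel q → .{{_ : NonZero q}} → q N.≤ fuel → ∃ λ k → ∃ λ n → q ≡ p N.^ k N.* n × ¬ (p ND.∣ n)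
strip p 1<p zero q q≤0 = ⊥-elim (N.≢-nonZero⁻¹ q (NP.n≤0⇒n≡0 q≤0))
strip p 1<p (suc fuel) q q≤ = go (p ND.∣? q) where
 go : Dec (p ND.∣ q) → ∃ λ k → ∃ λ n → q ≡ p N.^ k N.* n × ¬ (p ND.∣ n)
 go (no ¬d) = 0 , q , sym (NP.+-identityʳ q) , ¬d
 go (yes d) = let k , n , e , ¬d = strip p 1<p fuel (ND.quotient d) {{ND.quotient≢0 d}} (NP.≤-pred (NP.≤-trans (ND.quotient-< d {{N.n>1⇒nonTrivial 1<p}}) q≤)) in
  suc k , n , trans (ND.m∣n⇒n≡m*quotient d) (trans (cong (p N.*_) e) (sym (NP.*-assoc p (p N.^ k) n))) , ¬d

from-prime-power : ∀ {p k A} B → A N.≤ B N.* 4 → PrimePower p k A → Modulus (p N.^ suc k) B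
from-prime-power {p} {k} {A} B A≤ P = record
 { factors = PrimePower.factors P ; constant = A ; bound = PrimePower.bound P ; unique = PrimePower.unique P
 ; size = NP.≤-trans A≤ (NP.*-monoʳ-≤ B (subst (λ l → 4 N.≤ l N.* l) (sym (PrimePower.size P)) (NP.*-mono-≤ {2} {2 N.+ k} {2} {2 N.+ k} (NP.m≤m+n 2 k) (NP.m≤m+n 2 k)))) }

prime-power-coprime : ∀ {p} → Prime p → ∀ k n → ¬ (p ND.∣ n) → Coprime (p N.^ k) n
prime-power-coprime pr k n ¬d = Coprimality.sym (coprime-^ k (prime-coprime pr (+ n) (λ d → ¬d (ZD.∣⇒∣ᵤ d))))

prime-divisor : ∀ q .{{_ : NonZero q}} → q ≢ 1 → ∃ λ p → Prime p × p ND.∣ q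
prime-divisor q q≢1 = go (PrimeFactorisation.factors F) (PrimeFactorisation.isFactorisation F) (PrimeFactorisation.factorsPrime F) where
 F = factorise q
 go : ∀ ps → q ≡ product ps → All Prime ps → ∃ λ p → Prime p × p ND.∣ q
 go [] e _ = ⊥-elim (q≢1 e)
 go (p ∷ ps) e (pr ∷ _) = p , pr , subst (p ND.∣_) (sym e) (ND.m∣m*n (product ps))

cofactor≢0 : ∀ {q n} .{{_ : NonZero q}} a → q ≡ a N.* n → NonZero n
cofactor≢0 {q} a e = N.≢-nonZero λ { refl → N.≢-nonZero⁻¹ q (trans e (NP.*-zeroʳ a)) }

odd-modulus : ∀ fuel q .{{_ : NonZero q}} → q N.≤ fuel → ¬ (2 ND.∣ q) → Modulus q 1
odd-modulus zero q q≤0 _ = ⊥-elim (N.≢-nonZero⁻¹ q (NP.n≤0⇒n≡0 q≤0))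
odd-modulus (suc fuel) q q≤ odd = go (q N.≟ 1) where
 go : Dec (q ≡ 1) → Modulus q 1
 go (yes e) = subst (λ n → Modulus n 1) (sym e) modulus-1
 go (no q≢1) = let p , pr , p∣q = prime-divisor q q≢1 ; k , n , e , ¬d = strip p (N.nonTrivial⇒n>1 p {{prime⇒nonTrivial pr}}) q q NP.≤-refl in rest p pr p∣q k n e ¬d where
  rest : ∀ p → Prime p → p ND.∣ q → ∀ k n → q ≡ p N.^ k N.* n → ¬ (p ND.∣ n) → Modulus q 1
  rest p pr p∣q zero n e ¬d = ⊥-elim (¬d (subst (p ND.∣_) (trans e (NP.+-identityʳ n)) p∣q))
  rest p pr p∣q (suc k) n e ¬d = subst (λ z → Modulus z 1) (sym e) (combine {{NP.m^n≢0 p (suc k) {{prime⇒nonZero pr}}}} {{cofactor≢0 {q} (p N.^ suc k) e}} (prime-power-coprime pr (suc k) n ¬d)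
    (from-prime-power 1 NP.≤-refl (prime-power p pr 4 NP.≤-refl (star-odd p pr p≢2) k))
    (odd-modulus fuel n {{cofactor≢0 {q} (p N.^ suc k) e}} (NP.≤-pred (NP.≤-trans n<q q≤)) (λ d → odd (subst (2 ND.∣_) (sym e) (ND.∣n⇒∣m*n (p N.^ suc k) d))))) where
   p≢2 : p ≢ 2
   p≢2 refl = odd p∣q
   n<q : n N.< q
   n<q = subst (n N.<_) (sym (trans e (NP.*-comm (p N.^ suc k) n))) (NP.m<m*n n (p N.^ suc k) {{cofactor≢0 {q} (p N.^ suc k) e}} (NP.<-≤-trans (N.nonTrivial⇒n>1 p {{prime⇒nonTrivial pr}}) (NP.m≤m*n p (p N.^ k) {{NP.m^n≢0 p k {{prime⇒nonZero pr}}}})))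

modulus : ∀ q .{{_ : NonZero q}} → Modulus q 8
modulus q = let k , n , e , odd = strip 2 (N.s≤s (N.s≤s N.z≤n)) q q NP.≤-refl in go k n e odd where
 go : ∀ k n → q ≡ 2 N.^ k N.* n → ¬ (2 ND.∣ n) → Modulus q 8
 go zero n e odd = record
   { factors = M.factors ; constant = M.constant ; unique = M.unique
   ; bound = M.bound ; size = NP.≤-trans M.size (NP.*-monoˡ-≤ (length M.factors N.* length M.factors) {1} {8} (N.s≤s N.z≤n)) } where
  module M = Modulus (odd-modulus q q NP.≤-refl (λ d → odd (subst (2 ND.∣_) (trans e (NP.+-identityʳ n)) d)))
 go (suc k) n e odd = subst (λ z → Modulus z 8) (sym e) (combine {{NP.m^n≢0 2 (suc k)}} {{cofactor≢0 {q} (2 N.^ suc k) e}} (prime-power-coprime prime-2 (suc k) n odd)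
  (from-prime-power 8 NP.≤-refl (prime-power 2 prime-2 32 (NP.m≤m+n 4 28) star-two k)) (odd-modulus n n {{cofactor≢0 {q} (2 N.^ suc k) e}} NP.≤-refl odd))

-- A factorisation g s = q is determined by g, so the first entries are distinct divisors of q.
length-factors≤d : ∀ q .{{_ : NonZero q}} L → Unique L → All (λ gs → fst gs N.* snd gs ≡ q) L → length L N.≤ d q
length-factors≤d q L u fs = subst (N._≤ d q) (Listₚ.length-map fst L) (unique-⊆-length (map fst L) (unique-map fst (λ x∈ y∈ → factor-determined (All.lookup fs x∈) (All.lookup fs y∈)) u) sub) where
 sub : ∀ {g} → g ∈ map fst L → g ∈ filter (λ k → k ND.∣? q) (applyUpTo suc q)
 sub g∈ with ∈-map⁻ fst g∈
 ... | (g , s) , gs∈ , refl = ∈-filter⁺ (λ k → k ND.∣? q) (place g g∣q g≢0) g∣q where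
  e = All.lookup fs gs∈
  g∣q : g ND.∣ q
  g∣q = subst (g ND.∣_) e (ND.m∣m*n s)
  g≢0 : g ≢ 0
  g≢0 refl = N.≢-nonZero⁻¹ q (sym e)
  place : ∀ g → g ND.∣ q → g ≢ 0 → g ∈ applyUpTo suc q
  place zero _ ne = ⊥-elim (ne refl)
  place (suc g) dv _ = ∈-applyUpTo⁺ suc (ND.∣⇒≤ dv)

-- Quadratic forms of the interval functions.

sample : ∀ n .{{_ : NonZero n}} (f : ℤ → ℤ) → Periodic n f → ∀ a → ∑ (res n) (λ x → indicator (+ n ∣? (x - a)) * f x) ≡ f a
sample n f per a = trans (∑-single {f = λ x → indicator (+ n ∣? (x - a)) * f x} (res-unique n) r∈
  (λ {x} x∈ ne → cong (_* f x) (indicator-no (+ n ∣? (x - a)) (λ s → ne (res-mod-injective x∈ r∈ (mod-trans (mk s) (mod-sym (mod-%ℕ a n))))))))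
 (trans (cong (_* f r) (indicator-yes (+ n ∣? (r - a)) (divs (mod-%ℕ a n)))) (trans (ZP.*-identityˡ (f r)) (per (mod-%ℕ a n)))) where
 r = + (a %ℕ n)
 r∈ : r ∈ res n
 r∈ = ∈-res⁺ (n%ℕd<d a n)

indicator-res-≤1 : ∀ n .{{_ : NonZero n}} a → ∑ (res n) (λ x → indicator (+ n ∣? (x - a))) ≡ 1ℤ
indicator-res-≤1 n a = trans (∑-cong (res n) (λ x → sym (ZP.*-identityʳ _))) (sample n (λ _ → 1ℤ) (λ _ → refl) a)

∑-res-suc : ∀ n f → ∑ (res (suc n)) f ≡ ∑ (res n) f + f (+ n)
∑-res-suc n f = trans (∑-map +_ (upTo (suc n)) f) (trans (cong (λ xs → ∑ xs (λ k → f (+ k))) (sym (Listₚ.upTo-∷ʳ n))) (trans (∑-++ (upTo n) (n ∷ []) (λ k → f (+ k))) (cong₂ _+_ (sym (∑-map +_ (upTo n) f)) (ZP.+-identityʳ (f (+ n))))))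

∑-res-mono : ∀ {f} → (∀ x → 0ℤ ≤ f x) → ∀ {m n} → m N.≤ n → ∑ (res m) f ≤ ∑ (res n) f
∑-res-mono {f} f≥0 {m} {n} m≤n = subst (λ k → ∑ (res m) f ≤ ∑ (res k) f) (NP.m∸n+n≡m m≤n) (go (n N.∸ m)) where
 go : ∀ k → ∑ (res m) f ≤ ∑ (res (k N.+ m)) f
 go zero = ZP.≤-refl
 go (suc k) = ZP.≤-trans (go k) (ZP.≤-trans (ZP.≤-reflexive (sym (ZP.+-identityʳ _))) (ZP.≤-trans (ZP.+-monoʳ-≤ (∑ (res (k N.+ m)) f) (f≥0 (+ (k N.+ m)))) (ZP.≤-reflexive (sym (∑-res-suc (k N.+ m) f)))))

-- The interval is enlarged to L / s + 1 full periods of s, each of which contains one solution; the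
-- bound is multiplied by s to stay integral.
interval-count : ∀ s .{{_ : NonZero s}} L a → + s * ∑ (res L) (λ x → indicator (+ s ∣? (x - a))) ≤ + (L N.+ s)
interval-count s L a = ZP.≤-trans (*-monoˡ-nonneg {+ s} (ℤ.+≤+ N.z≤n) (ZP.≤-trans (∑-res-mono {λ x → indicator (+ s ∣? (x - a))} (λ x → indicator-nonneg (+ s ∣? (x - a))) L≤) (ZP.≤-reflexive (∑-res-count s t {{it}} {{NP.m*n≢0 s t}} a))))
  (ZP.≤-trans (ZP.≤-reflexive (sym (ZP.pos-* s t))) (ℤ.+≤+ st≤)) where
 open import Function using (it)
 t = suc (L / s)
 st≡ : s N.* t ≡ s N.+ L / s N.* s
 st≡ = NP.*-comm s t
 L≤ : L N.≤ s N.* t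
 L≤ = subst (L N.≤_) (sym st≡) (subst (N._≤ s N.+ L / s N.* s) (sym (m≡m%n+[m/n]*n L s)) (NP.+-monoˡ-≤ (L / s N.* s) (NP.<⇒≤ (m%n<n L s))))
 st≤ : s N.* t N.≤ L N.+ s
 st≤ = subst (N._≤ L N.+ s) (sym st≡) (NP.≤-trans (NP.+-monoʳ-≤ s (m/n*n≤m L s)) (NP.≤-reflexive (NP.+-comm s L)))

∑-product : {A B : Set} (xs : List A) (ys : List B) (f : A → ℤ) (g : B → ℤ) → ∑ xs (λ x → ∑ ys (λ y → f x * g y)) ≡ ∑ xs f * ∑ ys g
∑-product xs ys f g = trans (∑-cong xs (λ x → ∑-*ˡ (f x) ys g)) (∑-*ʳ (∑ ys g) xs f)

∑-applyUpTo : {A : Set} (h : ℕ → A) (n : ℕ) (f : A → ℤ) → ∑ (applyUpTo h n) f ≡ ∑ (upTo n) (λ k → f (h k))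
∑-applyUpTo h n f = trans (cong (λ xs → ∑ xs f) (sym (Listₚ.map-upTo h n))) (∑-map h (upTo n) f)

module Interval (q L : ℕ) .{{q≢0 : NonZero q}} (L≤q : L N.≤ q) where
 I : ℤ → ℤ
 I x = ∑ (upTo L) (λ l → indicator (+ q ∣? (x - + suc l)))

 I-nonneg : ∀ x → 0ℤ ≤ I x
 I-nonneg x = ∑-nonneg (upTo L) (λ l → indicator-nonneg (+ q ∣? (x - + suc l)))

 I-periodic : Periodic q I
 I-periodic {x} {y} h = ∑-cong (upTo L) (λ l → indicator-⇔ (+ q ∣? (x - + suc l)) (+ q ∣? (y - + suc l)) (λ s → divs {y} {+ suc l} (mod-trans (mod-sym h) (mk s))) (λ s → divs {x} {+ suc l} (mod-trans h (mk s))))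

 I-sample : ∀ e f → Periodic q f → ∑ (res q) (λ x → I (e + x) * f x) ≡ ∑ (upTo L) (λ l → f (+ suc l - e))
 I-sample e f per = trans (∑-cong (res q) (λ x → sym (∑-*ʳ (f x) (upTo L) _))) (trans (∑-swap (res q) (upTo L) _) (∑-cong (upTo L) (λ l → trans (∑-cong (res q) (λ x → cong (λ z → indicator (+ q ∣? z) * f x) (lem e x (+ suc l)))) (sample q f per (+ suc l - e))))) where
  lem : ∀ e x l → e + x - l ≡ x - (l - e)
  lem = solve-∀

 I-total : ∑ (res q) I ≡ + L
 I-total = trans (∑-cong (res q) (λ x → sym (trans (ZP.*-identityʳ _) (cong I (ZP.+-identityˡ x))))) (trans (I-sample 0ℤ (λ _ → 1ℤ) (λ _ → refl)) (trans (∑-const (upTo L) 1ℤ) (trans (ZP.*-identityʳ _) (cong +_ (Listₚ.length-upTo L)))))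

 -- q times the deviation of `I` from its mean, so that the sum over residues is zero.
 J : ℤ → ℤ
 J x = + q * I x - + L

 F : G → ℤ
 F (x , y) = J x * I y

 F-periodic : Periodic² q F
 F-periodic (mk² h₁ h₂) = cong₂ (λ a b → (+ q * a - + L) * b) (I-periodic h₁) (I-periodic h₂)

 module _ (g s : ℕ) (gs : g N.* s ≡ q) where
  private
   instance
    s≢0 : NonZero s
    s≢0 = N.≢-nonZero λ { refl → N.≢-nonZero⁻¹ q (trans (sym gs) (NP.*-zeroʳ g)) }
    g≢0 : NonZero g
    g≢0 = N.≢-nonZero λ { refl → N.≢-nonZero⁻¹ q (sym gs) }
   Q≡ : + g * + s ≡ + q
   Q≡ = trans (sym (ZP.pos-* g s)) (cong +_ gs)

  Iᵍ : ℤ → ℤ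
  Iᵍ x = ∑ (res g) (λ i → I (x + + s * i))

  Iᵍ-nonneg : ∀ x → 0ℤ ≤ Iᵍ x
  Iᵍ-nonneg x = ∑-nonneg (res g) (λ i → I-nonneg (x + + s * i))

  Iᵍ-total : ∑ (res q) Iᵍ ≡ + g * + L
  Iᵍ-total = trans (∑-swap (res q) (res g) _) (trans (∑-cong (res g) (λ i → trans (∑-cong (res q) (λ x → cong I (ZP.+-comm x (+ s * i)))) (trans (res-shift q I I-periodic (+ s * i)) I-total))) (trans (∑-const (res g) (+ L)) (cong (λ n → + n * + L) (res-length g))))

  -- `Iᵍ x` counts the l in [1, L] congruent to x modulo s: a given l in that class is met by
  -- exactly one of the g translates.
  Iᵍ≤ : ∀ x → + s * Iᵍ x ≤ + L + + s
  Iᵍ≤ x = ZP.≤-trans (*-monoˡ-nonneg {+ s} (ℤ.+≤+ N.z≤n) (ZP.≤-trans (ZP.≤-reflexive (∑-swap (res g) (upTo L) _)) (ZP.≤-trans (∑-mono (upTo L) (λ {l} _ → column l (+ s ∣? (+ l - (x - 1ℤ))))) (ZP.≤-reflexive (sym (∑-map +_ (upTo L) (λ y → indicator (+ s ∣? (y - (x - 1ℤ)))))))))) (interval-count s L (x - 1ℤ)) where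
   column : ∀ l (D : Dec (+ s ZD.∣ + l - (x - 1ℤ))) → ∑ (res g) (λ i → indicator (+ q ∣? (x + + s * i - + suc l))) ≤ indicator D
   column l (yes (divides j e)) = ZP.≤-reflexive (trans (∑-cong (res g) (λ i → indicator-⇔ (+ q ∣? (x + + s * i - + suc l)) (+ g ∣? (i - j)) (fwd i) (bwd i))) (indicator-res-≤1 g j)) where
    diff : ∀ i → x + + s * i - + suc l ≡ + s * (i - j)
    diff i = trans (lem1 x (+ s) i (+ l)) (trans (cong (λ z → + s * i - z) e) (lem2 (+ s) i j)) where
     lem1 : ∀ x s i l → x + s * i - (1ℤ + l) ≡ s * i - (l - (x - 1ℤ))
     lem1 = solve-∀
     lem2 : ∀ s i j → s * i - j * s ≡ s * (i - j)
     lem2 = solve-∀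
    fwd : ∀ i → + q ZD.∣ x + + s * i - + suc l → + g ZD.∣ i - j
    fwd i (divides n e') = divides n (ZP.*-cancelˡ-≡ (+ s) _ _ (trans (sym (diff i)) (trans e' (trans (cong (n *_) (sym Q≡)) (lem n (+ g) (+ s)))))) where
     lem : ∀ n g s → n * (g * s) ≡ s * (n * g)
     lem = solve-∀
    bwd : ∀ i → + g ZD.∣ i - j → + q ZD.∣ x + + s * i - + suc l
    bwd i (divides n e') = divides n (trans (diff i) (trans (cong (+ s *_) e') (trans (lem n (+ g) (+ s)) (cong (n *_) Q≡)))) where
     lem : ∀ n g s → s * (n * g) ≡ n * (g * s)
     lem = solve-∀
   column l (no ¬d) = ZP.≤-reflexive (∑-ε (res g) (λ i → indicator-no (+ q ∣? (x + + s * i - + suc l)) (λ { (divides n e') → ¬d (divides (i - n * + g) (trans (lem1 x (+ s) i (+ l)) (trans (cong (λ z → + s * i - z) (trans e' (cong (n *_) (sym Q≡)))) (lem2 (+ s) i n (+ g))))) }))) where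
    lem1 : ∀ x s i l → l - (x - 1ℤ) ≡ s * i - (x + s * i - (1ℤ + l))
    lem1 = solve-∀
    lem2 : ∀ s i n g → s * i - n * (g * s) ≡ (i - n * g) * s
    lem2 = solve-∀

  R : ℤ
  R = ∑ (res q) (λ y → Iᵍ y * I y)

  R≥0 : 0ℤ ≤ R
  R≥0 = ∑-nonneg (res q) (λ y → *-nonneg {Iᵍ y} (Iᵍ-nonneg y) (I-nonneg y))

  sR≤ : + s * R ≤ + L * (+ L + + s)
  sR≤ = begin
   + s * R                                         ≡⟨ trans (sym (∑-*ˡ (+ s) (res q) _)) (∑-cong (res q) (λ y → trans (sym (ZP.*-assoc (+ s) (Iᵍ y) (I y))) (ZP.*-comm (+ s * Iᵍ y) (I y)))) ⟩
   ∑ (res q) (λ y → I y * (+ s * Iᵍ y))            ≤⟨ ∑-mono (res q) (λ {y} _ → *-monoˡ-nonneg {I y} (I-nonneg y) (Iᵍ≤ y)) ⟩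
   ∑ (res q) (λ y → I y * (+ L + + s))             ≡⟨ trans (∑-*ʳ (+ L + + s) (res q) I) (cong (_* (+ L + + s)) I-total) ⟩
   + L * (+ L + + s)                               ∎ where
   open ZP.≤-Reasoning

  Jᵍ : ℤ → ℤ
  Jᵍ x = + q * Iᵍ x - + g * + L

  Pr-F : ∀ x y → Pr g s F (x , y) ≡ Jᵍ x * Iᵍ y
  Pr-F x y = trans (∑-box g _) (trans (∑-cong (res g) (λ i → ∑-cong (res g) (λ j → ZP.*-identityˡ _))) (trans (∑-product (res g) (res g) (λ i → J (x + + s * i)) (λ j → I (y + + s * j))) (cong (_* Iᵍ y) (trans (∑-minus (res g) (λ i → + q * I (x + + s * i)) (λ _ → + L)) (cong₂ _-_ (∑-*ˡ (+ q) (res g) _) (trans (∑-const (res g) (+ L)) (cong (λ n → + n * + L) (res-length g))))))))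

  correlation-J : ∑ (res q) (λ x → Jᵍ x * J x) ≡ + q * + q * R - + q * (+ g * (+ L * + L))
  correlation-J = trans (∑-cong (res q) (λ x → lem1 (+ q) (Iᵍ x) (+ g) (+ L) (I x)))
   (trans (∑-∙ (res q) (λ x → + q * + q * (Iᵍ x * I x) + - (+ q * + L) * Iᵍ x) (λ x → - (+ q * (+ g * + L)) * I x + + g * (+ L * + L)))
   (trans (cong₂ _+_ (trans (∑-∙ (res q) (λ x → + q * + q * (Iᵍ x * I x)) (λ x → - (+ q * + L) * Iᵍ x)) (cong₂ _+_ (∑-*ˡ (+ q * + q) (res q) _) (trans (∑-*ˡ (- (+ q * + L)) (res q) Iᵍ) (cong (- (+ q * + L) *_) Iᵍ-total))))
    (trans (∑-∙ (res q) (λ x → - (+ q * (+ g * + L)) * I x) (λ _ → + g * (+ L * + L))) (cong₂ _+_ (trans (∑-*ˡ (- (+ q * (+ g * + L))) (res q) I) (cong (- (+ q * (+ g * + L)) *_) I-total)) (trans (∑-const (res q) (+ g * (+ L * + L))) (cong (λ n → + n * (+ g * (+ L * + L))) (res-length q))))))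
   (lem2 (+ q) R (+ g) (+ L)))) where
   lem1 : ∀ q a g l i → (q * a - g * l) * (q * i - l) ≡ (q * q * (a * i) + - (q * l) * a) + (- (q * (g * l)) * i + g * (l * l))
   lem1 = solve-∀
   lem2 : ∀ q r g l → (q * q * r + - (q * l) * (g * l)) + (- (q * (g * l)) * l + q * (g * (l * l))) ≡ q * q * r - q * (g * (l * l))
   lem2 = solve-∀

  inner-F : Inner.⟨_,_⟩ q (Pr g s F) F ≡ (+ q * + q * R - + q * (+ g * (+ L * + L))) * R
  inner-F = trans (∑-box q _) (trans (∑-cong (res q) (λ x → ∑-cong (res q) (λ y → trans (cong (_* (J x * I y)) (Pr-F x y)) (lem (Jᵍ x) (Iᵍ y) (J x) (I y))))) (trans (∑-product (res q) (res q) (λ x → Jᵍ x * J x) (λ y → Iᵍ y * I y)) (cong (_* R) correlation-J))) where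
   lem : ∀ a b c d → a * b * (c * d) ≡ a * c * (b * d)
   lem = solve-∀

  -- Subtracting the mean in the first variable replaces s R by s R - L², which is at most L s
  -- instead of L (L + s). The other factor contributes s R ≤ L (L + s) ≤ 2 q L.
  term≤ : + s * Inner.⟨_,_⟩ q (Pr g s F) F ≤ + q * + q * (+ L * + L * (+ 2 * + q))
  term≤ = begin
   + s * Inner.⟨_,_⟩ q (Pr g s F) F
    ≡⟨ trans (cong (+ s *_) inner-F) (trans (lem1 (+ s) (+ q) R (+ g) (+ L)) (cong (λ z → (+ q * + q * (+ s * R) - + q * (z * (+ L * + L))) * R) Q≡)) ⟩
   (+ q * + q * (+ s * R) - + q * (+ q * (+ L * + L))) * R
    ≡⟨ lem2 (+ q) (+ s * R) (+ L) R ⟩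
   + q * + q * R * (+ s * R - + L * + L)
    ≤⟨ *-monoˡ-nonneg {+ q * + q * R} (*-nonneg {+ q * + q} (square-nonneg (+ q)) R≥0) (ZP.≤-trans (ZP.+-monoˡ-≤ (- (+ L * + L)) sR≤) (ZP.≤-reflexive (lem3 (+ L) (+ s)))) ⟩
   + q * + q * R * (+ L * + s)
    ≡⟨ lem4 (+ q) R (+ L) (+ s) ⟩
   + q * + q * + L * (+ s * R)
    ≤⟨ *-monoˡ-nonneg {+ q * + q * + L} (*-nonneg {+ q * + q} (square-nonneg (+ q)) (ℤ.+≤+ N.z≤n)) (ZP.≤-trans sR≤ (*-monoˡ-nonneg {+ L} (ℤ.+≤+ N.z≤n) (ℤ.+≤+ (NP.+-mono-≤ L≤q s≤q)))) ⟩
   + q * + q * + L * (+ L * (+ q + + q))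
    ≡⟨ lem5 (+ q) (+ L) ⟩
   + q * + q * (+ L * + L * (+ 2 * + q)) ∎ where
   open ZP.≤-Reasoning
   s≤q : s N.≤ q
   s≤q = subst (s N.≤_) gs (NP.m≤n*m s g)
   lem1 : ∀ s q r g l → s * ((q * q * r - q * (g * (l * l))) * r) ≡ (q * q * (s * r) - q * (g * s * (l * l))) * r
   lem1 = solve-∀
   lem2 : ∀ q x l r → (q * q * x - q * (q * (l * l))) * r ≡ q * q * r * (x - l * l)
   lem2 = solve-∀
   lem3 : ∀ l s → l * (l + s) + - (l * l) ≡ l * s
   lem3 = solve-∀
   lem4 : ∀ q r l s → q * q * r * (l * s) ≡ q * q * l * (s * r)
   lem4 = solve-∀
   lem5 : ∀ q l → q * q * l * (l * (q + q)) ≡ q * q * (l * l * (+ 2 * q))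
   lem5 = solve-∀

 -- The constant is at most 8 l² for l factors, there are l terms of size at most 2 q³ L², and l is
 -- at most d(q); hence 16 and the cube.
 κF-bound : ∀ c → Coprime ∣ c ∣ q → Inner.normSq q (κ q c F) ≤ + q * + q * + (16 N.* (L N.* L N.* q N.* d q N.^ 3))
 κF-bound c cop = begin
  Inner.normSq q (κ q c F)
   ≤⟨ Bound.bound X.bound c cop F F-periodic ⟩
  + X.constant * ∑ X.factors (λ gs → + snd gs * Inner.⟨_,_⟩ q (Pr (fst gs) (snd gs) F) F)
   ≤⟨ *-monoˡ-nonneg {+ X.constant} (ℤ.+≤+ N.z≤n) (∑-mono X.factors (λ {gs} gs∈ → term≤ (fst gs) (snd gs) (All.lookup (Bound.factors X.bound) gs∈))) ⟩
  + X.constant * ∑ X.factors (λ _ → + q * + q * (+ L * + L * (+ 2 * + q)))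
   ≡⟨ cong (+ X.constant *_) (∑-const X.factors _) ⟩
  + X.constant * (+ l * (+ q * + q * (+ L * + L * (+ 2 * + q))))
   ≡⟨ lem (+ X.constant) (+ l) (+ q) (+ L * + L * (+ 2 * + q)) ⟩
  + q * + q * (+ X.constant * (+ l * (+ L * + L * (+ 2 * + q))))
   ≡⟨ cong (+ q * + q *_) (sym (trans (ZP.pos-* X.constant _) (cong (+ X.constant *_) (trans (ZP.pos-* l _) (cong (+ l *_) (trans (ZP.pos-* (L N.* L) _) (cong₂ _*_ (ZP.pos-* L L) (ZP.pos-* 2 q)))))))) ⟩
  + q * + q * + (X.constant N.* (l N.* (L N.* L N.* (2 N.* q))))
   ≤⟨ *-monoˡ-nonneg {+ q * + q} (square-nonneg (+ q)) (ℤ.+≤+ numeric) ⟩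
  + q * + q * + (16 N.* (L N.* L N.* q N.* d q N.^ 3)) ∎ where
  open ZP.≤-Reasoning
  open import Data.Nat.Tactic.RingSolver using () renaming (solve-∀ to solveℕ)
  module X = Modulus (modulus q)
  l = length X.factors
  lem : ∀ a b q x → a * (b * (q * q * x)) ≡ q * q * (a * (b * x))
  lem = solve-∀
  l≤d : l N.≤ d q
  l≤d = length-factors≤d q X.factors X.unique (Bound.factors X.bound)
  regroup : ∀ l L q → 8 N.* (l N.* l) N.* (l N.* (L N.* L N.* (2 N.* q))) ≡ 16 N.* (L N.* L N.* q N.* (l N.* (l N.* (l N.* 1))))
  regroup = solveℕ
  numeric : X.constant N.* (l N.* (L N.* L N.* (2 N.* q))) N.≤ 16 N.* (L N.* L N.* q N.* d q N.^ 3)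
  numeric = NP.≤-trans (NP.*-monoˡ-≤ (l N.* (L N.* L N.* (2 N.* q))) X.size) (NP.≤-trans (NP.≤-reflexive (regroup l L q)) (NP.*-monoʳ-≤ 16 (NP.*-monoʳ-≤ (L N.* L N.* q) (NP.^-monoˡ-≤ 3 l≤d))))

open import Defs

-- Counting solutions of the congruence.

module Counting (q L : ℕ) .{{q≢0 : NonZero q}} (L≤q : L N.≤ q) (c : ℤ) (cop : Coprime ∣ c ∣ q) where
 open Interval q L L≤q

 hit : ℤ → ℤ → ℤ
 hit u w = indicator (solution? q c (u , w))

 hit-periodicˡ : ∀ w → Periodic q (λ u → hit u w)
 hit-periodicˡ w {u} {u'} h = indicator-⇔ (solution? q c (u , w)) (solution? q c (u' , w)) (λ s → divs (mod-trans (mod-sym (mod-* h (mod-refl {i = w}))) (mk s))) (λ s → divs (mod-trans (mod-* h (mod-refl {i = w})) (mk s)))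

 hit-periodicʳ : ∀ u → Periodic q (λ w → hit u w)
 hit-periodicʳ u {w} {w'} h = indicator-⇔ (solution? q c (u , w)) (solution? q c (u , w')) (λ s → divs (mod-trans (mod-sym (mod-*ˡ u h)) (mk s))) (λ s → divs (mod-trans (mod-*ˡ u h) (mk s)))

 hit⇒coprime : ∀ u n → + q ZD.∣ u * + n - c → Coprime n q
 hit⇒coprime u n s {k} (d∣n , d∣q) = cop (ZD.∣⇒∣ᵤ (subst (+ k ZD.∣_) (lem (u * + n) c) (ZD.∣m∣n⇒∣m-n (ZD.∣n⇒∣m*n u (ZD.∣ᵤ⇒∣ {+ k} {+ n} d∣n)) (ZD.∣-trans (ZD.∣ᵤ⇒∣ {+ k} {+ q} d∣q) s))) , d∣q) where
  lem : ∀ x c → x - (x - c) ≡ c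
  lem = solve-∀

 fibre : ∀ n → ∑ (res q) (λ u → hit u (+ n)) ≡ indicator (coprime? n q)
 fibre n = go (coprime? n q) where
  go : (D : Dec (Coprime n q)) → ∑ (res q) (λ u → hit u (+ n)) ≡ indicator D
  go (no ¬cop) = ∑-ε (res q) (λ u → indicator-no (solution? q c (u , + n)) (λ s → ¬cop (hit⇒coprime u n s)))
  go (yes cn) = trans (∑-cong (res q) (λ u → indicator-⇔ (solution? q c (u , + n)) (+ q ∣? (u - u₀)) (λ s → divs (mod-cancel {c = + n} cn (mod-resp (ZP.*-comm u (+ n)) (ZP.*-comm u₀ (+ n)) (mod-trans (mk s) (mod-sym u₀-solves))))) (λ s → divs (mod-trans (mod-* (mk {u} {u₀} s) (mod-refl {i = + n})) u₀-solves)))) (indicator-res-≤1 q u₀) where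
   inv = unit-mod {q} {c = + n} cn
   u₀ = c * fst inv
   u₀-solves : u₀ * + n ≡ c [ q ]
   u₀-solves = mod-resp (lem c (+ n) (fst inv)) (ZP.*-identityʳ c) (mod-*ˡ c (snd inv)) where
    lem : ∀ c n e → c * (n * e) ≡ c * e * n
    lem = solve-∀

 Nᶻ Mᶻ : ℕ → ℕ → ℤ
 Nᶻ a b = ∑ (Ioc a L) (λ q₁ → ∑ (Ioc b L) (λ q₂ → hit (+ q₁) (+ q₂)))
 Mᶻ a b = ∑ (Ioc a L) (λ q₁ → ∑ (Ioc b L) (λ q₂ → indicator (coprime? q₂ q)))

 ∑-Ioc : ∀ a f → Periodic q f → ∑ (res q) (λ x → I (- + a + x) * f x) ≡ ∑ (Ioc a L) (λ n → f (+ n))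
 ∑-Ioc a f per = trans (I-sample (- + a) f per) (trans (∑-cong (upTo L) (λ l → cong f (lem a l))) (sym (∑-applyUpTo (λ i → a N.+ suc i) L (λ n → f (+ n))))) where
  lem : ∀ a l → + suc l - - + a ≡ + (a N.+ suc l)
  lem a l = trans (cong (λ z → + suc l + z) (ZP.neg-involutive (+ a))) (trans (sym (ZP.pos-+ (suc l) a)) (cong +_ (NP.+-comm (suc l) a)))

 -- At negative arguments the windows of `I` become (a, a + L] and (b, b + L]. In the subtracted
 -- term every q₂ prime to q meets exactly one u mod q, and L is the number of q₁; this yields `Mᶻ`.
 κF-value : ∀ a b → κ q c F (- + a , - + b) ≡ + q * Nᶻ a b - Mᶻ a b
 κF-value a b = begin
  κ q c F (- + a , - + b)
   ≡⟨ trans (∑-box q _) (∑-cong (res q) (λ u → ∑-cong (res q) (λ w → trans (cong (λ z → hit u w * F ((- + a , - + b) ⊹ z)) (1· (u , w))) (lem (hit u w) (+ q) (I (- + a + u)) (+ L) (I (- + b + w)))))) ⟩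
  ∑ (res q) (λ u → ∑ (res q) (λ w → + q * I (- + a + u) * (I (- + b + w) * hit u w) - + L * (I (- + b + w) * hit u w)))
   ≡⟨ trans (∑-cong (res q) (λ u → ∑-minus (res q) _ _)) (∑-minus (res q) _ _) ⟩
  ∑ (res q) (λ u → ∑ (res q) (λ w → + q * I (- + a + u) * (I (- + b + w) * hit u w))) - ∑ (res q) (λ u → ∑ (res q) (λ w → + L * (I (- + b + w) * hit u w)))
   ≡⟨ cong₂ _-_ first second ⟩
  + q * Nᶻ a b - Mᶻ a b ∎ where
  open ≡.≡-Reasoning
  lem : ∀ h q i l j → h * ((q * i - l) * j) ≡ q * i * (j * h) - l * (j * h)
  lem = solve-∀
  first : ∑ (res q) (λ u → ∑ (res q) (λ w → + q * I (- + a + u) * (I (- + b + w) * hit u w))) ≡ + q * Nᶻ a b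
  first = trans (∑-cong (res q) (λ u → trans (∑-*ˡ (+ q * I (- + a + u)) (res q) _) (trans (ZP.*-assoc (+ q) (I (- + a + u)) _) (cong (λ z → + q * (I (- + a + u) * z)) (∑-Ioc b (hit u) (hit-periodicʳ u))))))
   (trans (∑-*ˡ (+ q) (res q) _) (cong (+ q *_) (∑-Ioc a (λ u → ∑ (Ioc b L) (λ q₂ → hit u (+ q₂))) (λ h → ∑-cong (Ioc b L) (λ q₂ → hit-periodicˡ (+ q₂) h)))))
  second : ∑ (res q) (λ u → ∑ (res q) (λ w → + L * (I (- + b + w) * hit u w))) ≡ Mᶻ a b
  second = trans (∑-swap (res q) (res q) _) (trans (∑-cong (res q) (λ w → trans (∑-*ˡ (+ L) (res q) _) (cong (+ L *_) (∑-*ˡ (I (- + b + w)) (res q) (λ u → hit u w)))))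
   (trans (∑-*ˡ (+ L) (res q) _) (trans (cong (+ L *_) (trans (∑-Ioc b (λ w → ∑ (res q) (λ u → hit u w)) (λ h → ∑-cong (res q) (λ u → hit-periodicʳ u h))) (∑-cong (Ioc b L) fibre)))
   (sym (trans (∑-const (Ioc a L) _) (cong (λ n → + n * ∑ (Ioc b L) (λ q₂ → indicator (coprime? q₂ q))) (Listₚ.length-applyUpTo (λ i → a N.+ suc i) L)))))))

 res-neg : ∀ f → Periodic q f → ∑ (applyUpTo suc q) (λ a → f (- + a)) ≡ ∑ (res q) f
 res-neg f per = trans (∑-applyUpTo suc q (λ a → f (- + a))) (complete (upTo q) (λ k → - + suc k) q (Uniqueₚ.upTo⁺ q) (Listₚ.length-upTo q)
  (λ {k} {l} k∈ l∈ h → small-mod-≡ (∈-upTo⁻ k∈) (∈-upTo⁻ l∈) (mod-cancel-+ 1ℤ (mod-resp (ZP.neg-involutive (+ suc k)) (ZP.neg-involutive (+ suc l)) (mod-neg h)))) f per)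

 variance≤ : ∑ (applyUpTo suc q) (λ a → ∑ (applyUpTo suc q) (λ b → (+ q * Nᶻ a b - Mᶻ a b) * (+ q * Nᶻ a b - Mᶻ a b))) ≤ + q * + q * + (16 N.* (L N.* L N.* q N.* d q N.^ 3))
 variance≤ = ZP.≤-trans (ZP.≤-reflexive (trans (∑-cong (applyUpTo suc q) (λ a → ∑-cong (applyUpTo suc q) (λ b → cong₂ _*_ (sym (κF-value a b)) (sym (κF-value a b)))))
   (trans (∑-cong (applyUpTo suc q) (λ a → res-neg (λ y → f (- + a , y)) (λ {i} {j} h → fper { - + a , i} { - + a , j} (mk² mod-refl h)))) (trans (res-neg (λ x → ∑ (res q) (λ y → f (x , y))) (λ h → ∑-cong (res q) (λ y → fper {_ , y} {_ , y} (mk² h mod-refl)))) (sym (∑-box q f)))))) (κF-bound c cop) where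
  f : G → ℤ
  f x = κ q c F x * κ q c F x
  fper : Periodic² q f
  fper h = cong₂ _*_ (κper h) (κper h) where
   κper : Periodic² q (κ q c F)
   κper = conv-periodic (box q) (λ a → indicator (solution? q c a)) (+ 1 ·_) {v = F} F-periodic

-- Transfer to the rationals.

fromℤ : ℤ → ℚ
fromℤ z = z ℚ./ 1

private
 toℚᵘ-fromℤ : ∀ z → ℚ.toℚᵘ (fromℤ z) ℚᵘ.≃ mkℚᵘ z 0
 toℚᵘ-fromℤ z = ℚₚ.toℚᵘ-fromℚᵘ (mkℚᵘ z 0)

fromℤ-+ : ∀ a b → fromℤ (a + b) ≡ fromℤ a ℚ.+ fromℤ b
fromℤ-+ a b = ℚₚ.toℚᵘ-injective (ℚᵘₚ.≃-trans (toℚᵘ-fromℤ (a + b)) (ℚᵘₚ.≃-sym (ℚᵘₚ.≃-trans (ℚₚ.toℚᵘ-homo-+ (fromℤ a) (fromℤ b)) (ℚᵘₚ.≃-trans (ℚᵘₚ.+-cong (toℚᵘ-fromℤ a) (toℚᵘ-fromℤ b)) (*≡* (lem a b)))))) where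
 lem : ∀ a b → (a * + 1 + b * + 1) * + 1 ≡ (a + b) * + 1
 lem = solve-∀

fromℤ-* : ∀ a b → fromℤ (a * b) ≡ fromℤ a ℚ.* fromℤ b
fromℤ-* a b = ℚₚ.toℚᵘ-injective (ℚᵘₚ.≃-trans (toℚᵘ-fromℤ (a * b)) (ℚᵘₚ.≃-sym (ℚᵘₚ.≃-trans (ℚₚ.toℚᵘ-homo-* (fromℤ a) (fromℤ b)) (ℚᵘₚ.≃-trans (ℚᵘₚ.*-cong (toℚᵘ-fromℤ a) (toℚᵘ-fromℤ b)) (*≡* refl)))))

fromℤ-neg : ∀ a → fromℤ (- a) ≡ ℚ.- fromℤ a
fromℤ-neg a = ℚₚ.toℚᵘ-injective (ℚᵘₚ.≃-trans (toℚᵘ-fromℤ (- a)) (ℚᵘₚ.≃-sym (ℚᵘₚ.≃-trans (ℚₚ.toℚᵘ-homo‿- (fromℤ a)) (ℚᵘₚ.-‿cong (toℚᵘ-fromℤ a)))))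

fromℤ-mono : ∀ {a b} → a ≤ b → fromℤ a ℚ.≤ fromℤ b
fromℤ-mono {a} {b} a≤b = ℚₚ.toℚᵘ-cancel-≤ (ℚᵘₚ.≤-respˡ-≃ (ℚᵘₚ.≃-sym (toℚᵘ-fromℤ a)) (ℚᵘₚ.≤-respʳ-≃ (ℚᵘₚ.≃-sym (toℚᵘ-fromℤ b)) (*≤* (ZP.*-monoʳ-≤-nonNeg (+ 1) a≤b))))

fromℤ-inverse : ∀ q .{{_ : NonZero q}} → fromℤ (+ q) ℚ.* (+ 1 ℚ./ q) ≡ ℚ.1ℚ
fromℤ-inverse zero = ⊥-elim (N.≢-nonZero⁻¹ 0 refl)
fromℤ-inverse (suc n) = ℚₚ.toℚᵘ-injective (ℚᵘₚ.≃-trans (ℚₚ.toℚᵘ-homo-* (fromℤ (+ suc n)) (+ 1 ℚ./ suc n)) (ℚᵘₚ.≃-trans (ℚᵘₚ.*-cong (toℚᵘ-fromℤ (+ suc n)) (ℚₚ.toℚᵘ-fromℚᵘ (mkℚᵘ (+ 1) n))) (*≡* (lem n)))) where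
 lem : ∀ n → + suc n * + 1 * + 1 ≡ + 1 * + suc (n N.+ 0)
 lem n = trans (ZP.*-identityʳ _) (trans (ZP.*-identityʳ _) (sym (trans (ZP.*-identityˡ _) (cong (λ k → + suc k) (NP.+-identityʳ n)))))

Σℚ-cong : {A : Set} (xs : List A) {f g : A → ℚ} → (∀ x → f x ≡ g x) → Σℚ xs f ≡ Σℚ xs g
Σℚ-cong [] e = refl
Σℚ-cong (x ∷ xs) e = cong₂ ℚ._+_ (e x) (Σℚ-cong xs e)

Σℚ-fromℤ : {A : Set} (xs : List A) (f : A → ℤ) → Σℚ xs (λ x → fromℤ (f x)) ≡ fromℤ (∑ xs f)
Σℚ-fromℤ [] f = refl
Σℚ-fromℤ (x ∷ xs) f = trans (cong (λ z → fromℤ (f x) ℚ.+ z) (Σℚ-fromℤ xs f)) (sym (fromℤ-+ (f x) (∑ xs f)))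

Σℚ-*ˡ : {A : Set} (r : ℚ) (xs : List A) (f : A → ℚ) → r ℚ.* Σℚ xs f ≡ Σℚ xs (λ x → r ℚ.* f x)
Σℚ-*ˡ r [] f = ℚₚ.*-zeroʳ r
Σℚ-*ˡ r (x ∷ xs) f = trans (ℚₚ.*-distribˡ-+ r (f x) (Σℚ xs f)) (cong (λ z → r ℚ.* f x ℚ.+ z) (Σℚ-*ˡ r xs f))

𝟙-fromℤ : {P : Set} (D : Dec P) → 𝟙 D ≡ fromℤ (indicator D)
𝟙-fromℤ D with does D
... | true = refl
... | false = refl

module Rational (q L : ℕ) .{{q≢0 : NonZero q}} (L≤q : L N.≤ q) (c : ℤ) (cop : Coprime ∣ c ∣ q) where
 open Counting q L L≤q c cop

 N-fromℤ : ∀ a b → N q L c a b ≡ fromℤ (Nᶻ a b)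
 N-fromℤ a b = trans (Σℚ-cong (Ioc a L) (λ q₁ → trans (Σℚ-cong (Ioc b L) (λ q₂ → trans (𝟙-fromℤ (coprime? q₂ q ×-dec congMod? q q₁ q₂ c)) (cong fromℤ (same q₁ q₂)))) (Σℚ-fromℤ (Ioc b L) (λ q₂ → hit (+ q₁) (+ q₂))))) (Σℚ-fromℤ (Ioc a L) _) where
  same : ∀ q₁ q₂ → indicator (coprime? q₂ q ×-dec congMod? q q₁ q₂ c) ≡ hit (+ q₁) (+ q₂)
  same q₁ q₂ = indicator-⇔ (coprime? q₂ q ×-dec congMod? q q₁ q₂ c) (solution? q c (+ q₁ , + q₂)) (λ { (_ , s) → subst (λ z → + q ZD.∣ z - c) (ZP.pos-* q₁ q₂) s })
   (λ s → hit⇒coprime (+ q₁) q₂ s , subst (λ z → + q ZD.∣ z - c) (sym (ZP.pos-* q₁ q₂)) s)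

 M-fromℤ : ∀ a b → M q L a b ≡ fromℤ (Mᶻ a b)
 M-fromℤ a b = trans (Σℚ-cong (Ioc a L) (λ q₁ → trans (Σℚ-cong (Ioc b L) (λ q₂ → 𝟙-fromℤ (coprime? q₂ q))) (Σℚ-fromℤ (Ioc b L) (λ q₂ → indicator (coprime? q₂ q))))) (Σℚ-fromℤ (Ioc a L) _)

 private
  Q = fromℤ (+ q)
  r = + 1 ℚ./ q

 -- Multiplying by q clears the only denominator, so q² S is an integer sum and the inequality can
 -- be taken over from the integers.
 deviation : ∀ a b → Q ℚ.* (N q L c a b ℚ.- (M q L a b ℚ.* r)) ≡ fromℤ (+ q * Nᶻ a b - Mᶻ a b)
 deviation a b = begin
  Q ℚ.* (N q L c a b ℚ.- (M q L a b ℚ.* r))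
   ≡⟨ ℚₚ.*-distribˡ-+ Q (N q L c a b) (ℚ.- (M q L a b ℚ.* r)) ⟩
  Q ℚ.* N q L c a b ℚ.+ Q ℚ.* ℚ.- (M q L a b ℚ.* r)
   ≡⟨ cong₂ ℚ._+_ (trans (cong (Q ℚ.*_) (N-fromℤ a b)) (sym (fromℤ-* (+ q) (Nᶻ a b)))) (trans (sym (ℚₚ.neg-distribʳ-* Q (M q L a b ℚ.* r))) (trans (cong ℚ.-_ (trans move (M-fromℤ a b))) (sym (fromℤ-neg (Mᶻ a b))))) ⟩
  fromℤ (+ q * Nᶻ a b) ℚ.+ fromℤ (- Mᶻ a b)
   ≡⟨ sym (fromℤ-+ (+ q * Nᶻ a b) (- Mᶻ a b)) ⟩
  fromℤ (+ q * Nᶻ a b - Mᶻ a b) ∎ where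
  open ≡.≡-Reasoning
  move : Q ℚ.* (M q L a b ℚ.* r) ≡ M q L a b
  move = trans (cong (Q ℚ.*_) (ℚₚ.*-comm (M q L a b) r)) (trans (sym (ℚₚ.*-assoc Q r (M q L a b))) (trans (cong (ℚ._* M q L a b) (fromℤ-inverse q)) (ℚₚ.*-identityˡ (M q L a b))))

 S-fromℤ : Q ℚ.* Q ℚ.* S q L c ≡ fromℤ (∑ (applyUpTo suc q) (λ a → ∑ (applyUpTo suc q) (λ b → (+ q * Nᶻ a b - Mᶻ a b) * (+ q * Nᶻ a b - Mᶻ a b))))
 S-fromℤ = trans (Σℚ-*ˡ (Q ℚ.* Q) (applyUpTo suc q) _) (trans (Σℚ-cong (applyUpTo suc q) (λ a → trans (Σℚ-*ˡ (Q ℚ.* Q) (applyUpTo suc q) _) (trans (Σℚ-cong (applyUpTo suc q) (λ b → square a b)) (Σℚ-fromℤ (applyUpTo suc q) _)))) (Σℚ-fromℤ (applyUpTo suc q) _)) where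
  semigroup : CommutativeSemigroup 0ℓ 0ℓ
  semigroup = record { isCommutativeSemigroup = record { isSemigroup = ℚₚ.*-isSemigroup ; comm = ℚₚ.*-comm } }
  open import Algebra.Properties.CommutativeSemigroup semigroup using (interchange)
  square : ∀ a b → Q ℚ.* Q ℚ.* ((N q L c a b ℚ.- (M q L a b ℚ.* r)) ℚ.* (N q L c a b ℚ.- (M q L a b ℚ.* r))) ≡ fromℤ ((+ q * Nᶻ a b - Mᶻ a b) * (+ q * Nᶻ a b - Mᶻ a b))
  square a b = trans (interchange Q Q _ _) (trans (cong₂ ℚ._*_ (deviation a b) (deviation a b)) (sym (fromℤ-* (+ q * Nᶻ a b - Mᶻ a b) (+ q * Nᶻ a b - Mᶻ a b))))

 S≤ : S q L c ℚ.≤ fromℤ (+ 16) ℚ.* fromℤ (+ (L N.* L N.* q N.* (d q N.^ 3)))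
 S≤ = ℚₚ.*-cancelˡ-≤-pos (fromℤ (+ (q N.* q))) {{pos}} (subst₂ ℚ._≤_ (trans (sym S-fromℤ) (cong (ℚ._* S q L c) QQ≡)) (trans (fromℤ-* (+ q * + q) _) (cong₂ ℚ._*_ (cong fromℤ (sym (ZP.pos-* q q))) (trans (cong fromℤ (ZP.pos-* 16 Y)) (fromℤ-* (+ 16) (+ Y))))) (fromℤ-mono variance≤)) where
  open ≡ using (subst₂)
  Y = L N.* L N.* q N.* d q N.^ 3
  QQ≡ : Q ℚ.* Q ≡ fromℤ (+ (q N.* q))
  QQ≡ = trans (sym (fromℤ-* (+ q) (+ q))) (cong fromℤ (sym (ZP.pos-* q q)))
  pos : ℚ.Positive (fromℤ (+ (q N.* q)))
  pos = ℚₚ.normalize-pos (q N.* q) 1 {{it}} {{NP.m*n≢0 q q}} where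
   open import Function using (it)

import Data.Nat as ℕ

theorem1 : Σ ℚ λ C → (0ℚ ℚ.< C) ×
  ((q : ℕ) .{{_ : NonZero q}} (L : ℕ) (c : ℤ) →
   1 ℕ.≤ L → L ℕ.≤ q → Coprime ∣ c ∣ q →
   S q L c ℚ.≤ C ℚ.* ((+ (L ℕ.* L ℕ.* q ℕ.* (d q ℕ.^ 3))) ℚ./ 1))
theorem1 = fromℤ (+ 16) , ℚₚ.positive⁻¹ (fromℤ (+ 16)) , λ q L c _ L≤q cop → Rational.S≤ q L L≤q c cop
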